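{- Let $p$ be a prime with $p\equiv 1,4\pmod 5$, and let $A_n=\sum_{k=0}^n\binom{2k}k\binom{2n-2k}{n-k}\binom nk^2$. If $p\equiv 1,4\pmod{15}$, so that $p=x^2+15y^2$ for some integers $x,y$, then $\sum_{n=0}^{p-1}A_n\equiv 4x^2\pmod p$. If $p\equiv 11,14\pmod{15}$, then $\sum_{n=0}^{p-1}A_n\equiv 0\pmod p$. -}

module Defs where

open import Data.Nat using (ℕ; zero; suc; _+_; _*_; _∸_)
open import Data.Nat.Combinatorics using (_C_)

sumTo : ℕ → (ℕ → ℕ) → ℕ
sumTo zero    f = f 0
sumTo (suc n) f = sumTo n f + f (suc n)

sumBelow : ℕ → (ℕ → ℕ) → ℕ
sumBelow zero    f = 0
sumBelow (suc n) f = sumBelow n f + f n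

A : ℕ → ℕ
A n = sumTo n (λ k → ((2 * k) C k) * ((2 * n ∸ 2 * k) C (n ∸ k)) * ((n C k) * (n C k)))

{-# OPTIONS --safe #-}
-- The Aₙ are the Domb numbers.  Their recurrence and a Clausen-type identity show that the sum is, modulo p,
-- the square of the Hasse invariant of y² = 4 x³ + (x + w)², with -27 w (1 - 27 w) = 1.  Over a ring containing
-- r = √5 and θ = √-3 this curve is a translate of E : y² = 1 + A x² + x⁴, which has complex multiplication by
-- α = (1 + √-15) / 2.  Points of E over power series whose x-coordinate is a uniformiser carry the
-- multiplier m of the invariant differential, and comparing t^p-coefficients gives h m^p = m h for the Hasse
-- invariant h.
--
-- If p ≡ 11, 14 (mod 15), the Frobenius sends α to 1 - α, so h = 0.
--
-- If p = x² + 15 y², put N = 2 |y| and M = |x| + |y|, so that N² · 4 - N M + M² = p and υ = N α - M is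
-- divisible by p for a suitable lift of α to ℤ / p².  The x-coordinate of j P + k α P is a rational function of
-- t whose height satisfies the parallelogram law; hence the height is a quadratic form, determined by its
-- integrality and nonnegativity, and υ P has height exactly 2 p.  As its multiplier vanishes modulo p, it is a
-- function of t^p of degree 2.  Dividing its differential equation by p over ℤ / p² turns it into a point
-- of degree 2 over ℤ / p with multiplier (υ / p) h, and such a multiplier must be ± 1.  Therefore
-- h² ≡ (N (1 - α) - M)² ≡ (N - 2 M)² = 4 x².
module Submission where

open import Algebra.Bundles using (CommutativeRing)
open import Algebra.Morphism.Structures using (IsRingHomomorphism)
open import Data.Empty using (⊥; ⊥-elim)
import Data.Integer.Properties as ℤₚ
open import Data.Nat as ℕ using (ℕ; zero; suc; s≤s; z≤n)
import Data.Nat.Divisibility as ℕ∣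
open import Data.Nat.Primality using (Prime)
import Data.Nat.Properties as ℕₚ
open import Data.Nat.Solver renaming (module +-*-Solver to N)
open import Data.Product using (∃; ∃₂; _×_; _,_; proj₁; proj₂)
open import Data.Sum using (_⊎_; inj₁; inj₂)
open import Level using (0ℓ)
open import Relation.Binary.PropositionalEquality as ≡ using (_≡_)
open import Relation.Nullary using (¬_; Dec; yes; no)

-- The relation `h m^p = m h` determines nothing when the Frobenius fixes `m`, and in the split case
-- it fixes every multiplier. The value of `h` must then come from a point whose multiplier vanishes
-- modulo p; reduction modulo p hides the unit that is sought, and only a second digit, hence ℤ /
-- p², makes it visible. Neither associativity of the addition nor a bilinear height pairing is
-- established. The sole group-theoretic fact in use is `(P + Q) - Q = P` on x-coordinates, so
-- heights are computed along the multiples of α P and then along the two rows N α P + j P and N α P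
-- - j P, each step involving only two neighbours. The equation for `w` comes from t = 1: in
-- characteristic 0 the generating function of the Aₙ is (1 - 4 t)⁻¹ times a hypergeometric series
-- in t² / (1 - 4 t)³, a quantity equal to -1/27 at t = 1, while Clausen's formula expresses the
-- square of the Hasse polynomial at w by the same series at w (1 - 27 w).

module Expressions where
 open import Data.Fin using (Fin)
 open import Data.Integer using (ℤ; +_)

 infixl 6 _:+_ _:-_
 infixl 7 _:*_
 infixr 8 _:^_
 infix 8 :-_
 infix 4 _:=_

 data Expr (n : ℕ) : Set where
   var : Fin n → Expr n
   con : ℤ → Expr n
   :0 :1 : Expr n
   _:+_ _:*_ : Expr n → Expr n → Expr n
   :-_ : Expr n → Expr n
   _:^_ : Expr n → ℕ → Expr n

 _:-_ : ∀ {n} → Expr n → Expr n → Expr n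
 a :- b = a :+ (:- b)

 κ : ∀ {n} → ℕ → Expr n
 κ k = con (+ k)

 _:=_ : ∀ {n} → Expr n → Expr n → Expr n × Expr n
 _:=_ = _,_

open Expressions

-- Commutative rings and normalisation of polynomial identities

module RingKit (R : CommutativeRing 0ℓ 0ℓ) where
 open import Data.Bool using (Bool; true; false; if_then_else_; _∧_; T)
 open import Data.Bool.Properties using (T-≡)
 open import Function.Bundles using (Equivalence)
 open import Data.Fin using (Fin; zero; suc)
 open import Data.Integer as ℤ using (ℤ; +_; -[1+_]; +[1+_])
 open import Data.List using (List; []; _∷_)
 open import Data.Nat.Divisibility using (_∣_)
 open import Data.Unit using (⊤)
 open import Data.Vec using (Vec; []; _∷_; lookup; tabulate)
 open import Data.Vec.N-ary using (N-ary; Eq; curryⁿ; curryⁿ-cong; _$ⁿ_)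

 open CommutativeRing R public using
   ( Carrier; +-rawMonoid; _≈_; _+_; _*_; -_; 0#; 1#; _-_; refl; sym; trans; reflexive; setoid; +-cong; +-congˡ; +-congʳ; +-assoc; +-comm; +-identityˡ; +-identityʳ; -‿cong; -‿inverseˡ
   ; -‿inverseʳ; *-cong; *-congˡ; *-congʳ; *-assoc; *-comm; *-identityˡ; *-identityʳ; distribˡ; distribʳ; zeroˡ; zeroʳ; rawRing; ring; semiring; commutativeSemiring)
 open import Algebra.Properties.Ring ring public
   using (-‿distribˡ-*; -‿distribʳ-*; -‿involutive; -0#≈0#; -‿+-comm)
 open import Algebra.Properties.Semiring.Mult semiring public
   using (×-homo-+; ×1-homo-*; ×-congʳ; ×-congˡ; ×-cong) renaming (_×_ to _·_)
 open import Algebra.Properties.Semiring.Exp semiring public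
   using (_^_; ^-homo-*; ^-congˡ; ^-cong; ^-assocʳ)
 open import Algebra.Properties.CommutativeSemiring.Exp commutativeSemiring public using (^-distrib-*)
 open import Relation.Binary.Reasoning.Setoid setoid public using (begin_; _∎; step-≈-⟩; step-≡-⟩)

 nat : ℕ → Carrier
 nat n = n · 1#

 HasChar : ℕ → Set
 HasChar p = nat p ≈ 0#

 -- Weaker than being a field: the inert case lives in free quadratic extensions, where only the
 -- naturals prime to p are known to be invertible.
 UnitsPrimeTo : ℕ → Set
 UnitsPrimeTo p = ∀ k → ¬ p ∣ k → ∃ λ b → nat k * b ≈ 1#

 IsHalf : Carrier → Set
 IsHalf h = h * nat 2 ≈ 1#

 ZeroTest Inverses : Set
 ZeroTest = ∀ a → Dec (a ≈ 0#)
 Inverses = ∀ a → ¬ a ≈ 0# → ∃ λ b → a * b ≈ 1#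

 NonTrivial : Set
 NonTrivial = ¬ 1# ≈ 0#

 int : ℤ → Carrier
 int (+ n) = nat n
 int -[1+ n ] = - nat (suc n)

 private
   cancel-common : ∀ x a b → (x + a) - (x + b) ≈ a - b
   cancel-common x a b = begin
     (x + a) - (x + b) ≈⟨ +-congˡ (sym (-‿+-comm x b)) ⟩
     (x + a) + (- x - b) ≈⟨ +-congʳ (+-comm x a) ⟩
     (a + x) + (- x - b) ≈⟨ +-assoc a x _ ⟩
     a + (x + (- x - b)) ≈⟨ +-congˡ (sym (+-assoc x (- x) (- b))) ⟩
     a + ((x - x) - b) ≈⟨ +-congˡ (trans (+-congʳ (-‿inverseʳ x)) (+-identityˡ _)) ⟩
     a - b ∎

 int-⊖ : ∀ m n → int (m ℤ.⊖ n) ≈ nat m - nat n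
 int-⊖ zero zero = sym (-‿inverseʳ 0#)
 int-⊖ zero (suc n) = sym (+-identityˡ _)
 int-⊖ (suc m) zero = sym (trans (+-congˡ -0#≈0#) (+-identityʳ _))
 int-⊖ (suc m) (suc n) = begin
   int (suc m ℤ.⊖ suc n) ≡⟨ ≡.cong int (ℤₚ.[1+m]⊖[1+n]≡m⊖n m n) ⟩
   int (m ℤ.⊖ n) ≈⟨ int-⊖ m n ⟩
   nat m - nat n ≈⟨ sym (cancel-common 1# (nat m) (nat n)) ⟩
   nat (suc m) - nat (suc n) ∎

 int-+ : ∀ i j → int (i ℤ.+ j) ≈ int i + int j
 int-+ (+ m) (+ n) = ×-homo-+ 1# m n
 int-+ (+ m) -[1+ n ] = int-⊖ m (suc n)
 int-+ -[1+ m ] (+ n) = trans (int-⊖ n (suc m)) (+-comm _ _)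
 int-+ -[1+ m ] -[1+ n ] = begin
   - nat (suc (suc (m ℕ.+ n))) ≡⟨ ≡.cong (λ k → - nat k) (≡.sym (ℕₚ.+-suc (suc m) n)) ⟩
   - nat (suc m ℕ.+ suc n) ≈⟨ -‿cong (×-homo-+ 1# (suc m) (suc n)) ⟩
   - (nat (suc m) + nat (suc n)) ≈⟨ sym (-‿+-comm _ _) ⟩
   - nat (suc m) - nat (suc n) ∎

 int-neg : ∀ i → int (ℤ.- i) ≈ - int i
 int-neg (+ zero) = sym -0#≈0#
 int-neg +[1+ n ] = refl
 int-neg -[1+ n ] = sym (-‿involutive _)

 int-* : ∀ i j → int (i ℤ.* j) ≈ int i * int j
 int-* (+ m) (+ n) = begin
   int (+ m ℤ.* + n) ≡⟨ ≡.cong int (≡.sym (ℤₚ.pos-* m n)) ⟩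
   nat (m ℕ.* n) ≈⟨ ×1-homo-* m n ⟩
   nat m * nat n ∎
 int-* (+ m) -[1+ n ] = begin
   int (+ m ℤ.* -[1+ n ]) ≡⟨ ≡.cong int (≡.sym (ℤₚ.neg-distribʳ-* (+ m) +[1+ n ])) ⟩
   int (ℤ.- (+ m ℤ.* +[1+ n ])) ≈⟨ int-neg (+ m ℤ.* +[1+ n ]) ⟩
   - int (+ m ℤ.* +[1+ n ]) ≈⟨ -‿cong (int-* (+ m) +[1+ n ]) ⟩
   - (nat m * nat (suc n)) ≈⟨ -‿distribʳ-* _ _ ⟩
   nat m * - nat (suc n) ∎
 int-* -[1+ m ] (+ n) = begin
   int (-[1+ m ] ℤ.* + n) ≡⟨ ≡.cong int (≡.sym (ℤₚ.neg-distribˡ-* +[1+ m ] (+ n))) ⟩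
   int (ℤ.- (+[1+ m ] ℤ.* + n)) ≈⟨ int-neg (+[1+ m ] ℤ.* + n) ⟩
   - int (+[1+ m ] ℤ.* + n) ≈⟨ -‿cong (int-* +[1+ m ] (+ n)) ⟩
   - (nat (suc m) * nat n) ≈⟨ -‿distribˡ-* _ _ ⟩
   - nat (suc m) * nat n ∎
 int-* -[1+ m ] -[1+ n ] = begin
   int (+[1+ m ] ℤ.* +[1+ n ]) ≈⟨ int-* +[1+ m ] +[1+ n ] ⟩
   nat (suc m) * nat (suc n) ≈⟨ sym (-‿involutive _) ⟩
   - - (nat (suc m) * nat (suc n)) ≈⟨ -‿cong (-‿distribʳ-* _ _) ⟩
   - (nat (suc m) * - nat (suc n)) ≈⟨ -‿distribˡ-* _ _ ⟩
   - nat (suc m) * - nat (suc n) ∎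

 ⟦_⟧ : ∀ {n} → Expr n → Vec Carrier n → Carrier
 ⟦ var i ⟧ ρ = lookup ρ i
 ⟦ con k ⟧ ρ = int k
 ⟦ :0 ⟧ ρ = 0#
 ⟦ :1 ⟧ ρ = 1#
 ⟦ a :+ b ⟧ ρ = ⟦ a ⟧ ρ + ⟦ b ⟧ ρ
 ⟦ a :* b ⟧ ρ = ⟦ a ⟧ ρ * ⟦ b ⟧ ρ
 ⟦ :- a ⟧ ρ = - ⟦ a ⟧ ρ
 ⟦ a :^ k ⟧ ρ = ⟦ a ⟧ ρ ^ k

 private
   Mono : ℕ → Set
   Mono = Vec ℕ

   Poly : ℕ → Set
   Poly n = List (Mono n × ℤ)

   ⟦_⟧ᵐ : ∀ {n} → Mono n → Vec Carrier n → Carrier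
   ⟦ [] ⟧ᵐ [] = 1#
   ⟦ e ∷ es ⟧ᵐ (x ∷ ρ) = x ^ e * ⟦ es ⟧ᵐ ρ

   ⟦_⟧ᵖ : ∀ {n} → Poly n → Vec Carrier n → Carrier
   ⟦ [] ⟧ᵖ ρ = 0#
   ⟦ (m , k) ∷ p ⟧ᵖ ρ = int k * ⟦ m ⟧ᵐ ρ + ⟦ p ⟧ᵖ ρ

   eqᵇ : ∀ {n} → Mono n → Mono n → Bool
   eqᵇ [] [] = true
   eqᵇ (a ∷ as) (b ∷ bs) = (a ℕ.≡ᵇ b) ∧ eqᵇ as bs

   eqᵇ-sound : ∀ {n} (a b : Mono n) → eqᵇ a b ≡ true → a ≡ b
   eqᵇ-sound [] [] _ = ≡.refl
   eqᵇ-sound (a ∷ as) (b ∷ bs) h with a ℕ.≡ᵇ b in e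
   ... | true = ≡.cong₂ _∷_ (ℕₚ.≡ᵇ⇒≡ a b (≡.subst Data.Bool.T (≡.sym e) _)) (eqᵇ-sound as bs h)

   insert : ∀ {n} → Mono n → ℤ → Poly n → Poly n
   insert m k [] = (m , k) ∷ []
   insert m k ((m′ , k′) ∷ p) = if eqᵇ m m′ then (m′ , k ℤ.+ k′) ∷ p else (m′ , k′) ∷ insert m k p

   addᵖ : ∀ {n} → Poly n → Poly n → Poly n
   addᵖ [] q = q
   addᵖ ((m , k) ∷ p) q = addᵖ p (insert m k q)

   mulᵐ : ∀ {n} → Mono n → Mono n → Mono n
   mulᵐ [] [] = []
   mulᵐ (a ∷ as) (b ∷ bs) = (a ℕ.+ b) ∷ mulᵐ as bs

   addScaled : ∀ {n} → Mono n → ℤ → Poly n → Poly n → Poly n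
   addScaled m k [] acc = acc
   addScaled m k ((m′ , k′) ∷ p) acc = addScaled m k p (insert (mulᵐ m m′) (k ℤ.* k′) acc)

   mulᵖ : ∀ {n} → Poly n → Poly n → Poly n → Poly n
   mulᵖ [] q acc = acc
   mulᵖ ((m , k) ∷ p) q acc = mulᵖ p q (addScaled m k q acc)

   negᵖ : ∀ {n} → Poly n → Poly n
   negᵖ [] = []
   negᵖ ((m , k) ∷ p) = (m , ℤ.- k) ∷ negᵖ p

   zeros : ∀ n → Mono n
   zeros zero = []
   zeros (suc n) = 0 ∷ zeros n

   unit : ∀ {n} → Fin n → Mono n
   unit {suc n} zero = 1 ∷ zeros n
   unit (suc i) = 0 ∷ unit i

   constᵖ : ∀ {n} → ℤ → Poly n
   constᵖ k = (zeros _ , k) ∷ []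

   powᵖ : ∀ {n} → Poly n → ℕ → Poly n
   powᵖ p zero = constᵖ ℤ.1ℤ
   powᵖ p (suc k) = mulᵖ p (powᵖ p k) []

   norm : ∀ {n} → Expr n → Poly n
   norm (var i) = (unit i , ℤ.1ℤ) ∷ []
   norm (con k) = constᵖ k
   norm :0 = []
   norm :1 = constᵖ ℤ.1ℤ
   norm (a :+ b) = addᵖ (norm a) (norm b)
   norm (a :* b) = mulᵖ (norm a) (norm b) []
   norm (:- a) = negᵖ (norm a)
   norm (a :^ k) = powᵖ (norm a) k

   isZero : ℤ → Bool
   isZero (+ zero) = true
   isZero _ = false

   -- Cancelled monomials stay in the list with coefficient 0, so every coefficient has to be
   -- inspected. Equality is decided in ℤ only; the ring itself needs no decision procedure.
   allZero : ∀ {n} → Poly n → Bool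
   allZero [] = true
   allZero ((_ , k) ∷ p) = isZero k ∧ allZero p

   interchange* : ∀ a b c d → (a * b) * (c * d) ≈ (a * c) * (b * d)
   interchange* a b c d = begin
     (a * b) * (c * d) ≈⟨ *-assoc a b _ ⟩
     a * (b * (c * d)) ≈⟨ *-congˡ (sym (*-assoc b c d)) ⟩
     a * ((b * c) * d) ≈⟨ *-congˡ (*-congʳ (*-comm b c)) ⟩
     a * ((c * b) * d) ≈⟨ *-congˡ (*-assoc c b d) ⟩
     a * (c * (b * d)) ≈⟨ sym (*-assoc a c _) ⟩
     (a * c) * (b * d) ∎

   insert-sound : ∀ {n} m k (p : Poly n) ρ → ⟦ insert m k p ⟧ᵖ ρ ≈ int k * ⟦ m ⟧ᵐ ρ + ⟦ p ⟧ᵖ ρ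
   insert-sound m k [] ρ = refl
   insert-sound m k ((m′ , k′) ∷ p) ρ with eqᵇ m m′ in e
   ... | true rewrite eqᵇ-sound m m′ e = begin
     int (k ℤ.+ k′) * ⟦ m′ ⟧ᵐ ρ + ⟦ p ⟧ᵖ ρ ≈⟨ +-congʳ (*-congʳ (int-+ k k′)) ⟩
     (int k + int k′) * ⟦ m′ ⟧ᵐ ρ + ⟦ p ⟧ᵖ ρ ≈⟨ +-congʳ (distribʳ _ _ _) ⟩
     (int k * ⟦ m′ ⟧ᵐ ρ + int k′ * ⟦ m′ ⟧ᵐ ρ) + ⟦ p ⟧ᵖ ρ ≈⟨ +-assoc _ _ _ ⟩
     int k * ⟦ m′ ⟧ᵐ ρ + (int k′ * ⟦ m′ ⟧ᵐ ρ + ⟦ p ⟧ᵖ ρ) ∎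
   ... | false = begin
     int k′ * ⟦ m′ ⟧ᵐ ρ + ⟦ insert m k p ⟧ᵖ ρ ≈⟨ +-congˡ (insert-sound m k p ρ) ⟩
     int k′ * ⟦ m′ ⟧ᵐ ρ + (int k * ⟦ m ⟧ᵐ ρ + ⟦ p ⟧ᵖ ρ) ≈⟨ sym (+-assoc _ _ _) ⟩
     (int k′ * ⟦ m′ ⟧ᵐ ρ + int k * ⟦ m ⟧ᵐ ρ) + ⟦ p ⟧ᵖ ρ ≈⟨ +-congʳ (+-comm _ _) ⟩
     (int k * ⟦ m ⟧ᵐ ρ + int k′ * ⟦ m′ ⟧ᵐ ρ) + ⟦ p ⟧ᵖ ρ ≈⟨ +-assoc _ _ _ ⟩
     int k * ⟦ m ⟧ᵐ ρ + (int k′ * ⟦ m′ ⟧ᵐ ρ + ⟦ p ⟧ᵖ ρ) ∎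

   addᵖ-sound : ∀ {n} (p q : Poly n) ρ → ⟦ addᵖ p q ⟧ᵖ ρ ≈ ⟦ p ⟧ᵖ ρ + ⟦ q ⟧ᵖ ρ
   addᵖ-sound [] q ρ = sym (+-identityˡ _)
   addᵖ-sound ((m , k) ∷ p) q ρ = begin
     ⟦ addᵖ p (insert m k q) ⟧ᵖ ρ ≈⟨ addᵖ-sound p (insert m k q) ρ ⟩
     ⟦ p ⟧ᵖ ρ + ⟦ insert m k q ⟧ᵖ ρ ≈⟨ +-congˡ (insert-sound m k q ρ) ⟩
     ⟦ p ⟧ᵖ ρ + (int k * ⟦ m ⟧ᵐ ρ + ⟦ q ⟧ᵖ ρ) ≈⟨ sym (+-assoc _ _ _) ⟩
     (⟦ p ⟧ᵖ ρ + int k * ⟦ m ⟧ᵐ ρ) + ⟦ q ⟧ᵖ ρ ≈⟨ +-congʳ (+-comm _ _) ⟩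
     (int k * ⟦ m ⟧ᵐ ρ + ⟦ p ⟧ᵖ ρ) + ⟦ q ⟧ᵖ ρ ∎

   mulᵐ-sound : ∀ {n} (a b : Mono n) ρ → ⟦ mulᵐ a b ⟧ᵐ ρ ≈ ⟦ a ⟧ᵐ ρ * ⟦ b ⟧ᵐ ρ
   mulᵐ-sound [] [] [] = sym (*-identityˡ 1#)
   mulᵐ-sound (a ∷ as) (b ∷ bs) (x ∷ ρ) = begin
     x ^ (a ℕ.+ b) * ⟦ mulᵐ as bs ⟧ᵐ ρ ≈⟨ *-cong (^-homo-* x a b) (mulᵐ-sound as bs ρ) ⟩
     (x ^ a * x ^ b) * (⟦ as ⟧ᵐ ρ * ⟦ bs ⟧ᵐ ρ) ≈⟨ interchange* _ _ _ _ ⟩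
     (x ^ a * ⟦ as ⟧ᵐ ρ) * (x ^ b * ⟦ bs ⟧ᵐ ρ) ∎

   addScaled-sound : ∀ {n} m k (p acc : Poly n) ρ →
     ⟦ addScaled m k p acc ⟧ᵖ ρ ≈ (int k * ⟦ m ⟧ᵐ ρ) * ⟦ p ⟧ᵖ ρ + ⟦ acc ⟧ᵖ ρ
   addScaled-sound m k [] acc ρ = sym (trans (+-congʳ (zeroʳ _)) (+-identityˡ _))
   addScaled-sound m k ((m′ , k′) ∷ p) acc ρ = begin
     ⟦ addScaled m k p (insert (mulᵐ m m′) (k ℤ.* k′) acc) ⟧ᵖ ρ
       ≈⟨ addScaled-sound m k p _ ρ ⟩
     s * ⟦ p ⟧ᵖ ρ + ⟦ insert (mulᵐ m m′) (k ℤ.* k′) acc ⟧ᵖ ρ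
       ≈⟨ +-congˡ (insert-sound (mulᵐ m m′) (k ℤ.* k′) acc ρ) ⟩
     s * ⟦ p ⟧ᵖ ρ + (int (k ℤ.* k′) * ⟦ mulᵐ m m′ ⟧ᵐ ρ + ⟦ acc ⟧ᵖ ρ)
       ≈⟨ +-congˡ (+-congʳ (*-cong (int-* k k′) (mulᵐ-sound m m′ ρ))) ⟩
     s * ⟦ p ⟧ᵖ ρ + ((int k * int k′) * (⟦ m ⟧ᵐ ρ * ⟦ m′ ⟧ᵐ ρ) + ⟦ acc ⟧ᵖ ρ)
       ≈⟨ +-congˡ (+-congʳ (interchange* _ _ _ _)) ⟩
     s * ⟦ p ⟧ᵖ ρ + (s * s′ + ⟦ acc ⟧ᵖ ρ)
       ≈⟨ sym (+-assoc _ _ _) ⟩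
     (s * ⟦ p ⟧ᵖ ρ + s * s′) + ⟦ acc ⟧ᵖ ρ
       ≈⟨ +-congʳ (+-comm _ _) ⟩
     (s * s′ + s * ⟦ p ⟧ᵖ ρ) + ⟦ acc ⟧ᵖ ρ
       ≈⟨ +-congʳ (sym (distribˡ s _ _)) ⟩
     s * (s′ + ⟦ p ⟧ᵖ ρ) + ⟦ acc ⟧ᵖ ρ ∎
     where s = int k * ⟦ m ⟧ᵐ ρ
           s′ = int k′ * ⟦ m′ ⟧ᵐ ρ

   mulᵖ-sound : ∀ {n} (p q acc : Poly n) ρ → ⟦ mulᵖ p q acc ⟧ᵖ ρ ≈ ⟦ p ⟧ᵖ ρ * ⟦ q ⟧ᵖ ρ + ⟦ acc ⟧ᵖ ρ
   mulᵖ-sound [] q acc ρ = sym (trans (+-congʳ (zeroˡ _)) (+-identityˡ _))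
   mulᵖ-sound ((m , k) ∷ p) q acc ρ = begin
     ⟦ mulᵖ p q (addScaled m k q acc) ⟧ᵖ ρ ≈⟨ mulᵖ-sound p q _ ρ ⟩
     ⟦ p ⟧ᵖ ρ * ⟦ q ⟧ᵖ ρ + ⟦ addScaled m k q acc ⟧ᵖ ρ ≈⟨ +-congˡ (addScaled-sound m k q acc ρ) ⟩
     ⟦ p ⟧ᵖ ρ * ⟦ q ⟧ᵖ ρ + (s * ⟦ q ⟧ᵖ ρ + ⟦ acc ⟧ᵖ ρ) ≈⟨ sym (+-assoc _ _ _) ⟩
     (⟦ p ⟧ᵖ ρ * ⟦ q ⟧ᵖ ρ + s * ⟦ q ⟧ᵖ ρ) + ⟦ acc ⟧ᵖ ρ ≈⟨ +-congʳ (sym (distribʳ _ _ _)) ⟩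
     (⟦ p ⟧ᵖ ρ + s) * ⟦ q ⟧ᵖ ρ + ⟦ acc ⟧ᵖ ρ ≈⟨ +-congʳ (*-congʳ (+-comm _ _)) ⟩
     (s + ⟦ p ⟧ᵖ ρ) * ⟦ q ⟧ᵖ ρ + ⟦ acc ⟧ᵖ ρ ∎
     where s = int k * ⟦ m ⟧ᵐ ρ

   negᵖ-sound : ∀ {n} (p : Poly n) ρ → ⟦ negᵖ p ⟧ᵖ ρ ≈ - ⟦ p ⟧ᵖ ρ
   negᵖ-sound [] ρ = sym -0#≈0#
   negᵖ-sound ((m , k) ∷ p) ρ = begin
     int (ℤ.- k) * ⟦ m ⟧ᵐ ρ + ⟦ negᵖ p ⟧ᵖ ρ ≈⟨ +-cong (*-congʳ (int-neg k)) (negᵖ-sound p ρ) ⟩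
     - int k * ⟦ m ⟧ᵐ ρ - ⟦ p ⟧ᵖ ρ ≈⟨ +-congʳ (sym (-‿distribˡ-* _ _)) ⟩
     - (int k * ⟦ m ⟧ᵐ ρ) - ⟦ p ⟧ᵖ ρ ≈⟨ -‿+-comm _ _ ⟩
     - (int k * ⟦ m ⟧ᵐ ρ + ⟦ p ⟧ᵖ ρ) ∎

   zeros-sound : ∀ {n} (ρ : Vec Carrier n) → ⟦ zeros n ⟧ᵐ ρ ≈ 1#
   zeros-sound [] = refl
   zeros-sound (x ∷ ρ) = trans (*-identityˡ _) (zeros-sound ρ)

   constᵖ-sound : ∀ {n} k (ρ : Vec Carrier n) → ⟦ constᵖ k ⟧ᵖ ρ ≈ int k
   constᵖ-sound k ρ = trans (+-identityʳ _) (trans (*-congˡ (zeros-sound ρ)) (*-identityʳ _))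

   unit-sound : ∀ {n} (i : Fin n) ρ → ⟦ unit i ⟧ᵐ ρ ≈ lookup ρ i
   unit-sound zero (x ∷ ρ) = trans (*-cong (*-identityʳ x) (zeros-sound ρ)) (*-identityʳ x)
   unit-sound (suc i) (x ∷ ρ) = trans (*-identityˡ _) (unit-sound i ρ)

   int1 : int ℤ.1ℤ ≈ 1#
   int1 = +-identityʳ 1#

   mul0-sound : ∀ {n} (p q : Poly n) ρ → ⟦ mulᵖ p q [] ⟧ᵖ ρ ≈ ⟦ p ⟧ᵖ ρ * ⟦ q ⟧ᵖ ρ
   mul0-sound p q ρ = trans (mulᵖ-sound p q [] ρ) (+-identityʳ _)

   powᵖ-sound : ∀ {n} (p : Poly n) k ρ → ⟦ powᵖ p k ⟧ᵖ ρ ≈ ⟦ p ⟧ᵖ ρ ^ k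
   powᵖ-sound p zero ρ = trans (constᵖ-sound ℤ.1ℤ ρ) int1
   powᵖ-sound p (suc k) ρ = trans (mul0-sound p (powᵖ p k) ρ) (*-congˡ (powᵖ-sound p k ρ))

   norm-sound : ∀ {n} (e : Expr n) ρ → ⟦ norm e ⟧ᵖ ρ ≈ ⟦ e ⟧ ρ
   norm-sound (var i) ρ = trans (+-identityʳ _) (trans (*-congʳ int1) (trans (*-identityˡ _) (unit-sound i ρ)))
   norm-sound (con k) ρ = constᵖ-sound k ρ
   norm-sound :0 ρ = refl
   norm-sound :1 ρ = trans (constᵖ-sound ℤ.1ℤ ρ) int1
   norm-sound (a :+ b) ρ = trans (addᵖ-sound (norm a) (norm b) ρ) (+-cong (norm-sound a ρ) (norm-sound b ρ))
   norm-sound (a :* b) ρ = trans (mul0-sound (norm a) (norm b) ρ) (*-cong (norm-sound a ρ) (norm-sound b ρ))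
   norm-sound (:- a) ρ = trans (negᵖ-sound (norm a) ρ) (-‿cong (norm-sound a ρ))
   norm-sound (a :^ k) ρ = trans (powᵖ-sound (norm a) k ρ) (^-congˡ k (norm-sound a ρ))

   allZero-sound : ∀ {n} (p : Poly n) ρ → allZero p ≡ true → ⟦ p ⟧ᵖ ρ ≈ 0#
   allZero-sound [] ρ _ = refl
   allZero-sound ((m , + zero) ∷ p) ρ h =
     trans (+-cong (zeroˡ _) (allZero-sound p ρ h)) (+-identityˡ 0#)

 diff≈0⇒≈ : ∀ {a b} → a - b ≈ 0# → a ≈ b
 diff≈0⇒≈ {a} {b} h = begin
   a ≈⟨ sym (+-identityʳ a) ⟩
   a + 0# ≈⟨ +-congˡ (sym (-‿inverseˡ b)) ⟩
   a + (- b + b) ≈⟨ sym (+-assoc a (- b) b) ⟩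
   (a - b) + b ≈⟨ +-congʳ h ⟩
   0# + b ≈⟨ +-identityˡ b ⟩
   b ∎

 ≈⇒diff≈0 : ∀ {a b} → a ≈ b → a - b ≈ 0#
 ≈⇒diff≈0 {a} {b} h = trans (+-congʳ h) (-‿inverseʳ b)

 check : ∀ {n} → Expr n × Expr n → Bool
 check (a , b) = allZero (norm (a :- b))

 prove : ∀ {n} (e : Expr n × Expr n) → check e ≡ true → ∀ ρ → ⟦ proj₁ e ⟧ ρ ≈ ⟦ proj₂ e ⟧ ρ
 prove (a , b) h ρ = diff≈0⇒≈ (trans (sym (norm-sound (a :- b) ρ)) (allZero-sound (norm (a :- b)) ρ h))

 close : ∀ {a} {A : Set a} n → N-ary n (Expr n) A → A
 close n f = f $ⁿ tabulate var

 solve : ∀ n (f : N-ary n (Expr n) (Expr n × Expr n)) {_ : T (check (close n f))} →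
         Eq n _≈_ (curryⁿ ⟦ proj₁ (close n f) ⟧) (curryⁿ ⟦ proj₂ (close n f) ⟧)
 solve n f {h} = curryⁿ-cong _≈_ ⟦ proj₁ (close n f) ⟧ ⟦ proj₂ (close n f) ⟧ (prove (close n f) (Equivalence.to T-≡ h))

 -- Serves identities that hold only modulo given relations: `c` and `d` collect multiples of the
 -- two sides of these relations, chosen so that the first premise is a plain polynomial identity.
 cancel+ : ∀ {a b c d} → a + c ≈ b + d → c ≈ d → a ≈ b
 cancel+ {a} {b} {c} {d} h e = diff≈0⇒≈ (begin
   a - b ≈⟨ sym (cancel-common c a b) ⟩
   (c + a) - (c + b) ≈⟨ +-cong (+-comm c a) (-‿cong (trans (+-comm c b) (+-congˡ e))) ⟩
   (a + c) - (b + d) ≈⟨ ≈⇒diff≈0 h ⟩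
   0# ∎)

 -- lhs ≈ rhs modulo equations u ≈ v, each with a cofactor a certifying lhs - rhs = Σ a (u - v)
 combination : ∀ {n} → List (Expr n × Expr n × Expr n) → Expr n × Expr n → Expr n × Expr n
 combination [] e = e
 combination ((a , u , v) ∷ cs) (l , r) = combination cs (l :+ a :* v , r :+ a :* u)

 Hypotheses : ∀ {n} → List (Expr n × Expr n × Expr n) → Vec Carrier n → Set
 Hypotheses [] ρ = ⊤
 Hypotheses ((a , u , v) ∷ cs) ρ = ⟦ u ⟧ ρ ≈ ⟦ v ⟧ ρ × Hypotheses cs ρ

 prove-mod : ∀ {n} (e : Expr n × Expr n) (cs : List (Expr n × Expr n × Expr n)) → check (combination cs e) ≡ true →
   ∀ ρ → Hypotheses cs ρ → ⟦ proj₁ e ⟧ ρ ≈ ⟦ proj₂ e ⟧ ρ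
 prove-mod e [] h ρ _ = prove e h ρ
 prove-mod (l , r) ((a , u , v) ∷ cs) h ρ (uv , hs) = cancel+ (prove-mod (l :+ a :* v , r :+ a :* u) cs h ρ hs) (*-congˡ (sym uv))

-- Formal power series over a commutative ring

module Series (R : CommutativeRing 0ℓ 0ℓ) where
 open RingKit R

 Series : Set
 Series = ℕ → Carrier

 infix 4 _≋_
 _≋_ : Series → Series → Set
 f ≋ g = ∀ n → f n ≈ g n

 infixl 6 _⊕_
 infixl 7 _⊛_ _•_

 _⊕_ : Series → Series → Series
 (f ⊕ g) n = f n + g n

 ⊖_ : Series → Series
 (⊖ f) n = - f n

 _•_ : Carrier → Series → Series
 (a • f) n = a * f n

 tl : Series → Series
 tl f n = f (suc n)

 _⊛_ : Series → Series → Series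
 (f ⊛ g) zero = f 0 * g 0
 (f ⊛ g) (suc n) = f 0 * g (suc n) + (tl f ⊛ g) n

 𝟎 𝟏 t : Series
 𝟎 _ = 0#
 𝟏 zero = 1#
 𝟏 (suc _) = 0#
 t zero = 0#
 t (suc n) = 𝟏 n

 C : Carrier → Series
 C a zero = a
 C a (suc _) = 0#

 -- Coefficient n of a product involves coefficients up to n only. This causality lets products
 -- occur in the recursions solved by `Fix`.
 ⊛-cong≤ : ∀ {f f′ g g′} n → (∀ i → i ℕ.≤ n → f i ≈ f′ i) → (∀ i → i ℕ.≤ n → g i ≈ g′ i) →
           (f ⊛ g) n ≈ (f′ ⊛ g′) n
 ⊛-cong≤ zero hf hg = *-cong (hf 0 z≤n) (hg 0 z≤n)
 ⊛-cong≤ (suc n) hf hg = +-cong (*-cong (hf 0 z≤n) (hg (suc n) ℕₚ.≤-refl))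
   (⊛-cong≤ n (λ i i≤n → hf (suc i) (s≤s i≤n)) (λ i i≤n → hg i (ℕₚ.m≤n⇒m≤1+n i≤n)))

 ⊛-cong : ∀ {f f′ g g′} → f ≋ f′ → g ≋ g′ → f ⊛ g ≋ f′ ⊛ g′
 ⊛-cong hf hg n = ⊛-cong≤ n (λ i _ → hf i) (λ i _ → hg i)

 ⊛-rec : ∀ f g n → (f ⊛ g) (suc n) ≈ (f ⊛ tl g) n + f (suc n) * g 0
 ⊛-rec f g zero = refl
 ⊛-rec f g (suc n) = trans (+-congˡ (⊛-rec (tl f) g n)) (sym (+-assoc _ _ _))

 ⊛-comm : ∀ f g → f ⊛ g ≋ g ⊛ f
 ⊛-comm f g zero = *-comm _ _
 ⊛-comm f g (suc n) = begin
   f 0 * g (suc n) + (tl f ⊛ g) n ≈⟨ +-cong (*-comm _ _) (⊛-comm (tl f) g n) ⟩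
   g (suc n) * f 0 + (g ⊛ tl f) n ≈⟨ +-comm _ _ ⟩
   (g ⊛ tl f) n + g (suc n) * f 0 ≈⟨ sym (⊛-rec g f n) ⟩
   (g ⊛ f) (suc n) ∎

 ⊛-zeroˡ : ∀ f g → f ≋ 𝟎 → f ⊛ g ≋ 𝟎
 ⊛-zeroˡ f g h zero = trans (*-congʳ (h 0)) (zeroˡ _)
 ⊛-zeroˡ f g h (suc n) = trans (+-cong (trans (*-congʳ (h 0)) (zeroˡ _)) (⊛-zeroˡ (tl f) g (λ i → h (suc i)) n)) (+-identityˡ 0#)

 const-⊛ : ∀ f g → (∀ n → f (suc n) ≈ 0#) → f ⊛ g ≋ f 0 • g
 const-⊛ f g h zero = refl
 const-⊛ f g h (suc n) = trans (+-congˡ (⊛-zeroˡ (tl f) g h n)) (+-identityʳ _)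

 C-⊛ : ∀ a g → C a ⊛ g ≋ a • g
 C-⊛ a g = const-⊛ (C a) g (λ _ → refl)

 ⊛-identityˡ : ∀ g → 𝟏 ⊛ g ≋ g
 ⊛-identityˡ g n = trans (const-⊛ 𝟏 g (λ _ → refl) n) (*-identityˡ _)

 ⊛-distribˡ : ∀ f g h → f ⊛ (g ⊕ h) ≋ f ⊛ g ⊕ f ⊛ h
 ⊛-distribˡ f g h zero = distribˡ _ _ _
 ⊛-distribˡ f g h (suc n) = trans (+-cong (distribˡ _ _ _) (⊛-distribˡ (tl f) g h n))
   (solve 4 (λ a b c d → (a :+ b) :+ (c :+ d) := (a :+ c) :+ (b :+ d)) _ _ _ _)

 ⊛-distribʳ : ∀ f g h → (g ⊕ h) ⊛ f ≋ g ⊛ f ⊕ h ⊛ f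
 ⊛-distribʳ f g h n = begin
   ((g ⊕ h) ⊛ f) n ≈⟨ ⊛-comm (g ⊕ h) f n ⟩
   (f ⊛ (g ⊕ h)) n ≈⟨ ⊛-distribˡ f g h n ⟩
   (f ⊛ g) n + (f ⊛ h) n ≈⟨ +-cong (⊛-comm f g n) (⊛-comm f h n) ⟩
   (g ⊛ f) n + (h ⊛ f) n ∎

 •-⊛ : ∀ a f g → (a • f) ⊛ g ≋ a • (f ⊛ g)
 •-⊛ a f g zero = *-assoc _ _ _
 •-⊛ a f g (suc n) = trans (+-cong (*-assoc _ _ _) (•-⊛ a (tl f) g n)) (sym (distribˡ a _ _))

 ⊛-assoc : ∀ f g h → (f ⊛ g) ⊛ h ≋ f ⊛ (g ⊛ h)
 ⊛-assoc f g h zero = *-assoc _ _ _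
 ⊛-assoc f g h (suc n) = begin
   f 0 * g 0 * h (suc n) + (tl (f ⊛ g) ⊛ h) n
     ≈⟨ +-congˡ (⊛-distribʳ h (f 0 • tl g) (tl f ⊛ g) n) ⟩
   f 0 * g 0 * h (suc n) + (((f 0 • tl g) ⊛ h) n + ((tl f ⊛ g) ⊛ h) n)
     ≈⟨ +-congˡ (+-cong (•-⊛ (f 0) (tl g) h n) (⊛-assoc (tl f) g h n)) ⟩
   f 0 * g 0 * h (suc n) + (f 0 * (tl g ⊛ h) n + (tl f ⊛ (g ⊛ h)) n)
     ≈⟨ solve 5 (λ a b c d e → a :* b :* c :+ (a :* d :+ e) := a :* (b :* c :+ d) :+ e) _ _ _ _ _ ⟩
   f 0 * (g ⊛ h) (suc n) + (tl f ⊛ (g ⊛ h)) n ∎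

 seriesRing : CommutativeRing 0ℓ 0ℓ
 seriesRing = record
   { Carrier = Series ; _≈_ = _≋_ ; _+_ = _⊕_ ; _*_ = _⊛_ ; -_ = ⊖_ ; 0# = 𝟎 ; 1# = 𝟏
   ; isCommutativeRing = record
     { isRing = record
       { +-isAbelianGroup = record
         { isGroup = record
           { isMonoid = record
             { isSemigroup = record
               { isMagma = record
                 { isEquivalence = record { refl = λ _ → refl ; sym = λ h n → sym (h n) ; trans = λ h k n → trans (h n) (k n) }
                 ; ∙-cong = λ h k n → +-cong (h n) (k n) }
               ; assoc = λ f g h n → +-assoc _ _ _ }
             ; identity = (λ f n → +-identityˡ _) , (λ f n → +-identityʳ _) }
           ; inverse = (λ f n → -‿inverseˡ _) , (λ f n → -‿inverseʳ _)
           ; ⁻¹-cong = λ h n → -‿cong (h n) }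
         ; comm = λ f g n → +-comm _ _ }
       ; *-cong = ⊛-cong
       ; *-assoc = ⊛-assoc
       ; *-identity = ⊛-identityˡ , (λ f n → trans (⊛-comm f 𝟏 n) (⊛-identityˡ f n))
       ; distrib = ⊛-distribˡ , ⊛-distribʳ }
     ; *-comm = ⊛-comm } }

 private module S = RingKit seriesRing

 t-⊛-zero : ∀ f → (t ⊛ f) 0 ≈ 0#
 t-⊛-zero f = zeroˡ _

 t-⊛-suc : ∀ f n → (t ⊛ f) (suc n) ≈ f n
 t-⊛-suc f n = trans (+-cong (zeroˡ _) (⊛-identityˡ f n)) (+-identityˡ _)

 horner : ∀ f → f ≋ C (f 0) ⊕ t ⊛ tl f
 horner f zero = sym (trans (+-congˡ (t-⊛-zero (tl f))) (+-identityʳ _))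
 horner f (suc n) = sym (trans (+-identityˡ _) (t-⊛-suc (tl f) n))

 t^-⊛ : ∀ k f n → (t S.^ k ⊛ f) (k ℕ.+ n) ≈ f n
 t^-⊛ zero f n = ⊛-identityˡ f n
 t^-⊛ (suc k) f n = trans (S.*-assoc t (t S.^ k) f (suc (k ℕ.+ n))) (trans (t-⊛-suc (t S.^ k ⊛ f) (k ℕ.+ n)) (t^-⊛ k f n))

 C-cong : ∀ {a b} → a ≈ b → C a ≋ C b
 C-cong h zero = h
 C-cong h (suc n) = refl

 C-+ : ∀ a b → C (a + b) ≋ C a ⊕ C b
 C-+ a b zero = refl
 C-+ a b (suc n) = sym (+-identityˡ 0#)

 C-* : ∀ a b → C (a * b) ≋ C a ⊛ C b
 C-* a b zero = refl
 C-* a b (suc n) = sym (trans (C-⊛ a (C b) (suc n)) (zeroʳ a))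

 C-neg : ∀ a → C (- a) ≋ ⊖ C a
 C-neg a zero = refl
 C-neg a (suc n) = sym -0#≈0#

 C-1 : C 1# ≋ 𝟏
 C-1 zero = refl
 C-1 (suc n) = refl

 C-0 : C 0# ≋ 𝟎
 C-0 zero = refl
 C-0 (suc n) = refl

 C-nat : ∀ k → C (nat k) ≋ S.nat k
 C-nat zero = C-0
 C-nat (suc k) = S.trans (C-+ 1# (nat k)) (S.+-cong C-1 (C-nat k))

 C-^ : ∀ a k → C (a ^ k) ≋ C a S.^ k
 C-^ a zero = C-1
 C-^ a (suc k) = S.trans (C-* a (a ^ k)) (S.*-congˡ (C-^ a k))

 -- The Euler derivation t d/dt. Unlike d/dt it preserves degree bounds and acts diagonally; in
 -- characteristic p, with the naturals prime to p invertible, its kernel consists of the series in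
 -- t^p.
 θ : Series → Series
 θ f n = nat n * f n

 θ-cong : ∀ {f g} → f ≋ g → θ f ≋ θ g
 θ-cong h n = *-congˡ (h n)

 θ-+ : ∀ f g → θ (f ⊕ g) ≋ θ f ⊕ θ g
 θ-+ f g n = distribˡ _ _ _

 θ-neg : ∀ f → θ (⊖ f) ≋ ⊖ θ f
 θ-neg f n = sym (-‿distribʳ-* _ _)

 θ-* : ∀ f g → θ (f ⊛ g) ≋ θ f ⊛ g ⊕ f ⊛ θ g
 θ-* f g zero = solve 2 (λ a b → :0 :* (a :* b) := :0 :* a :* b :+ a :* (:0 :* b)) (f 0) (g 0)
 θ-* f g (suc n) = begin
   nat (suc n) * (f 0 * g (suc n) + (tl f ⊛ g) n)
     ≈⟨ solve 4 (λ m a b x → (:1 :+ m) :* (a :* b :+ x) := a :* ((:1 :+ m) :* b) :+ (x :+ m :* x)) _ _ _ _ ⟩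
   f 0 * θ g (suc n) + ((tl f ⊛ g) n + nat n * (tl f ⊛ g) n)
     ≈⟨ +-congˡ (+-congˡ (θ-* (tl f) g n)) ⟩
   f 0 * θ g (suc n) + ((tl f ⊛ g) n + ((θ (tl f) ⊛ g) n + (tl f ⊛ θ g) n))
     ≈⟨ solve 5 (λ a b d e u → a :+ (b :+ (d :+ e)) := (:0 :* u :+ (b :+ d)) :+ (a :+ e)) _ _ _ _ (f 0 * g (suc n)) ⟩
   (0# * (f 0 * g (suc n)) + ((tl f ⊛ g) n + (θ (tl f) ⊛ g) n)) + (f 0 * θ g (suc n) + (tl f ⊛ θ g) n)
     ≈⟨ +-congʳ (+-cong (sym (*-assoc _ _ _)) (sym (⊛-distribʳ g (tl f) (θ (tl f)) n))) ⟩
   (θ f 0 * g (suc n) + ((tl f ⊕ θ (tl f)) ⊛ g) n) + (f 0 * θ g (suc n) + (tl f ⊛ θ g) n)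
     ≈⟨ +-congʳ (+-congˡ (⊛-cong {g = g} (λ i → solve 2 (λ x m → x :+ m :* x := (:1 :+ m) :* x) (f (suc i)) (nat i)) (λ _ → refl) n)) ⟩
   (θ f 0 * g (suc n) + (tl (θ f) ⊛ g) n) + (f 0 * θ g (suc n) + (tl f ⊛ θ g) n) ∎

 θ-C : ∀ a → θ (C a) ≋ 𝟎
 θ-C a zero = zeroˡ _
 θ-C a (suc n) = zeroʳ _

 θ-t : θ t ≋ t
 θ-t zero = zeroˡ _
 θ-t (suc zero) = trans (*-identityʳ _) (+-identityʳ _)
 θ-t (suc (suc n)) = zeroʳ _

 θ-^ : ∀ f k → θ (f S.^ suc k) ≋ S.nat (suc k) ⊛ f S.^ k ⊛ θ f
 θ-^ f zero = S.trans (θ-cong (S.*-identityʳ f))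
   (S.solve 1 (λ x → x := κ 1 :* :1 :* x) (θ f))
 θ-^ f (suc k) = S.trans (θ-* f (f S.^ suc k)) (S.trans (S.+-congˡ {θ f ⊛ f S.^ suc k} (S.*-congˡ {f} (θ-^ f k)))
   (S.solve 4 (λ x y d n → d :* (x :* y) :+ x :* (n :* y :* d) := (:1 :+ n) :* (x :* y) :* d) f (f S.^ k) (θ f) (S.nat (suc k))))

 -- A causal recursion determines its solution: the k-th iterate is correct below k, so the diagonal
 -- of the iterates is a fixed point.
 module Fix (a : Carrier) (Φ : Series → Series)
            (Φ-cong≤ : ∀ {f g} n → (∀ i → i ℕ.≤ n → f i ≈ g i) → Φ f n ≈ Φ g n) where

   private
     G : Series → Series
     G f zero = a
     G f (suc n) = Φ f n

     approx : ℕ → Series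
     approx zero = 𝟎
     approx (suc k) = G (approx k)

     stable : ∀ k n → n ℕ.< k → approx k n ≈ approx (suc k) n
     stable (suc k) zero _ = refl
     stable (suc k) (suc n) (s≤s n<k) = Φ-cong≤ n (λ i i≤n → stable k i (ℕₚ.≤-<-trans i≤n n<k))

     stable+ : ∀ n j → approx (suc n) n ≈ approx (j ℕ.+ suc n) n
     stable+ n zero = refl
     stable+ n (suc j) = trans (stable+ n j) (stable (j ℕ.+ suc n) n (ℕₚ.m≤n+m (suc n) j))

   fix : Series
   fix n = approx (suc n) n

   private
     approx≈fix : ∀ k n → n ℕ.< k → approx k n ≈ fix n
     approx≈fix k n n<k = begin
       approx k n ≡⟨ ≡.cong (λ j → approx j n) (≡.sym (ℕₚ.m∸n+n≡m n<k)) ⟩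
       approx ((k ℕ.∸ suc n) ℕ.+ suc n) n ≈⟨ sym (stable+ n (k ℕ.∸ suc n)) ⟩
       fix n ∎

   fix-suc : ∀ n → fix (suc n) ≈ Φ fix n
   fix-suc n = Φ-cong≤ n (λ i i≤n → approx≈fix (suc n) i (s≤s i≤n))

 module Inverse (f : Series) where
   private
     module F = Fix 1# (λ g → ⊖ (tl f ⊛ g))
       (λ n h → -‿cong (⊛-cong≤ {f = tl f} n (λ _ _ → refl) h))

   inv : Series
   inv = F.fix

   inv-zero : inv 0 ≈ 1#
   inv-zero = refl

   inv-inverse : f 0 ≈ 1# → f ⊛ inv ≋ 𝟏
   inv-inverse h zero = trans (*-identityʳ _) h
   inv-inverse h (suc n) = begin
     f 0 * inv (suc n) + (tl f ⊛ inv) n ≈⟨ +-congʳ (*-cong h (F.fix-suc n)) ⟩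
     1# * - (tl f ⊛ inv) n + (tl f ⊛ inv) n ≈⟨ solve 1 (λ x → :1 :* (:- x) :+ x := :0) _ ⟩
     0# ∎

 open Inverse public using (inv; inv-inverse; inv-zero)

 -- With the root written 1 + t g, the equation becomes 2 g = `tl F` - t g², a causal recursion for
 -- g.
 module Sqrt (½ : Carrier) (½*2 : ½ * nat 2 ≈ 1#) (F : Series) where
   private
     module X = Fix (½ * F 1) (λ g → ½ • (tl (tl F) ⊕ ⊖ (g ⊛ g)))
       (λ n h → *-congˡ (+-congˡ (-‿cong (⊛-cong≤ n h h))))
     g = X.fix

   √ : Series
   √ zero = 1#
   √ (suc n) = g n

   private
     halve : ∀ a → ½ * a + ½ * a ≈ a
     halve a = trans (solve 2 (λ h x → h :* x :+ h :* x := h :* κ 2 :* x) ½ a) (trans (*-congʳ ½*2) (*-identityˡ a))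

   √-square : F 0 ≈ 1# → √ ⊛ √ ≋ F
   √-square h zero = trans (*-identityˡ _) (sym h)
   √-square h (suc zero) = trans (+-cong (*-identityˡ _) (*-identityʳ _)) (halve (F 1))
   √-square h (suc (suc n)) = begin
     1# * g (suc n) + (g ⊛ √) (suc n)
       ≈⟨ +-congˡ (⊛-rec g √ n) ⟩
     1# * g (suc n) + ((g ⊛ g) n + g (suc n) * 1#)
       ≈⟨ solve 2 (λ x y → :1 :* x :+ (y :+ x :* :1) := (x :+ x) :+ y) _ _ ⟩
     (g (suc n) + g (suc n)) + (g ⊛ g) n
       ≈⟨ +-congʳ (+-cong (X.fix-suc n) (X.fix-suc n)) ⟩
     (½ * (F (suc (suc n)) - (g ⊛ g) n) + ½ * (F (suc (suc n)) - (g ⊛ g) n)) + (g ⊛ g) n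
       ≈⟨ +-congʳ (halve _) ⟩
     (F (suc (suc n)) - (g ⊛ g) n) + (g ⊛ g) n
       ≈⟨ solve 2 (λ x y → (x :- y) :+ y := x) _ _ ⟩
     F (suc (suc n)) ∎

 -- Polynomials are series with a bound that need not be attained. Exact degrees need a zero test
 -- and appear only over a field.
 Deg≤ : Series → ℕ → Set
 Deg≤ f d = ∀ n → d ℕ.< n → f n ≈ 0#

 Deg≤-mono : ∀ {f a b} → a ℕ.≤ b → Deg≤ f a → Deg≤ f b
 Deg≤-mono a≤b h n b<n = h n (ℕₚ.≤-<-trans a≤b b<n)

 Deg≤-cong : ∀ {f g a} → f ≋ g → Deg≤ f a → Deg≤ g a
 Deg≤-cong e h n b<n = trans (sym (e n)) (h n b<n)

 Deg≤-+ : ∀ {f g a} → Deg≤ f a → Deg≤ g a → Deg≤ (f ⊕ g) a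
 Deg≤-+ hf hg n a<n = trans (+-cong (hf n a<n) (hg n a<n)) (+-identityˡ 0#)

 Deg≤-neg : ∀ {f a} → Deg≤ f a → Deg≤ (⊖ f) a
 Deg≤-neg hf n a<n = trans (-‿cong (hf n a<n)) -0#≈0#

 Deg≤-tl : ∀ {f a} → Deg≤ f (suc a) → Deg≤ (tl f) a
 Deg≤-tl hf n a<n = hf (suc n) (s≤s a<n)

 Deg≤-θ : ∀ {f a} → Deg≤ f a → Deg≤ (θ f) a
 Deg≤-θ hf n a<n = trans (*-congˡ (hf n a<n)) (zeroʳ _)

 Deg≤-C : ∀ a → Deg≤ (C a) 0
 Deg≤-C a (suc n) _ = refl

 Deg≤-𝟏 : Deg≤ 𝟏 0
 Deg≤-𝟏 (suc n) _ = refl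

 Deg≤-t : Deg≤ t 1
 Deg≤-t (suc (suc n)) _ = refl
 Deg≤-t (suc zero) (s≤s ())

 private
   Deg0⇒const : ∀ {f} → Deg≤ f 0 → ∀ n → f (suc n) ≈ 0#
   Deg0⇒const hf n = hf (suc n) (s≤s z≤n)

 Deg≤-* : ∀ {f g} a b → Deg≤ f a → Deg≤ g b → Deg≤ (f ⊛ g) (a ℕ.+ b)
 Deg≤-* {f} {g} zero b hf hg n b<n =
   trans (const-⊛ f g (Deg0⇒const {f} hf) n) (trans (*-congˡ (hg n b<n)) (zeroʳ _))
 Deg≤-* {f} {g} (suc a) b hf hg (suc n) (s≤s a+b<n) = trans
   (+-cong (trans (*-congˡ (hg (suc n) (ℕₚ.m≤n⇒m≤1+n (ℕₚ.≤-<-trans (ℕₚ.m≤n+m b a) a+b<n)))) (zeroʳ _))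
           (Deg≤-* a b (Deg≤-tl {f} hf) hg n a+b<n))
   (+-identityˡ 0#)

 top-* : ∀ {f g} a b → Deg≤ f a → Deg≤ g b → (f ⊛ g) (a ℕ.+ b) ≈ f a * g b
 top-* {f} {g} zero b hf hg = const-⊛ f g (Deg0⇒const {f} hf) b
 top-* {f} {g} (suc a) b hf hg = trans
   (+-cong (trans (*-congˡ (hg (suc (a ℕ.+ b)) (s≤s (ℕₚ.m≤n+m b a)))) (zeroʳ _))
           (top-* {tl f} {g} a b (Deg≤-tl {f} hf) hg))
   (+-identityˡ _)

 Deg≤-^ : ∀ {f a} k → Deg≤ f a → Deg≤ (f S.^ k) (k ℕ.* a)
 Deg≤-^ zero h = Deg≤-𝟏
 Deg≤-^ {f} {a} (suc k) h = Deg≤-* {f} {f S.^ k} a (k ℕ.* a) h (Deg≤-^ k h)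

 module Evaluation (x : Carrier) where

   ev : ℕ → Series → Carrier
   ev zero f = f 0
   ev (suc d) f = f 0 + x * ev d (tl f)

   ev-cong : ∀ d {f g} → f ≋ g → ev d f ≈ ev d g
   ev-cong zero h = h 0
   ev-cong (suc d) h = +-cong (h 0) (*-congˡ (ev-cong d (λ i → h (suc i))))

   ev-agree : ∀ d {f g} → (∀ k → k ℕ.≤ d → f k ≈ g k) → ev d f ≈ ev d g
   ev-agree zero h = h 0 z≤n
   ev-agree (suc d) h = +-cong (h 0 z≤n) (*-congˡ (ev-agree d (λ k k≤d → h (suc k) (s≤s k≤d))))

   ev-+ : ∀ d f g → ev d (f ⊕ g) ≈ ev d f + ev d g
   ev-+ zero f g = refl
   ev-+ (suc d) f g = trans (+-congˡ (*-congˡ (ev-+ d (tl f) (tl g))))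
     (solve 5 (λ a b x u v → (a :+ b) :+ x :* (u :+ v) := (a :+ x :* u) :+ (b :+ x :* v)) _ _ _ _ _)

   ev-• : ∀ d a f → ev d (a • f) ≈ a * ev d f
   ev-• zero a f = refl
   ev-• (suc d) a f = trans (+-congˡ (*-congˡ (ev-• d a (tl f))))
     (solve 4 (λ a b x u → a :* b :+ x :* (a :* u) := a :* (b :+ x :* u)) _ _ _ _)

   ev-zero : ∀ d {f} → f ≋ 𝟎 → ev d f ≈ 0#
   ev-zero zero h = h 0
   ev-zero (suc d) h = trans (+-cong (h 0) (trans (*-congˡ (ev-zero d (λ i → h (suc i)))) (zeroʳ x))) (+-identityˡ 0#)

   ev-pad : ∀ k d {f} → Deg≤ f d → ev (k ℕ.+ d) f ≈ ev d f
   ev-pad zero d h = refl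
   ev-pad (suc k) zero {f} h = trans (+-congˡ (trans (*-congˡ (ev-zero (k ℕ.+ 0) (Deg0⇒const {f} h))) (zeroʳ x))) (+-identityʳ _)
   ev-pad (suc k) (suc d) {f} h = +-congˡ (*-congˡ (trans (reflexive (≡.cong (λ j → ev j (tl f)) (ℕₚ.+-suc k d))) (ev-pad (suc k) d (Deg≤-tl {f} h))))

   ev-* : ∀ a b {f g} → Deg≤ f a → Deg≤ g b → ev (a ℕ.+ b) (f ⊛ g) ≈ ev a f * ev b g
   ev-* zero b {f} {g} hf hg = trans (ev-cong b (const-⊛ f g (Deg0⇒const {f} hf))) (ev-• b (f 0) g)
   ev-* (suc a) b {f} {g} hf hg = begin
     f 0 * g 0 + x * ev (a ℕ.+ b) ((f 0 • tl g) ⊕ tl f ⊛ g)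
       ≈⟨ +-congˡ (*-congˡ (trans (ev-+ (a ℕ.+ b) (f 0 • tl g) (tl f ⊛ g)) (+-cong (ev-• (a ℕ.+ b) (f 0) (tl g)) (ev-* a b (Deg≤-tl {f} hf) hg)))) ⟩
     f 0 * g 0 + x * (f 0 * ev (a ℕ.+ b) (tl g) + ev a (tl f) * ev b g)
       ≈⟨ solve 6 (λ f0 g0 x e u v → f0 :* g0 :+ x :* (f0 :* e :+ u :* v) := f0 :* (g0 :+ x :* e) :+ x :* u :* v) _ _ _ _ _ _ ⟩
     f 0 * ev (suc a ℕ.+ b) g + x * ev a (tl f) * ev b g
       ≈⟨ +-congʳ (*-congˡ (ev-pad (suc a) b hg)) ⟩
     f 0 * ev b g + x * ev a (tl f) * ev b g
       ≈⟨ sym (distribʳ _ _ _) ⟩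
     ev (suc a) f * ev b g ∎

-- Unimodular pairs and the algebra behind the parallelogram law

module Coprime (R : CommutativeRing 0ℓ 0ℓ) where
 open RingKit R

 Coprime : Carrier → Carrier → Set
 Coprime a b = ∃₂ λ s r → s * a + r * b ≈ 1#

 coprime-sym : ∀ {a b} → Coprime a b → Coprime b a
 coprime-sym (s , r , h) = r , s , trans (+-comm _ _) h

 coprime-respʳ : ∀ {a b b′} → b ≈ b′ → Coprime a b → Coprime a b′
 coprime-respʳ e (s , r , h) = s , r , trans (+-congˡ (*-congˡ (sym e))) h

 coprime-* : ∀ {a b d} → Coprime a b → Coprime a d → Coprime a (b * d)
 coprime-* {a} {b} {d} (s , r , h) (s′ , r′ , h′) = s * s′ * a + s * r′ * d + s′ * r * b , r * r′ , (begin
   (s * s′ * a + s * r′ * d + s′ * r * b) * a + r * r′ * (b * d)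
     ≈⟨ solve 7 (λ a b d s r s′ r′ → (s :* s′ :* a :+ s :* r′ :* d :+ s′ :* r :* b) :* a :+ r :* r′ :* (b :* d)
          := (s :* a :+ r :* b) :* (s′ :* a :+ r′ :* d)) a b d s r s′ r′ ⟩
   (s * a + r * b) * (s′ * a + r′ * d)
     ≈⟨ *-cong h h′ ⟩
   1# * 1#
     ≈⟨ *-identityˡ 1# ⟩
   1# ∎)

 coprime-*ˡ : ∀ {a b d} → Coprime a d → Coprime b d → Coprime (a * b) d
 coprime-*ˡ p q = coprime-sym (coprime-* (coprime-sym p) (coprime-sym q))

 coprime-unit : ∀ {a u v} → u * v ≈ 1# → Coprime a u
 coprime-unit {a} {u} {v} h = 0# , v , trans (solve 3 (λ a u v → :0 :* a :+ v :* u := u :* v) a u v) h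

 coprime-+ : ∀ {a b} k → Coprime a b → Coprime a (k * a + b)
 coprime-+ {a} {b} k (s , r , h) = s - r * k , r , trans
   (solve 5 (λ a b s r k → (s :- r :* k) :* a :+ r :* (k :* a :+ b) := s :* a :+ r :* b) a b s r k) h

 coprime-divides : ∀ {n d e f} → Coprime n d → n * e ≈ d * f → ∃ λ q → e ≈ d * q
 coprime-divides {n} {d} {e} {f} (s , r , h) eq = s * f + r * e , (begin
   e ≈⟨ sym (trans (*-congʳ h) (*-identityˡ e)) ⟩
   (s * n + r * d) * e ≈⟨ solve 5 (λ n d e s r → (s :* n :+ r :* d) :* e := s :* (n :* e) :+ r :* d :* e) n d e s r ⟩
   s * (n * e) + r * d * e ≈⟨ +-congʳ (*-congˡ eq) ⟩
   s * (d * f) + r * d * e ≈⟨ solve 5 (λ d e f s r → s :* (d :* f) :+ r :* d :* e := d :* (s :* f :+ r :* e)) d e f s r ⟩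
   d * (s * f + r * e) ∎)

 -- If (n₁ : d₁) and (n₂ : d₂) are unimodular, so is the triple of symmetric functions of the two
 -- x-values of their sum and difference on y² = x (1 + a x + x²): this is what makes the
 -- parallelogram law for heights an equality.
 module Parallelogram (a n₁ d₁ n₂ d₂ : Carrier) where

   e₁ e₂ lead middle last : Carrier
   e₁ = d₁ * d₂ - n₁ * n₂
   e₂ = n₁ * d₂ - n₂ * d₁
   lead = e₁ * e₁
   middle = n₁ * d₁ * (d₂ * d₂ + a * (d₂ * n₂) + n₂ * n₂) + n₂ * d₂ * (d₁ * d₁ + a * (d₁ * n₁) + n₁ * n₁)
   last = e₂ * e₂

   InIdeal : Carrier → Set
   InIdeal x = ∃ λ p → ∃₂ λ q r → p * e₁ + q * e₂ + r * middle ≈ x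

   private
     UnitMod : Carrier → Set
     UnitMod x = ∃₂ λ k j → InIdeal j × k * x + j ≈ 1#

     ideal-combine : ∀ {x y} k l → InIdeal x → InIdeal y → InIdeal (k * x + l * y)
     ideal-combine k l (p , q , r , h) (p′ , q′ , r′ , h′) =
       k * p + l * p′ , k * q + l * q′ , k * r + l * r′ , trans
         (solve 11 (λ k l p q r p′ q′ r′ x y z → (k :* p :+ l :* p′) :* x :+ (k :* q :+ l :* q′) :* y :+ (k :* r :+ l :* r′) :* z
            := k :* (p :* x :+ q :* y :+ r :* z) :+ l :* (p′ :* x :+ q′ :* y :+ r′ :* z)) k l p q r p′ q′ r′ e₁ e₂ middle)
         (+-cong (*-congˡ h) (*-congˡ h′))

     ideal-resp : ∀ {x y} → x ≈ y → InIdeal x → InIdeal y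
     ideal-resp e (p , q , r , h) = p , q , r , trans h e

     unit-* : ∀ {x y} → UnitMod x → UnitMod y → UnitMod (x * y)
     unit-* {x} {y} (k , j , ij , h) (k′ , j′ , ij′ , h′) = k * k′ , _ , ideal-combine (k′ * y + j′) (k * x) ij ij′ , (begin
       k * k′ * (x * y) + ((k′ * y + j′) * j + k * x * j′)
         ≈⟨ solve 6 (λ k k′ x y j j′ → k :* k′ :* (x :* y) :+ ((k′ :* y :+ j′) :* j :+ k :* x :* j′) := (k :* x :+ j) :* (k′ :* y :+ j′)) k k′ x y j j′ ⟩
       (k * x + j) * (k′ * y + j′) ≈⟨ *-cong h h′ ⟩
       1# * 1# ≈⟨ *-identityˡ 1# ⟩
       1# ∎)

   module _ (cop₁ : Coprime n₁ d₁) (cop₂ : Coprime n₂ d₂) (u : Carrier)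
            (u-inv : nat 4 * (nat 4 - a * a) * u ≈ 1#) where

     private
       f₁∈ : InIdeal (d₁ * d₁ - n₁ * n₁)
       f₁∈ = let (s , r , h) = cop₂ in s * n₁ + r * d₁ , - (s * d₁ + r * n₁) , 0# , (begin
         (s * n₁ + r * d₁) * e₁ + - (s * d₁ + r * n₁) * e₂ + 0# * middle
           ≈⟨ solve 7 (λ n₁ d₁ n₂ d₂ s r m → (s :* n₁ :+ r :* d₁) :* (d₁ :* d₂ :- n₁ :* n₂) :+ (:- (s :* d₁ :+ r :* n₁)) :* (n₁ :* d₂ :- n₂ :* d₁) :+ :0 :* m
                := (s :* n₂ :+ r :* d₂) :* (d₁ :* d₁ :- n₁ :* n₁)) n₁ d₁ n₂ d₂ s r middle ⟩
         (s * n₂ + r * d₂) * (d₁ * d₁ - n₁ * n₁) ≈⟨ trans (*-congʳ h) (*-identityˡ _) ⟩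
         d₁ * d₁ - n₁ * n₁ ∎)

       f₂∈ : InIdeal (d₂ * d₂ - n₂ * n₂)
       f₂∈ = let (s , r , h) = cop₁ in s * n₂ + r * d₂ , s * d₂ + r * n₂ , 0# , (begin
         (s * n₂ + r * d₂) * e₁ + (s * d₂ + r * n₂) * e₂ + 0# * middle
           ≈⟨ solve 7 (λ n₁ d₁ n₂ d₂ s r m → (s :* n₂ :+ r :* d₂) :* (d₁ :* d₂ :- n₁ :* n₂) :+ (s :* d₂ :+ r :* n₂) :* (n₁ :* d₂ :- n₂ :* d₁) :+ :0 :* m
                := (s :* n₁ :+ r :* d₁) :* (d₂ :* d₂ :- n₂ :* n₂)) n₁ d₁ n₂ d₂ s r middle ⟩
         (s * n₁ + r * d₁) * (d₂ * d₂ - n₂ * n₂) ≈⟨ trans (*-congʳ h) (*-identityˡ _) ⟩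
         d₂ * d₂ - n₂ * n₂ ∎)

       -- Modulo d² - n², the square of s n + r d = 1 becomes a multiple of d.
       unit-d : ∀ {n d} → Coprime n d → InIdeal (d * d - n * n) → UnitMod d
       unit-d {n} {d} (s , r , h) i = s * s * d + nat 2 * s * r * n + r * r * d , _ , ideal-combine (- (s * s)) 0# i i , (begin
         (s * s * d + nat 2 * s * r * n + r * r * d) * d + (- (s * s) * (d * d - n * n) + 0# * (d * d - n * n))
           ≈⟨ solve 4 (λ n d s r → (s :* s :* d :+ κ 2 :* s :* r :* n :+ r :* r :* d) :* d :+ ((:- (s :* s)) :* (d :* d :- n :* n) :+ :0 :* (d :* d :- n :* n))
                := (s :* n :+ r :* d) :* (s :* n :+ r :* d)) n d s r ⟩
         (s * n + r * d) * (s * n + r * d) ≈⟨ *-cong h h ⟩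
         1# * 1# ≈⟨ *-identityˡ 1# ⟩
         1# ∎)

       -- Modulo e₁ and e₂ the two x-values coincide in some x with x² = 1. There `middle` becomes 2
       -- x (2 + a x), and 2 (2 x - a) times this is 4 (4 - a²), a unit. The powers of d₁ and d₂
       -- appear on homogenising.
       power∈ : InIdeal (d₁ * d₁ * d₁ * (d₂ * d₂))
       power∈ = ideal-resp (begin
           u * (nat 2 * (nat 2 * n₁ - a * d₁) * middle) + 1# * (u * w)
             ≈⟨ solve 7 (λ a n₁ d₁ n₂ d₂ u u′ →
                  let e₁ = d₁ :* d₂ :- n₁ :* n₂ ; e₂ = n₁ :* d₂ :- n₂ :* d₁
                      mid = n₁ :* d₁ :* (d₂ :* d₂ :+ a :* (d₂ :* n₂) :+ n₂ :* n₂) :+ n₂ :* d₂ :* (d₁ :* d₁ :+ a :* (d₁ :* n₁) :+ n₁ :* n₁)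
                      k = κ 2 :* n₁ :- a :* d₁
                      p = κ 2 :* k :* (n₁ :* d₂ :+ n₂ :* d₁ :+ κ 2 :* a :* (d₁ :* d₂))
                      q = κ 4 :* k :* (d₁ :* d₂)
                      f = κ 16 :* (d₁ :* (d₂ :* d₂))
                      wt = p :* e₁ :+ q :* e₂ :+ f :* (d₁ :* d₁ :- n₁ :* n₁)
                  in u :* (κ 2 :* k :* mid) :+ :1 :* (u :* wt) := (κ 4 :* (κ 4 :- a :* a) :* u) :* (d₁ :* d₁ :* d₁ :* (d₂ :* d₂)) :+ :0 :* u′) a n₁ d₁ n₂ d₂ u u ⟩
           (nat 4 * (nat 4 - a * a) * u) * (d₁ * d₁ * d₁ * (d₂ * d₂)) + 0# * u
             ≈⟨ trans (+-cong (trans (*-congʳ u-inv) (*-identityˡ _)) (zeroˡ u)) (+-identityʳ _) ⟩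
           d₁ * d₁ * d₁ * (d₂ * d₂) ∎)
         (ideal-combine u 1# (0# , 0# , nat 2 * (nat 2 * n₁ - a * d₁) , solve 4 (λ x y z k → :0 :* x :+ :0 :* y :+ k :* z := k :* z) e₁ e₂ middle _)
           (ideal-resp (solve 2 (λ u w → u :* w :+ :0 :* w := u :* w) u w) (ideal-combine u 0# w∈ w∈)))
         where
         k = nat 2 * n₁ - a * d₁
         p = nat 2 * k * (n₁ * d₂ + n₂ * d₁ + nat 2 * a * (d₁ * d₂))
         q = nat 4 * k * (d₁ * d₂)
         f = nat 16 * (d₁ * (d₂ * d₂))
         w = p * e₁ + q * e₂ + f * (d₁ * d₁ - n₁ * n₁)
         w∈ : InIdeal w
         w∈ = ideal-resp (solve 2 (λ x y → :1 :* x :+ y := x :+ y) _ _)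
           (ideal-combine 1# f (p , q , 0# , solve 3 (λ x y z → x :+ y :+ :0 :* z := x :+ y) _ _ middle) f₁∈)

     one∈ : InIdeal 1#
     one∈ = let (k , j , ij , h) = unit-* (unit-* (unit-* ud₁ ud₁) ud₁) (unit-* ud₂ ud₂) in
       ideal-resp (trans (+-congˡ (*-identityˡ j)) h) (ideal-combine k 1# power∈ ij)
       where
       ud₁ = unit-d cop₁ f₁∈
       ud₂ = unit-d cop₂ f₂∈

     -- The cube of p e₁ + q e₂ lies in the ideal of e₁² and e₂², so cubing the relation for 1
     -- replaces e₁ and e₂ by their squares `lead` and `last`.
     unimodular : ∃ λ p → ∃₂ λ q r → p * lead + q * last + r * middle ≈ 1#
     unimodular = let (p , q , r , h) = one∈ ; z = p * e₁ + q * e₂ ; b = r * middle in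
       p * p * p * e₁ + nat 3 * p * p * q * e₂ , nat 3 * p * q * q * e₁ + q * q * q * e₂
       , r * (nat 3 * z * z + nat 3 * z * b + b * b) , (begin
         (p * p * p * e₁ + nat 3 * p * p * q * e₂) * lead + (nat 3 * p * q * q * e₁ + q * q * q * e₂) * last + r * (nat 3 * z * z + nat 3 * z * b + b * b) * middle
           ≈⟨ solve 6 (λ p q r x y m → let z = p :* x :+ q :* y ; b = r :* m in
                (p :* p :* p :* x :+ κ 3 :* p :* p :* q :* y) :* (x :* x) :+ (κ 3 :* p :* q :* q :* x :+ q :* q :* q :* y) :* (y :* y) :+ r :* (κ 3 :* z :* z :+ κ 3 :* z :* b :+ b :* b) :* m
                := (z :+ b) :* (z :+ b) :* (z :+ b)) p q r e₁ e₂ middle ⟩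
         (z + b) * (z + b) * (z + b) ≈⟨ *-cong (*-cong h h) h ⟩
         1# * 1# * 1# ≈⟨ solve 0 (:1 :* :1 :* :1 := :1) ⟩
         1# ∎)

-- Formal points and the addition law on y² = 1 + A x² + x⁴

module Points (K : CommutativeRing 0ℓ 0ℓ) where
 private module K = RingKit K
 open Series K
 open RingKit seriesRing

 module On
   (½ : CommutativeRing.Carrier K)
   (½*2 : RingKit.IsHalf K ½)
   (A : CommutativeRing.Carrier K) where

  a : Series
  a = C A

  quartic : Series → Series
  quartic X = 1# + a * X + X * X

  y₀ : Series
  y₀ = Sqrt.√ ½ ½*2 (quartic (t * t))

  private
    quartic0 : ∀ {x} → x 0 K.≈ K.0# → quartic (x * x) 0 K.≈ K.1#
    quartic0 {x} h = K.trans
      (K.+-cong (K.+-congˡ (K.*-congˡ (K.*-cong h h))) (K.*-cong (K.*-cong h h) (K.*-cong h h)))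
      (K.solve 1 (λ A → :1 :+ A :* (:0 :* :0) :+ :0 :* :0 :* (:0 :* :0) := :1) A)

  y₀-square : y₀ * y₀ ≈ quartic (t * t)
  y₀-square = Sqrt.√-square ½ ½*2 (quartic (t * t)) (quartic0 {t} K.refl)

  -- The x-coordinate is a uniformiser at the origin, and m is the multiplier of the invariant
  -- differential dx/y along the point, seen as a formal endomorphism.
  record Point : Set where
    field
      x y : Series
      m : K.Carrier
      x-zero : x 0 K.≈ K.0#
      y-zero : y 0 K.≈ K.1#
      curve : y * y ≈ quartic (x * x)
      diff : y₀ * θ x ≈ t * (C m * y)
  open Point

  cancel-unit : ∀ {u v a b} → u * v ≈ 1# → u * a ≈ u * b → a ≈ b
  cancel-unit {u} {v} {a} {b} uv h = begin
    a ≈⟨ sym (*-identityˡ a) ⟩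
    1# * a ≈⟨ *-congʳ (sym uv) ⟩
    (u * v) * a ≈⟨ solve 3 (λ u v a → u :* v :* a := v :* (u :* a)) u v a ⟩
    v * (u * a) ≈⟨ *-congˡ {v} h ⟩
    v * (u * b) ≈⟨ solve 3 (λ u v a → v :* (u :* a) := u :* v :* a) u v b ⟩
    (u * v) * b ≈⟨ *-congʳ uv ⟩
    1# * b ≈⟨ *-identityˡ b ⟩
    b ∎

  two-unit : nat 2 * C ½ ≈ 1#
  two-unit = begin
    nat 2 * C ½ ≈⟨ *-congʳ (sym (C-nat 2)) ⟩
    C (K.nat 2) * C ½ ≈⟨ sym (C-* _ _) ⟩
    C (K.nat 2 K.* ½) ≈⟨ C-cong (K.trans (K.*-comm _ _) ½*2) ⟩
    C K.1# ≈⟨ C-1 ⟩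
    1# ∎

  -- Differentiate the curve equation and cancel 2 y, a unit because y has constant term 1.
  diff-y : ∀ P → y₀ * θ (y P) ≈ t * (C (m P) * (a * x P + nat 2 * (x P * x P * x P)))
  diff-y P = cancel-unit two-unit (cancel-unit (inv-inverse Y (y-zero P)) (begin
    Y * (nat 2 * (y₀ * θ Y))
      ≈⟨ solve 3 (λ y q d → y :* (κ 2 :* (q :* d)) := q :* (d :* y :+ y :* d)) Y y₀ (θ Y) ⟩
    y₀ * (θ Y * Y + Y * θ Y)
      ≈⟨ *-congˡ {y₀} (sym (θ-* Y Y)) ⟩
    y₀ * θ (Y * Y)
      ≈⟨ *-congˡ {y₀} θcurve ⟩
    y₀ * (a * (θ X * X + X * θ X) + ((θ X * X + X * θ X) * (X * X) + (X * X) * (θ X * X + X * θ X)))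
      ≈⟨ solve 4 (λ q d a x → q :* (a :* (d :* x :+ x :* d) :+ ((d :* x :+ x :* d) :* (x :* x) :+ (x :* x) :* (d :* x :+ x :* d)))
                    := q :* d :* (κ 2 :* (a :* x :+ κ 2 :* (x :* x :* x)))) y₀ (θ X) a X ⟩
    y₀ * θ X * (nat 2 * (a * X + nat 2 * (X * X * X)))
      ≈⟨ *-congʳ (diff P) ⟩
    t * (C (m P) * Y) * (nat 2 * (a * X + nat 2 * (X * X * X)))
      ≈⟨ solve 4 (λ t m y w → t :* (m :* y) :* (κ 2 :* w) := y :* (κ 2 :* (t :* (m :* w)))) t (C (m P)) Y _ ⟩
    Y * (nat 2 * (t * (C (m P) * (a * X + nat 2 * (X * X * X))))) ∎))
    where
    X = x P
    Y = y P
    θcurve : θ (Y * Y) ≈ a * (θ X * X + X * θ X) + ((θ X * X + X * θ X) * (X * X) + (X * X) * (θ X * X + X * θ X))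
    θcurve = begin
      θ (Y * Y) ≈⟨ θ-cong (curve P) ⟩
      θ (1# + a * (X * X) + X * X * (X * X)) ≈⟨ θ-+ _ (X * X * (X * X)) ⟩
      θ (1# + a * (X * X)) + θ (X * X * (X * X))
        ≈⟨ +-cong (θ-+ 1# (a * (X * X))) (θ-* (X * X) (X * X)) ⟩
      θ 1# + θ (a * (X * X)) + (θ (X * X) * (X * X) + X * X * θ (X * X))
        ≈⟨ +-cong (+-cong (trans (θ-cong (sym C-1)) (θ-C K.1#)) (trans (θ-* a (X * X)) (+-congʳ (*-congʳ (θ-C A)))))
                  (+-cong (*-congʳ (θ-* X X)) (*-congˡ {X * X} (θ-* X X))) ⟩
      0# + (0# * (X * X) + a * θ (X * X)) + ((θ X * X + X * θ X) * (X * X) + X * X * (θ X * X + X * θ X))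
        ≈⟨ +-congʳ (+-congˡ {0#} (+-congˡ {0# * (X * X)} (*-congˡ {a} (θ-* X X)))) ⟩
      0# + (0# * (X * X) + a * (θ X * X + X * θ X)) + ((θ X * X + X * θ X) * (X * X) + X * X * (θ X * X + X * θ X))
        ≈⟨ solve 3 (λ u v w → :0 :+ (:0 :* u :+ v) :+ w := v :+ w) (X * X) _ _ ⟩
      a * (θ X * X + X * θ X) + ((θ X * X + X * θ X) * (X * X) + (X * X) * (θ X * X + X * θ X)) ∎

  C0-* : ∀ {f g : Series} → f 0 K.≈ K.0# → (f * g) 0 K.≈ K.0#
  C0-* h = K.trans (K.*-congʳ h) (K.zeroˡ _)

  -- Euler's addition theorem for the quartic. The denominators are powers of Δ = 1 - x₁² x₂², which
  -- is invertible as a series because the x-coordinates vanish at t = 0.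
  module Sum (P Q : Point) where
    private
      x₁ = x P
      x₂ = x Q
      y₁ = y P
      y₂ = y Q

    Δ : Series
    Δ = 1# - x₁ * x₂ * (x₁ * x₂)

    Δ-zero : Δ 0 K.≈ K.1#
    Δ-zero = K.trans (K.+-congˡ (K.-‿cong (K.*-congʳ (K.trans (K.*-congʳ (x-zero P)) (K.zeroˡ _)))))
      (K.solve 1 (λ u → :1 :- :0 :* u := :1) _)

    i : Series
    i = inv Δ

    Δi : Δ * i ≈ 1#
    Δi = inv-inverse Δ Δ-zero

    N : Series
    N = x₁ * y₂ + x₂ * y₁

    V : Series
    V = (1# + x₁ * x₂ * (x₁ * x₂)) * (y₁ * y₂ + a * (x₁ * x₂)) + nat 2 * (x₁ * x₂ * (x₁ * x₁ + x₂ * x₂))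

    curve-cleared : V * V ≈ Δ * Δ * (Δ * Δ) + a * (N * N) * (Δ * Δ) + N * N * (N * N)
    curve-cleared = begin
      V * V ≈⟨ cancel+ (solve 5 (λ a x₁ x₂ y₁ y₂ →
          let p = x₁ :* x₂ ; s = x₁ :* x₁ :+ x₂ :* x₂ ; Y = y₁ :* y₂
              Q₁ = :1 :+ a :* (x₁ :* x₁) :+ x₁ :* x₁ :* (x₁ :* x₁)
              Q₂ = :1 :+ a :* (x₂ :* x₂) :+ x₂ :* x₂ :* (x₂ :* x₂)
              d = :1 :- p :* p
              v = (:1 :+ p :* p) :* (Y :+ a :* p) :+ κ 2 :* (p :* s)
              M = s :* (:1 :+ p :* p) :+ κ 2 :* a :* (p :* p) :+ κ 2 :* p :* Y
          in v :* v :+ Q₁ :* Q₂ :* (d :* d) := (d :* d :* (d :* d) :+ a :* M :* (d :* d) :+ M :* M) :+ (y₁ :* y₁) :* (y₂ :* y₂) :* (d :* d)) a x₁ x₂ y₁ y₂)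
          (*-congʳ (*-cong (sym (curve P)) (sym (curve Q)))) ⟩
      Δ * Δ * (Δ * Δ) + a * _ * (Δ * Δ) + _ * _
        ≈⟨ +-cong (+-congˡ {Δ * Δ * (Δ * Δ)} (*-congʳ (*-congˡ {a} (sym N²)))) (*-cong (sym N²) (sym N²)) ⟩
      Δ * Δ * (Δ * Δ) + a * (N * N) * (Δ * Δ) + N * N * (N * N) ∎
      where
      N² : N * N ≈ (x₁ * x₁ + x₂ * x₂) * (1# + x₁ * x₂ * (x₁ * x₂)) + nat 2 * a * (x₁ * x₂ * (x₁ * x₂)) + nat 2 * (x₁ * x₂) * (y₁ * y₂)
      N² = cancel+ (solve 5 (λ a x₁ x₂ y₁ y₂ →
          let p = x₁ :* x₂ ; s = x₁ :* x₁ :+ x₂ :* x₂ ; Y = y₁ :* y₂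
              Q₁ = :1 :+ a :* (x₁ :* x₁) :+ x₁ :* x₁ :* (x₁ :* x₁)
              Q₂ = :1 :+ a :* (x₂ :* x₂) :+ x₂ :* x₂ :* (x₂ :* x₂)
              n = x₁ :* y₂ :+ x₂ :* y₁
              M = s :* (:1 :+ p :* p) :+ κ 2 :* a :* (p :* p) :+ κ 2 :* p :* Y
          in n :* n :+ (x₁ :* x₁ :* Q₂ :+ x₂ :* x₂ :* Q₁) := M :+ (x₁ :* x₁ :* (y₂ :* y₂) :+ x₂ :* x₂ :* (y₁ :* y₁))) a x₁ x₂ y₁ y₂)
          (+-cong (*-congˡ {x₁ * x₁} (sym (curve Q))) (*-congˡ {x₂ * x₂} (sym (curve P))))

    curve-sum : V * (i * i) * (V * (i * i)) ≈ quartic (N * i * (N * i))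
    curve-sum = begin
      V * (i * i) * (V * (i * i))
        ≈⟨ solve 2 (λ v i → v :* (i :* i) :* (v :* (i :* i)) := v :* v :* (i :* i :* (i :* i))) V i ⟩
      V * V * (i * i * (i * i))
        ≈⟨ *-congʳ curve-cleared ⟩
      (Δ * Δ * (Δ * Δ) + a * (N * N) * (Δ * Δ) + N * N * (N * N)) * (i * i * (i * i))
        ≈⟨ solve 4 (λ d n i a → (d :* d :* (d :* d) :+ a :* (n :* n) :* (d :* d) :+ n :* n :* (n :* n)) :* (i :* i :* (i :* i))
             := d :* i :* (d :* i) :* (d :* i :* (d :* i)) :+ a :* (n :* i :* (n :* i)) :* (d :* i :* (d :* i)) :+ n :* i :* (n :* i) :* (n :* i :* (n :* i))) Δ N i a ⟩
      Δ * i * (Δ * i) * (Δ * i * (Δ * i)) + a * (N * i * (N * i)) * (Δ * i * (Δ * i)) + N * i * (N * i) * (N * i * (N * i))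
        ≈⟨ +-congʳ (+-cong (*-cong (*-cong Δi Δi) (*-cong Δi Δi)) (*-congˡ {a * (N * i * (N * i))} (*-cong Δi Δi))) ⟩
      1# * 1# * (1# * 1#) + a * (N * i * (N * i)) * (1# * 1#) + N * i * (N * i) * (N * i * (N * i))
        ≈⟨ solve 2 (λ u v → :1 :* :1 :* (:1 :* :1) :+ u :* (:1 :* :1) :+ v := :1 :+ u :+ v) (a * (N * i * (N * i))) _ ⟩
      quartic (N * i * (N * i)) ∎

    θi : θ i ≈ - (i * i * θ Δ)
    θi = cancel-unit {Δ} {i} Δi (begin
      Δ * θ i ≈⟨ solve 2 (λ u v → u := (v :+ u) :- v) (Δ * θ i) (θ Δ * i) ⟩
      (θ Δ * i + Δ * θ i) - θ Δ * i ≈⟨ +-congʳ (sym (θ-* Δ i)) ⟩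
      θ (Δ * i) - θ Δ * i ≈⟨ +-congʳ (trans (θ-cong (trans Δi (sym C-1))) (θ-C K.1#)) ⟩
      0# - θ Δ * i ≈⟨ solve 2 (λ d i → :0 :- d :* i := :- (:1 :* (i :* d))) (θ Δ) i ⟩
      - (1# * (i * θ Δ)) ≈⟨ -‿cong (*-congʳ (sym Δi)) ⟩
      - (Δ * i * (i * θ Δ)) ≈⟨ solve 3 (λ D i d → :- (D :* i :* (i :* d)) := D :* (:- (i :* i :* d))) Δ i (θ Δ) ⟩
      Δ * - (i * i * θ Δ) ∎)

    private
      c₁ = C (m P)
      c₂ = C (m Q)

    diff-N : y₀ * θ N ≈ t * (c₁ * (y₁ * y₂ + x₂ * (a * x₁ + nat 2 * (x₁ * x₁ * x₁))) + c₂ * (y₁ * y₂ + x₁ * (a * x₂ + nat 2 * (x₂ * x₂ * x₂))))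
    diff-N = begin
      y₀ * θ N
        ≈⟨ *-congˡ {y₀} (trans (θ-+ (x₁ * y₂) (x₂ * y₁)) (+-cong (θ-* x₁ y₂) (θ-* x₂ y₁))) ⟩
      y₀ * (θ x₁ * y₂ + x₁ * θ y₂ + (θ x₂ * y₁ + x₂ * θ y₁))
        ≈⟨ solve 9 (λ q d₁ d₂ e₁ e₂ x₁ x₂ y₁ y₂ → q :* (d₁ :* y₂ :+ x₁ :* e₂ :+ (d₂ :* y₁ :+ x₂ :* e₁))
             := q :* d₁ :* y₂ :+ x₁ :* (q :* e₂) :+ (q :* d₂ :* y₁ :+ x₂ :* (q :* e₁))) y₀ (θ x₁) (θ x₂) (θ y₁) (θ y₂) x₁ x₂ y₁ y₂ ⟩
      y₀ * θ x₁ * y₂ + x₁ * (y₀ * θ y₂) + (y₀ * θ x₂ * y₁ + x₂ * (y₀ * θ y₁))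
        ≈⟨ +-cong (+-cong (*-congʳ (diff P)) (*-congˡ {x₁} (diff-y Q))) (+-cong (*-congʳ (diff Q)) (*-congˡ {x₂} (diff-y P))) ⟩
      t * (c₁ * y₁) * y₂ + x₁ * (t * (c₂ * (a * x₂ + nat 2 * (x₂ * x₂ * x₂)))) + (t * (c₂ * y₂) * y₁ + x₂ * (t * (c₁ * (a * x₁ + nat 2 * (x₁ * x₁ * x₁)))))
        ≈⟨ solve 9 (λ t c₁ c₂ x₁ x₂ y₁ y₂ u v → t :* (c₁ :* y₁) :* y₂ :+ x₁ :* (t :* (c₂ :* u)) :+ (t :* (c₂ :* y₂) :* y₁ :+ x₂ :* (t :* (c₁ :* v)))
             := t :* (c₁ :* (y₁ :* y₂ :+ x₂ :* v) :+ c₂ :* (y₁ :* y₂ :+ x₁ :* u))) t c₁ c₂ x₁ x₂ y₁ y₂ _ _ ⟩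
      t * (c₁ * (y₁ * y₂ + x₂ * (a * x₁ + nat 2 * (x₁ * x₁ * x₁))) + c₂ * (y₁ * y₂ + x₁ * (a * x₂ + nat 2 * (x₂ * x₂ * x₂)))) ∎

    diff-Δ : y₀ * θ Δ ≈ - (nat 2 * (x₁ * x₂) * (t * (c₁ * (y₁ * x₂) + c₂ * (x₁ * y₂))))
    diff-Δ = begin
      y₀ * θ Δ
        ≈⟨ *-congˡ {y₀} (trans (θ-+ 1# (- (x₁ * x₂ * (x₁ * x₂)))) (+-cong (trans (θ-cong (sym C-1)) (θ-C K.1#))
             (trans (θ-neg (x₁ * x₂ * (x₁ * x₂))) (-‿cong (trans (θ-* (x₁ * x₂) (x₁ * x₂)) (+-cong (*-congʳ (θ-* x₁ x₂)) (*-congˡ {x₁ * x₂} (θ-* x₁ x₂)))))))) ⟩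
      y₀ * (0# - ((θ x₁ * x₂ + x₁ * θ x₂) * (x₁ * x₂) + x₁ * x₂ * (θ x₁ * x₂ + x₁ * θ x₂)))
        ≈⟨ solve 5 (λ q d₁ d₂ x₁ x₂ → q :* (:0 :- ((d₁ :* x₂ :+ x₁ :* d₂) :* (x₁ :* x₂) :+ x₁ :* x₂ :* (d₁ :* x₂ :+ x₁ :* d₂)))
             := :- (κ 2 :* (x₁ :* x₂) :* (q :* d₁ :* x₂ :+ x₁ :* (q :* d₂)))) y₀ (θ x₁) (θ x₂) x₁ x₂ ⟩
      - (nat 2 * (x₁ * x₂) * (y₀ * θ x₁ * x₂ + x₁ * (y₀ * θ x₂)))
        ≈⟨ -‿cong (*-congˡ {nat 2 * (x₁ * x₂)} (+-cong (*-congʳ (diff P)) (*-congˡ {x₁} (diff Q)))) ⟩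
      - (nat 2 * (x₁ * x₂) * (t * (c₁ * y₁) * x₂ + x₁ * (t * (c₂ * y₂))))
        ≈⟨ solve 8 (λ w t c₁ c₂ x₁ x₂ y₁ y₂ → :- (w :* (t :* (c₁ :* y₁) :* x₂ :+ x₁ :* (t :* (c₂ :* y₂)))) := :- (w :* (t :* (c₁ :* (y₁ :* x₂) :+ c₂ :* (x₁ :* y₂))))) _ t c₁ c₂ x₁ x₂ y₁ y₂ ⟩
      - (nat 2 * (x₁ * x₂) * (t * (c₁ * (y₁ * x₂) + c₂ * (x₁ * y₂)))) ∎

    -- The differential dx/y is invariant under translation, hence multipliers add. After clearing Δ
    -- this is an identity modulo the two curve equations, with u₁ and u₂ as cofactors.
    diff-sum : y₀ * θ (N * i) ≈ t * (C (m P K.+ m Q) * (V * (i * i)))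
    diff-sum = begin
      y₀ * θ (N * i)
        ≈⟨ *-congˡ {y₀} (trans (θ-* N i) (+-congˡ {θ N * i} (*-congˡ {N} θi))) ⟩
      y₀ * (θ N * i + N * - (i * i * θ Δ))
        ≈⟨ solve 5 (λ q n' i n d → q :* (n' :* i :+ n :* (:- (i :* i :* d))) := (q :* n') :* i :* :1 :- n :* (q :* d) :* (i :* i)) y₀ (θ N) i N (θ Δ) ⟩
      (y₀ * θ N) * i * 1# - N * (y₀ * θ Δ) * (i * i)
        ≈⟨ +-congʳ (*-congˡ {(y₀ * θ N) * i} (sym Δi)) ⟩
      (y₀ * θ N) * i * (Δ * i) - N * (y₀ * θ Δ) * (i * i)
        ≈⟨ solve 5 (λ u v i n d → u :* i :* (d :* i) :- n :* v :* (i :* i) := (u :* d :- n :* v) :* (i :* i)) (y₀ * θ N) (y₀ * θ Δ) i N Δ ⟩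
      ((y₀ * θ N) * Δ - N * (y₀ * θ Δ)) * (i * i)
        ≈⟨ *-congʳ (+-cong (*-congʳ diff-N) (-‿cong (*-congˡ {N} diff-Δ))) ⟩
      (t * (c₁ * (y₁ * y₂ + x₂ * (a * x₁ + nat 2 * (x₁ * x₁ * x₁))) + c₂ * (y₁ * y₂ + x₁ * (a * x₂ + nat 2 * (x₂ * x₂ * x₂)))) * Δ
        - N * - (nat 2 * (x₁ * x₂) * (t * (c₁ * (y₁ * x₂) + c₂ * (x₁ * y₂))))) * (i * i)
        ≈⟨ *-congʳ (cancel+ (solve 8 (λ a t c₁ c₂ x₁ x₂ y₁ y₂ →
            let p = x₁ :* x₂
                Q₁ = :1 :+ a :* (x₁ :* x₁) :+ x₁ :* x₁ :* (x₁ :* x₁)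
                Q₂ = :1 :+ a :* (x₂ :* x₂) :+ x₂ :* x₂ :* (x₂ :* x₂)
                n = x₁ :* y₂ :+ x₂ :* y₁
                v = (:1 :+ p :* p) :* (y₁ :* y₂ :+ a :* p) :+ κ 2 :* (p :* (x₁ :* x₁ :+ x₂ :* x₂))
                u₁ = κ 2 :* t :* c₁ :* x₁ :* x₂ :* x₂ :* x₂
                u₂ = κ 2 :* t :* c₂ :* x₂ :* x₁ :* x₁ :* x₁
            in (t :* (c₁ :* (y₁ :* y₂ :+ x₂ :* (a :* x₁ :+ κ 2 :* (x₁ :* x₁ :* x₁))) :+ c₂ :* (y₁ :* y₂ :+ x₁ :* (a :* x₂ :+ κ 2 :* (x₂ :* x₂ :* x₂)))) :* (:1 :- p :* p)
                 :- n :* (:- (κ 2 :* p :* (t :* (c₁ :* (y₁ :* x₂) :+ c₂ :* (x₁ :* y₂)))))) :+ (u₁ :* Q₁ :+ u₂ :* Q₂)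
               := t :* ((c₁ :+ c₂) :* v) :+ (u₁ :* (y₁ :* y₁) :+ u₂ :* (y₂ :* y₂))) a t c₁ c₂ x₁ x₂ y₁ y₂)
            (+-cong (*-congˡ {nat 2 * t * c₁ * x₁ * x₂ * x₂ * x₂} (sym (curve P))) (*-congˡ {nat 2 * t * c₂ * x₂ * x₁ * x₁ * x₁} (sym (curve Q))))) ⟩
      t * ((c₁ + c₂) * V) * (i * i)
        ≈⟨ solve 4 (λ t c v i → t :* (c :* v) :* i := t :* (c :* (v :* i))) t (c₁ + c₂) V (i * i) ⟩
      t * ((c₁ + c₂) * (V * (i * i)))
        ≈⟨ *-congˡ {t} (*-congʳ (sym (C-+ (m P) (m Q)))) ⟩
      t * (C (m P K.+ m Q) * (V * (i * i))) ∎

    x₁0 = x-zero P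
    x₂0 = x-zero Q

    sum : Point
    sum = record
      { x = N * i
      ; y = V * (i * i)
      ; m = m P K.+ m Q
      ; x-zero = C0-* {N} {i} (K.trans (K.+-cong (C0-* {x₁} {y₂} x₁0) (C0-* {x₂} {y₁} x₂0)) (K.+-identityˡ _))
      ; y-zero = K.trans (K.*-cong V-zero (K.trans (K.*-cong (inv-zero Δ) (inv-zero Δ)) (K.*-identityˡ _))) (K.*-identityˡ _)
      ; curve = curve-sum
      ; diff = diff-sum
      }
      where
      V-zero : V 0 K.≈ K.1#
      V-zero = K.trans (K.+-cong (K.*-cong (K.+-congˡ (K.*-cong (K.*-cong x₁0 x₂0) (K.*-cong x₁0 x₂0)))
          (K.+-cong (K.*-cong (y-zero P) (y-zero Q)) (K.*-congˡ (K.*-cong x₁0 x₂0)))) (K.*-congˡ (K.*-congʳ (K.*-cong x₁0 x₂0))))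
        (K.solve 3 (λ A u v → (:1 :+ :0 :* :0 :* (:0 :* :0)) :* (:1 :* :1 :+ A :* (:0 :* :0)) :+ u :* (:0 :* :0 :* v) := :1) A _ _)

    x-sum-Δ : N * i * Δ ≈ N
    x-sum-Δ = trans (solve 3 (λ n i d → n :* i :* d := n :* (d :* i)) N i Δ) (trans (*-congˡ {N} Δi) (*-identityʳ N))

  open Sum using (sum) public

  infixl 6 _⊞_ _⊟_
  _⊞_ : Point → Point → Point
  P ⊞ Q = sum P Q

  neg : Point → Point
  neg P = record
    { x = - x P ; y = y P ; m = K.- m P
    ; x-zero = K.trans (K.-‿cong (x-zero P)) K.-0#≈0#
    ; y-zero = y-zero P
    ; curve = trans (curve P) (solve 2 (λ a x → :1 :+ a :* (x :* x) :+ x :* x :* (x :* x)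
        := :1 :+ a :* ((:- x) :* (:- x)) :+ (:- x) :* (:- x) :* ((:- x) :* (:- x))) a (x P))
    ; diff = begin
        y₀ * θ (- x P) ≈⟨ *-congˡ {y₀} (θ-neg (x P)) ⟩
        y₀ * - θ (x P) ≈⟨ sym (-‿distribʳ-* y₀ (θ (x P))) ⟩
        - (y₀ * θ (x P)) ≈⟨ -‿cong (diff P) ⟩
        - (t * (C (m P) * y P)) ≈⟨ solve 3 (λ t c y → :- (t :* (c :* y)) := t :* ((:- c) :* y)) t (C (m P)) (y P) ⟩
        t * (- C (m P) * y P) ≈⟨ *-congˡ {t} (*-congʳ (sym (C-neg (m P)))) ⟩
        t * (C (K.- m P) * y P) ∎
    }

  _⊟_ : Point → Point → Point
  P ⊟ Q = P ⊞ neg Q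

  -- Double negation is the identity only up to equality of coefficients, so the inverses of the two
  -- denominators have to be compared.
  ⊟-⊞-neg : ∀ P Q → x (P ⊞ neg (neg Q)) ≈ x (P ⊞ Q)
  ⊟-⊞-neg P Q = *-cong (+-congˡ {x P * y Q} (*-congʳ nn)) inv-eq
    where
    nn : - - x Q ≈ x Q
    nn = -‿involutive (x Q)
    Δ₁ = Sum.Δ P (neg (neg Q))
    Δ₂ = Sum.Δ P Q
    Δ-eq : Δ₁ ≈ Δ₂
    Δ-eq = +-congˡ {1#} (-‿cong (*-cong (*-congˡ {x P} nn) (*-congˡ {x P} nn)))
    inv-eq : inv Δ₁ ≈ inv Δ₂
    inv-eq = cancel-unit (Sum.Δi P Q) (trans (trans (*-congʳ (sym Δ-eq)) (Sum.Δi P (neg (neg Q)))) (sym (Sum.Δi P Q)))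

  -- Stands in for associativity: in a row P, P + Q, (P + Q) + Q the parallelogram law for P + Q and
  -- Q involves (P + Q) - Q, whose height has to be that of P.
  ⊞-⊟-cancel : ∀ P Q → x ((P ⊞ Q) ⊟ Q) ≈ x P
  ⊞-⊟-cancel P Q = begin
    (N * i * y₂ + - x₂ * (V * (i * i))) * inv Δ′
      ≈⟨ *-congʳ numerator ⟩
    x₁ * Δ′ * inv Δ′
      ≈⟨ trans (*-assoc x₁ Δ′ (inv Δ′)) (trans (*-congˡ {x₁} (Sum.Δi (P ⊞ Q) (neg Q))) (*-identityʳ x₁)) ⟩
    x₁ ∎
    where
    open Sum P Q using (N; V; i; Δ; Δi)
    x₁ = x P
    x₂ = x Q
    y₁ = y P
    y₂ = y Q
    Δ′ = Sum.Δ (P ⊞ Q) (neg Q)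
    numerator : N * i * y₂ + - x₂ * (V * (i * i)) ≈ x₁ * Δ′
    numerator = begin
      N * i * y₂ + - x₂ * (V * (i * i))
        ≈⟨ solve 5 (λ n i y x v → n :* i :* y :+ (:- x) :* (v :* (i :* i)) := n :* y :* (i :* :1) :- x :* v :* (i :* i)) N i y₂ x₂ V ⟩
      N * y₂ * (i * 1#) - x₂ * V * (i * i)
        ≈⟨ +-congʳ (*-congˡ {N * y₂} (*-congˡ {i} (sym Δi))) ⟩
      N * y₂ * (i * (Δ * i)) - x₂ * V * (i * i)
        ≈⟨ solve 4 (λ u v i d → u :* (i :* (d :* i)) :- v :* (i :* i) := (u :* d :- v) :* (i :* i)) (N * y₂) (x₂ * V) i Δ ⟩
      (N * y₂ * Δ - x₂ * V) * (i * i)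
        ≈⟨ *-congʳ (cancel+ (solve 5 (λ a x₁ x₂ y₁ y₂ →
            let p = x₁ :* x₂
                Q₁ = :1 :+ a :* (x₁ :* x₁) :+ x₁ :* x₁ :* (x₁ :* x₁)
                Q₂ = :1 :+ a :* (x₂ :* x₂) :+ x₂ :* x₂ :* (x₂ :* x₂)
                n = x₁ :* y₂ :+ x₂ :* y₁
                d = :1 :- p :* p
                v = (:1 :+ p :* p) :* (y₁ :* y₂ :+ a :* p) :+ κ 2 :* (p :* (x₁ :* x₁ :+ x₂ :* x₂))
                u₂ = x₁ :* d :+ x₁ :* x₁ :* x₁ :* x₂ :* x₂
                u₁ = x₁ :* x₂ :* x₂ :* x₂ :* x₂
            in (n :* y₂ :* d :- x₂ :* v) :+ (u₁ :* Q₁ :+ u₂ :* Q₂) := x₁ :* (d :* d :- n :* n :* (x₂ :* x₂)) :+ (u₁ :* (y₁ :* y₁) :+ u₂ :* (y₂ :* y₂))) a x₁ x₂ y₁ y₂)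
            (+-cong (*-congˡ {x₁ * x₂ * x₂ * x₂ * x₂} (sym (curve P))) (*-congˡ {x₁ * Δ + x₁ * x₁ * x₁ * x₂ * x₂} (sym (curve Q))))) ⟩
      x₁ * (Δ * Δ - N * N * (x₂ * x₂)) * (i * i)
        ≈⟨ solve 5 (λ x d n z i → x :* (d :* d :- n :* n :* (z :* z)) :* (i :* i) := x :* (d :* i :* (d :* i) :- n :* i :* (:- z) :* (n :* i :* (:- z)))) x₁ Δ N x₂ i ⟩
      x₁ * (Δ * i * (Δ * i) - N * i * - x₂ * (N * i * - x₂))
        ≈⟨ *-congˡ {x₁} (+-congʳ (trans (*-cong Δi Δi) (*-identityˡ 1#))) ⟩
      x₁ * Δ′ ∎

  generic : Point
  generic = record
    { x = t ; y = y₀ ; m = K.1#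
    ; x-zero = K.refl
    ; y-zero = K.refl
    ; curve = y₀-square
    ; diff = trans (*-congˡ {y₀} θ-t) (trans (*-comm y₀ t) (*-congˡ {t} (trans (sym (*-identityˡ y₀)) (*-congʳ (sym C-1)))))
    }

-- The point given by complex multiplication by α

module AlphaPoint (K : CommutativeRing 0ℓ 0ℓ) where
 private module K = RingKit K
 open Series K
 open RingKit seriesRing

 module On
   (½ : CommutativeRing.Carrier K)
   (½*2 : RingKit.IsHalf K ½)
   (A α μ : CommutativeRing.Carrier K) where
  open Points.On K ½ ½*2 A

  T q : Series
  T = t * t
  q = (1# + T) * (1# + T) + C μ * T

  -- The endomorphism is the composite of two Landen transformations x ↦ x / (1 + k x²).
  module _
    (rel₁ : A K.- K.nat 6 K.- K.nat 6 K.* μ K.≈ A K.* (α K.* α))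
    (rel₂ : μ K.* μ K.≈ K.nat 8 K.- K.nat 4 K.* A)
    (rel₃ : K.nat 4 K.* μ K.* (K.nat 2 K.* μ K.- A K.+ K.nat 6) K.≈ α K.* α K.* (α K.* α))
    where

    private
      r i : Series
      r = (1# + T) * (1# + T) - C μ * T
      i = inv q

      q-zero : q 0 K.≈ K.1#
      q-zero = K.solve 1 (λ m → (:1 :+ :0 :* :0) :* (:1 :+ :0 :* :0) :+ m :* (:0 :* :0) := :1) μ

      qi : q * i ≈ 1#
      qi = inv-inverse q q-zero

      C-sub : ∀ a b → C (a K.- b) ≈ C a - C b
      C-sub a b = trans (C-+ a (K.- b)) (+-congˡ {C a} (C-neg b))

      C-nat* : ∀ k a → C (K.nat k K.* a) ≈ nat k * C a
      C-nat* k a = trans (C-* (K.nat k) a) (*-congʳ (C-nat k))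

      rel₁′ : C A - nat 6 - nat 6 * C μ ≈ C A * (C α * C α)
      rel₁′ = trans (sym (trans (C-sub _ _) (+-cong (trans (C-sub A (K.nat 6)) (+-congˡ {C A} (-‿cong (C-nat 6)))) (-‿cong (C-nat* 6 μ)))))
        (trans (C-cong rel₁) (trans (C-* A (α K.* α)) (*-congˡ {C A} (C-* α α))))

      rel₂′ : C μ * C μ ≈ nat 8 - nat 4 * C A
      rel₂′ = trans (sym (C-* μ μ)) (trans (C-cong rel₂) (trans (C-sub _ _) (+-cong (C-nat 8) (-‿cong (C-nat* 4 A)))))

      rel₃′ : nat 4 * C μ * (nat 2 * C μ - C A + nat 6) ≈ C α * C α * (C α * C α)
      rel₃′ = trans (sym (trans (C-* _ _) (*-cong (C-nat* 4 μ) (trans (C-+ _ (K.nat 6)) (+-cong (trans (C-sub _ A) (+-congʳ (C-nat* 2 μ))) (C-nat 6))))))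
        (trans (C-cong rel₃) (trans (C-* _ _) (*-cong (C-* α α) (C-* α α))))

      X Y : Series
      X = C α * (t * (1# + T)) * i
      Y = y₀ * ((1# - T) * r) * (i * i)

      -- a quartic form in (1 + T)² and T
      curve-cleared : quartic T * ((1# - T) * r * ((1# - T) * r))
        ≈ q * q * (q * q) + C A * (C α * C α) * (T * ((1# + T) * (1# + T)) * (q * q)) + C α * C α * (C α * C α) * (T * T * ((1# + T) * (1# + T) * ((1# + T) * (1# + T))))
      curve-cleared = trans (cancel+ (solve 3 (λ a m T →
          -- One has 1 + a T + T² = s + (a - 2) T and (1 - T)² = s - 4 T, so both sides are quartic
          -- forms in s and T. Comparing their coefficients leads to the three relations between a,
          -- μ and α.
          let s = (:1 :+ T) :* (:1 :+ T)
              q = s :+ m :* T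
              r = s :- m :* T
              k = T :* T :* (r :* r)
          in (:1 :+ a :* T :+ T :* T) :* ((:1 :- T) :* r :* ((:1 :- T) :* r)) :+ m :* m :* k
             := (q :* q :* (q :* q) :+ (a :- κ 6 :- κ 6 :* m) :* (T :* s :* (q :* q)) :+ κ 4 :* m :* (κ 2 :* m :- a :+ κ 6) :* (T :* T :* (s :* s)))
                :+ (κ 8 :- κ 4 :* a) :* k) (C A) (C μ) T) (*-congʳ rel₂′))
        (+-cong (+-congˡ {q * q * (q * q)} (*-congʳ rel₁′)) (*-congʳ rel₃′))

      curve-eq : Y * Y ≈ quartic (X * X)
      curve-eq = begin
        Y * Y
          ≈⟨ solve 3 (λ y v i → y :* v :* (i :* i) :* (y :* v :* (i :* i)) := y :* y :* (v :* v) :* (i :* i :* (i :* i))) y₀ ((1# - T) * r) i ⟩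
        y₀ * y₀ * ((1# - T) * r * ((1# - T) * r)) * (i * i * (i * i))
          ≈⟨ *-congʳ (trans (*-congʳ y₀-square) curve-cleared) ⟩
        (q * q * (q * q) + C A * (C α * C α) * (T * ((1# + T) * (1# + T)) * (q * q)) + C α * C α * (C α * C α) * (T * T * ((1# + T) * (1# + T) * ((1# + T) * (1# + T))))) * (i * i * (i * i))
          ≈⟨ solve 5 (λ a l t q i → let T = t :* t ; x = l :* (t :* (:1 :+ T)) :* i in
               (q :* q :* (q :* q) :+ a :* (l :* l) :* (T :* ((:1 :+ T) :* (:1 :+ T)) :* (q :* q)) :+ l :* l :* (l :* l) :* (T :* T :* ((:1 :+ T) :* (:1 :+ T) :* ((:1 :+ T) :* (:1 :+ T))))) :* (i :* i :* (i :* i))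
               := q :* i :* (q :* i) :* (q :* i :* (q :* i)) :+ a :* (x :* x) :* (q :* i :* (q :* i)) :+ x :* x :* (x :* x)) (C A) (C α) t q i ⟩
        q * i * (q * i) * (q * i * (q * i)) + C A * (X * X) * (q * i * (q * i)) + X * X * (X * X)
          ≈⟨ +-congʳ (+-cong (*-cong (*-cong qi qi) (*-cong qi qi)) (*-congˡ {C A * (X * X)} (*-cong qi qi))) ⟩
        1# * 1# * (1# * 1#) + C A * (X * X) * (1# * 1#) + X * X * (X * X)
          ≈⟨ solve 2 (λ u v → :1 :* :1 :* (:1 :* :1) :+ u :* (:1 :* :1) :+ v := :1 :+ u :+ v) (C A * (X * X)) _ ⟩
        quartic (X * X) ∎

      θ1 : θ 1# ≈ 0#
      θ1 = trans (θ-cong (sym C-1)) (θ-C K.1#)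

      θT : θ T ≈ nat 2 * T
      θT = trans (θ-* t t) (trans (+-cong (*-congʳ θ-t) (*-congˡ {t} θ-t)) (solve 1 (λ T → T :+ T := κ 2 :* T) T))

      θ[1+T] : θ (1# + T) ≈ nat 2 * T
      θ[1+T] = trans (θ-+ 1# T) (trans (+-cong θ1 θT) (+-identityˡ _))

      θq : θ q ≈ nat 4 * (T * (1# + T)) + C μ * (nat 2 * T)
      θq = trans (θ-+ ((1# + T) * (1# + T)) (C μ * T)) (+-cong
        (trans (θ-* (1# + T) (1# + T)) (trans (+-cong (*-congʳ θ[1+T]) (*-congˡ {1# + T} θ[1+T])) (solve 1 (λ T → κ 2 :* T :* (:1 :+ T) :+ (:1 :+ T) :* (κ 2 :* T) := κ 4 :* (T :* (:1 :+ T))) T)))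
        (trans (θ-* (C μ) T) (trans (+-cong (trans (*-congʳ (θ-C μ)) (zeroˡ T)) (*-congˡ {C μ} θT)) (+-identityˡ _))))

      θi : θ i ≈ - (i * i * θ q)
      θi = cancel-unit {q} {i} qi (begin
        q * θ i ≈⟨ solve 2 (λ u v → u := (v :+ u) :- v) (q * θ i) (θ q * i) ⟩
        (θ q * i + q * θ i) - θ q * i ≈⟨ +-congʳ (sym (θ-* q i)) ⟩
        θ (q * i) - θ q * i ≈⟨ +-congʳ (trans (θ-cong qi) θ1) ⟩
        0# - θ q * i ≈⟨ solve 2 (λ d i → :0 :- d :* i := :- (:1 :* (i :* d))) (θ q) i ⟩
        - (1# * (i * θ q)) ≈⟨ -‿cong (*-congʳ (sym qi)) ⟩
        - (q * i * (i * θ q)) ≈⟨ solve 3 (λ D i d → :- (D :* i :* (i :* d)) := D :* (:- (i :* i :* d))) q i (θ q) ⟩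
        q * - (i * i * θ q) ∎)

      θX : θ X ≈ C α * t * ((1# - T) * r * (i * i))
      θX = begin
        θ (C α * (t * (1# + T)) * i)
          ≈⟨ trans (θ-* (C α * (t * (1# + T))) i) (+-cong (*-congʳ (trans (θ-* (C α) (t * (1# + T))) (+-cong (*-congʳ (θ-C α)) (*-congˡ {C α}
               (trans (θ-* t (1# + T)) (+-cong (*-congʳ θ-t) (*-congˡ {t} θ[1+T]))))))) (*-congˡ {C α * (t * (1# + T))} (trans θi (-‿cong (*-congˡ {i * i} θq))))) ⟩
        (0# * (t * (1# + T)) + C α * (t * (1# + T) + t * (nat 2 * T))) * i + C α * (t * (1# + T)) * - (i * i * (nat 4 * (T * (1# + T)) + C μ * (nat 2 * T)))
          ≈⟨ solve 5 (λ l t T i w → (:0 :* (t :* (:1 :+ T)) :+ l :* (t :* (:1 :+ T) :+ t :* (κ 2 :* T))) :* i :+ l :* (t :* (:1 :+ T)) :* (:- (i :* i :* w))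
               := l :* t :* ((:1 :+ κ 3 :* T) :* (i :* :1) :- (:1 :+ T) :* w :* (i :* i))) (C α) t T i (nat 4 * (T * (1# + T)) + C μ * (nat 2 * T)) ⟩
        C α * t * ((1# + nat 3 * T) * (i * 1#) - (1# + T) * (nat 4 * (T * (1# + T)) + C μ * (nat 2 * T)) * (i * i))
          ≈⟨ *-congˡ {C α * t} (+-congʳ (*-congˡ {1# + nat 3 * T} (*-congˡ {i} (sym qi)))) ⟩
        C α * t * ((1# + nat 3 * T) * (i * (q * i)) - (1# + T) * (nat 4 * (T * (1# + T)) + C μ * (nat 2 * T)) * (i * i))
          ≈⟨ *-congˡ {C α * t} (solve 3 (λ m T i → let s = (:1 :+ T) :* (:1 :+ T) in
               (:1 :+ κ 3 :* T) :* (i :* ((s :+ m :* T) :* i)) :- (:1 :+ T) :* (κ 4 :* (T :* (:1 :+ T)) :+ m :* (κ 2 :* T)) :* (i :* i)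
               := (:1 :- T) :* (s :- m :* T) :* (i :* i)) (C μ) T i) ⟩
        C α * t * ((1# - T) * r * (i * i)) ∎

    αPoint : Point
    αPoint = record
      { x = X ; y = Y ; m = α
      ; x-zero = K.trans (K.*-congʳ (K.trans (K.*-congˡ (K.zeroˡ _)) (K.zeroʳ α))) (K.zeroˡ _)
      ; y-zero = K.trans (K.*-cong (K.trans (K.*-identityˡ _) (K.solve 1 (λ m → (:1 :- :0 :* :0) :* ((:1 :+ :0 :* :0) :* (:1 :+ :0 :* :0) :- m :* (:0 :* :0)) := :1) μ))
          (K.*-cong (inv-zero q) (inv-zero q))) (K.solve 0 (:1 :* (:1 :* :1) := :1))
      ; curve = curve-eq
      ; diff = trans (*-congˡ {y₀} θX) (solve 5 (λ y a t v i → y :* (a :* t :* (v :* i)) := t :* (a :* (y :* v :* i))) y₀ (C α) t ((1# - T) * r) (i * i))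
      }

    αPoint-quotient : q * q * (Point.x αPoint * Point.x αPoint) ≈ C α * C α * (T * ((1# + T) * (1# + T)))
    αPoint-quotient = trans (solve 4 (λ a t i q → let x = a :* (t :* (:1 :+ t :* t)) :* i in q :* q :* (x :* x) := a :* a :* (t :* t :* ((:1 :+ t :* t) :* (:1 :+ t :* t))) :* (q :* i :* (q :* i))) (C α) t i q) (trans (*-congˡ {C α * C α * (T * ((1# + T) * (1# + T)))} (trans (*-cong qi qi) (*-identityˡ 1#))) (*-identityʳ _))

-- Polynomials over a field and the height of a rational function

module Heights (K : CommutativeRing 0ℓ 0ℓ) where
 open import Relation.Binary.Definitions using (Tri; tri<; tri≈; tri>)
 private module K = RingKit K
 open Series K
 open RingKit seriesRing

 module On
   (_≟0 : RingKit.ZeroTest K)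
   (inverse : RingKit.Inverses K)
   (1≉0 : RingKit.NonTrivial K) where

  integral : ∀ {a b} → a K.* b K.≈ K.0# → ¬ a K.≈ K.0# → b K.≈ K.0#
  integral {a} {b} h a≉0 = let (a′ , e) = inverse a a≉0 in K.begin
    b K.≈⟨ K.sym (K.*-identityˡ b) ⟩
    K.1# K.* b K.≈⟨ K.*-congʳ (K.sym e) ⟩
    (a K.* a′) K.* b K.≈⟨ K.solve 3 (λ a a′ b → a :* a′ :* b := a′ :* (a :* b)) a a′ b ⟩
    a′ K.* (a K.* b) K.≈⟨ K.*-congˡ h ⟩
    a′ K.* K.0# K.≈⟨ K.zeroʳ a′ ⟩
    K.0# K.∎

  *-nonzero : ∀ {a b} → ¬ a K.≈ K.0# → ¬ b K.≈ K.0# → ¬ a K.* b K.≈ K.0#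
  *-nonzero ha hb h = hb (integral h ha)

  square-zero : ∀ {a} → a K.* a K.≈ K.0# → a K.≈ K.0#
  square-zero {a} h with a ≟0
  ... | yes z = z
  ... | no nz = integral h nz

  unit-series : ∀ f → ¬ f 0 K.≈ K.0# → ∃ λ g → f * g ≈ 1#
  unit-series f f0 with inverse (f 0) f0
  ... | b , e = C b * inv (C b * f) , trans
    (solve 3 (λ f b i → f :* (b :* i) := (b :* f) :* i) f (C b) (inv (C b * f)))
    (inv-inverse (C b * f) (K.trans (C-⊛ b f 0) (K.trans (K.*-comm b (f 0)) e)))

  cancel-series : ∀ {f g h} → ¬ f 0 K.≈ K.0# → f * g ≈ f * h → g ≈ h
  cancel-series {f} {g} {h} f0 e = let (u , fu) = unit-series f f0 in begin
    g ≈⟨ sym (trans (*-congʳ fu) (*-identityˡ g)) ⟩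
    (f * u) * g ≈⟨ solve 3 (λ f u g → f :* u :* g := u :* (f :* g)) f u g ⟩
    u * (f * g) ≈⟨ *-congˡ {u} e ⟩
    u * (f * h) ≈⟨ solve 3 (λ f u g → u :* (f :* g) := f :* u :* g) f u h ⟩
    (f * u) * h ≈⟨ trans (*-congʳ fu) (*-identityˡ h) ⟩
    h ∎

  IsPoly : Series → Set
  IsPoly f = ∃ (Deg≤ f)

  private
    poly-+ : ∀ {f g} → IsPoly f → IsPoly g → IsPoly (f + g)
    poly-+ {f} {g} (a , hf) (b , hg) = a ℕ.+ b ,
      Deg≤-+ {f} {g} (Deg≤-mono {f} (ℕₚ.m≤m+n a b) hf) (Deg≤-mono {g} (ℕₚ.m≤n+m b a) hg)

  polyRing : CommutativeRing 0ℓ 0ℓ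
  polyRing = record
    { Carrier = ∃ IsPoly
    ; _≈_ = λ f g → proj₁ f ≈ proj₁ g
    ; _+_ = λ f g → proj₁ f + proj₁ g , poly-+ {proj₁ f} {proj₁ g} (proj₂ f) (proj₂ g)
    ; _*_ = λ f g → proj₁ f * proj₁ g , _ , Deg≤-* {proj₁ f} {proj₁ g} _ _ (proj₂ (proj₂ f)) (proj₂ (proj₂ g))
    ; -_ = λ f → - proj₁ f , proj₁ (proj₂ f) , Deg≤-neg {proj₁ f} (proj₂ (proj₂ f))
    ; 0# = 0# , 0 , (λ _ _ → K.refl)
    ; 1# = 1# , 0 , Deg≤-𝟏
    ; isCommutativeRing = record
      { isRing = record
        { +-isAbelianGroup = record
          { isGroup = record
            { isMonoid = record
              { isSemigroup = record
                { isMagma = record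
                  { isEquivalence = record { refl = refl ; sym = sym ; trans = trans }
                  ; ∙-cong = +-cong }
                ; assoc = λ f g h → +-assoc (proj₁ f) (proj₁ g) (proj₁ h) }
              ; identity = (λ f → +-identityˡ (proj₁ f)) , (λ f → +-identityʳ (proj₁ f)) }
            ; inverse = (λ f → -‿inverseˡ (proj₁ f)) , (λ f → -‿inverseʳ (proj₁ f))
            ; ⁻¹-cong = -‿cong }
          ; comm = λ f g → +-comm (proj₁ f) (proj₁ g) }
        ; *-cong = *-cong
        ; *-assoc = λ f g h → *-assoc (proj₁ f) (proj₁ g) (proj₁ h)
        ; *-identity = (λ f → *-identityˡ (proj₁ f)) , (λ f → *-identityʳ (proj₁ f))
        ; distrib = (λ f g h → distribˡ (proj₁ f) (proj₁ g) (proj₁ h)) , (λ f g h → distribʳ (proj₁ f) (proj₁ g) (proj₁ h)) }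
      ; *-comm = λ f g → *-comm (proj₁ f) (proj₁ g) } }

  module P = RingKit polyRing
  module Cop = Coprime polyRing
  open Cop using (coprime-sym; coprime-respʳ; coprime-*; coprime-*ˡ; coprime-unit; coprime-+; coprime-divides) renaming (Coprime to Coprimeₚ) public

  Poly : Set
  Poly = P.Carrier

  ser : Poly → Series
  ser = proj₁

  tₚ : Poly
  tₚ = t , 1 , Deg≤-t

  Cₚ : K.Carrier → Poly
  Cₚ a = C a , 0 , Deg≤-C a

  tlₚ : Poly → Poly
  tlₚ (f , d , h) = tl f , d , λ n d<n → h (suc n) (ℕₚ.m≤n⇒m≤1+n d<n)

  θₚ : Poly → Poly
  θₚ (f , d , h) = θ f , d , Deg≤-θ {f} h

  tl-of-zero : ∀ f → f 0 K.≈ K.0# → f ≈ t * tl f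
  tl-of-zero f h = trans (horner f) (trans (+-congʳ (trans (C-cong h) C-0)) (+-identityˡ _))

  coprime-t : ∀ a → ¬ ser a 0 K.≈ K.0# → Coprimeₚ a tₚ
  coprime-t a a0 with inverse (ser a 0) a0
  ... | b , e = Cₚ b , P.- (Cₚ b P.* tlₚ a) , (begin
    C b * ser a + - (C b * tl (ser a)) * t
      ≈⟨ +-congʳ (*-congˡ {C b} (horner (ser a))) ⟩
    C b * (C (ser a 0) + t * tl (ser a)) + - (C b * tl (ser a)) * t
      ≈⟨ solve 4 (λ b a t s → b :* (a :+ t :* s) :+ (:- (b :* s)) :* t := a :* b) (C b) (C (ser a 0)) t (tl (ser a)) ⟩
    C (ser a 0) * C b
      ≈⟨ trans (sym (C-* _ _)) (trans (C-cong e) C-1) ⟩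
    1# ∎)

  private
    Below : Series → ℕ → Set
    Below f d = ∀ n → d ℕ.≤ n → f n K.≈ K.0#

  record Split (a u : Poly) : Set where
    constructor split
    field
      g a′ u′ : Poly
      a-eq : ser a ≈ ser g * ser a′
      u-eq : ser u ≈ ser g * ser u′
      coprime : Coprimeₚ a′ u′

  private
    split-swap : ∀ {a u} → Split a u → Split u a
    split-swap (split g a′ u′ p q co) = split g u′ a′ q p (coprime-sym {a′} {u′} co)

    factor-nonzero : ∀ {f g h : Series} → f ≈ g * h → ¬ f 0 K.≈ K.0# → ¬ h 0 K.≈ K.0#
    factor-nonzero e f0 z = f0 (K.trans (e 0) (K.trans (K.*-congˡ z) (K.zeroʳ _)))

    -- one step of the gcd algorithm, with t in the role that 2 plays in the binary algorithm
    split-step : ∀ a u k v → ¬ ser a 0 K.≈ K.0# → ser u ≈ C k * ser a + t * ser v → Split a v → Split a u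
    split-step a u k v a0 e (split g a′ v′ p q co) = split g a′ (Cₚ k P.* a′ P.+ tₚ P.* v′) p
      (begin
        ser u ≈⟨ e ⟩
        C k * ser a + t * ser v ≈⟨ +-cong (*-congˡ {C k} p) (*-congˡ {t} q) ⟩
        C k * (ser g * ser a′) + t * (ser g * ser v′)
          ≈⟨ solve 5 (λ k g a t v → k :* (g :* a) :+ t :* (g :* v) := g :* (k :* a :+ t :* v)) (C k) (ser g) (ser a′) t (ser v′) ⟩
        ser g * (C k * ser a′ + t * ser v′) ∎)
      (coprime-+ {a′} {tₚ P.* v′} (Cₚ k) (coprime-* {a′} {tₚ} {v′} (coprime-t a′ (factor-nonzero {g = ser g} p a0)) co))

    split-zero : ∀ a u → ser u ≈ 0# → Split a u
    split-zero a u z = split a P.1# P.0# (sym (*-identityʳ (ser a))) (trans z (sym (zeroʳ (ser a))))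
      (coprime-sym {P.0#} {P.1#} (coprime-unit {P.0#} {P.1#} {P.1#} (*-identityˡ 1#)))

    -- One constant term must be nonzero, so t never divides both polynomials. The bounds replace
    -- degrees, whose exact values are unknown; every recursive step divides one polynomial by t and
    -- lowers the sum of the bounds.
    gcd-rec : ∀ k a u α β → α ℕ.+ β ℕ.≤ k → Below (ser a) α → Below (ser u) β →
              ¬ ser a 0 K.≈ K.0# ⊎ ¬ ser u 0 K.≈ K.0# → Split a u

    reduce : ∀ k a u α β → α ℕ.+ β ℕ.≤ suc k → Below (ser a) α → Below (ser u) (suc β) → α ℕ.≤ suc β →
             ¬ ser a 0 K.≈ K.0# → α ℕ.+ β ℕ.≤ k → Split a u
    reduce k a u α β _ ha hu α≤β a0 le with inverse (ser a 0) a0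
    ... | b , e = split-step a u κ′ v a0 eq (gcd-rec k a v α β le ha hv (inj₁ a0))
      where
      κ′ = ser u 0 K.* b
      w = u P.- Cₚ κ′ P.* a
      v = tlₚ w
      w0 : ser w 0 K.≈ K.0#
      w0 = K.trans (K.+-congˡ (K.-‿cong (C-⊛ κ′ (ser a) 0)))
        (K.trans (K.solve 3 (λ u b a → u :- u :* b :* a := u :* (:1 :- a :* b)) (ser u 0) b (ser a 0))
          (K.trans (K.*-congˡ (K.trans (K.+-congˡ (K.-‿cong e)) (K.-‿inverseʳ _))) (K.zeroʳ _)))
      hv : Below (ser v) β
      hv n β≤n = K.trans (K.+-cong (hu (suc n) (s≤s β≤n)) (K.-‿cong (K.trans (C-⊛ κ′ (ser a) (suc n))
        (K.trans (K.*-congˡ (ha (suc n) (ℕₚ.≤-trans α≤β (s≤s β≤n)))) (K.zeroʳ _))))) (K.-‿inverseʳ K.0#)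
      eq : ser u ≈ C κ′ * ser a + t * ser v
      eq = begin
        ser u ≈⟨ solve 2 (λ u x → u := x :+ (u :- x)) (ser u) (C κ′ * ser a) ⟩
        C κ′ * ser a + ser w            ≈⟨ +-congˡ {C κ′ * ser a} (tl-of-zero (ser w) w0) ⟩
        C κ′ * ser a + t * ser v ∎

    shift : ∀ k a u α β → α ℕ.+ suc β ℕ.≤ suc k → Below (ser a) α → Below (ser u) (suc β) →
            ¬ ser a 0 K.≈ K.0# → ser u 0 K.≈ K.0# → Split a u
    shift k a u α β le ha hu a0 u0 = split-step a u K.0# (tlₚ u) a0
      (trans (tl-of-zero (ser u) u0) (sym (trans (+-congʳ (trans (*-congʳ C-0) (zeroˡ (ser a)))) (+-identityˡ _))))
      (gcd-rec k a (tlₚ u) α β (ℕₚ.≤-pred (≡.subst (ℕ._≤ suc k) (ℕₚ.+-suc α β) le)) ha (λ n β≤n → hu (suc n) (s≤s β≤n)) (inj₁ a0))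

    gcd-rec zero a u zero zero _ ha hu (inj₁ a0) = ⊥-elim (a0 (ha 0 z≤n))
    gcd-rec zero a u zero zero _ ha hu (inj₂ u0) = ⊥-elim (u0 (hu 0 z≤n))
    gcd-rec (suc k) a u α β le ha hu nz with (ser a 0) ≟0 | (ser u 0) ≟0
    gcd-rec (suc k) a u α β le ha hu (inj₁ a0) | yes za | yes zu = ⊥-elim (a0 za)
    gcd-rec (suc k) a u α β le ha hu (inj₂ u0) | yes za | yes zu = ⊥-elim (u0 zu)
    gcd-rec (suc k) a u α zero le ha hu nz | no a0 | yes zu = split-zero a u (λ n → hu n z≤n)
    gcd-rec (suc k) a u α (suc β) le ha hu nz | no a0 | yes zu = shift k a u α β le ha hu a0 zu
    gcd-rec (suc k) a u zero β le ha hu nz | yes za | no u0 = split-swap (split-zero u a (λ n → ha n z≤n))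
    gcd-rec (suc k) a u (suc α) β le ha hu nz | yes za | no u0 =
      split-swap (shift k u a β α (≡.subst (ℕ._≤ suc k) (ℕₚ.+-comm (suc α) β) le) hu ha u0 za)
    gcd-rec (suc k) a u α β le ha hu nz | no a0 | no u0 with α ℕ.≤? β
    gcd-rec (suc k) a u α zero le ha hu nz | no a0 | no u0 | yes _ = ⊥-elim (u0 (hu 0 z≤n))
    gcd-rec (suc k) a u α (suc β) le ha hu nz | no a0 | no u0 | yes α≤β =
      let le′ = ℕₚ.≤-pred (≡.subst (ℕ._≤ suc k) (ℕₚ.+-suc α β) le) in
      reduce k a u α β (ℕₚ.m≤n⇒m≤1+n le′) ha hu α≤β a0 le′
    gcd-rec (suc k) a u zero β le ha hu nz | no a0 | no u0 | no α≰β = ⊥-elim (a0 (ha 0 z≤n))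
    gcd-rec (suc k) a u (suc α) β le ha hu nz | no a0 | no u0 | no α≰β =
      let le′ = ≡.subst (ℕ._≤ k) (ℕₚ.+-comm α β) (ℕₚ.≤-pred le) in
      split-swap (reduce k u a β α (ℕₚ.m≤n⇒m≤1+n le′) hu ha (ℕₚ.<⇒≤ (ℕₚ.≰⇒> α≰β)) u0 le′)

  gcd-split : ∀ a u → ¬ ser a 0 K.≈ K.0# → Split a u
  gcd-split a@(f , α , hf) u@(g , β , hg) a0 =
    gcd-rec (suc α ℕ.+ suc β) a u (suc α) (suc β) ℕₚ.≤-refl hf hg (inj₁ a0)

  -- Searches downwards for the last index at which one of the two is nonzero; the constant term of
  -- g ends the search.
  exact-degree₂ : ∀ d f g → Deg≤ f d → Deg≤ g d → ¬ g 0 K.≈ K.0# →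
    ∃ λ e → Deg≤ f e × Deg≤ g e × ¬ (f e K.≈ K.0# × g e K.≈ K.0#)
  exact-degree₂ d f g hf hg g0 with f d ≟0 | g d ≟0
  ... | no z | _ = d , hf , hg , (λ q → z (proj₁ q))
  ... | yes _ | no z = d , hf , hg , (λ q → z (proj₂ q))
  exact-degree₂ zero f g hf hg g0 | yes zf | yes zg = ⊥-elim (g0 zg)
  exact-degree₂ (suc d) f g hf hg g0 | yes zf | yes zg = exact-degree₂ d f g (lower f hf zf) (lower g hg zg) g0
    where
    lower : ∀ f → Deg≤ f (suc d) → f (suc d) K.≈ K.0# → Deg≤ f d
    lower f h z n d<n with n ℕ.≟ suc d
    ... | yes ≡.refl = z
    ... | no n≢ = h n (ℕₚ.≤∧≢⇒< d<n (λ e → n≢ (≡.sym e)))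

  exact-degree : ∀ (f : Poly) → ¬ ser f 0 K.≈ K.0# → ∃ λ e → Deg≤ (ser f) e × ¬ ser f e K.≈ K.0#
  exact-degree (f , d , h) f0 with exact-degree₂ d f f h h f0
  ... | e , he , _ , top = e , he , λ z → top (z , z)

  zero-or-degree : ∀ (f : Poly) → ser f ≈ 0# ⊎ ∃ λ e → Deg≤ (ser f) e × ¬ ser f e K.≈ K.0#
  zero-or-degree (f , d , h) = go d h
    where
    go : ∀ d → Deg≤ f d → f ≈ 0# ⊎ ∃ λ e → Deg≤ f e × ¬ f e K.≈ K.0#
    go d h with f d ≟0
    ... | no z = inj₂ (d , h , z)
    go zero h | yes z = inj₁ λ { zero → z ; (suc n) → h (suc n) (s≤s z≤n) }
    go (suc d) h | yes z = go d lower
      where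
      lower : Deg≤ f d
      lower n d<n with n ℕ.≟ suc d
      ... | yes ≡.refl = z
      ... | no n≢ = h n (ℕₚ.≤∧≢⇒< d<n (λ e → n≢ (≡.sym e)))

  -- d is the degree of f as a map to the projective line
  record Height (f : Series) (d : ℕ) : Set where
    constructor height
    field
      num den : Series
      num-deg : Deg≤ num d
      den-deg : Deg≤ den d
      den-zero : ¬ den 0 K.≈ K.0#
      quotient : den * f ≈ num
      top : ¬ (num d K.≈ K.0# × den d K.≈ K.0#)
      coprime : Coprimeₚ (num , d , num-deg) (den , d , den-deg)

    numₚ denₚ : Poly
    numₚ = num , d , num-deg
    denₚ = den , d , den-deg

  private
    degree-mult : ∀ {f g : Series} {a b} → Deg≤ f a → Deg≤ g b → ¬ f a K.≈ K.0# → ¬ g b K.≈ K.0# →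
      ∀ {d} → Deg≤ (f * g) d → a ℕ.+ b ℕ.≤ d
    degree-mult {f} {g} {a} {b} hf hg fa gb {d} h with a ℕ.+ b ℕ.≤? d
    ... | yes le = le
    ... | no nle = ⊥-elim (*-nonzero fa gb (K.trans (K.sym (top-* {f} {g} a b hf hg)) (h (a ℕ.+ b) (ℕₚ.≰⇒> nle))))

    -- a second representation is a multiple of the coprime one, hence has at least its degree
    height-≤ : ∀ {f d e} (H : Height f d) (n′ d′ : Series) → Deg≤ n′ e → Deg≤ d′ e → ¬ d′ 0 K.≈ K.0# →
      d′ * f ≈ n′ → d ℕ.≤ e
    height-≤ {f} {d} {e} H n′ d′ hn hd d0 eq = bound (exact-degree q q0) (num d ≟0)
      where
      open Height H
      cross : num * d′ ≈ den * n′
      cross = begin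
        num * d′ ≈⟨ *-congʳ (sym quotient) ⟩
        den * f * d′ ≈⟨ solve 3 (λ d f x → d :* f :* x := d :* (x :* f)) den f d′ ⟩
        den * (d′ * f) ≈⟨ *-congˡ {den} eq ⟩
        den * n′ ∎
      q-ex = coprime-divides {numₚ} {denₚ} {d′ , e , hd} {n′ , e , hn} coprime cross
      q = proj₁ q-ex
      d′-eq : d′ ≈ den * ser q
      d′-eq = proj₂ q-ex
      n′-eq : n′ ≈ num * ser q
      n′-eq = cancel-series {den} den-zero (begin
        den * n′ ≈⟨ sym cross ⟩
        num * d′ ≈⟨ *-congˡ {num} d′-eq ⟩
        num * (den * ser q) ≈⟨ solve 3 (λ n d q → n :* (d :* q) := d :* (n :* q)) num den (ser q) ⟩
        den * (num * ser q) ∎)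
      q0 : ¬ ser q 0 K.≈ K.0#
      q0 = factor-nonzero {g = den} d′-eq d0
      bound : (∃ λ b → Deg≤ (ser q) b × ¬ ser q b K.≈ K.0#) → Dec (num d K.≈ K.0#) → d ℕ.≤ e
      bound (b , hq , qb) (no nd) = ℕₚ.≤-trans (ℕₚ.m≤m+n d b) (degree-mult {num} {ser q} num-deg hq nd qb (Deg≤-cong {n′} n′-eq hn))
      bound (b , hq , qb) (yes zn) = ℕₚ.≤-trans (ℕₚ.m≤m+n d b)
        (degree-mult {den} {ser q} den-deg hq (λ zd → top (zn , zd)) qb (Deg≤-cong {d′} d′-eq hd))

  height-unique : ∀ {f g d e} → f ≈ g → Height f d → Height g e → d ≡ e
  height-unique {f} {g} eq H H′ = ℕₚ.≤-antisym
    (height-≤ H (num H′) (den H′) (num-deg H′) (den-deg H′) (den-zero H′) (trans (*-congˡ {den H′} eq) (quotient H′)))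
    (height-≤ H′ (num H) (den H) (num-deg H) (den-deg H) (den-zero H) (trans (*-congˡ {den H} (sym eq)) (quotient H)))
    where open Height

  height-cong : ∀ {f g d} → f ≈ g → Height f d → Height g d
  height-cong eq (height n d nd dd d0 q tp co) = height n d nd dd d0 (trans (*-congˡ {d} (sym eq)) q) tp co

  module _ {f d} (H : Height f d) (θf : θ f ≈ 0#) where
    open Height H

    private
      cross : num * θ den ≈ den * θ num
      cross = begin
        num * θ den ≈⟨ *-congʳ (sym quotient) ⟩
        den * f * θ den ≈⟨ solve 3 (λ d f x → d :* f :* x := d :* (x :* f :+ d :* :0)) den f (θ den) ⟩
        den * (θ den * f + den * 0#) ≈⟨ *-congˡ {den} (+-congˡ {θ den * f} (*-congˡ {den} (sym θf))) ⟩
        den * (θ den * f + den * θ f) ≈⟨ *-congˡ {den} (sym (θ-* den f)) ⟩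
        den * θ (den * f) ≈⟨ *-congˡ {den} (θ-cong quotient) ⟩
        den * θ num ∎

      q-ex = coprime-divides {numₚ} {denₚ} {θₚ denₚ} {θₚ numₚ} coprime cross
      q = proj₁ q-ex

      θden-quotient : θ den ≈ den * ser q
      θden-quotient = proj₂ q-ex

      θq-zero : ser q 0 K.≈ K.0#
      θq-zero = integral (K.trans (K.sym (θden-quotient 0)) (K.zeroˡ _)) den-zero

      -- `den * q` is θ den, of degree at most that of `den`, so a nonzero q would be constant; but
      -- its constant term is 0, because that of θ den is.
      q≈0 : ser q ≈ 0#
      q≈0 with zero-or-degree q
      ... | inj₁ z = z
      ... | inj₂ (zero , _ , tq) = ⊥-elim (tq θq-zero)
      ... | inj₂ (suc e , hq , tq) with exact-degree denₚ den-zero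
      ... | b , hb , tb = ⊥-elim (ℕₚ.1+n≰n (ℕₚ.≤-trans (s≤s (ℕₚ.m≤m+n b e))
        (≡.subst (ℕ._≤ b) (ℕₚ.+-suc b e) (degree-mult {den} {ser q} hb hq tb tq (Deg≤-cong {θ den} θden-quotient (Deg≤-θ {den} hb))))))

    -- In lowest terms, a fraction with derivative 0 has numerator and denominator with derivative
    -- 0; in characteristic p this will make both of them polynomials in t^p.
    θden≈0 : θ den ≈ 0#
    θden≈0 = trans θden-quotient (trans (*-congˡ {den} q≈0) (zeroʳ den))

    θnum≈0 : θ num ≈ 0#
    θnum≈0 = cancel-series {den} den-zero (trans (sym cross) (trans (*-congˡ {num} θden≈0) (trans (zeroʳ num) (sym (zeroʳ den)))))

  module ParallelogramLaw (a : K.Carrier) (u : K.Carrier)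
    (u-inv : K.nat 4 K.* (K.nat 4 K.- a K.* a) K.* u K.≈ K.1#)
    {f₁ f₂ : Series} {d₁ d₂ : ℕ} (H₁ : Height f₁ d₁) (H₂ : Height f₂ d₂) where

    private
      module H₁ = Height H₁
      module H₂ = Height H₂
      module Par = Cop.Parallelogram (Cₚ a) H₁.numₚ H₁.denₚ H₂.numₚ H₂.denₚ

    M : ℕ
    M = (d₁ ℕ.+ d₁) ℕ.+ (d₂ ℕ.+ d₂)

    lead middle last : Series
    lead = ser Par.lead
    middle = ser Par.middle
    last = ser Par.last

    private
      s = d₁ ℕ.+ d₂

      s+s≡M : s ℕ.+ s ≡ M
      s+s≡M = N.solve 2 (λ x y → (x N.:+ y) N.:+ (x N.:+ y) N.:= (x N.:+ x) N.:+ (y N.:+ y)) ≡.refl d₁ d₂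

      n₁ = H₁.num d₁
      δ₁ = H₁.den d₁
      n₂ = H₂.num d₂
      δ₂ = H₂.den d₂

      deg-11 : ∀ {f g} → Deg≤ f d₁ → Deg≤ g d₂ → Deg≤ (f * g) s
      deg-11 {f} {g} = Deg≤-* {f} {g} d₁ d₂

      top-11 : ∀ {f g} → Deg≤ f d₁ → Deg≤ g d₂ → (f * g) s K.≈ f d₁ K.* g d₂
      top-11 {f} {g} = top-* {f} {g} d₁ d₂

      e₁ e₂ : Series
      e₁ = ser Par.e₁
      e₂ = ser Par.e₂

      e₁-deg : Deg≤ e₁ s
      e₁-deg = Deg≤-+ {H₁.den * H₂.den} (deg-11 {H₁.den} {H₂.den} H₁.den-deg H₂.den-deg) (Deg≤-neg {H₁.num * H₂.num} (deg-11 {H₁.num} {H₂.num} H₁.num-deg H₂.num-deg))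

      e₁-top : e₁ s K.≈ δ₁ K.* δ₂ K.- n₁ K.* n₂
      e₁-top = K.+-cong (top-11 {H₁.den} {H₂.den} H₁.den-deg H₂.den-deg) (K.-‿cong (top-11 {H₁.num} {H₂.num} H₁.num-deg H₂.num-deg))

      swap₁₂ : ∀ f g → Deg≤ f d₁ → Deg≤ g d₂ → Deg≤ (g * f) s
      swap₁₂ f g hf hg = Deg≤-cong {f * g} (*-comm f g) (deg-11 {f} {g} hf hg)

      e₂-deg : Deg≤ e₂ s
      e₂-deg = Deg≤-+ {H₁.num * H₂.den} (deg-11 {H₁.num} {H₂.den} H₁.num-deg H₂.den-deg) (Deg≤-neg {H₂.num * H₁.den} (swap₁₂ H₁.den H₂.num H₁.den-deg H₂.num-deg))

      e₂-top : e₂ s K.≈ n₁ K.* δ₂ K.- n₂ K.* δ₁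
      e₂-top = K.+-cong (top-11 {H₁.num} {H₂.den} H₁.num-deg H₂.den-deg)
        (K.-‿cong (K.trans (*-comm H₂.num H₁.den s) (K.trans (top-11 {H₁.den} {H₂.num} H₁.den-deg H₂.num-deg) (K.*-comm _ _))))

      lead-deg : Deg≤ lead M
      lead-deg = ≡.subst (Deg≤ lead) s+s≡M (Deg≤-* {e₁} {e₁} s s e₁-deg e₁-deg)

      last-deg : Deg≤ last M
      last-deg = ≡.subst (Deg≤ last) s+s≡M (Deg≤-* {e₂} {e₂} s s e₂-deg e₂-deg)

      lead-top : lead M K.≈ (δ₁ K.* δ₂ K.- n₁ K.* n₂) K.* (δ₁ K.* δ₂ K.- n₁ K.* n₂)
      lead-top = ≡.subst (λ k → lead k K.≈ (δ₁ K.* δ₂ K.- n₁ K.* n₂) K.* (δ₁ K.* δ₂ K.- n₁ K.* n₂)) s+s≡M (K.trans (top-* {e₁} {e₁} s s e₁-deg e₁-deg) (K.*-cong e₁-top e₁-top))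

      last-top : last M K.≈ (n₁ K.* δ₂ K.- n₂ K.* δ₁) K.* (n₁ K.* δ₂ K.- n₂ K.* δ₁)
      last-top = ≡.subst (λ k → last k K.≈ (n₁ K.* δ₂ K.- n₂ K.* δ₁) K.* (n₁ K.* δ₂ K.- n₂ K.* δ₁)) s+s≡M (K.trans (top-* {e₂} {e₂} s s e₂-deg e₂-deg) (K.*-cong e₂-top e₂-top))

      quadratic : Series → Series → Series
      quadratic n d = d * d + C a * (d * n) + n * n

      quadratic-deg : ∀ {n d k} → Deg≤ n k → Deg≤ d k → Deg≤ (quadratic n d) (k ℕ.+ k)
      quadratic-deg {n} {d} {k} hn hd = Deg≤-+ {d * d + C a * (d * n)} (Deg≤-+ {d * d} (Deg≤-* {d} {d} k k hd hd)
        (Deg≤-* {C a} {d * n} 0 (k ℕ.+ k) (Deg≤-C a) (Deg≤-* {d} {n} k k hd hn))) (Deg≤-* {n} {n} k k hn hn)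

      quadratic-top : ∀ {n d k} → Deg≤ n k → Deg≤ d k → quadratic n d (k ℕ.+ k) K.≈ d k K.* d k K.+ a K.* (d k K.* n k) K.+ n k K.* n k
      quadratic-top {n} {d} {k} hn hd = K.+-cong (K.+-cong (top-* {d} {d} k k hd hd)
        (K.trans (C-⊛ a (d * n) (k ℕ.+ k)) (K.*-congˡ (top-* {d} {n} k k hd hn)))) (top-* {n} {n} k k hn hn)

      half₁ half₂ : Series
      half₁ = H₁.num * H₁.den * quadratic H₂.num H₂.den
      half₂ = H₂.num * H₂.den * quadratic H₁.num H₁.den

      nd₁-deg : Deg≤ (H₁.num * H₁.den) (d₁ ℕ.+ d₁)
      nd₁-deg = Deg≤-* {H₁.num} {H₁.den} d₁ d₁ H₁.num-deg H₁.den-deg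

      nd₂-deg : Deg≤ (H₂.num * H₂.den) (d₂ ℕ.+ d₂)
      nd₂-deg = Deg≤-* {H₂.num} {H₂.den} d₂ d₂ H₂.num-deg H₂.den-deg

      M′ = (d₂ ℕ.+ d₂) ℕ.+ (d₁ ℕ.+ d₁)

      M′≡M : M′ ≡ M
      M′≡M = ℕₚ.+-comm (d₂ ℕ.+ d₂) (d₁ ℕ.+ d₁)

      q₁-deg = quadratic-deg {H₁.num} {H₁.den} H₁.num-deg H₁.den-deg
      q₂-deg = quadratic-deg {H₂.num} {H₂.den} H₂.num-deg H₂.den-deg

    middle-deg : Deg≤ middle M
    middle-deg = Deg≤-+ {half₁} {half₂} (Deg≤-* {H₁.num * H₁.den} {quadratic H₂.num H₂.den} (d₁ ℕ.+ d₁) (d₂ ℕ.+ d₂) nd₁-deg q₂-deg)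
      (≡.subst (Deg≤ half₂) M′≡M (Deg≤-* {H₂.num * H₂.den} {quadratic H₁.num H₁.den} (d₂ ℕ.+ d₂) (d₁ ℕ.+ d₁) nd₂-deg q₁-deg))

    private
      middle-top : middle M K.≈ n₁ K.* δ₁ K.* (δ₂ K.* δ₂ K.+ a K.* (δ₂ K.* n₂) K.+ n₂ K.* n₂) K.+ n₂ K.* δ₂ K.* (δ₁ K.* δ₁ K.+ a K.* (δ₁ K.* n₁) K.+ n₁ K.* n₁)
      middle-top = K.+-cong
        (K.trans (top-* {H₁.num * H₁.den} {quadratic H₂.num H₂.den} (d₁ ℕ.+ d₁) (d₂ ℕ.+ d₂) nd₁-deg q₂-deg)
          (K.*-cong (top-* {H₁.num} {H₁.den} d₁ d₁ H₁.num-deg H₁.den-deg) (quadratic-top {H₂.num} {H₂.den} H₂.num-deg H₂.den-deg)))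
        (≡.subst (λ k → half₂ k K.≈ n₂ K.* δ₂ K.* (δ₁ K.* δ₁ K.+ a K.* (δ₁ K.* n₁) K.+ n₁ K.* n₁)) M′≡M (K.trans (top-* {H₂.num * H₂.den} {quadratic H₁.num H₁.den} (d₂ ℕ.+ d₂) (d₁ ℕ.+ d₁) nd₂-deg q₁-deg)
          (K.*-cong (top-* {H₂.num} {H₂.den} d₂ d₂ H₂.num-deg H₂.den-deg) (quadratic-top {H₁.num} {H₁.den} H₁.num-deg H₁.den-deg))))

      unit-pair : ∀ {n d} → ¬ (n K.≈ K.0# × d K.≈ K.0#) → Coprime.Coprime K n d
      unit-pair {n} {d} nz with n ≟0 | d ≟0
      ... | yes zn | yes zd = ⊥-elim (nz (zn , zd))
      ... | no nn | _ = let (b , e) = inverse n nn in b , K.0# , K.trans (K.solve 3 (λ n b d → b :* n :+ :0 :* d := n :* b) n b d) e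
      ... | yes _ | no nd = let (b , e) = inverse d nd in K.0# , b , K.trans (K.solve 3 (λ n b d → :0 :* n :+ b :* d := d :* b) n b d) e

      -- At t = ∞ the leading coefficients take the place of the polynomials: unimodularity over K
      -- shows that one of the three attains the degree bound M.
      tops-nonzero : ¬ (lead M K.≈ K.0# × middle M K.≈ K.0# × last M K.≈ K.0#)
      tops-nonzero (zl , zm , zr) =
        let (p , q , r , e) = Coprime.Parallelogram.unimodular K a n₁ δ₁ n₂ δ₂ (unit-pair H₁.top) (unit-pair H₂.top) u u-inv in
        1≉0 (K.trans (K.sym e) (K.trans (K.+-cong (K.+-cong (K.*-congˡ (K.trans (K.sym lead-top) zl)) (K.*-congˡ (K.trans (K.sym last-top) zr)))
          (K.*-congˡ (K.trans (K.sym middle-top) zm))) (K.solve 3 (λ p q r → p :* :0 :+ q :* :0 :+ r :* :0 := :0) p q r)))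

      u-invₚ : P.nat 4 P.* (P.nat 4 P.- Cₚ a P.* Cₚ a) P.* Cₚ u P.≈ P.1#
      u-invₚ = begin
        nat 4 * (nat 4 - C a * C a) * C u
          ≈⟨ *-congʳ (*-cong (sym (C-nat 4)) (+-cong (sym (C-nat 4)) (-‿cong (sym (C-* a a))))) ⟩
        C (K.nat 4) * (C (K.nat 4) - C (a K.* a)) * C u
          ≈⟨ *-congʳ (*-congˡ {C (K.nat 4)} (trans (+-congˡ {C (K.nat 4)} (sym (C-neg _))) (sym (C-+ _ _)))) ⟩
        C (K.nat 4) * C (K.nat 4 K.- a K.* a) * C u
          ≈⟨ trans (*-congʳ (sym (C-* _ _))) (sym (C-* _ _)) ⟩
        C (K.nat 4 K.* (K.nat 4 K.- a K.* a) K.* u)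
          ≈⟨ trans (C-cong u-inv) C-1 ⟩
        1# ∎

    module _ (f₁-zero : f₁ 0 K.≈ K.0#) (w : Poly) {f₊ f₋ : Series}
      (eq₊ : f₊ * lead ≈ middle + ser w) (eq₋ : f₋ * lead ≈ middle - ser w)
      (prod : (middle + ser w) * (middle - ser w) ≈ lead * last) where

      private
        n₁-zero : H₁.num 0 K.≈ K.0#
        n₁-zero = K.trans (K.sym (H₁.quotient 0)) (K.trans (K.*-congˡ f₁-zero) (K.zeroʳ _))

        lead-zero : ¬ lead 0 K.≈ K.0#
        lead-zero z = *-nonzero H₁.den-zero H₂.den-zero (K.trans (K.sym e₁0) (square-zero z))
          where
          e₁0 : e₁ 0 K.≈ H₁.den 0 K.* H₂.den 0
          e₁0 = K.trans (K.+-congˡ (K.-‿cong (K.*-congʳ n₁-zero))) (K.solve 2 (λ x y → x :- :0 :* y := x) _ _)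

        U₊ U₋ : Poly
        U₊ = Par.middle P.+ w
        U₋ = Par.middle P.- w

        -- f₊ and f₋ are the roots of lead X² - 2 middle X + last. Cancelling the gcd g of lead and
        -- middle + w gives f₊ = N / D; as N is prime to D, the latter divides middle - w, with
        -- quotient e, and f₋ = e / g.
        open Split (gcd-split Par.lead U₊ lead-zero) renaming (a′ to D; u′ to N; a-eq to lead-eq; u-eq to U₊-eq; coprime to coprime-DN)

        g-zero : ¬ ser g 0 K.≈ K.0#
        g-zero z = lead-zero (K.trans (lead-eq 0) (K.trans (K.*-congʳ z) (K.zeroˡ _)))

        D-zero : ¬ ser D 0 K.≈ K.0#
        D-zero z = lead-zero (K.trans (lead-eq 0) (K.trans (K.*-congˡ z) (K.zeroʳ _)))

        cross : ser N * ser U₋ ≈ ser D * last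
        cross = cancel-series {ser g} g-zero (begin
          ser g * (ser N * ser U₋) ≈⟨ sym (*-assoc (ser g) (ser N) (ser U₋)) ⟩
          ser g * ser N * ser U₋ ≈⟨ *-congʳ (sym U₊-eq) ⟩
          ser U₊ * ser U₋ ≈⟨ prod ⟩
          lead * last ≈⟨ *-congʳ lead-eq ⟩
          ser g * ser D * last ≈⟨ *-assoc (ser g) (ser D) last ⟩
          ser g * (ser D * last) ∎)

        coprime-ND : Coprimeₚ N D
        coprime-ND = coprime-sym {D} {N} coprime-DN

        e-ex = coprime-divides {N} {D} {U₋} {Par.last} coprime-ND cross
        e = proj₁ e-ex

        U₋-eq : ser U₋ ≈ ser D * ser e
        U₋-eq = proj₂ e-ex

        last-eq : last ≈ ser N * ser e
        last-eq = cancel-series {ser D} D-zero (begin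
          ser D * last ≈⟨ sym cross ⟩
          ser N * ser U₋ ≈⟨ *-congˡ {ser N} U₋-eq ⟩
          ser N * (ser D * ser e) ≈⟨ solve 3 (λ n d e → n :* (d :* e) := d :* (n :* e)) (ser N) (ser D) (ser e) ⟩
          ser D * (ser N * ser e) ∎)

        middle-eq : nat 2 * middle ≈ ser N * ser g + ser D * ser e
        middle-eq = begin
          nat 2 * middle ≈⟨ solve 2 (λ m w → κ 2 :* m := (m :+ w) :+ (m :- w)) middle (ser w) ⟩
          ser U₊ + ser U₋ ≈⟨ +-cong (trans U₊-eq (*-comm (ser g) (ser N))) U₋-eq ⟩
          ser N * ser g + ser D * ser e ∎

        quotient₊ : ser D * f₊ ≈ ser N
        quotient₊ = cancel-series {ser g} g-zero (begin
          ser g * (ser D * f₊) ≈⟨ solve 3 (λ g d f → g :* (d :* f) := f :* (g :* d)) (ser g) (ser D) f₊ ⟩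
          f₊ * (ser g * ser D) ≈⟨ *-congˡ {f₊} (sym lead-eq) ⟩
          f₊ * lead ≈⟨ eq₊ ⟩
          ser U₊ ≈⟨ U₊-eq ⟩
          ser g * ser N ∎)

        quotient₋ : ser g * f₋ ≈ ser e
        quotient₋ = cancel-series {ser D} D-zero (begin
          ser D * (ser g * f₋) ≈⟨ solve 3 (λ g d f → d :* (g :* f) := f :* (g :* d)) (ser g) (ser D) f₋ ⟩
          f₋ * (ser g * ser D) ≈⟨ *-congˡ {f₋} (sym lead-eq) ⟩
          f₋ * lead ≈⟨ eq₋ ⟩
          ser U₋ ≈⟨ U₋-eq ⟩
          ser D * ser e ∎)

        -- Gauss's lemma: (D X - N) (g X - e) is lead X² - 2 middle X + last, whose coefficients
        -- generate the unit ideal, so the second factor is primitive.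
        coprime-eg : Coprimeₚ e g
        coprime-eg =
          let (p , q , r , h) = Par.unimodular H₁.coprime H₂.coprime (Cₚ u) u-invₚ
              h₂ = P.nat 2 P.* (P.nat 4 P.- Cₚ a P.* Cₚ a) P.* Cₚ u
          in q P.* N P.+ r P.* h₂ P.* D , p P.* D P.+ r P.* h₂ P.* N , (begin
            (ser q * ser N + ser r * ser h₂ * ser D) * ser e + (ser p * ser D + ser r * ser h₂ * ser N) * ser g
              ≈⟨ solve 8 (λ p q r h N D e g → (q :* N :+ r :* h :* D) :* e :+ (p :* D :+ r :* h :* N) :* g
                   := p :* (g :* D) :+ q :* (N :* e) :+ r :* h :* (N :* g :+ D :* e)) (ser p) (ser q) (ser r) (ser h₂) (ser N) (ser D) (ser e) (ser g) ⟩
            ser p * (ser g * ser D) + ser q * (ser N * ser e) + ser r * ser h₂ * (ser N * ser g + ser D * ser e)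
              ≈⟨ +-cong (+-cong (*-congˡ {ser p} (sym lead-eq)) (*-congˡ {ser q} (sym last-eq))) (*-congˡ {ser r * ser h₂} (sym middle-eq)) ⟩
            ser p * lead + ser q * last + ser r * ser h₂ * (nat 2 * middle)
              ≈⟨ +-congˡ {ser p * lead + ser q * last} (solve 4 (λ r m a u → r :* (κ 2 :* (κ 4 :- a :* a) :* u) :* (κ 2 :* m) := r :* m :* (κ 4 :* (κ 4 :- a :* a) :* u)) (ser r) middle (C a) (C u)) ⟩
            ser p * lead + ser q * last + ser r * middle * (nat 4 * (nat 4 - C a * C a) * C u)
              ≈⟨ +-congˡ {ser p * lead + ser q * last} (trans (*-congˡ {ser r * middle} u-invₚ) (*-identityʳ _)) ⟩
            ser p * lead + ser q * last + ser r * middle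
              ≈⟨ h ⟩
            1# ∎)

        two-zero : ∀ {x} → K.nat 2 K.* x K.≈ K.0# → x K.≈ K.0#
        two-zero {x} z = K.trans (K.sym (K.trans (K.*-congʳ u-inv) (K.*-identityˡ x)))
          (K.trans (K.solve 3 (λ a u x → κ′ 4 :* (κ′ 4 :- a :* a) :* u :* x := κ′ 2 :* (κ′ 4 :- a :* a) :* u :* (κ′ 2 :* x)) a u x)
            (K.trans (K.*-congˡ z) (K.zeroʳ _)))
          where κ′ = κ

        middle-zero : ∀ k → (nat 2 * middle) k K.≈ K.0# → middle k K.≈ K.0#
        middle-zero k z = two-zero (K.trans (K.sym (K.trans (*-congʳ (sym (C-nat 2)) k) (C-⊛ (K.nat 2) middle k))) z)

        bound : ∀ (f g : Poly) → Deg≤ (ser f) (proj₁ (proj₂ f) ℕ.+ proj₁ (proj₂ g))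
        bound (f , α , hf) (g , β , hg) = Deg≤-mono {f} (ℕₚ.m≤m+n α β) hf

        bound′ : ∀ (f g : Poly) → Deg≤ (ser g) (proj₁ (proj₂ f) ℕ.+ proj₁ (proj₂ g))
        bound′ (f , α , hf) (g , β , hg) = Deg≤-mono {g} (ℕₚ.m≤n+m β α) hg

        -- Gauss's lemma at t = ∞: two nonzero linear forms over a field have a nonzero product.
        disjoint : ∀ {n d e g} → ¬ (n K.≈ K.0# × d K.≈ K.0#) → ¬ (e K.≈ K.0# × g K.≈ K.0#) →
          d K.* g K.≈ K.0# → n K.* e K.≈ K.0# → n K.* g K.+ d K.* e K.≈ K.0# → ⊥
        disjoint {n} {d} {e} {g} nd eg dg ne sm with d ≟0 | n ≟0
        ... | yes zd | yes zn = nd (zn , zd)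
        ... | yes zd | no nn = eg (integral ne nn , integral
          (K.trans (K.sym (K.trans (K.+-congˡ (K.trans (K.*-congʳ zd) (K.zeroˡ e))) (K.+-identityʳ _))) sm) nn)
        ... | no ndz | _ = let zg = integral dg ndz in
          eg (integral (K.trans (K.sym (K.trans (K.+-congʳ (K.trans (K.*-congˡ zg) (K.zeroʳ n))) (K.+-identityˡ _))) sm) ndz , zg)

        DG = ser D * ser g
        NE = ser N * ser e
        NG = ser N * ser g
        DE = ser D * ser e

        lead-eq′ : lead ≈ DG
        lead-eq′ = trans lead-eq (*-comm (ser g) (ser D))

        Exact : Poly → Poly → Set
        Exact p q = ∃ λ d → Deg≤ (ser p) d × Deg≤ (ser q) d × ¬ (ser p d K.≈ K.0# × ser q d K.≈ K.0#)

        -- If d₊ + d₋ were below M, the top coefficients of `lead`, `middle` and `last` would all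
        -- vanish; if it exceeded M, the product of the two leading linear forms would.
        degrees : ((d₊ , _) : Exact N D) ((d₋ , _) : Exact e g) → d₊ ℕ.+ d₋ ≡ M
        degrees (d₊ , N≤ , D≤ , top₊) (d₋ , e≤ , g≤ , top₋) = go (ℕₚ.<-cmp σ M)
          where
          σ = d₊ ℕ.+ d₋
          go : Tri (σ ℕ.< M) (σ ≡ M) (M ℕ.< σ) → σ ≡ M
          go (tri≈ _ eq _) = eq
          go (tri< lt _ _) = ⊥-elim (tops-nonzero
            ( K.trans (lead-eq′ M) (Deg≤-* {ser D} {ser g} d₊ d₋ D≤ g≤ M lt)
            , middle-zero M (K.trans (middle-eq M) (Deg≤-+ {NG} {DE} (Deg≤-* {ser N} {ser g} d₊ d₋ N≤ g≤) (Deg≤-* {ser D} {ser e} d₊ d₋ D≤ e≤) M lt))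
            , K.trans (last-eq M) (Deg≤-* {ser N} {ser e} d₊ d₋ N≤ e≤ M lt)))
          go (tri> _ _ gt) = ⊥-elim (disjoint top₊ top₋
            (K.trans (K.sym (top-* {ser D} {ser g} d₊ d₋ D≤ g≤)) (K.trans (K.sym (lead-eq′ σ)) (lead-deg σ gt)))
            (K.trans (K.sym (top-* {ser N} {ser e} d₊ d₋ N≤ e≤)) (K.trans (K.sym (last-eq σ)) (last-deg σ gt)))
            (K.trans (K.sym (K.+-cong (top-* {ser N} {ser g} d₊ d₋ N≤ g≤) (top-* {ser D} {ser e} d₊ d₋ D≤ e≤)))
              (K.trans (K.sym (middle-eq σ)) (K.trans (*-congʳ (sym (C-nat 2)) σ) (K.trans (C-⊛ (K.nat 2) middle σ) (K.trans (K.*-congˡ (middle-deg σ gt)) (K.zeroʳ _)))))))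

        assemble : Exact N D → Exact e g → ∃₂ λ d₊ d₋ → Height f₊ d₊ × Height f₋ d₋ × d₊ ℕ.+ d₋ ≡ M
        assemble x@(d₊ , N≤ , D≤ , top₊) y@(d₋ , e≤ , g≤ , top₋) = d₊ , d₋
          , height (ser N) (ser D) N≤ D≤ D-zero quotient₊ top₊ coprime-ND
          , height (ser e) (ser g) e≤ g≤ g-zero quotient₋ top₋ coprime-eg
          , degrees x y

      parallelogram : ∃₂ λ d₊ d₋ → Height f₊ d₊ × Height f₋ d₋ × d₊ ℕ.+ d₋ ≡ M
      parallelogram = assemble (exact-degree₂ _ (ser N) (ser D) (bound N D) (bound′ N D) D-zero) (exact-degree₂ _ (ser e) (ser g) (bound e g) (bound′ e g) g-zero)

-- The parallelogram law for heights of points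

module PointHeights (K : CommutativeRing 0ℓ 0ℓ) where
 private module K = RingKit K
 open Series K
 open RingKit seriesRing

 module On
   (_≟0 : RingKit.ZeroTest K)
   (inverse : RingKit.Inverses K)
   (1≉0 : RingKit.NonTrivial K)
   (½ : CommutativeRing.Carrier K)
   (½*2 : RingKit.IsHalf K ½)
   (A : CommutativeRing.Carrier K) where
  open Points.On K ½ ½*2 A
  open Point
  open Heights.On K _≟0 inverse 1≉0

  X : Point → Series
  X P = x P * x P

  -- the Wronskian of numerator and denominator recovers x y up to the factor y₀ / (2 m t)
  module Wronskian (P : Point) {d} (H : Height (X P) d) where
    open Height H

    V : Series
    V = θ num * den - num * θ den

    V-eq : y₀ * V ≈ den * den * (nat 2 * C (m P) * t * (x P * y P))
    V-eq = begin
      y₀ * (θ num * den - num * θ den)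
        ≈⟨ *-congˡ {y₀} (+-cong (*-congʳ (trans (θ-cong (sym quotient)) (θ-* den (X P)))) (-‿cong (*-congʳ (sym quotient)))) ⟩
      y₀ * ((θ den * X P + den * θ (X P)) * den - den * X P * θ den)
        ≈⟨ *-congˡ {y₀} (+-congʳ (*-congʳ (+-congˡ {θ den * X P} (*-congˡ {den} (θ-* (x P) (x P)))))) ⟩
      y₀ * ((θ den * X P + den * (θ (x P) * x P + x P * θ (x P))) * den - den * X P * θ den)
        ≈⟨ solve 5 (λ q d d′ x x′ → q :* ((d′ :* (x :* x) :+ d :* (x′ :* x :+ x :* x′)) :* d :- d :* (x :* x) :* d′)
             := d :* d :* (κ 2 :* x) :* (q :* x′)) y₀ den (θ den) (x P) (θ (x P)) ⟩
      den * den * (nat 2 * x P) * (y₀ * θ (x P))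
        ≈⟨ *-congˡ {den * den * (nat 2 * x P)} (diff P) ⟩
      den * den * (nat 2 * x P) * (t * (C (m P) * y P))
        ≈⟨ solve 5 (λ d x t m y → d :* d :* (κ 2 :* x) :* (t :* (m :* y)) := d :* d :* (κ 2 :* m :* t :* (x :* y))) den (x P) t (C (m P)) (y P) ⟩
      den * den * (nat 2 * C (m P) * t * (x P * y P)) ∎

    V-deg : Deg≤ V (d ℕ.+ d)
    V-deg = Deg≤-+ {θ num * den} (Deg≤-* {θ num} {den} d d (Deg≤-θ {num} num-deg) den-deg)
      (Deg≤-neg {num * θ den} (Deg≤-* {num} {θ den} d d num-deg (Deg≤-θ {den} den-deg)))

    V-top : V (d ℕ.+ d) K.≈ K.0#
    V-top = K.trans (K.+-cong (top-* {θ num} {den} d d (Deg≤-θ {num} num-deg) den-deg)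
        (K.-‿cong (top-* {num} {θ den} d d num-deg (Deg≤-θ {den} den-deg))))
      (K.solve 3 (λ k n e → (k :* n) :* e :- n :* (k :* e) := :0) (K.nat d) (num d) (den d))

    -- Both products have top coefficient d times num_d times den_d, and these cancel. The degree
    -- saved here is what brings the degree of `W` down to `L.M`.
    V-deg′ : Deg≤ V (ℕ.pred (d ℕ.+ d))
    V-deg′ n lt with n ℕ.≟ d ℕ.+ d
    ... | yes ≡.refl = V-top
    ... | no n≢ = V-deg n (ℕₚ.≤∧≢⇒< (ℕₚ.≤-trans (suc-pred-≤ d) lt) (λ e → n≢ (≡.sym e)))
      where
      suc-pred-≤ : ∀ d → d ℕ.+ d ℕ.≤ suc (ℕ.pred (d ℕ.+ d))
      suc-pred-≤ zero = z≤n
      suc-pred-≤ (suc d) = ℕₚ.≤-refl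

  module _ (u : K.Carrier) (u-inv : K.nat 4 K.* (K.nat 4 K.- A K.* A) K.* u K.≈ K.1#)
    (P Q : Point) (mP : ¬ m P K.≈ K.0#) (mQ : ¬ m Q K.≈ K.0#)
    {d₁ d₂} (H₁ : Height (X P) d₁) (H₂ : Height (X Q) d₂) where

    private
      module H₁ = Height H₁
      module H₂ = Height H₂
      module W₁ = Wronskian P H₁
      module W₂ = Wronskian Q H₂
      module L = ParallelogramLaw A u u-inv H₁ H₂

      x₁ = x P
      x₂ = x Q
      y₁ = y P
      y₂ = y Q
      D₁ = H₁.den
      D₂ = H₂.den
      DD = D₁ * D₂

      -- Up to denominators this is 2 x₁ y₁ x₂ y₂, the cross term that completes `middle` to the
      -- squares of x₁ y₂ + x₂ y₁ and x₁ y₂ - x₂ y₁.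
      W : Series
      W = nat 2 * (x₁ * y₁ * (x₂ * y₂)) * (DD * DD)

      μ : K.Carrier
      μ = K.nat 2 K.* m P K.* m Q

      two-inverse : K.nat 2 K.* ½ K.≈ K.1#
      two-inverse = K.trans (K.*-comm _ _) ½*2

      μ-nonzero : ¬ μ K.≈ K.0#
      μ-nonzero = *-nonzero (*-nonzero (λ z → 1≉0 (K.trans (K.sym two-inverse) (K.trans (K.*-congʳ z) (K.zeroˡ ½)))) mP) mQ

      Cμ : C μ ≈ nat 2 * C (m P) * C (m Q)
      Cμ = trans (C-* (K.nat 2 K.* m P) (m Q)) (*-congʳ (trans (C-* (K.nat 2) (m P)) (*-congʳ (C-nat 2))))

      QVV : Series
      QVV = quartic (t * t) * (W₁.V * W₂.V)

      QVV-eq : QVV ≈ C μ * (t * (t * W))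
      QVV-eq = begin
        quartic (t * t) * (W₁.V * W₂.V) ≈⟨ *-congʳ (sym y₀-square) ⟩
        y₀ * y₀ * (W₁.V * W₂.V) ≈⟨ solve 3 (λ q v w → q :* q :* (v :* w) := (q :* v) :* (q :* w)) y₀ W₁.V W₂.V ⟩
        (y₀ * W₁.V) * (y₀ * W₂.V) ≈⟨ *-cong W₁.V-eq W₂.V-eq ⟩
        (D₁ * D₁ * (nat 2 * C (m P) * t * (x₁ * y₁))) * (D₂ * D₂ * (nat 2 * C (m Q) * t * (x₂ * y₂)))
          ≈⟨ solve 7 (λ d e m n t z w → (d :* d :* (κ 2 :* m :* t :* z)) :* (e :* e :* (κ 2 :* n :* t :* w))
               := (κ 2 :* m :* n) :* (t :* (t :* (κ 2 :* (z :* w) :* (d :* e :* (d :* e)))))) D₁ D₂ (C (m P)) (C (m Q)) t (x₁ * y₁) (x₂ * y₂) ⟩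
        (nat 2 * C (m P) * C (m Q)) * (t * (t * W)) ≈⟨ *-congʳ (sym Cμ) ⟩
        C μ * (t * (t * W)) ∎

      QVV-coeff : ∀ n → QVV (suc (suc n)) K.≈ μ K.* W n
      QVV-coeff n = K.trans (QVV-eq (suc (suc n))) (K.trans (C-⊛ μ (t * (t * W)) (suc (suc n)))
        (K.*-congˡ (K.trans (t-⊛-suc (t * W) (suc n)) (t-⊛-suc W n))))

      quartic-deg : Deg≤ (quartic (t * t)) 4
      quartic-deg = Deg≤-+ {1# + C A * (t * t)} (Deg≤-+ {1#} (Deg≤-mono {1#} z≤n Deg≤-𝟏)
        (Deg≤-mono {C A * (t * t)} (s≤s (s≤s z≤n)) (Deg≤-* {C A} {t * t} 0 2 (Deg≤-C A) tt))) (Deg≤-* {t * t} {t * t} 2 2 tt tt)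
        where tt = Deg≤-* {t} {t} 1 1 Deg≤-t Deg≤-t

      QVV-deg : Deg≤ QVV (4 ℕ.+ (ℕ.pred (d₁ ℕ.+ d₁) ℕ.+ ℕ.pred (d₂ ℕ.+ d₂)))
      QVV-deg = Deg≤-* {quartic (t * t)} {W₁.V * W₂.V} 4 _ quartic-deg (Deg≤-* {W₁.V} {W₂.V} _ _ W₁.V-deg′ W₂.V-deg′)

      const-zero : ∀ (f : Series) → Deg≤ f 0 → f 0 K.≈ K.0# → f ≈ 0#
      const-zero f h z zero = z
      const-zero f h z (suc n) = h (suc n) (s≤s z≤n)

      -- `ℕ.pred` is truncated at 0, where the degree count would fail; height 0 makes the Wronskian
      -- vanish and is treated separately.
      QVV-vanish : ∀ d₁ d₂ → Deg≤ QVV (4 ℕ.+ (ℕ.pred (d₁ ℕ.+ d₁) ℕ.+ ℕ.pred (d₂ ℕ.+ d₂))) →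
        (d₁ ≡ 0 → W₁.V ≈ 0#) → (d₂ ≡ 0 → W₂.V ≈ 0#) →
        ∀ n → (d₁ ℕ.+ d₁) ℕ.+ (d₂ ℕ.+ d₂) ℕ.< n → QVV (suc (suc n)) K.≈ K.0#
      QVV-vanish zero d₂ h v₁ v₂ n lt = trans (*-congˡ {quartic (t * t)} (trans (*-congʳ (v₁ ≡.refl)) (zeroˡ W₂.V))) (zeroʳ (quartic (t * t))) (suc (suc n))
      QVV-vanish (suc d₁) zero h v₁ v₂ n lt = trans (*-congˡ {quartic (t * t)} (trans (*-congˡ {W₁.V} (v₂ ≡.refl)) (zeroʳ W₁.V))) (zeroʳ (quartic (t * t))) (suc (suc n))
      QVV-vanish (suc a) (suc b) h v₁ v₂ n lt = h (suc (suc n)) (≡.subst (ℕ._< suc (suc n))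
        (N.solve 2 (λ a b → N.con 2 N.:+ ((N.con 1 N.:+ a) N.:+ (N.con 1 N.:+ a) N.:+ ((N.con 1 N.:+ b) N.:+ (N.con 1 N.:+ b)))
          N.:= N.con 4 N.:+ ((a N.:+ (N.con 1 N.:+ a)) N.:+ (b N.:+ (N.con 1 N.:+ b)))) ≡.refl a b) (s≤s (s≤s lt)))

      -- The quartic at t² times the two Wronskians equals μ t² W with μ invertible, and 4 + (2 d₁ -
      -- 1) + (2 d₂ - 1) - 2 is exactly `L.M`. This also shows that W is a polynomial at all.
      W-deg : Deg≤ W L.M
      W-deg n lt = integral (K.trans (K.sym (QVV-coeff n)) (QVV-vanish d₁ d₂ QVV-deg
          (λ { ≡.refl → const-zero W₁.V W₁.V-deg W₁.V-top }) (λ { ≡.refl → const-zero W₂.V W₂.V-deg W₂.V-top }) n lt)) μ-nonzero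

      X₁ = X P
      X₂ = X Q
      Δ = 1# - x₁ * x₂ * (x₁ * x₂)

      lead-eq : L.lead ≈ (DD * Δ) * (DD * Δ)
      lead-eq = *-cong e e
        where
        e : D₁ * D₂ - H₁.num * H₂.num ≈ DD * Δ
        e = trans (+-congˡ {D₁ * D₂} (-‿cong (*-cong (sym H₁.quotient) (sym H₂.quotient))))
          (solve 4 (λ d e x z → d :* e :- d :* (x :* x) :* (e :* (z :* z)) := d :* e :* (:1 :- x :* z :* (x :* z))) D₁ D₂ x₁ x₂)

      last-eq : L.last ≈ (DD * (X₁ - X₂)) * (DD * (X₁ - X₂))
      last-eq = *-cong e e
        where
        e : H₁.num * D₂ - H₂.num * D₁ ≈ DD * (X₁ - X₂)
        e = trans (+-cong (*-congʳ (sym H₁.quotient)) (-‿cong (*-congʳ (sym H₂.quotient))))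
          (solve 4 (λ d e x z → d :* x :* e :- e :* z :* d := d :* e :* (x :- z)) D₁ D₂ X₁ X₂)

      middle-eq : L.middle ≈ DD * DD * (X₁ * (y₂ * y₂) + X₂ * (y₁ * y₁))
      middle-eq = trans (+-cong (*-cong (*-congʳ (sym H₁.quotient)) (quad {H₂.num} {D₂} (sym H₂.quotient)))
                                (*-cong (*-congʳ (sym H₂.quotient)) (quad {H₁.num} {D₁} (sym H₁.quotient))))
        (trans (solve 5 (λ a d e x z → d :* x :* d :* (e :* e :+ a :* (e :* (e :* z)) :+ e :* z :* (e :* z)) :+ e :* z :* e :* (d :* d :+ a :* (d :* (d :* x)) :+ d :* x :* (d :* x))
            := d :* e :* (d :* e) :* (x :* (:1 :+ a :* z :+ z :* z) :+ z :* (:1 :+ a :* x :+ x :* x))) a D₁ D₂ X₁ X₂)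
          (*-congˡ {DD * DD} (+-cong (*-congˡ {X₁} (sym (curve Q))) (*-congˡ {X₂} (sym (curve P))))))
        where
        quad : ∀ {n d z} → n ≈ d * z → d * d + a * (d * n) + n * n ≈ d * d + a * (d * (d * z)) + d * z * (d * z)
        quad {n} {d} e = +-cong (+-congˡ {d * d} (*-congˡ {a} (*-congˡ {d} e))) (*-cong e e)

      N₊ N₋ : Series
      N₊ = x₁ * y₂ + x₂ * y₁
      N₋ = x₁ * y₂ + - x₂ * y₁

      plus : L.middle + W ≈ DD * DD * (N₊ * N₊)
      plus = trans (+-congʳ middle-eq) (solve 5 (λ d x z y w → d :* d :* (x :* x :* (w :* w) :+ z :* z :* (y :* y)) :+ κ 2 :* (x :* y :* (z :* w)) :* (d :* d)
        := d :* d :* ((x :* w :+ z :* y) :* (x :* w :+ z :* y))) DD x₁ x₂ y₁ y₂)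

      minus : L.middle - W ≈ DD * DD * (N₋ * N₋)
      minus = trans (+-congʳ middle-eq) (solve 5 (λ d x z y w → d :* d :* (x :* x :* (w :* w) :+ z :* z :* (y :* y)) :- κ 2 :* (x :* y :* (z :* w)) :* (d :* d)
        := d :* d :* ((x :* w :+ (:- z) :* y) :* (x :* w :+ (:- z) :* y))) DD x₁ x₂ y₁ y₂)

      NN : N₊ * N₋ ≈ (X₁ - X₂) * Δ
      NN = begin
        N₊ * N₋ ≈⟨ solve 4 (λ x z y w → (x :* w :+ z :* y) :* (x :* w :+ (:- z) :* y) := x :* x :* (w :* w) :- z :* z :* (y :* y)) x₁ x₂ y₁ y₂ ⟩
        X₁ * (y₂ * y₂) - X₂ * (y₁ * y₁) ≈⟨ +-cong (*-congˡ {X₁} (curve Q)) (-‿cong (*-congˡ {X₂} (curve P))) ⟩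
        X₁ * quartic X₂ - X₂ * quartic X₁
          ≈⟨ solve 3 (λ a x z → x :* x :* (:1 :+ a :* (z :* z) :+ z :* z :* (z :* z)) :- z :* z :* (:1 :+ a :* (x :* x) :+ x :* x :* (x :* x))
               := (x :* x :- z :* z) :* (:1 :- x :* z :* (x :* z))) a x₁ x₂ ⟩
        (X₁ - X₂) * Δ ∎

      prod : (L.middle + W) * (L.middle - W) ≈ L.lead * L.last
      prod = begin
        (L.middle + W) * (L.middle - W) ≈⟨ *-cong plus minus ⟩
        DD * DD * (N₊ * N₊) * (DD * DD * (N₋ * N₋))
          ≈⟨ solve 3 (λ d n k → d :* d :* (n :* n) :* (d :* d :* (k :* k)) := d :* d :* (d :* d) :* ((n :* k) :* (n :* k))) DD N₊ N₋ ⟩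
        DD * DD * (DD * DD) * ((N₊ * N₋) * (N₊ * N₋))
          ≈⟨ *-congˡ {DD * DD * (DD * DD)} (*-cong NN NN) ⟩
        DD * DD * (DD * DD) * (((X₁ - X₂) * Δ) * ((X₁ - X₂) * Δ))
          ≈⟨ solve 3 (λ d z w → d :* d :* (d :* d) :* ((z :* w) :* (z :* w)) := (d :* w) :* (d :* w) :* ((d :* z) :* (d :* z))) DD (X₁ - X₂) Δ ⟩
        (DD * Δ) * (DD * Δ) * ((DD * (X₁ - X₂)) * (DD * (X₁ - X₂)))
          ≈⟨ *-cong (sym lead-eq) (sym last-eq) ⟩
        L.lead * L.last ∎

      eq₊ : X (P ⊞ Q) * L.lead ≈ L.middle + W
      eq₊ = begin
        z * z * L.lead ≈⟨ *-congˡ {z * z} lead-eq ⟩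
        z * z * ((DD * Δ) * (DD * Δ)) ≈⟨ solve 3 (λ z d e → z :* z :* ((d :* e) :* (d :* e)) := d :* d :* ((z :* e) :* (z :* e))) z DD Δ ⟩
        DD * DD * ((z * Δ) * (z * Δ)) ≈⟨ *-congˡ {DD * DD} (*-cong (Sum.x-sum-Δ P Q) (Sum.x-sum-Δ P Q)) ⟩
        DD * DD * (N₊ * N₊) ≈⟨ sym plus ⟩
        L.middle + W ∎
        where z = x (P ⊞ Q)

      eq₋ : X (P ⊟ Q) * L.lead ≈ L.middle - W
      eq₋ = begin
        z * z * L.lead ≈⟨ *-congˡ {z * z} lead-eq ⟩
        z * z * ((DD * Δ) * (DD * Δ)) ≈⟨ solve 3 (λ z d e → z :* z :* ((d :* e) :* (d :* e)) := d :* d :* ((z :* e) :* (z :* e))) z DD Δ ⟩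
        DD * DD * ((z * Δ) * (z * Δ)) ≈⟨ *-congˡ {DD * DD} (*-cong zΔ zΔ) ⟩
        DD * DD * (N₋ * N₋) ≈⟨ sym minus ⟩
        L.middle - W ∎
        where
        z = x (P ⊟ Q)
        zΔ : z * Δ ≈ N₋
        zΔ = trans (*-congˡ {z} (solve 2 (λ x w → :1 :- x :* w :* (x :* w) := :1 :- x :* (:- w) :* (x :* (:- w))) x₁ x₂)) (Sum.x-sum-Δ P (neg Q))

    point-parallelogram : ∃₂ λ d₊ d₋ → Height (X (P ⊞ Q)) d₊ × Height (X (P ⊟ Q)) d₋ × d₊ ℕ.+ d₋ ≡ (d₁ ℕ.+ d₁) ℕ.+ (d₂ ℕ.+ d₂)
    point-parallelogram = L.parallelogram (K.trans (K.*-congʳ (x-zero P)) (K.zeroˡ _)) (W , L.M , W-deg) eq₊ eq₋ prod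

-- Frobenius, substitution and the Cartier operator in characteristic p

module CharP (R : CommutativeRing 0ℓ 0ℓ) where
 open import Data.Nat.Divisibility using (_∣_)
 open import Data.Nat.Divisibility using (divides; ∣⇒≤; ∣-refl)
 open Series R
 open RingKit R
 private module S = RingKit seriesRing
 private module SS = Series seriesRing

 module On (p : ℕ) (1<p : 1 ℕ.< p)
   (char : RingKit.HasChar R p)
   (unit : RingKit.UnitsPrimeTo R p) where

  cancel-nat : ∀ {n a b} → ¬ p ∣ n → nat n * a ≈ nat n * b → a ≈ b
  cancel-nat {n} {a} {b} p∤n h = let (i , e) = unit n p∤n in begin
    a ≈⟨ sym (trans (*-congʳ e) (*-identityˡ a)) ⟩
    (nat n * i) * a ≈⟨ solve 3 (λ n i a → n :* i :* a := i :* (n :* a)) (nat n) i a ⟩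
    i * (nat n * a) ≈⟨ *-congˡ h ⟩
    i * (nat n * b) ≈⟨ solve 3 (λ n i a → i :* (n :* a) := n :* i :* a) (nat n) i b ⟩
    (nat n * i) * b ≈⟨ trans (*-congʳ e) (*-identityˡ b) ⟩
    b ∎

  nat-zero : ∀ {n a} → ¬ p ∣ n → nat n * a ≈ 0# → a ≈ 0#
  nat-zero {n} p∤n h = cancel-nat p∤n (trans h (sym (zeroʳ (nat n))))

  ∤-small : ∀ {n} → 0 ℕ.< n → n ℕ.< p → ¬ p ∣ n
  ∤-small {suc n} _ n<p d = ℕₚ.<⇒≱ n<p (∣⇒≤ d)

  ∤-between : ∀ {n} → 0 ℕ.< n → n ℕ.< p ℕ.+ p → ¬ n ≡ p → ¬ p ∣ n
  ∤-between {n} 0<n n<2p n≢p (divides zero eq) = ℕₚ.<⇒≢ 0<n (≡.sym eq)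
  ∤-between {n} 0<n n<2p n≢p (divides (suc zero) eq) = n≢p (≡.trans eq (ℕₚ.+-identityʳ p))
  ∤-between {n} 0<n n<2p n≢p (divides (suc (suc q)) eq) = ℕₚ.<⇒≱ n<2p
    (ℕₚ.≤-trans (ℕₚ.+-monoʳ-≤ p (ℕₚ.m≤m+n p (q ℕ.* p))) (ℕₚ.≤-reflexive (≡.sym eq)))

  θ-kernel : ∀ {f} → θ f ≋ 𝟎 → ∀ n → ¬ p ∣ n → f n ≈ 0#
  θ-kernel h n p∤n = nat-zero p∤n (h n)

  p-1 : ℕ
  p-1 = ℕ.pred p

  suc-p-1 : suc p-1 ≡ p
  suc-p-1 = ℕₚ.suc-pred p {{ℕ.>-nonZero (ℕₚ.<-trans (s≤s z≤n) 1<p)}}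

  Snat-p : S.nat p ≋ 𝟎
  Snat-p = S.trans (S.sym (C-nat p)) (S.trans (C-cong char) C-0)

  θ-p-power : ∀ f → θ (f S.^ p) ≋ 𝟎
  θ-p-power f = ≡.subst (λ k → θ (f S.^ k) ≋ 𝟎) suc-p-1 (S.trans (θ-^ f p-1)
    (S.trans (S.*-congʳ {θ f} (S.*-congʳ {f S.^ p-1} (≡.subst (λ k → S.nat k ≋ 𝟎) (≡.sym suc-p-1) Snat-p)))
      (S.trans (S.*-congʳ {θ f} (S.zeroˡ (f S.^ p-1))) (S.zeroˡ (θ f)))))

  ^-zero : ∀ f n → (f S.^ n) 0 ≈ f 0 ^ n
  ^-zero f zero = refl
  ^-zero f (suc n) = *-congˡ (^-zero f n)

  p-power-coeff : ∀ f n → 0 ℕ.< n → n ℕ.< p → (f S.^ p) n ≈ 0#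
  p-power-coeff f n 0<n n<p = θ-kernel (θ-p-power f) n (∤-small 0<n n<p)

  top-^ : ∀ {f} d k → Deg≤ f d → (f S.^ k) (k ℕ.* d) ≈ f d ^ k
  top-^ d zero h = refl
  top-^ {f} d (suc k) h = trans (top-* {f} {f S.^ k} d (k ℕ.* d) h (Deg≤-^ {f} k h)) (*-congˡ (top-^ d k h))

  module _ (x : Carrier) where
    open Evaluation x

    ev-^ : ∀ d k {f} → Deg≤ f d → ev (k ℕ.* d) (f S.^ k) ≈ ev d f ^ k
    ev-^ d zero h = refl
    ev-^ d (suc k) {f} h = trans (ev-* d (k ℕ.* d) h (Deg≤-^ {f} k h)) (*-congˡ (ev-^ d k h))

  -- (a + b t)^p has vanishing derivative, so only its extreme coefficients survive; now put t = 1.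
  frobenius : ∀ a b → (a + b) ^ p ≈ a ^ p + b ^ p
  frobenius a b = begin
    (a + b) ^ p ≈⟨ ^-congˡ p (solve 2 (λ a b → a :+ b := a :+ :1 :* b) a b) ⟩
    ev 1 f ^ p ≈⟨ sym (ev-^ 1# 1 p {f} f-deg) ⟩
    ev (p ℕ.* 1) (f S.^ p) ≡⟨ ≡.cong (λ k → ev k (f S.^ p)) (ℕₚ.*-identityʳ p) ⟩
    ev p (f S.^ p) ≡⟨ ≡.cong (λ k → ev k (f S.^ p)) (≡.sym suc-p-1) ⟩
    (f S.^ p) 0 + 1# * ev p-1 (tl (f S.^ p))
      ≈⟨ +-cong (^-zero f p) (trans (*-identityˡ _) (ends p-1 (tl (f S.^ p)) (λ n n< → p-power-coeff f (suc n) (s≤s z≤n) (≡.subst (suc n ℕ.<_) suc-p-1 (s≤s n<))))) ⟩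
    a ^ p + (f S.^ p) (suc p-1) ≡⟨ ≡.cong (λ k → a ^ p + (f S.^ p) k) (≡.trans suc-p-1 (≡.sym (ℕₚ.*-identityʳ p))) ⟩
    a ^ p + (f S.^ p) (p ℕ.* 1) ≈⟨ +-congˡ (top-^ {f} 1 p f-deg) ⟩
    a ^ p + b ^ p ∎
    where
    open Evaluation 1#
    f : Series
    f zero = a
    f (suc zero) = b
    f (suc (suc _)) = 0#
    f-deg : Deg≤ f 1
    f-deg (suc (suc n)) _ = refl
    f-deg (suc zero) (s≤s ())
    ends : ∀ d g → (∀ n → n ℕ.< d → g n ≈ 0#) → ev d g ≈ g d
    ends zero g h = refl
    ends (suc d) g h = trans (+-cong (h 0 (s≤s z≤n)) (trans (*-identityˡ _) (ends d (tl g) (λ n n<d → h (suc n) (s≤s n<d))))) (+-identityˡ _)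

  one-^ : ∀ k → 1# ^ k ≈ 1#
  one-^ zero = refl
  one-^ (suc k) = trans (*-identityˡ _) (one-^ k)

  fermat : ∀ k → nat k ^ p ≈ nat k
  fermat zero = ≡.subst (λ j → 0# ^ j ≈ 0#) suc-p-1 (zeroˡ _)
  fermat (suc k) = trans (frobenius 1# (nat k)) (+-cong (one-^ p) (fermat k))

  -- sub d f is f(x) for a polynomial f of degree at most d
  module Substitution (x : Series) where
    private module E = SS.Evaluation x

    coefficients : Series → SS.Series
    coefficients f n = C (f n)

    sub : ℕ → Series → Series
    sub d f = E.ev d (coefficients f)

    private
      coefficients-* : ∀ f g → coefficients f SS.⊛ coefficients g SS.≋ coefficients (f ⊛ g)
      coefficients-* f g zero = S.sym (C-* (f 0) (g 0))
      coefficients-* f g (suc n) = S.trans (S.+-cong (S.sym (C-* (f 0) (g (suc n)))) (coefficients-* (tl f) g n)) (S.sym (C-+ _ _))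

      coefficients-deg : ∀ {f d} → Deg≤ f d → SS.Deg≤ (coefficients f) d
      coefficients-deg h n d<n = S.trans (C-cong (h n d<n)) C-0

    sub-cong : ∀ d {f g} → f ≋ g → sub d f ≋ sub d g
    sub-cong d h = E.ev-cong d (λ n → C-cong (h n))

    sub-horner : ∀ d b f → sub (suc d) (C b ⊕ t ⊛ f) ≋ C b ⊕ x ⊛ sub d f
    sub-horner d b f = S.+-cong (C-cong (trans (+-congˡ (t-⊛-zero f)) (+-identityʳ b)))
      (S.*-congˡ {x} (sub-cong d (λ k → trans (+-identityˡ _) (t-⊛-suc f k))))

    sub-+ : ∀ d f g → sub d (f ⊕ g) ≋ sub d f ⊕ sub d g
    sub-+ d f g = S.trans (E.ev-cong d (λ n → C-+ (f n) (g n))) (E.ev-+ d (coefficients f) (coefficients g))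

    sub-• : ∀ d a f → sub d (a • f) ≋ C a ⊛ sub d f
    sub-• d a f = S.trans (E.ev-cong d (λ n → C-* a (f n))) (E.ev-• d (C a) (coefficients f))

    sub-pad : ∀ d {f} → Deg≤ f d → sub (suc d) f ≋ sub d f
    sub-pad d {f} h = E.ev-pad 1 d (λ n d<n → S.trans (C-cong (h n d<n)) C-0)

    sub-t : ∀ d f → sub (suc d) (t ⊛ f) ≋ x ⊛ sub d f
    sub-t d f = S.trans (S.+-cong (S.trans (C-cong (t-⊛-zero f)) C-0) (S.*-congˡ {x} (sub-cong d (t-⊛-suc f)))) (S.+-identityˡ _)

    -- On f, θ acts as u d/du in the variable u of f, which puts a factor x on the left; multiplied
    -- out in this way the rule needs no division by x.
    chain-rule : ∀ d f → x ⊛ θ (sub d f) ≋ θ x ⊛ sub d (θ f)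
    chain-rule zero f = S.trans (S.*-congˡ {x} (θ-C (f 0)))
      (S.trans (S.zeroʳ x) (S.sym (S.trans (S.*-congˡ {θ x} (S.trans (C-cong (zeroˡ (f 0))) C-0)) (S.zeroʳ (θ x)))))
    chain-rule (suc d) f = S.begin
      x ⊛ θ (C (f 0) ⊕ x ⊛ s)
        S.≈⟨ S.*-congˡ {x} (S.trans (θ-+ (C (f 0)) (x ⊛ s)) (S.+-cong (θ-C (f 0)) (θ-* x s))) ⟩
      x ⊛ (𝟎 ⊕ (θ x ⊛ s ⊕ x ⊛ θ s))
        S.≈⟨ S.solve 4 (λ x d s e → x :* (:0 :+ (d :* s :+ x :* e)) := x :* (d :* s :+ x :* e)) x (θ x) s (θ s) ⟩
      x ⊛ (θ x ⊛ s ⊕ x ⊛ θ s)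
        S.≈⟨ S.*-congˡ {x} (S.+-congˡ {θ x ⊛ s} (chain-rule d (tl f))) ⟩
      x ⊛ (θ x ⊛ s ⊕ θ x ⊛ sub d (θ (tl f)))
        S.≈⟨ S.solve 4 (λ x d s e → x :* (d :* s :+ d :* e) := d :* (:0 :+ x :* (s :+ e))) x (θ x) s _ ⟩
      θ x ⊛ (𝟎 ⊕ x ⊛ (s ⊕ sub d (θ (tl f))))
        S.≈⟨ S.*-congˡ {θ x} (S.+-cong (S.sym (S.trans (C-cong (zeroˡ (f 0))) C-0)) (S.*-congˡ {x} (S.trans (S.sym (sub-+ d (tl f) (θ (tl f))))
              (sub-cong d (λ i → solve 2 (λ a m → a :+ m :* a := (:1 :+ m) :* a) (f (suc i)) (nat i)))))) ⟩
      θ x ⊛ (C (θ f 0) ⊕ x ⊛ sub d (tl (θ f))) S.∎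
      where s = sub d (tl f)

    sub-* : ∀ a b {f g} → Deg≤ f a → Deg≤ g b → sub (a ℕ.+ b) (f ⊛ g) ≋ sub a f ⊛ sub b g
    sub-* a b {f} {g} hf hg = S.trans (E.ev-cong (a ℕ.+ b) (λ n → S.sym (coefficients-* f g n)))
      (E.ev-* a b (coefficients-deg {f} hf) (coefficients-deg {g} hg))

    sub-^ : ∀ d k {f} → Deg≤ f d → sub (k ℕ.* d) (f S.^ k) ≋ sub d f S.^ k
    sub-^ d zero h = C-1
    sub-^ d (suc k) {f} h = S.trans (sub-* d (k ℕ.* d) {f} {f S.^ k} h (Deg≤-^ {f} k h)) (S.*-congˡ {sub d f} (sub-^ d k h))

    module _ (N : ℕ) (charN : nat N ≈ 0#) where

      private
        -- x^j θ x is 1 / (j + 1) times a derivative, and coefficient N of a derivative is a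
        -- multiple of `nat N`, which is 0.
        exact-term : ∀ j → ¬ p ∣ suc j → (x S.^ j ⊛ θ x) N ≈ 0#
        exact-term j p∤ = nat-zero p∤ (begin
          nat (suc j) * (x S.^ j ⊛ θ x) N
            ≈⟨ sym (C-⊛ (nat (suc j)) (x S.^ j ⊛ θ x) N) ⟩
          (C (nat (suc j)) ⊛ (x S.^ j ⊛ θ x)) N
            ≈⟨ S.trans (S.*-congʳ {x S.^ j ⊛ θ x} (C-nat (suc j))) (S.sym (S.*-assoc (S.nat (suc j)) (x S.^ j) (θ x))) N ⟩
          (S.nat (suc j) ⊛ x S.^ j ⊛ θ x) N
            ≈⟨ sym (θ-^ x j N) ⟩
          nat N * (x S.^ suc j) N
            ≈⟨ trans (*-congʳ charN) (zeroˡ _) ⟩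
          0# ∎)

        step : ∀ d f j → (x S.^ j ⊛ sub (suc d) f ⊛ θ x) N ≈ f 0 * (x S.^ j ⊛ θ x) N + (x S.^ suc j ⊛ sub d (tl f) ⊛ θ x) N
        step d f j = begin
          (x S.^ j ⊛ (C (f 0) ⊕ x ⊛ sub d (tl f)) ⊛ θ x) N
            ≈⟨ S.solve 5 (λ a b x s d → a :* (b :+ x :* s) :* d := b :* (a :* d) :+ x :* a :* s :* d) (x S.^ j) (C (f 0)) x (sub d (tl f)) (θ x) N ⟩
          (C (f 0) ⊛ (x S.^ j ⊛ θ x)) N + (x S.^ suc j ⊛ sub d (tl f) ⊛ θ x) N
            ≈⟨ +-congʳ (C-⊛ (f 0) (x S.^ j ⊛ θ x) N) ⟩
          f 0 * (x S.^ j ⊛ θ x) N + (x S.^ suc j ⊛ sub d (tl f) ⊛ θ x) N ∎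

        base : ∀ (f : Series) j → (x S.^ j ⊛ C (f 0) ⊛ θ x) N ≈ f 0 * (x S.^ j ⊛ θ x) N
        base f j = trans (S.solve 3 (λ a b d → a :* b :* d := b :* (a :* d)) (x S.^ j) (C (f 0)) (θ x) N) (C-⊛ (f 0) _ N)

        -- After the exponent p - 1 the next one that is not exact is 2 p - 1, which the degree
        -- bound excludes.
        above : ∀ d f j → p ℕ.≤ j → suc j ℕ.+ d ℕ.< p ℕ.+ p → (x S.^ j ⊛ sub d f ⊛ θ x) N ≈ 0#
        above zero f j p≤j lt = trans (base f j) (trans (*-congˡ (exact-term j
          (∤-between (s≤s z≤n) (ℕₚ.≤-<-trans (ℕₚ.m≤m+n (suc j) 0) lt) (λ e → ℕₚ.<⇒≢ (s≤s p≤j) (≡.sym e))))) (zeroʳ _))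
        above (suc d) f j p≤j lt = trans (step d f j) (trans (+-cong (trans (*-congˡ (exact-term j
          (∤-between (s≤s z≤n) (ℕₚ.≤-<-trans (ℕₚ.m≤m+n (suc j) (suc d)) lt) (λ e → ℕₚ.<⇒≢ (s≤s p≤j) (≡.sym e))))) (zeroʳ _))
            (above d (tl f) (suc j) (ℕₚ.m≤n⇒m≤1+n p≤j) (≡.subst (ℕ._< p ℕ.+ p) (ℕₚ.+-suc (suc j) d) lt))) (+-identityˡ 0#))

        below : ∀ i d f j → j ℕ.+ i ≡ p-1 → suc j ℕ.+ (i ℕ.+ d) ℕ.< p ℕ.+ p →
          (x S.^ j ⊛ sub (i ℕ.+ d) f ⊛ θ x) N ≈ f i * (x S.^ p-1 ⊛ θ x) N
        below zero zero f j eq lt rewrite ≡.trans (≡.sym (ℕₚ.+-identityʳ j)) eq = base f p-1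
        below zero (suc d) f j eq lt rewrite ≡.trans (≡.sym (ℕₚ.+-identityʳ j)) eq =
          trans (step d f p-1) (trans (+-congˡ (above d (tl f) (suc p-1) (ℕₚ.≤-reflexive (≡.sym suc-p-1)) (≡.subst (ℕ._< p ℕ.+ p) (ℕₚ.+-suc (suc p-1) d) lt))) (+-identityʳ _))
        below (suc i) d f j eq lt = trans (step (i ℕ.+ d) f j) (trans (+-cong
          (trans (*-congˡ (exact-term j (∤-small (s≤s z≤n) (≡.subst (suc j ℕ.<_) suc-p-1 (s≤s (≡.subst (suc j ℕ.≤_) (≡.trans (≡.sym (ℕₚ.+-suc j i)) eq) (ℕₚ.m≤m+n (suc j) i))))))) (zeroʳ _))
          (below i d (tl f) (suc j) (≡.trans (≡.sym (ℕₚ.+-suc j i)) eq) (≡.subst (ℕ._< p ℕ.+ p) (ℕₚ.+-suc (suc j) (i ℕ.+ d)) lt))) (+-identityˡ _))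

      -- Cartier operator: x^j dx is exact for j ≠ p - 1 in the relevant range
      cartier : ∀ d f → suc (p-1 ℕ.+ d) ℕ.< p ℕ.+ p → (sub (p-1 ℕ.+ d) f ⊛ θ x) N ≈ f p-1 * (x S.^ p-1 ⊛ θ x) N
      cartier d f lt = trans (S.solve 2 (λ a b → a :* b := :1 :* a :* b) (sub (p-1 ℕ.+ d) f) (θ x) N)
        (below p-1 d f 0 ≡.refl lt)

-- The Hasse invariant, its behaviour under points and under change of model

module Hasse (R : CommutativeRing 0ℓ 0ℓ) where
 open import Data.Nat.Divisibility using (_∣_)
 open Series R
 open RingKit seriesRing
 private module R = RingKit R

 module On (n : ℕ) (1<p : 1 ℕ.< suc (n ℕ.+ n))
   (char : RingKit.HasChar R (suc (n ℕ.+ n)))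
   (unit : RingKit.UnitsPrimeTo R (suc (n ℕ.+ n))) where
  open CharP.On R (suc (n ℕ.+ n)) 1<p char unit

  p : ℕ
  p = suc (n ℕ.+ n)

  private
    2∤ : ¬ p ∣ 2
    2∤ = ∤-small (s≤s z≤n) (odd n 1<p)
      where
      odd : ∀ n → 1 ℕ.< suc (n ℕ.+ n) → 2 ℕ.< suc (n ℕ.+ n)
      odd zero (s≤s ())
      odd (suc n) _ = s≤s (s≤s (≡.subst (1 ℕ.≤_) (≡.sym (ℕₚ.+-suc n n)) (s≤s z≤n)))

  ½ : R.Carrier
  ½ = proj₁ (unit 2 2∤)

  ½*2 : ½ R.* R.nat 2 R.≈ R.1#
  ½*2 = R.trans (R.*-comm _ _) (proj₂ (unit 2 2∤))

  -- Applied to p-th powers, which are 1 modulo t^p when the constant term is 1.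
  like-one : ∀ {z} G k → z 0 R.≈ R.1# → (∀ j → 0 ℕ.< j → j ℕ.≤ k → z j R.≈ R.0#) → (z * G) k R.≈ G k
  like-one {z} G k z0 zj = R.trans (⊛-cong≤ {z} {𝟏} {G} {G} k
    (λ { zero _ → z0 ; (suc j) j≤ → zj (suc j) (s≤s z≤n) j≤ }) (λ _ _ → R.refl)) (⊛-identityˡ G k)

  private
    p-power-one : ∀ f → f 0 R.≈ R.1# → (f ^ p) 0 R.≈ R.1#
    p-power-one f f0 = R.trans (^-zero f p) (R.trans (R.^-congˡ p f0) (one^ p))
      where
      one^ : ∀ k → R.1# R.^ k R.≈ R.1#
      one^ zero = R.refl
      one^ (suc k) = R.trans (R.*-identityˡ _) (one^ k)

  square^ : ∀ f k → f ^ (k ℕ.+ k) ≈ (f * f) ^ k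
  square^ f k = trans (^-homo-* f k k) (sym (^-distrib-* f f k))

  tl-factor : ∀ f → f 0 R.≈ R.0# → f ≈ t * tl f
  tl-factor f f0 = trans (horner f) (trans (+-congʳ (trans (C-cong f0) C-0)) (+-identityˡ (t * tl f)))

  module Curve (A : R.Carrier) where
    open Points.On R ½ ½*2 A

    Q : Series
    Q = quartic (t * t)

    -- the Hasse invariant of y² = 1 + A x² + x⁴
    hasse : R.Carrier
    hasse = (Q ^ n) (n ℕ.+ n)

    tt-deg : Deg≤ (t * t) 2
    tt-deg = Deg≤-* {t} {t} 1 1 Deg≤-t Deg≤-t

    Q-deg : Deg≤ Q 4
    Q-deg = Deg≤-+ {1# + a * (t * t)} (Deg≤-+ {1#} (Deg≤-mono {1#} z≤n Deg≤-𝟏)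
      (Deg≤-mono {a * (t * t)} (s≤s (s≤s z≤n)) (Deg≤-* {a} {t * t} 0 2 (Deg≤-C A) tt-deg))) (Deg≤-* {t * t} {t * t} 2 2 tt-deg tt-deg)

    Q-horner : Q ≈ C R.1# + t * (C R.0# + t * (C A + t * (C R.0# + t * C R.1#)))
    Q-horner = begin
      1# + a * (t * t) + t * t * (t * t)
        ≈⟨ solve 2 (λ a t → :1 :+ a :* (t :* t) :+ t :* t :* (t :* t) := :1 :+ t :* (:0 :+ t :* (a :+ t :* (:0 :+ t :* :1)))) a t ⟩
      1# + t * (0# + t * (a + t * (0# + t * 1#)))
        ≈⟨ +-cong (sym C-1) (*-congˡ {t} (+-cong (sym C-0) (*-congˡ {t} (+-congˡ {a} (*-congˡ {t} (+-cong (sym C-0) (*-congˡ {t} (sym C-1)))))))) ⟩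
      C R.1# + t * (C R.0# + t * (C A + t * (C R.0# + t * C R.1#))) ∎

    module _ (x : Series) where
      open Substitution x

      sub-Q : sub 4 Q ≈ quartic (x * x)
      sub-Q = begin
        sub 4 Q ≈⟨ sub-cong 4 Q-horner ⟩
        sub 4 (C R.1# + t * (C R.0# + t * (C A + t * (C R.0# + t * C R.1#))))
          ≈⟨ trans (sub-horner 3 R.1# h₃) (+-congˡ {C R.1#} (*-congˡ {x} (trans (sub-horner 2 R.0# h₂) (+-congˡ {C R.0#} (*-congˡ {x}
               (trans (sub-horner 1 A h₁) (+-congˡ {C A} (*-congˡ {x} (sub-horner 0 R.0# (C R.1#)))))))))) ⟩
        C R.1# + x * (C R.0# + x * (C A + x * (C R.0# + x * C R.1#)))
          ≈⟨ +-cong C-1 (*-congˡ {x} (+-cong C-0 (*-congˡ {x} (+-congˡ {a} (*-congˡ {x} (+-cong C-0 (*-congˡ {x} C-1))))))) ⟩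
        1# + x * (0# + x * (a + x * (0# + x * 1#)))
          ≈⟨ solve 2 (λ a t → :1 :+ t :* (:0 :+ t :* (a :+ t :* (:0 :+ t :* :1))) := :1 :+ a :* (t :* t) :+ t :* t :* (t :* t)) a x ⟩
        quartic (x * x) ∎
        where
        h₁ = C R.0# + t * C R.1#
        h₂ = C A + t * h₁
        h₃ = C R.0# + t * h₂

      -- Q^n has degree 4 n = (p - 1) + 2 n, still below 2 p - 1, so x^(p-1) θ x is the only
      -- contribution.
      cartier-Q : ∀ N → R.nat N R.≈ R.0# → (quartic (x * x) ^ n * θ x) N R.≈ hasse R.* (x ^ (n ℕ.+ n) * θ x) N
      cartier-Q N charN = R.trans (*-congʳ {θ x} sub-power N) (cartier N charN (n ℕ.+ n) (Q ^ n) (≡.subst (λ k → suc (n ℕ.+ n ℕ.+ (n ℕ.+ n)) ℕ.< suc k) (≡.sym (ℕₚ.+-suc (n ℕ.+ n) (n ℕ.+ n))) ℕₚ.≤-refl))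
        where
        sub-power : quartic (x * x) ^ n ≈ sub (n ℕ.+ n ℕ.+ (n ℕ.+ n)) (Q ^ n)
        sub-power = sym (trans (≡.subst (λ k → sub k (Q ^ n) ≈ sub 4 Q ^ n) (N.solve 1 (λ n → n N.:* N.con 4 N.:= n N.:+ n N.:+ (n N.:+ n)) ≡.refl n) (sub-^ 4 n {Q} Q-deg)) (^-congˡ n sub-Q))

    module _ (P : Point) where
      open Point P renaming (x to X; y to Y; m to μ)

      private
        X1 : X 1 R.≈ μ
        X1 = R.trans (R.solve 3 (λ x w z → x := :1 :* ((:1 :+ :0) :* x) :+ w :* (:0 :* z)) (X 1) (y₀ 1) (X 0))
          (R.trans (diff 1) (R.trans (t-⊛-suc (C μ * Y) 0) (R.trans (C-⊛ μ Y 0) (R.trans (R.*-congˡ y-zero) (R.*-identityʳ μ)))))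

        k = n ℕ.+ n

        leading : (X ^ k * θ X) p R.≈ μ R.^ p
        leading = R.trans (shape p) (R.trans (≡.subst (λ j → (t ^ k * (g ^ k * (t * (g + θ g)))) j R.≈ (g ^ k * (t * (g + θ g))) 1) (≡.trans (ℕₚ.+-suc k 0) (≡.cong suc (ℕₚ.+-identityʳ k)))
              (t^-⊛ k (g ^ k * (t * (g + θ g))) 1))
            (R.trans (trans (solve 3 (λ a t b → a :* (t :* b) := t :* (a :* b)) (g ^ k) t (g + θ g)) (λ _ → R.refl) 1)
              (R.trans (t-⊛-suc (g ^ k * (g + θ g)) 0) (R.trans (R.*-cong (R.trans (^-zero g k) (R.^-congˡ k X1)) (R.+-cong X1 (R.zeroˡ _)))
                (R.solve 2 (λ a b → a :* (b :+ :0) := b :* a) (μ R.^ k) μ)))))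
          where
          g = tl X
          X-eq : X ≈ t * g
          X-eq = tl-factor X x-zero
          shape : X ^ k * θ X ≈ t ^ k * (g ^ k * (t * (g + θ g)))
          shape = begin
            X ^ k * θ X ≈⟨ *-cong (trans (^-congˡ k X-eq) (^-distrib-* t g k)) (trans (θ-cong X-eq) (trans (θ-* t g) (+-congʳ (*-congʳ θ-t)))) ⟩
            t ^ k * g ^ k * (t * g + t * θ g) ≈⟨ solve 5 (λ a b t g d → a :* b :* (t :* g :+ t :* d) := a :* (b :* (t :* (g :+ d)))) (t ^ k) (g ^ k) t g (θ g) ⟩
            t ^ k * (g ^ k * (t * (g + θ g))) ∎

        F : Series
        F = Y ^ k * θ X

        F-coeff : F p R.≈ hasse R.* μ R.^ p
        F-coeff = R.trans (*-congʳ {θ X} (trans (square^ Y n) (^-congˡ n curve)) p)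
          (R.trans (cartier-Q X p char) (R.*-congˡ leading))

        F-zero : F 0 R.≈ R.0#
        F-zero = R.trans (R.*-congˡ (R.zeroˡ _)) (R.zeroʳ _)

        -- The even power y₀^(p-1) becomes Q^n. The p-th powers that remain on the two sides are 1
        -- modulo t^p and disappear on comparing coefficients of t^p, since both sides have a factor
        -- t.
        key : y₀ ^ p * F ≈ t * (C μ * (Y ^ p * Q ^ n))
        key = begin
          y₀ * y₀ ^ k * (Y ^ k * θ X)
            ≈⟨ solve 4 (λ y yk Yk d → y :* yk :* (Yk :* d) := (y :* d) :* (Yk :* yk)) y₀ (y₀ ^ k) (Y ^ k) (θ X) ⟩
          (y₀ * θ X) * (Y ^ k * y₀ ^ k)
            ≈⟨ *-cong diff (*-congˡ {Y ^ k} (trans (square^ y₀ n) (^-congˡ n y₀-square))) ⟩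
          t * (C μ * Y) * (Y ^ k * Q ^ n)
            ≈⟨ solve 5 (λ t m y Yk q → t :* (m :* y) :* (Yk :* q) := t :* (m :* (y :* Yk :* q))) t (C μ) Y (Y ^ k) (Q ^ n) ⟩
          t * (C μ * (Y ^ p * Q ^ n)) ∎

      -- both sides are the t^p-coefficient of the pull-back of the invariant differential along P
      hasse-point : hasse R.* μ R.^ p R.≈ μ R.* hasse
      hasse-point = R.begin
        hasse R.* μ R.^ p R.≈⟨ R.sym F-coeff ⟩
        F p R.≈⟨ R.sym (like-one (tl F) k (p-power-one y₀ R.refl) (λ j 0<j j≤k → p-power-coeff y₀ j 0<j (s≤s j≤k))) ⟩
        (y₀ ^ p * tl F) k R.≈⟨ R.sym (t-⊛-suc (y₀ ^ p * tl F) k) ⟩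
        (t * (y₀ ^ p * tl F)) p R.≈⟨ trans (solve 3 (λ t y f → t :* (y :* f) := y :* (t :* f)) t (y₀ ^ p) (tl F)) (*-congˡ {y₀ ^ p} (sym (tl-factor F F-zero))) p ⟩
        (y₀ ^ p * F) p R.≈⟨ key p ⟩
        (t * (C μ * (Y ^ p * Q ^ n))) p R.≈⟨ t-⊛-suc (C μ * (Y ^ p * Q ^ n)) k ⟩
        (C μ * (Y ^ p * Q ^ n)) k R.≈⟨ C-⊛ μ (Y ^ p * Q ^ n) k ⟩
        μ R.* (Y ^ p * Q ^ n) k R.≈⟨ R.*-congˡ (like-one (Q ^ n) k (p-power-one Y y-zero) (λ j 0<j j≤k → p-power-coeff Y j 0<j (s≤s j≤k))) ⟩
        μ R.* hasse R.∎

    module Cubic (w : R.Carrier) where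

      cubic : Series → Series
      cubic x = nat 4 * (x * x * x) + (x + C w) * (x + C w)

      cubic-hasse : R.Carrier
      cubic-hasse = (cubic t ^ n) (n ℕ.+ n)

      private
        c0 c1 c2 c3 : R.Carrier
        c0 = w R.* w
        c1 = R.nat 2 R.* w
        c2 = R.1#
        c3 = R.nat 4

        cubic-horner : ∀ x → cubic x ≈ C c0 + x * (C c1 + x * (C c2 + x * C c3))
        cubic-horner x = trans (solve 2 (λ x w → κ 4 :* (x :* x :* x) :+ (x :+ w) :* (x :+ w) := w :* w :+ x :* (κ 2 :* w :+ x :* (:1 :+ x :* κ 4))) x (C w))
          (sym (+-cong (C-* w w) (*-congˡ {x} (+-cong (trans (C-* (R.nat 2) w) (*-congʳ (C-nat 2))) (*-congˡ {x} (+-cong C-1 (*-congˡ {x} (C-nat 4))))))))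

        cubic-deg : Deg≤ (cubic t) 3
        cubic-deg = Deg≤-+ {nat 4 * (t * t * t)} (Deg≤-* {nat 4} {t * t * t} 0 3 (Deg≤-cong {C (R.nat 4)} (C-nat 4) (Deg≤-C (R.nat 4))) (Deg≤-* {t * t} {t} 2 1 tt-deg Deg≤-t))
          (Deg≤-mono {(t + C w) * (t + C w)} (s≤s (s≤s z≤n)) (Deg≤-* {t + C w} {t + C w} 1 1 tw tw))
          where
          tw : Deg≤ (t + C w) 1
          tw = Deg≤-+ {t} Deg≤-t (Deg≤-mono {C w} z≤n (Deg≤-C w))

      sub-cubic : ∀ x → Substitution.sub x 3 (cubic t) ≈ cubic x
      sub-cubic x = begin
        sub 3 (cubic t) ≈⟨ sub-cong 3 (cubic-horner t) ⟩
        sub 3 (C c0 + t * (C c1 + t * (C c2 + t * C c3)))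
          ≈⟨ trans (sub-horner 2 c0 h₂) (+-congˡ {C c0} (*-congˡ {x} (trans (sub-horner 1 c1 h₁) (+-congˡ {C c1} (*-congˡ {x} (sub-horner 0 c2 (C c3))))))) ⟩
        C c0 + x * (C c1 + x * (C c2 + x * C c3)) ≈⟨ sym (cubic-horner x) ⟩
        cubic x ∎
        where
        open Substitution x
        h₁ = C c2 + t * C c3
        h₂ = C c1 + t * h₁

      cartier-cubic : ∀ x N → R.nat N R.≈ R.0# → (cubic x ^ n * θ x) N R.≈ cubic-hasse R.* (x ^ (n ℕ.+ n) * θ x) N
      cartier-cubic x N charN = R.trans (*-congʳ {θ x} sub-power N) (cartier N charN n (cubic t ^ n) lt)
        where
        open Substitution x
        lt : suc (n ℕ.+ n ℕ.+ n) ℕ.< suc (n ℕ.+ n) ℕ.+ suc (n ℕ.+ n)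
        lt = s≤s (≡.subst (suc (n ℕ.+ n ℕ.+ n) ℕ.≤_) (≡.sym (ℕₚ.+-suc (n ℕ.+ n) (n ℕ.+ n))) (s≤s (ℕₚ.+-monoʳ-≤ (n ℕ.+ n) (ℕₚ.m≤m+n n n))))
        sub-power : cubic x ^ n ≈ sub (n ℕ.+ n ℕ.+ n) (cubic t ^ n)
        sub-power = sym (trans (≡.subst (λ k → sub k (cubic t ^ n) ≈ sub 3 (cubic t) ^ n) (N.solve 1 (λ n → n N.:* N.con 3 N.:= n N.:+ n N.:+ n) ≡.refl n) (sub-^ 3 n {cubic t} cubic-deg)) (^-congˡ n (sub-cubic x)))

      -- x = ν t² + e moves the 2-torsion point e to the origin
      module _ (e ν : R.Carrier)
        (root : R.nat 4 R.* (e R.* e R.* e) R.+ (e R.+ w) R.* (e R.+ w) R.≈ R.0#)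
        (lin : R.nat 12 R.* (e R.* e) R.+ R.nat 2 R.* (e R.+ w) R.≈ R.nat 4 R.* (ν R.* ν))
        (quad : R.nat 12 R.* e R.+ R.1# R.≈ R.nat 4 R.* (ν R.* A)) where

        private
          k = n ℕ.+ n

          x : Series
          x = C ν * (t * t) + C e

          b : R.Carrier
          b = R.nat 4 R.* (ν R.* ν R.* ν)

          root′ : nat 4 * (C e * C e * C e) + (C e + C w) * (C e + C w) ≈ 0#
          root′ = trans (sym (trans (C-+ _ _) (+-cong (trans (C-* (R.nat 4) _) (*-cong (C-nat 4) (trans (C-* _ e) (*-congʳ (C-* e e)))))
            (trans (C-* _ _) (*-cong (C-+ e w) (C-+ e w)))))) (trans (C-cong root) C-0)

          lin′ : nat 12 * (C e * C e) + nat 2 * (C e + C w) ≈ nat 4 * (C ν * C ν)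
          lin′ = trans (sym (trans (C-+ _ _) (+-cong (trans (C-* (R.nat 12) _) (*-cong (C-nat 12) (C-* e e))) (trans (C-* (R.nat 2) _) (*-cong (C-nat 2) (C-+ e w))))))
            (trans (C-cong lin) (trans (C-* (R.nat 4) _) (*-cong (C-nat 4) (C-* ν ν))))

          quad′ : nat 12 * C e + 1# ≈ nat 4 * (C ν * C A)
          quad′ = trans (sym (trans (C-+ _ _) (+-cong (trans (C-* (R.nat 12) e) (*-congʳ (C-nat 12))) C-1)))
            (trans (C-cong quad) (trans (C-* (R.nat 4) _) (*-cong (C-nat 4) (C-* ν A))))

          b′ : C b ≈ nat 4 * (C ν * C ν * C ν)
          b′ = trans (C-* (R.nat 4) _) (*-cong (C-nat 4) (trans (C-* _ ν) (*-congʳ (C-* ν ν))))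

          cubic-x : cubic x ≈ C b * (t * t) * Q
          cubic-x = begin
            cubic x
              ≈⟨ solve 4 (λ v T e w → let x = v :* T :+ e in κ 4 :* (x :* x :* x) :+ (x :+ w) :* (x :+ w)
                   := (κ 4 :* (e :* e :* e) :+ (e :+ w) :* (e :+ w)) :+ v :* T :* (κ 12 :* (e :* e) :+ κ 2 :* (e :+ w)) :+ v :* v :* T :* T :* (κ 12 :* e :+ :1) :+ κ 4 :* (v :* v :* v) :* T :* T :* T) (C ν) (t * t) (C e) (C w) ⟩
            (nat 4 * (C e * C e * C e) + (C e + C w) * (C e + C w)) + C ν * (t * t) * (nat 12 * (C e * C e) + nat 2 * (C e + C w)) + C ν * C ν * (t * t) * (t * t) * (nat 12 * C e + 1#) + nat 4 * (C ν * C ν * C ν) * (t * t) * (t * t) * (t * t)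
              ≈⟨ +-congʳ (+-cong (+-cong root′ (*-congˡ {C ν * (t * t)} lin′)) (*-congˡ {C ν * C ν * (t * t) * (t * t)} quad′)) ⟩
            0# + C ν * (t * t) * (nat 4 * (C ν * C ν)) + C ν * C ν * (t * t) * (t * t) * (nat 4 * (C ν * C A)) + nat 4 * (C ν * C ν * C ν) * (t * t) * (t * t) * (t * t)
              ≈⟨ solve 3 (λ v T A → :0 :+ v :* T :* (κ 4 :* (v :* v)) :+ v :* v :* T :* T :* (κ 4 :* (v :* A)) :+ κ 4 :* (v :* v :* v) :* T :* T :* T
                   := κ 4 :* (v :* v :* v) :* T :* (:1 :+ A :* T :+ T :* T)) (C ν) (t * t) (C A) ⟩
            nat 4 * (C ν * C ν * C ν) * (t * t) * Q
              ≈⟨ *-congʳ (*-congʳ (sym b′)) ⟩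
            C b * (t * t) * Q ∎

          θx : θ x ≈ C (R.nat 2 R.* ν) * (t * t)
          θx = begin
            θ (C ν * (t * t) + C e) ≈⟨ θ-+ (C ν * (t * t)) (C e) ⟩
            θ (C ν * (t * t)) + θ (C e)
              ≈⟨ +-cong (trans (θ-* (C ν) (t * t)) (+-cong (*-congʳ (θ-C ν)) (*-congˡ {C ν} (trans (θ-* t t) (+-cong (*-congʳ θ-t) (*-congˡ {t} θ-t)))))) (θ-C e) ⟩
            0# * (t * t) + C ν * (t * t + t * t) + 0#
              ≈⟨ solve 2 (λ v T → :0 :* T :+ v :* (T :+ T) :+ :0 := κ 2 :* v :* T) (C ν) (t * t) ⟩
            nat 2 * C ν * (t * t)
              ≈⟨ *-congʳ (sym (trans (C-* (R.nat 2) ν) (*-congʳ (C-nat 2)))) ⟩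
            C (R.nat 2 R.* ν) * (t * t) ∎

          2ν : R.Carrier
          2ν = R.nat 2 R.* ν

          -- This is 2 p, the degree of x^(2n) θ x. The sum is arranged for splitting off t^(2n+2),
          -- which leaves the coefficient of degree 2 n in Q^n.
          N = (n ℕ.+ suc (suc n)) ℕ.+ (n ℕ.+ n)

          N≡ : N ≡ p ℕ.+ p
          N≡ = N.solve 1 (λ n → (n N.:+ (N.con 2 N.:+ n)) N.:+ (n N.:+ n) N.:= (N.con 1 N.:+ (n N.:+ n)) N.:+ (N.con 1 N.:+ (n N.:+ n))) ≡.refl n

          charN : R.nat N R.≈ R.0#
          charN = ≡.subst (λ k → R.nat k R.≈ R.0#) (≡.sym N≡) (R.trans (R.×-homo-+ R.1# p p) (R.trans (R.+-cong char char) (R.+-identityˡ R.0#)))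

          b^ : C (b R.^ n) ≈ C b ^ n
          b^ = C-^ b n

          lhs : (cubic x ^ n * θ x) N R.≈ (b R.^ n R.* 2ν) R.* hasse
          lhs = R.trans (shape N) (R.trans (C-⊛ _ (t ^ (n ℕ.+ suc (suc n)) * Q ^ n) N) (R.*-congˡ (t^-⊛ (n ℕ.+ suc (suc n)) (Q ^ n) (n ℕ.+ n))))
            where
            shape : cubic x ^ n * θ x ≈ C (b R.^ n R.* 2ν) * (t ^ (n ℕ.+ suc (suc n)) * Q ^ n)
            shape = begin
              cubic x ^ n * θ x
                ≈⟨ *-cong (trans (^-congˡ n cubic-x) (trans (^-distrib-* (C b * (t * t)) Q n) (*-congʳ (^-distrib-* (C b) (t * t) n)))) θx ⟩
              C b ^ n * (t * t) ^ n * Q ^ n * (C 2ν * (t * t))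
                ≈⟨ *-congʳ (*-congʳ (*-cong (sym b^) (trans (sym (square^ t n)) (^-homo-* t n n)))) ⟩
              C (b R.^ n) * (t ^ n * t ^ n) * Q ^ n * (C 2ν * (t * t))
                ≈⟨ solve 5 (λ b s q v t → b :* (s :* s) :* q :* (v :* (t :* t)) := (b :* v) :* (s :* (t :* (t :* s)) :* q)) (C (b R.^ n)) (t ^ n) (Q ^ n) (C 2ν) t ⟩
              (C (b R.^ n) * C 2ν) * (t ^ n * t ^ suc (suc n) * Q ^ n)
                ≈⟨ *-cong (sym (C-* _ _)) (*-congʳ (sym (^-homo-* t n (suc (suc n))))) ⟩
              C (b R.^ n R.* 2ν) * (t ^ (n ℕ.+ suc (suc n)) * Q ^ n) ∎

          x-deg : Deg≤ x 2
          x-deg = Deg≤-+ {C ν * (t * t)} (Deg≤-* {C ν} {t * t} 0 2 (Deg≤-C ν) tt-deg) (Deg≤-mono {C e} z≤n (Deg≤-C e))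

          x-top : x 2 R.≈ ν
          x-top = R.trans (R.+-identityʳ _) (R.trans (C-⊛ ν (t * t) 2) (R.trans (R.*-congˡ (R.trans (t-⊛-suc t 1) R.refl)) (R.*-identityʳ ν)))

          rhs : (x ^ k * θ x) N R.≈ ν R.^ k R.* 2ν
          rhs = ≡.subst (λ j → (x ^ k * θ x) j R.≈ ν R.^ k R.* 2ν) (N.solve 1 (λ n → (n N.:+ n) N.:* N.con 2 N.:+ N.con 2 N.:= (n N.:+ (N.con 2 N.:+ n)) N.:+ (n N.:+ n)) ≡.refl n)
            (R.trans (top-* {x ^ k} {θ x} (k ℕ.* 2) 2 (Deg≤-^ {x} k x-deg) (Deg≤-θ {x} x-deg))
              (R.*-cong (R.trans (top-^ {x} 2 k x-deg) (R.^-congˡ k x-top)) (R.*-congˡ x-top′)))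
            where
            x-top′ : x 2 R.≈ ν
            x-top′ = x-top

        -- Coefficient 2 p of cubic(x)^n θ x is taken twice: the Cartier operator gives
        -- `cubic-hasse` times the top coefficient of x^(2n) θ x, while cubic(x) = 4 ν³ t² Q turns
        -- it into a multiple of the coefficient defining `hasse`.
        hasse-shift : cubic-hasse R.* ν R.^ k R.* ν R.≈ b R.^ n R.* ν R.* hasse
        hasse-shift = cancel-nat 2∤ (R.begin
          R.nat 2 R.* (cubic-hasse R.* ν R.^ k R.* ν) R.≈⟨ R.solve 3 (λ h a v → κ 2 :* (h :* a :* v) := h :* (a :* (κ 2 :* v))) cubic-hasse (ν R.^ k) ν ⟩
          cubic-hasse R.* (ν R.^ k R.* 2ν) R.≈⟨ R.*-congˡ (R.sym rhs) ⟩
          cubic-hasse R.* (x ^ k * θ x) N R.≈⟨ R.sym (cartier-cubic x N charN) ⟩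
          (cubic x ^ n * θ x) N R.≈⟨ lhs ⟩
          (b R.^ n R.* 2ν) R.* hasse R.≈⟨ R.solve 3 (λ b v h → (b :* (κ 2 :* v)) :* h := κ 2 :* (b :* v :* h)) (b R.^ n) ν hasse ⟩
          R.nat 2 R.* (b R.^ n R.* ν R.* hasse) R.∎)

-- Differential equations modulo p: Clausen's formula and the Domb generating function

module ODE (R : CommutativeRing 0ℓ 0ℓ) where
 open import Data.Integer using (+_; -[1+_])
 open import Data.Nat.Induction using (<-rec)
 open Series R
 open RingKit seriesRing
 private module R = RingKit R

 module On (p : ℕ) (1<p : 1 ℕ.< p)
   (char : RingKit.HasChar R p)
   (unit : RingKit.UnitsPrimeTo R p) where
  open CharP.On R p 1<p char unit

  Vanishing : Series → ℕ → Set
  Vanishing f k = ∀ i → i ℕ.< k → f i R.≈ R.0#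

  lowest-* : ∀ g {h} k → Vanishing h k → (g * h) k R.≈ g 0 R.* h k
  lowest-* g {h} zero v = R.refl
  lowest-* g {h} (suc k) v = R.trans (⊛-rec g h k) (trans′ k v)
    where
    trans′ : ∀ k → Vanishing h (suc k) → (g * tl h) k R.+ g (suc k) R.* h 0 R.≈ g 0 R.* h (suc k)
    trans′ k v = R.trans (R.+-cong (lowest-* g {tl h} k (λ i i<k → v (suc i) (s≤s i<k))) (R.trans (R.*-congˡ (v 0 (s≤s z≤n))) (R.zeroʳ _))) (R.+-identityʳ _)

  record Operator : Set where
    constructor op
    field a₃ a₂ a₁ a₀ : Series

    apply : Series → Series
    apply Y = a₃ * θ (θ (θ Y)) + a₂ * θ (θ Y) + a₁ * θ Y + a₀ * Y

  -- Fuchsian operators with all exponents 0 at the origin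
  record Unipotent (L : Operator) : Set where
    open Operator L
    field
      a₃-zero : a₃ 0 R.≈ R.1#
      a₂-zero : a₂ 0 R.≈ R.0#
      a₁-zero : a₁ 0 R.≈ R.0#
      a₀-zero : a₀ 0 R.≈ R.0#

  module _ (L : Operator) (unip : Unipotent L) where
    open Operator L
    open Unipotent unip

    private
      θ-vanish : ∀ {f k} → Vanishing f k → Vanishing (θ f) k
      θ-vanish v i i<k = R.trans (R.*-congˡ (v i i<k)) (R.zeroʳ _)

      lowest : ∀ D k → Vanishing D k → apply D k R.≈ R.nat k R.* (R.nat k R.* (R.nat k R.* D k))
      lowest D k v = R.trans
        (R.+-cong (R.+-cong (R.+-cong (term a₃ (θ (θ (θ D))) (θ-vanish {θ (θ D)} (θ-vanish {θ D} (θ-vanish {D} v))) a₃-zero)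
                                      (term a₂ (θ (θ D)) (θ-vanish {θ D} (θ-vanish {D} v)) a₂-zero))
                            (term a₁ (θ D) (θ-vanish {D} v) a₁-zero))
                  (term a₀ D v a₀-zero))
        (R.solve 4 (λ x y z w → :1 :* x :+ :0 :* y :+ :0 :* z :+ :0 :* w := x) _ _ _ _)
        where
        term : ∀ g h {b} → Vanishing h k → g 0 R.≈ b → (g * h) k R.≈ b R.* h k
        term g h w e = R.trans (lowest-* g k w) (R.*-congʳ e)

    -- On the lowest coefficient of a difference of solutions the operator acts as k³, which is
    -- invertible for 0 < k < p. Below degree p solutions therefore behave as in characteristic 0.
    unique : ∀ {Y Z} → apply Y ≈ 0# → apply Z ≈ 0# → Y 0 R.≈ Z 0 → ∀ k → k ℕ.< p → Y k R.≈ Z k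
    unique {Y} {Z} LY LZ Y0 k k<p = R.diff≈0⇒≈ (<-rec (λ k → k ℕ.< p → D k R.≈ R.0#) step k k<p)
      where
      D : Series
      D = Y - Z
      θ- : ∀ f g → θ (f - g) ≈ θ f - θ g
      θ- f g = trans (θ-+ f (- g)) (+-congˡ {θ f} (θ-neg g))
      LD : apply D ≈ 0#
      LD = begin
        apply D
          ≈⟨ +-congʳ (+-cong (+-cong (*-congˡ {a₃} (trans (θ-cong (trans (θ-cong (θ- Y Z)) (θ- (θ Y) (θ Z)))) (θ- (θ (θ Y)) (θ (θ Z)))))
               (*-congˡ {a₂} (trans (θ-cong (θ- Y Z)) (θ- (θ Y) (θ Z))))) (*-congˡ {a₁} (θ- Y Z))) ⟩
        a₃ * (θ (θ (θ Y)) - θ (θ (θ Z))) + a₂ * (θ (θ Y) - θ (θ Z)) + a₁ * (θ Y - θ Z) + a₀ * (Y - Z)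
          ≈⟨ solve 12 (λ a b c d y₃ y₂ y₁ y z₃ z₂ z₁ z → a :* (y₃ :- z₃) :+ b :* (y₂ :- z₂) :+ c :* (y₁ :- z₁) :+ d :* (y :- z)
               := (a :* y₃ :+ b :* y₂ :+ c :* y₁ :+ d :* y) :- (a :* z₃ :+ b :* z₂ :+ c :* z₁ :+ d :* z))
               a₃ a₂ a₁ a₀ (θ (θ (θ Y))) (θ (θ Y)) (θ Y) Y (θ (θ (θ Z))) (θ (θ Z)) (θ Z) Z ⟩
        apply Y - apply Z ≈⟨ +-cong LY (-‿cong LZ) ⟩
        0# - 0# ≈⟨ -‿inverseʳ 0# ⟩
        0# ∎
      step : ∀ k → (∀ {j} → j ℕ.< k → j ℕ.< p → D j R.≈ R.0#) → k ℕ.< p → D k R.≈ R.0#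
      step zero rec _ = R.≈⇒diff≈0 Y0
      step (suc k) rec k<p = nz (nz (nz (R.trans (R.sym (lowest D (suc k) (λ i i<k → rec i<k (ℕₚ.<-trans i<k k<p)))) (LD (suc k)))))
        where
        nz : ∀ {a} → R.nat (suc k) R.* a R.≈ R.0# → a R.≈ R.0#
        nz = nat-zero (∤-small (s≤s z≤n) k<p)

  cancel-const-one : ∀ {u a} → u 0 R.≈ R.1# → u * a ≈ 0# → a ≈ 0#
  cancel-const-one {u} {a} u0 h = begin
    a ≈⟨ sym (trans (*-congʳ (inv-inverse u u0)) (*-identityˡ a)) ⟩
    u * inv u * a ≈⟨ solve 3 (λ u v a → u :* v :* a := v :* (u :* a)) u (inv u) a ⟩
    inv u * (u * a) ≈⟨ *-congˡ {inv u} h ⟩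
    inv u * 0# ≈⟨ zeroʳ (inv u) ⟩
    0# ∎

  cancel-t : ∀ {a b} → t * a ≈ t * b → a ≈ b
  cancel-t {a} {b} h k = R.trans (R.sym (t-⊛-suc a k)) (R.trans (h (suc k)) (t-⊛-suc b k))

  cancel-const-one′ : ∀ {u a b} → u 0 R.≈ R.1# → u * a ≈ u * b → a ≈ b
  cancel-const-one′ {u} {a} {b} u0 h = diff≈0⇒≈ (cancel-const-one u0
    (trans (solve 3 (λ u a b → u :* (a :- b) := u :* a :- u :* b) u a b) (≈⇒diff≈0 h)))

  θ-int : ∀ k → θ (int k) ≈ 0#
  θ-int (+ k) = trans (θ-cong (sym (C-nat k))) (θ-C (R.nat k))
  θ-int -[1+ k ] = trans (θ-neg (nat (suc k))) (trans (-‿cong (θ-int (+ suc k))) -0#≈0#)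

  θ-scaled : ∀ l f → θ (int l * f) ≈ int l * θ f
  θ-scaled l f = trans (θ-* (int l) f) (trans (+-congʳ (trans (*-congʳ (θ-int l)) (zeroˡ f))) (+-identityˡ _))

  θ-linear : ∀ k l → θ (int k + int l * t) ≈ int l * t
  θ-linear k l = trans (θ-+ (int k) (int l * t)) (trans (+-cong (θ-int k) (trans (θ-scaled l t) (*-congˡ {int l} θ-t))) (+-identityˡ _))

  -- Clausen's formula, f² as a function of the quadratic argument t (1 - 27 t)
  module Clausen (f v : Series) (d : ℕ) (v-deg : Deg≤ v d)
    (f-ode : θ (θ f) ≈ t * (nat 27 * θ (θ f) + nat 27 * θ f + nat 6 * f))
    (v-ode : θ (θ (θ v)) ≈ t * (nat 108 * θ (θ (θ v)) + nat 162 * θ (θ v) + nat 78 * θ v + nat 12 * v))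
    (same : f 0 R.* f 0 R.≈ v 0) where

    P s z : Series
    P = 1# - nat 27 * t
    s = 1# - nat 54 * t
    z = t * P

    open Substitution z

    -- The symmetric square of the operator annihilating f, multiplied by P² to clear denominators.
    L : Operator
    L = op (P * P) (- (nat 81 * t * P)) (nat 2106 * (t * t) - nat 51 * t) (- (nat 12 * t * s))

    private
      P0 : P 0 R.≈ R.1#
      P0 = R.trans (R.+-congˡ (R.-‿cong (R.zeroʳ _))) (R.solve 0 (:1 :- :0 := :1))

      s0 : s 0 R.≈ R.1#
      s0 = R.trans (R.+-congˡ (R.-‿cong (R.zeroʳ _))) (R.solve 0 (:1 :- :0 := :1))

      unip : Unipotent L
      unip = record
        { a₃-zero = R.trans (R.*-cong P0 P0) (R.*-identityˡ _)
        ; a₂-zero = R.trans (R.-‿cong (R.trans (R.*-congʳ (R.zeroʳ _)) (R.zeroˡ _))) R.-0#≈0#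
        ; a₁-zero = R.solve 2 (λ a b → a :* (:0 :* :0) :- b :* :0 := :0) (nat 2106 0) (nat 51 0)
        ; a₀-zero = R.trans (R.-‿cong (R.trans (R.*-congʳ (R.zeroʳ _)) (R.zeroˡ _))) R.-0#≈0# }

      θP : θ P ≈ - (nat 27 * t)
      θP = trans (θ-cong (solve 1 (λ t → :1 :- κ 27 :* t := κ 1 :+ con -[1+ 26 ] :* t) t))
        (trans (θ-linear (+ 1) -[1+ 26 ]) (solve 1 (λ t → con -[1+ 26 ] :* t := :- (κ 27 :* t)) t))

      θs : θ s ≈ - (nat 54 * t)
      θs = trans (θ-cong (solve 1 (λ t → :1 :- κ 54 :* t := κ 1 :+ con -[1+ 53 ] :* t) t))
        (trans (θ-linear (+ 1) -[1+ 53 ]) (solve 1 (λ t → con -[1+ 53 ] :* t := :- (κ 54 :* t)) t))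

      θz : θ z ≈ t * s
      θz = trans (θ-* t P) (trans (+-cong (*-congʳ θ-t) (*-congˡ {t} θP)) (solve 1 (λ t → t :* (:1 :- κ 27 :* t) :+ t :* (:- (κ 27 :* t)) := t :* (:1 :- κ 54 :* t)) t))

      g = θ f
      h = θ g
      k = θ h

      f-ode₁ : P * h ≈ t * (nat 27 * g + nat 6 * f)
      f-ode₁ = trans (solve 2 (λ t h → (:1 :- κ 27 :* t) :* h := h :- κ 27 :* t :* h) t h)
        (trans (+-congʳ f-ode) (solve 4 (λ t f g h → t :* (κ 27 :* h :+ κ 27 :* g :+ κ 6 :* f) :- κ 27 :* t :* h := t :* (κ 27 :* g :+ κ 6 :* f)) t f g h))

      f-ode₂ : P * k - nat 27 * t * h ≈ t * (nat 27 * g + nat 6 * f) + t * (nat 27 * h + nat 6 * g)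
      f-ode₂ = begin
        P * k - nat 27 * t * h ≈⟨ solve 3 (λ u t h → u :- κ 27 :* t :* h := (:- (κ 27 :* t)) :* h :+ u) (P * k) t h ⟩
        - (nat 27 * t) * h + P * k ≈⟨ +-congʳ (*-congʳ (sym θP)) ⟩
        θ P * h + P * θ h ≈⟨ sym (θ-* P h) ⟩
        θ (P * h) ≈⟨ θ-cong f-ode₁ ⟩
        θ (t * (nat 27 * g + nat 6 * f))
          ≈⟨ trans (θ-* t _) (+-cong (*-congʳ θ-t) (*-congˡ {t} (trans (θ-+ (nat 27 * g) (nat 6 * f)) (+-cong (θ-scaled (+ 27) g) (θ-scaled (+ 6) f))))) ⟩
        t * (nat 27 * g + nat 6 * f) + t * (nat 27 * h + nat 6 * g) ∎

      L-square : Operator.apply L (f * f) ≈ 0#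
      L-square = begin
        Operator.apply L (f * f)
          ≈⟨ +-congʳ (+-cong (+-cong (*-congˡ {P * P} θ³) (*-congˡ { - (nat 81 * t * P)} θ²)) (*-congˡ {nat 2106 * (t * t) - nat 51 * t} (θ-* f f))) ⟩
        _ ≈⟨ cancel+ (solve 5 (λ t f g h k →
               let P = :1 :- κ 27 :* t ; s = :1 :- κ 54 :* t
                   q₁′ = κ 6 :* P :* g :- κ 54 :* t :* f
                   q₂ = κ 2 :* P :* f
               in (P :* P :* ((k :* f :+ h :* g :+ (h :* g :+ g :* h)) :+ (h :* g :+ g :* h :+ (g :* h :+ f :* k))) :+ (:- (κ 81 :* t :* P)) :* (h :* f :+ g :* g :+ (g :* g :+ f :* h)) :+ (κ 2106 :* (t :* t) :- κ 51 :* t) :* (g :* f :+ f :* g) :+ (:- (κ 12 :* t :* s)) :* (f :* f))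
                    :+ (q₁′ :* (t :* (κ 27 :* g :+ κ 6 :* f)) :+ q₂ :* (t :* (κ 27 :* g :+ κ 6 :* f) :+ t :* (κ 27 :* h :+ κ 6 :* g)))
                  := :0 :+ (q₁′ :* (P :* h) :+ q₂ :* (P :* k :- κ 27 :* t :* h))) t f g h k)
             (+-cong (*-congˡ {_} (sym f-ode₁)) (*-congˡ {_} (sym f-ode₂))) ⟩
        0# ∎
        where
        θ² : θ (θ (f * f)) ≈ h * f + g * g + (g * g + f * h)
        θ² = trans (θ-cong (θ-* f f)) (trans (θ-+ (g * f) (f * g)) (+-cong (θ-* g f) (θ-* f g)))
        θ³ : θ (θ (θ (f * f))) ≈ (k * f + h * g + (h * g + g * h)) + (h * g + g * h + (g * h + f * k))
        θ³ = trans (θ-cong θ²) (trans (θ-+ (h * f + g * g) (g * g + f * h)) (+-cong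
          (trans (θ-+ (h * f) (g * g)) (+-cong (θ-* h f) (θ-* g g))) (trans (θ-+ (g * g) (f * h)) (+-cong (θ-* g g) (θ-* f h)))))

      -- The bound `suc d` leaves room for the factor t on the right of `v-ode`.
      Yof : Series → Series
      Yof w = sub (suc d) w

      Y Y₁ Y₂ Y₃ : Series
      Y = Yof v
      Y₁ = Yof (θ v)
      Y₂ = Yof (θ (θ v))
      Y₃ = Yof (θ (θ (θ v)))

      chain : ∀ w → P * θ (Yof w) ≈ s * Yof (θ w)
      chain w = cancel-t (begin
        t * (P * θ (Yof w)) ≈⟨ sym (*-assoc t P _) ⟩
        z * θ (Yof w) ≈⟨ chain-rule (suc d) w ⟩
        θ z * Yof (θ w) ≈⟨ *-congʳ θz ⟩
        t * s * Yof (θ w) ≈⟨ *-assoc t s _ ⟩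
        t * (s * Yof (θ w)) ∎)

      chain′ : ∀ w → P * θ (θ (Yof w)) - nat 27 * t * θ (Yof w) ≈ s * θ (Yof (θ w)) - nat 54 * t * Yof (θ w)
      chain′ w = begin
        P * θ u - nat 27 * t * u ≈⟨ solve 3 (λ a t h → a :- κ 27 :* t :* h := (:- (κ 27 :* t)) :* h :+ a) (P * θ u) t u ⟩
        - (nat 27 * t) * u + P * θ u ≈⟨ trans (+-congʳ (*-congʳ (sym θP))) (sym (θ-* P u)) ⟩
        θ (P * u) ≈⟨ θ-cong (chain w) ⟩
        θ (s * y) ≈⟨ trans (θ-* s y) (+-congʳ (*-congʳ θs)) ⟩
        - (nat 54 * t) * y + s * θ y ≈⟨ solve 3 (λ a t h → (:- (κ 54 :* t)) :* h :+ a := a :- κ 54 :* t :* h) (s * θ y) t y ⟩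
        s * θ y - nat 54 * t * y ∎
        where
        u = θ (Yof w)
        y = Yof (θ w)

      chain″ : P * θ (θ (θ Y)) - nat 54 * t * θ (θ Y) - nat 27 * t * θ Y ≈ s * θ (θ Y₁) - nat 108 * t * θ Y₁ - nat 54 * t * Y₁
      chain″ = begin
        P * θ b - nat 54 * t * b - nat 27 * t * a
          ≈⟨ solve 4 (λ c t a b → c :- κ 54 :* t :* b :- κ 27 :* t :* a := ((:- (κ 27 :* t)) :* b :+ c) :- κ 27 :* (t :* a :+ t :* b)) (P * θ b) t a b ⟩
        (- (nat 27 * t) * b + P * θ b) - nat 27 * (t * a + t * b)
          ≈⟨ +-cong (trans (+-congʳ (*-congʳ (sym θP))) (sym (θ-* P b))) (-‿cong (*-congˡ {nat 27} (trans (+-congʳ (*-congʳ (sym θ-t))) (sym (θ-* t a))))) ⟩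
        θ (P * b) - nat 27 * θ (t * a)
          ≈⟨ sym (θ-sub 27 (P * b) (t * a)) ⟩
        θ (P * b - nat 27 * (t * a))
          ≈⟨ θ-cong (trans (+-congˡ {P * b} (-‿cong (sym (*-assoc (nat 27) t a)))) (trans (chain′ v) (+-congˡ {s * θ Y₁} (-‿cong (*-assoc (nat 54) t Y₁))))) ⟩
        θ (s * d₁ - nat 54 * (t * Y₁))
          ≈⟨ trans (θ-sub 54 (s * d₁) (t * Y₁)) (+-cong (trans (θ-* s d₁) (+-congʳ (*-congʳ θs))) (-‿cong (*-congˡ {nat 54} (trans (θ-* t Y₁) (+-congʳ (*-congʳ θ-t)))))) ⟩
        (- (nat 54 * t) * d₁ + s * θ d₁) - nat 54 * (t * Y₁ + t * d₁)
          ≈⟨ solve 4 (λ c t a b → ((:- (κ 54 :* t)) :* b :+ c) :- κ 54 :* (t :* a :+ t :* b) := c :- κ 108 :* t :* b :- κ 54 :* t :* a) (s * θ d₁) t Y₁ d₁ ⟩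
        s * θ d₁ - nat 108 * t * d₁ - nat 54 * t * Y₁ ∎
        where
        a = θ Y
        b = θ a
        d₁ = θ Y₁
        θ-sub : ∀ k f g → θ (f - nat k * g) ≈ θ f - nat k * θ g
        θ-sub k f g = trans (θ-+ f (- (nat k * g))) (+-congˡ {θ f} (trans (θ-neg (nat k * g)) (-‿cong (θ-scaled (+ k) g))))

      sub-nat : ∀ e k w → sub e (nat k * w) ≈ nat k * sub e w
      sub-nat e k w = trans (sub-cong e (trans (*-congʳ (sym (C-nat k))) (C-⊛ (R.nat k) w))) (trans (sub-• e (R.nat k) w) (*-congʳ (C-nat k)))

      closure : Y₃ ≈ z * (nat 108 * Y₃ + nat 162 * Y₂ + nat 78 * Y₁ + nat 12 * Y)
      closure = begin
        Yof (θ (θ (θ v))) ≈⟨ sub-cong (suc d) v-ode ⟩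
        sub (suc d) (t * (nat 108 * θ (θ (θ v)) + nat 162 * θ (θ v) + nat 78 * θ v + nat 12 * v))
          ≈⟨ sub-t d _ ⟩
        z * sub d (nat 108 * θ (θ (θ v)) + nat 162 * θ (θ v) + nat 78 * θ v + nat 12 * v)
          ≈⟨ *-congˡ {z} (trans (sub-+ d (nat 108 * θ (θ (θ v)) + nat 162 * θ (θ v) + nat 78 * θ v) (nat 12 * v)) (+-cong
               (trans (sub-+ d (nat 108 * θ (θ (θ v)) + nat 162 * θ (θ v)) (nat 78 * θ v)) (+-cong
               (trans (sub-+ d (nat 108 * θ (θ (θ v))) (nat 162 * θ (θ v))) (+-cong (term 108 (θ (θ (θ v))) dv₃) (term 162 (θ (θ v)) dv₂))) (term 78 (θ v) dv₁))) (term 12 v v-deg))) ⟩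
        z * (nat 108 * Y₃ + nat 162 * Y₂ + nat 78 * Y₁ + nat 12 * Y) ∎
        where
        dv₁ = Deg≤-θ {v} v-deg
        dv₂ = Deg≤-θ {θ v} dv₁
        dv₃ = Deg≤-θ {θ (θ v)} dv₂
        term : ∀ k w → Deg≤ w d → sub d (nat k * w) ≈ nat k * Yof w
        term k w h = trans (sub-nat d k w) (*-congˡ {nat k} (sym (sub-pad d {w} h)))

      s-d₂ : s * θ Y₂ ≈ t * (nat 162 * Y₂ + nat 78 * Y₁ + nat 12 * Y)
      s-d₂ = cancel-const-one′ {P} P0 (begin
        P * (s * θ Y₂) ≈⟨ solve 3 (λ p s d → p :* (s :* d) := s :* (p :* d)) P s (θ Y₂) ⟩
        s * (P * θ Y₂) ≈⟨ *-congˡ {s} (chain (θ (θ v))) ⟩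
        -- s² = 1 - 108 z, so the term 108 Y₃ of `closure` cancels.
        s * (s * Y₃)       ≈⟨ solve 2 (λ t y → let s = :1 :- κ 54 :* t in s :* (s :* y) := y :- κ 108 :* (t :* (:1 :- κ 27 :* t) :* y)) t Y₃ ⟩
        Y₃ - nat 108 * (z * Y₃) ≈⟨ +-congʳ closure ⟩
        z * (nat 108 * Y₃ + nat 162 * Y₂ + nat 78 * Y₁ + nat 12 * Y) - nat 108 * (z * Y₃)
          ≈⟨ solve 6 (λ t p y₃ y₂ y₁ y → t :* p :* (κ 108 :* y₃ :+ κ 162 :* y₂ :+ κ 78 :* y₁ :+ κ 12 :* y) :- κ 108 :* (t :* p :* y₃)
               := p :* (t :* (κ 162 :* y₂ :+ κ 78 :* y₁ :+ κ 12 :* y))) t P Y₃ Y₂ Y₁ Y ⟩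
        P * (t * (nat 162 * Y₂ + nat 78 * Y₁ + nat 12 * Y)) ∎)

      L-Y : Operator.apply L Y ≈ 0#
      L-Y = cancel+ (solve 11 (λ t Y Y₁ Y₂ a b c d₁ e d₂ w →
          let P = :1 :- κ 27 :* t ; s = :1 :- κ 54 :* t
          in (P :* P :* c :+ (:- (κ 81 :* t :* P)) :* b :+ (κ 2106 :* (t :* t) :- κ 51 :* t) :* a :+ (:- (κ 12 :* t :* s)) :* Y)
             :+ (P :* (s :* e :- κ 108 :* t :* d₁ :- κ 54 :* t :* Y₁) :+ (:- (κ 27 :* t)) :* (s :* d₁ :- κ 54 :* t :* Y₁) :+ s :* (s :* d₂ :- κ 54 :* t :* Y₂)
                 :+ (:- (κ 108 :* t)) :* (s :* Y₂) :+ (:- (κ 24 :* t)) :* (s :* Y₁) :+ s :* (t :* (κ 162 :* Y₂ :+ κ 78 :* Y₁ :+ κ 12 :* Y)))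
            := :0 :+ (P :* (P :* c :- κ 54 :* t :* b :- κ 27 :* t :* a) :+ (:- (κ 27 :* t)) :* (P :* b :- κ 27 :* t :* a) :+ s :* (P :* e :- κ 27 :* t :* d₁)
                 :+ (:- (κ 108 :* t)) :* (P :* d₁) :+ (:- (κ 24 :* t)) :* (P :* a) :+ s :* (s :* d₂))) t Y Y₁ Y₂ (θ Y) (θ (θ Y)) (θ (θ (θ Y))) (θ Y₁) (θ (θ Y₁)) (θ Y₂) t)
        (+-cong (+-cong (+-cong (+-cong (+-cong (*-congˡ {P} (sym chain″)) (*-congˡ { - (nat 27 * t)} (sym (chain′ v)))) (*-congˡ {s} (sym (chain′ (θ v)))))
          (*-congˡ { - (nat 108 * t)} (sym (chain (θ v))))) (*-congˡ { - (nat 24 * t)} (sym (chain v)))) (*-congˡ {s} (sym s-d₂)))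

    -- f solves the equation of ₂F₁(1/3, 2/3; 1; 27 t) and v that of ₃F₂(1/3, 1/2, 2/3; 1, 1; 108
    -- t). Both f² and v(z) are annihilated by `L`, and they have the same constant term.
    clausen : ∀ k → k ℕ.< p → (f * f) k R.≈ sub (suc d) v k
    clausen = unique L unip L-square L-Y (R.trans same (R.sym (R.trans (R.+-congˡ (R.trans (R.*-congʳ (R.zeroˡ _)) (R.zeroˡ _))) (R.+-identityʳ _))))

    module _ (w : R.Carrier) (f-deg : Deg≤ f d) (2d<p : d ℕ.+ d ℕ.< p) where
      private
        module Z = Evaluation (w R.* (R.1# R.- R.nat 27 R.* w))
        open Evaluation w

        z-deg : Deg≤ z 2
        z-deg = Deg≤-* {t} {P} 1 1 Deg≤-t (Deg≤-+ {1#} (Deg≤-mono {1#} z≤n Deg≤-𝟏)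
          (Deg≤-neg {nat 27 * t} (Deg≤-* {nat 27} {t} 0 1 (Deg≤-cong {C (R.nat 27)} (C-nat 27) (Deg≤-C (R.nat 27))) Deg≤-t)))

        P-deg : Deg≤ P 1
        P-deg = Deg≤-+ {1#} (Deg≤-mono {1#} z≤n Deg≤-𝟏) (Deg≤-neg {nat 27 * t} (Deg≤-* {nat 27} {t} 0 1 (Deg≤-cong {C (R.nat 27)} (C-nat 27) (Deg≤-C (R.nat 27))) Deg≤-t))

        ev-z : ev 2 z R.≈ w R.* (R.1# R.- R.nat 27 R.* w)
        ev-z = R.trans (ev-* 1 1 {t} {P} Deg≤-t P-deg) (R.*-cong (R.solve 1 (λ w → :0 :+ w :* :1 := w) w)
          (R.trans (R.+-cong P0 (R.*-congˡ (R.trans (R.+-identityˡ _) (R.-‿cong (R.trans (*-congʳ {t} (sym (C-nat 27)) 1) (R.trans (C-⊛ (R.nat 27) t 1) (R.*-identityʳ _)))))))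
            (R.solve 1 (λ w → :1 :+ w :* (:- κ 27) := :1 :- κ 27 :* w) w)))

        sub-deg : ∀ e h → Deg≤ (sub e h) (e ℕ.* 2)
        sub-deg zero h = Deg≤-C (h 0)
        sub-deg (suc e) h = Deg≤-+ {C (h 0)} (Deg≤-mono {C (h 0)} z≤n (Deg≤-C (h 0))) (Deg≤-* {z} {sub e (tl h)} 2 (e ℕ.* 2) z-deg (sub-deg e (tl h)))

        ev-C : ∀ k c → ev k (C c) R.≈ c
        ev-C k c = R.trans (R.reflexive (≡.cong (λ j → ev j (C c)) (≡.sym (ℕₚ.+-identityʳ k)))) (ev-pad k 0 {C c} (Deg≤-C c))

        ev-sub : ∀ e h → ev (e ℕ.* 2) (sub e h) R.≈ Z.ev e h
        ev-sub zero h = R.refl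
        ev-sub (suc e) h = R.trans (ev-+ (suc e ℕ.* 2) (C (h 0)) (z * sub e (tl h))) (R.+-cong (ev-C (suc e ℕ.* 2) (h 0))
          (R.trans (ev-* 2 (e ℕ.* 2) {z} {sub e (tl h)} z-deg (sub-deg e (tl h))) (R.*-cong ev-z (ev-sub e (tl h)))))

      -- Both polynomials have degree at most 2 d < p, so agreement of the coefficients below p is
      -- equality, and the formula may be evaluated at w.
      clausen-value : ev d f R.* ev d f R.≈ Z.ev d v
      clausen-value = R.begin
        ev d f R.* ev d f R.≈⟨ R.sym (ev-* d d {f} {f} f-deg f-deg) ⟩
        ev (d ℕ.+ d) (f * f) R.≈⟨ ev-agree (d ℕ.+ d) (λ k k≤ → R.trans (clausen k (ℕₚ.≤-<-trans k≤ 2d<p)) (sub-pad d {v} v-deg k)) ⟩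
        ev (d ℕ.+ d) (sub d v) R.≡⟨ ≡.cong (λ k → ev k (sub d v)) (≡.trans (≡.cong (d ℕ.+_) (≡.sym (ℕₚ.+-identityʳ d))) (ℕₚ.*-comm 2 d)) ⟩
        ev (d ℕ.* 2) (sub d v) R.≈⟨ ev-sub d v ⟩
        Z.ev d v R.∎

  -- The generating function of the Domb numbers, as (1 - 4 t)^(p-1) v(ζ) with ζ = t² / (1 - 4 t)³:
  -- the p-th power of 1 - 4 t is a constant for θ.
  module Domb (e K r : ℕ) (e+1≡p : suc e ≡ p) (e≡ : e ≡ r ℕ.+ K ℕ.* 3) (v : Series) (v-deg : Deg≤ v K)
    (v-ode : θ (θ (θ v)) ≈ t * (nat 108 * θ (θ (θ v)) + nat 162 * θ (θ v) + nat 78 * θ v + nat 12 * v)) where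

    E i ζ κ₂ W : Series
    E = 1# - nat 4 * t
    i = inv E
    ζ = t * (t * (i * i * i))
    κ₂ = nat 2 + nat 4 * t
    W = E ^ e

    open Substitution ζ

    -- The recurrence of the Aₙ as an operator: θ³ - t (20 θ³ + 30 θ² + 18 θ + 4) + 64 t² (θ + 1)³.
    L : Operator
    L = op (1# - nat 20 * t + nat 64 * (t * t)) (nat 192 * (t * t) - nat 30 * t) (nat 192 * (t * t) - nat 18 * t) (nat 64 * (t * t) - nat 4 * t)

    private
      E0 : E 0 R.≈ R.1#
      E0 = R.trans (R.+-congˡ (R.-‿cong (R.zeroʳ _))) (R.solve 0 (:1 :- :0 := :1))

      Ei : E * i ≈ 1#
      Ei = inv-inverse E E0

      lower-zero : ∀ a b → (a * (t * t) - b * t) 0 R.≈ R.0#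
      lower-zero a b = R.solve 2 (λ a b → a :* (:0 :* :0) :- b :* :0 := :0) (a 0) (b 0)

      unip : Unipotent L
      unip = record
        { a₃-zero = R.solve 2 (λ a b → :1 :- a :* :0 :+ b :* (:0 :* :0) := :1) (nat 20 0) (nat 64 0)
        ; a₂-zero = lower-zero (nat 192) (nat 30)
        ; a₁-zero = lower-zero (nat 192) (nat 18)
        ; a₀-zero = lower-zero (nat 64) (nat 4) }

      θE : θ E ≈ - (nat 4 * t)
      θE = trans (θ-cong (solve 1 (λ t → :1 :- κ 4 :* t := κ 1 :+ con -[1+ 3 ] :* t) t))
        (trans (θ-linear (+ 1) -[1+ 3 ]) (solve 1 (λ t → con -[1+ 3 ] :* t := :- (κ 4 :* t)) t))

      θ1 : θ 1# ≈ 0#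
      θ1 = trans (θ-cong (sym C-1)) (θ-C R.1#)

      Eθi : E * θ i ≈ nat 4 * t * i
      Eθi = begin
        E * θ i ≈⟨ solve 2 (λ u v → u := (v :+ u) :- v) (E * θ i) (θ E * i) ⟩
        (θ E * i + E * θ i) - θ E * i ≈⟨ +-cong (trans (sym (θ-* E i)) (trans (θ-cong Ei) θ1)) (-‿cong (*-congʳ θE)) ⟩
        0# - - (nat 4 * t) * i ≈⟨ solve 2 (λ t i → :0 :- (:- (κ 4 :* t)) :* i := κ 4 :* t :* i) t i ⟩
        nat 4 * t * i ∎

      Eθζ : E * θ ζ ≈ ζ * κ₂
      Eθζ = begin
        E * θ ζ
          ≈⟨ *-congˡ {E} (trans (θ-* t (t * (i * i * i))) (+-cong (*-congʳ θ-t) (*-congˡ {t} (trans (θ-* t (i * i * i)) (+-cong (*-congʳ θ-t)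
               (*-congˡ {t} (trans (θ-* (i * i) i) (+-congʳ (*-congʳ (θ-* i i)))))))))) ⟩
        E * (t * (t * (i * i * i)) + t * (t * (i * i * i) + t * ((θ i * i + i * θ i) * i + i * i * θ i)))
          ≈⟨ solve 4 (λ E t i d → E :* (t :* (t :* (i :* i :* i)) :+ t :* (t :* (i :* i :* i) :+ t :* ((d :* i :+ i :* d) :* i :+ i :* i :* d)))
               := κ 2 :* E :* (t :* (t :* (i :* i :* i))) :+ κ 3 :* (t :* t :* i :* i) :* (E :* d)) E t i (θ i) ⟩
        nat 2 * E * ζ + nat 3 * (t * t * i * i) * (E * θ i)
          ≈⟨ +-congˡ {nat 2 * E * ζ} (*-congˡ {nat 3 * (t * t * i * i)} Eθi) ⟩
        nat 2 * E * ζ + nat 3 * (t * t * i * i) * (nat 4 * t * i)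
          ≈⟨ solve 2 (λ t i → let z = t :* (t :* (i :* i :* i)) in κ 2 :* (:1 :- κ 4 :* t) :* z :+ κ 3 :* (t :* t :* i :* i) :* (κ 4 :* t :* i) := z :* (κ 2 :+ κ 4 :* t)) t i ⟩
        ζ * κ₂ ∎

      E³ζ : E * E * E * ζ ≈ t * t
      E³ζ = trans (solve 3 (λ E t i → E :* E :* E :* (t :* (t :* (i :* i :* i))) := t :* t :* (E :* i :* (E :* i) :* (E :* i))) E t i)
        (trans (*-congˡ {t * t} (*-cong (*-cong Ei Ei) Ei)) (solve 1 (λ T → T :* (:1 :* :1 :* :1) := T) (t * t)))

      cancel-ζ : ∀ {a b} → ζ * a ≈ ζ * b → a ≈ b
      cancel-ζ {a} {b} h = cancel-const-one′ {i * i * i} i³0 (cancel-t (cancel-t (trans (assoc a) (trans h (sym (assoc b))))))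
        where
        assoc : ∀ a → t * (t * (i * i * i * a)) ≈ ζ * a
        assoc a = solve 3 (λ t j a → t :* (t :* (j :* a)) := t :* (t :* j) :* a) t (i * i * i) a
        i³0 : (i * i * i) 0 R.≈ R.1#
        i³0 = R.trans (R.*-cong (R.*-cong (inv-zero E) (inv-zero E)) (inv-zero E)) (R.solve 0 (:1 :* :1 :* :1 := :1))

      S : Series → Series
      S w = sub (suc K) w

      EθS : ∀ w → E * θ (S w) ≈ κ₂ * S (θ w)
      EθS w = cancel-ζ (begin
        ζ * (E * θ (S w)) ≈⟨ solve 3 (λ z e d → z :* (e :* d) := e :* (z :* d)) ζ E (θ (S w)) ⟩
        E * (ζ * θ (S w)) ≈⟨ *-congˡ {E} (chain-rule (suc K) w) ⟩
        E * (θ ζ * S (θ w)) ≈⟨ sym (*-assoc E (θ ζ) _) ⟩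
        E * θ ζ * S (θ w) ≈⟨ *-congʳ Eθζ ⟩
        ζ * κ₂ * S (θ w) ≈⟨ *-assoc ζ κ₂ _ ⟩
        ζ * (κ₂ * S (θ w)) ∎)

      nat-e : R.nat e R.≈ R.- R.1#
      nat-e = R.diff≈0⇒≈ (R.trans (R.solve 1 (λ a → a :- (:- :1) := :1 :+ a) (R.nat e)) (≡.subst (λ k → R.nat k R.≈ R.0#) (≡.sym e+1≡p) char))

      Eθ^ : ∀ k → E * θ (E ^ k) ≈ nat k * θ E * E ^ k
      Eθ^ zero = trans (*-congˡ {E} θ1) (solve 2 (λ e d → e :* :0 := κ 0 :* d :* :1) E (θ E))
      Eθ^ (suc k) = trans (*-congˡ {E} (θ-^ E k)) (solve 4 (λ e n x d → e :* (n :* x :* d) := n :* d :* (e :* x)) E (nat (suc k)) (E ^ k) (θ E))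

      -- The exponent p - 1 is -1 in R, so W satisfies the equation of 1 / E while being a
      -- polynomial.
      EθW : E * θ W ≈ nat 4 * t * W
      EθW = trans (Eθ^ e) (*-congʳ (trans (*-cong (trans (sym (C-nat e)) (trans (C-cong nat-e) (trans (C-neg R.1#) (-‿cong C-1)))) θE)
        (solve 1 (λ t → (:- :1) :* (:- (κ 4 :* t)) := κ 4 :* t) t)))

      Yof : Series → Series
      Yof w = W * S w

      Y Y₁ Y₂ Y₃ : Series
      Y = Yof v
      Y₁ = Yof (θ v)
      Y₂ = Yof (θ (θ v))
      Y₃ = Yof (θ (θ (θ v)))

      chain : ∀ w → E * θ (Yof w) ≈ κ₂ * Yof (θ w) + nat 4 * (t * Yof w)
      chain w = begin
        E * θ (W * S w) ≈⟨ *-congˡ {E} (θ-* W (S w)) ⟩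
        E * (θ W * S w + W * θ (S w)) ≈⟨ solve 5 (λ e a b c d → e :* (a :* b :+ c :* d) := e :* a :* b :+ c :* (e :* d)) E (θ W) (S w) W (θ (S w)) ⟩
        E * θ W * S w + W * (E * θ (S w)) ≈⟨ +-cong (*-congʳ EθW) (*-congˡ {W} (EθS w)) ⟩
        nat 4 * t * W * S w + W * (κ₂ * S (θ w))
          ≈⟨ solve 5 (λ t W s k s′ → κ 4 :* t :* W :* s :+ W :* (k :* s′) := k :* (W :* s′) :+ κ 4 :* (t :* (W :* s))) t W (S w) κ₂ (S (θ w)) ⟩
        κ₂ * Yof (θ w) + nat 4 * (t * Yof w) ∎

      θκ₂ : θ κ₂ ≈ nat 4 * t
      θκ₂ = θ-linear (+ 2) (+ 4)

      θ-nat* : ∀ k f → θ (nat k * f) ≈ nat k * θ f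
      θ-nat* k f = θ-scaled (+ k) f

      θt* : ∀ f → θ (t * f) ≈ t * f + t * θ f
      θt* f = trans (θ-* t f) (+-congʳ (*-congʳ θ-t))

      chain′ : ∀ w → E * θ (θ (Yof w)) ≈ nat 4 * t * θ (Yof w) + (nat 4 * t * Yof (θ w) + κ₂ * θ (Yof (θ w))) + nat 4 * (t * Yof w + t * θ (Yof w))
      chain′ w = begin
        E * θ u ≈⟨ solve 3 (λ x t u → x := κ 4 :* t :* u :+ ((:- (κ 4 :* t)) :* u :+ x)) (E * θ u) t u ⟩
        nat 4 * t * u + (- (nat 4 * t) * u + E * θ u)
          ≈⟨ +-congˡ {nat 4 * t * u} (trans (+-congʳ (*-congʳ (sym θE))) (trans (sym (θ-* E u)) (θ-cong (chain w)))) ⟩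
        nat 4 * t * u + θ (κ₂ * y + nat 4 * (t * Yof w))
          ≈⟨ +-congˡ {nat 4 * t * u} (trans (θ-+ (κ₂ * y) (nat 4 * (t * Yof w))) (+-cong (trans (θ-* κ₂ y) (+-congʳ (*-congʳ θκ₂))) (trans (θ-nat* 4 (t * Yof w)) (*-congˡ {nat 4} (θt* (Yof w)))))) ⟩
        nat 4 * t * u + ((nat 4 * t * y + κ₂ * θ y) + nat 4 * (t * Yof w + t * u))
          ≈⟨ sym (+-assoc (nat 4 * t * u) (nat 4 * t * y + κ₂ * θ y) _) ⟩
        nat 4 * t * u + (nat 4 * t * y + κ₂ * θ y) + nat 4 * (t * Yof w + t * u) ∎
        where
        u = θ (Yof w)
        y = Yof (θ w)

      chain″ : E * θ (θ (θ Y)) ≈ nat 12 * (t * θ Y) + nat 12 * (t * θ (θ Y)) + nat 4 * (t * Y₁) + nat 8 * (t * θ Y₁) + κ₂ * θ (θ Y₁) + nat 4 * (t * Y)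
      chain″ = begin
        E * θ b
          ≈⟨ solve 3 (λ x t u → x := κ 4 :* t :* u :+ ((:- (κ 4 :* t)) :* u :+ x)) (E * θ b) t b ⟩
        nat 4 * t * b + (- (nat 4 * t) * b + E * θ b)
          ≈⟨ +-congˡ {nat 4 * t * b} (trans (+-congʳ (*-congʳ (sym θE))) (trans (sym (θ-* E b)) (θ-cong (trans (chain′ v)
               (solve 6 (λ t a y k d Y → κ 4 :* t :* a :+ (κ 4 :* t :* y :+ k :* d) :+ κ 4 :* (t :* Y :+ t :* a) := k :* d :+ κ 8 :* (t :* a) :+ κ 4 :* (t :* y) :+ κ 4 :* (t :* Y)) t a Y₁ κ₂ d₁ Y))))) ⟩
        nat 4 * t * b + θ (κ₂ * d₁ + nat 8 * (t * a) + nat 4 * (t * Y₁) + nat 4 * (t * Y))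
          ≈⟨ +-congˡ {nat 4 * t * b} (trans (θ-+ (κ₂ * d₁ + nat 8 * (t * a) + nat 4 * (t * Y₁)) (nat 4 * (t * Y))) (+-cong
               (trans (θ-+ (κ₂ * d₁ + nat 8 * (t * a)) (nat 4 * (t * Y₁))) (+-cong
               (trans (θ-+ (κ₂ * d₁) (nat 8 * (t * a))) (+-cong (trans (θ-* κ₂ d₁) (+-congʳ (*-congʳ θκ₂))) (term 8 a))) (term 4 Y₁))) (term 4 Y))) ⟩
        nat 4 * t * b + ((nat 4 * t * d₁ + κ₂ * θ d₁) + nat 8 * (t * a + t * b) + nat 4 * (t * Y₁ + t * d₁) + nat 4 * (t * Y + t * a))
          ≈⟨ solve 8 (λ t a b Y₁ d k e Y → κ 4 :* t :* b :+ ((κ 4 :* t :* d :+ k :* e) :+ κ 8 :* (t :* a :+ t :* b) :+ κ 4 :* (t :* Y₁ :+ t :* d) :+ κ 4 :* (t :* Y :+ t :* a))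
               := κ 12 :* (t :* a) :+ κ 12 :* (t :* b) :+ κ 4 :* (t :* Y₁) :+ κ 8 :* (t :* d) :+ k :* e :+ κ 4 :* (t :* Y)) t a b Y₁ d₁ κ₂ (θ d₁) Y ⟩
        nat 12 * (t * a) + nat 12 * (t * b) + nat 4 * (t * Y₁) + nat 8 * (t * d₁) + κ₂ * θ d₁ + nat 4 * (t * Y) ∎
        where
        a = θ Y
        b = θ a
        d₁ = θ Y₁
        term : ∀ k f → θ (nat k * (t * f)) ≈ nat k * (t * f + t * θ f)
        term k f = trans (θ-nat* k (t * f)) (*-congˡ {nat k} (θt* f))

      sub-nat : ∀ d k w → sub d (nat k * w) ≈ nat k * sub d w
      sub-nat d k w = trans (sub-cong d (trans (*-congʳ (sym (C-nat k))) (C-⊛ (R.nat k) w))) (trans (sub-• d (R.nat k) w) (*-congʳ (C-nat k)))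

      closure : S (θ (θ (θ v))) ≈ ζ * (nat 108 * S (θ (θ (θ v))) + nat 162 * S (θ (θ v)) + nat 78 * S (θ v) + nat 12 * S v)
      closure = begin
        S (θ (θ (θ v))) ≈⟨ sub-cong (suc K) v-ode ⟩
        sub (suc K) (t * (nat 108 * θ (θ (θ v)) + nat 162 * θ (θ v) + nat 78 * θ v + nat 12 * v))
          ≈⟨ sub-t K _ ⟩
        ζ * sub K (nat 108 * θ (θ (θ v)) + nat 162 * θ (θ v) + nat 78 * θ v + nat 12 * v)
          ≈⟨ *-congˡ {ζ} (trans (sub-+ K (nat 108 * θ (θ (θ v)) + nat 162 * θ (θ v) + nat 78 * θ v) (nat 12 * v)) (+-cong
               (trans (sub-+ K (nat 108 * θ (θ (θ v)) + nat 162 * θ (θ v)) (nat 78 * θ v)) (+-cong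
               (trans (sub-+ K (nat 108 * θ (θ (θ v))) (nat 162 * θ (θ v))) (+-cong (term 108 (θ (θ (θ v))) dv₃) (term 162 (θ (θ v)) dv₂))) (term 78 (θ v) dv₁))) (term 12 v v-deg))) ⟩
        ζ * (nat 108 * S (θ (θ (θ v))) + nat 162 * S (θ (θ v)) + nat 78 * S (θ v) + nat 12 * S v) ∎
        where
        dv₁ = Deg≤-θ {v} v-deg
        dv₂ = Deg≤-θ {θ v} dv₁
        dv₃ = Deg≤-θ {θ (θ v)} dv₂
        term : ∀ k w → Deg≤ w K → sub K (nat k * w) ≈ nat k * S w
        term k w h = trans (sub-nat K k w) (*-congˡ {nat k} (sym (sub-pad K {w} h)))

      -- Multiply the equation of v at ζ by E³, using E³ ζ = t²; the third derivative then has the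
      -- coefficient E³ - 108 t² = (1 - 16 t) (1 + 2 t)².
      closed : (1# - nat 16 * t) * ((1# + nat 2 * t) * (1# + nat 2 * t)) * Y₃ ≈ t * t * (nat 162 * Y₂ + nat 78 * Y₁ + nat 12 * Y)
      closed = begin
        (1# - nat 16 * t) * ((1# + nat 2 * t) * (1# + nat 2 * t)) * (W * s₃)
          ≈⟨ solve 3 (λ t W s → (:1 :- κ 16 :* t) :* ((:1 :+ κ 2 :* t) :* (:1 :+ κ 2 :* t)) :* (W :* s)
               := W :* ((:1 :- κ 4 :* t) :* (:1 :- κ 4 :* t) :* (:1 :- κ 4 :* t) :* s :- t :* t :* (κ 108 :* s))) t W s₃ ⟩
        W * (E * E * E * s₃ - t * t * (nat 108 * s₃))
          ≈⟨ *-congˡ {W} (+-congʳ (trans (*-congˡ {E * E * E} closure) (trans (sym (*-assoc (E * E * E) ζ _)) (*-congʳ E³ζ)))) ⟩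
        W * (t * t * (nat 108 * s₃ + nat 162 * S (θ (θ v)) + nat 78 * S (θ v) + nat 12 * S v) - t * t * (nat 108 * s₃))
          ≈⟨ solve 6 (λ W t s₃ s₂ s₁ s → W :* (t :* t :* (κ 108 :* s₃ :+ κ 162 :* s₂ :+ κ 78 :* s₁ :+ κ 12 :* s) :- t :* t :* (κ 108 :* s₃))
               := t :* t :* (κ 162 :* (W :* s₂) :+ κ 78 :* (W :* s₁) :+ κ 12 :* (W :* s))) W t s₃ (S (θ (θ v))) (S (θ v)) (S v) ⟩
        t * t * (nat 162 * Y₂ + nat 78 * Y₁ + nat 12 * Y) ∎
        where s₃ = S (θ (θ (θ v)))

      L-Y : Operator.apply L Y ≈ 0#
      L-Y = cancel-const-one (R.trans (R.*-cong E0 E0) (R.*-identityˡ _)) (cancel+ (solve 11 (λ t Y Y₁ Y₂ Y₃ a b c d₁ e d₂ →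
          let E = :1 :- κ 4 :* t ; k = κ 2 :+ κ 4 :* t ; g = :1 :- κ 16 :* t
              -- The multipliers eliminate the derivatives by the chain relations, the highest ones
              -- first; m₇ is forced by 1 - 20 t + 64 t² = (1 - 4 t) (1 - 16 t).
              m₁ = κ 8 :* (:1 :+ κ 2 :* t)
              m₂ = g :* (k :* k)
              m₃ = E :* g :* (κ 8 :* t) :- κ 18 :* t :* k :+ κ 8 :* t :* g :* k
              m₄ = g :* k :* E
              m₅ = :- (κ 18 :* t :* E)
              m₆ = :- (κ 6 :* t :* E) :- κ 144 :* (t :* t)
              m₇ = g :* (E :* E)
          in E :* E :* ((:1 :- κ 20 :* t :+ κ 64 :* (t :* t)) :* c :+ (κ 192 :* (t :* t) :- κ 30 :* t) :* b :+ (κ 192 :* (t :* t) :- κ 18 :* t) :* a :+ (κ 64 :* (t :* t) :- κ 4 :* t) :* Y)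
             :+ (m₇ :* (κ 12 :* (t :* a) :+ κ 12 :* (t :* b) :+ κ 4 :* (t :* Y₁) :+ κ 8 :* (t :* d₁) :+ k :* e :+ κ 4 :* (t :* Y))
               :+ m₅ :* (κ 4 :* t :* a :+ (κ 4 :* t :* Y₁ :+ k :* d₁) :+ κ 4 :* (t :* Y :+ t :* a))
               :+ m₄ :* (κ 4 :* t :* d₁ :+ (κ 4 :* t :* Y₂ :+ k :* d₂) :+ κ 4 :* (t :* Y₁ :+ t :* d₁))
               :+ m₃ :* (k :* Y₂ :+ κ 4 :* (t :* Y₁)) :+ m₂ :* (k :* Y₃ :+ κ 4 :* (t :* Y₂)) :+ m₆ :* (k :* Y₁ :+ κ 4 :* (t :* Y))
               :+ m₁ :* (t :* t :* (κ 162 :* Y₂ :+ κ 78 :* Y₁ :+ κ 12 :* Y)))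
            := :0 :+ (m₇ :* (E :* c) :+ m₅ :* (E :* b) :+ m₄ :* (E :* e) :+ m₃ :* (E :* d₁) :+ m₂ :* (E :* d₂) :+ m₆ :* (E :* a) :+ m₁ :* (g :* ((:1 :+ κ 2 :* t) :* (:1 :+ κ 2 :* t)) :* Y₃))) t Y Y₁ Y₂ Y₃ (θ Y) (θ (θ Y)) (θ (θ (θ Y))) (θ Y₁) (θ (θ Y₁)) (θ Y₂))
        (+-cong (+-cong (+-cong (+-cong (+-cong (+-cong (*-congˡ {_} (sym chain″)) (*-congˡ {_} (sym (chain′ v)))) (*-congˡ {_} (sym (chain′ (θ v)))))
          (*-congˡ {_} (sym (chain (θ v))))) (*-congˡ {_} (sym (chain (θ (θ v)))))) (*-congˡ {_} (sym (chain v)))) (*-congˡ {_} (sym closed))))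

      W0 : W 0 R.≈ R.1#
      W0 = R.trans (^-zero E e) (R.trans (R.^-congˡ e E0) (one-^ e))

    domb : ∀ {D} → Operator.apply L D ≈ 0# → D 0 R.≈ v 0 → ∀ k → k ℕ.< p → D k R.≈ (W * sub K v) k
    domb {D} LD D0 k k<p = R.trans (unique L unip LD L-Y
      (R.trans D0 (R.sym (R.trans (R.*-cong W0 (R.trans (R.+-congˡ (R.trans (R.*-congʳ (R.zeroˡ _)) (R.zeroˡ _))) (R.+-identityʳ _))) (R.*-identityˡ _)))) k k<p)
      (*-congˡ {W} (sub-pad K {v} v-deg) k)

    private
      E³ : Series
      E³ = E * E * E

      -- E^(3d) f(ζ) as the sum of the f_k t^(2k) E^(3(d-k)). No inverse of E is left, so it can be
      -- evaluated at t = 1.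
      cleared : ℕ → Series → Series
      cleared zero f = C (f 0)
      cleared (suc d) f = C (f 0) * E³ ^ suc d + t * t * cleared d (tl f)

      cleared-eq : ∀ d f → E³ ^ d * sub d f ≈ cleared d f
      cleared-eq zero f = *-identityˡ _
      cleared-eq (suc d) f = begin
        E³ * E³ ^ d * (C (f 0) + ζ * sub d (tl f))
          ≈⟨ solve 5 (λ e x c z s → e :* x :* (c :+ z :* s) := c :* (e :* x) :+ e :* z :* (x :* s)) E³ (E³ ^ d) (C (f 0)) ζ (sub d (tl f)) ⟩
        C (f 0) * E³ ^ suc d + E³ * ζ * (E³ ^ d * sub d (tl f))
          ≈⟨ +-congˡ {C (f 0) * E³ ^ suc d} (*-cong E³ζ (cleared-eq d (tl f))) ⟩
        cleared (suc d) f ∎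

      E-deg : Deg≤ E 1
      E-deg = Deg≤-+ {1#} (Deg≤-mono {1#} z≤n Deg≤-𝟏) (Deg≤-neg {nat 4 * t} (Deg≤-* {nat 4} {t} 0 1 (Deg≤-cong {C (R.nat 4)} (C-nat 4) (Deg≤-C (R.nat 4))) Deg≤-t))

      E³-deg : Deg≤ E³ 3
      E³-deg = Deg≤-* {E * E} {E} 2 1 (Deg≤-* {E} {E} 1 1 E-deg E-deg) E-deg

      tt-deg : Deg≤ (t * t) 2
      tt-deg = Deg≤-* {t} {t} 1 1 Deg≤-t Deg≤-t

      cleared-deg : ∀ d f → Deg≤ (cleared d f) (d ℕ.* 3)
      cleared-deg zero f = Deg≤-C (f 0)
      cleared-deg (suc d) f = Deg≤-+ {C (f 0) * E³ ^ suc d} (Deg≤-* {C (f 0)} {E³ ^ suc d} 0 (suc d ℕ.* 3) (Deg≤-C (f 0)) (Deg≤-^ {E³} (suc d) E³-deg))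
        (Deg≤-mono {t * t * cleared d (tl f)} (ℕₚ.n≤1+n _) (Deg≤-* {t * t} {cleared d (tl f)} 2 (d ℕ.* 3) tt-deg (cleared-deg d (tl f))))

      open Evaluation R.1#

      -3# : R.Carrier
      -3# = R.- R.nat 3

      ev-E : ev 1 E R.≈ -3#
      ev-E = R.trans (R.+-cong E0 (R.trans (R.*-identityˡ _) (R.trans (R.+-identityˡ _) (R.-‿cong (R.trans (*-congʳ {t} (sym (C-nat 4)) 1) (R.trans (C-⊛ (R.nat 4) t 1) (R.*-identityʳ _)))))))
        (R.solve 0 (:1 :- κ 4 := :- κ 3))

      ev-E³ : ev 3 E³ R.≈ -3# R.* -3# R.* -3#
      ev-E³ = R.trans (ev-* 2 1 {E * E} {E} (Deg≤-* {E} {E} 1 1 E-deg E-deg) E-deg) (R.*-cong (R.trans (ev-* 1 1 {E} {E} E-deg E-deg) (R.*-cong ev-E ev-E)) ev-E)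

      ev-tt : ev 2 (t * t) R.≈ R.1#
      ev-tt = R.trans (ev-* 1 1 {t} {t} Deg≤-t Deg≤-t) (R.solve 0 ((:0 :+ :1 :* :1) :* (:0 :+ :1 :* :1) := :1))

    module _ (z₀ : R.Carrier) (z₀-eq : -3# R.* -3# R.* -3# R.* z₀ R.≈ R.1#) where
      private
        module Z = Evaluation z₀
        c₀ = -3# R.* -3# R.* -3#

        ev-cleared : ∀ d f → ev (d ℕ.* 3) (cleared d f) R.≈ c₀ R.^ d R.* Z.ev d f
        ev-cleared zero f = R.sym (R.*-identityˡ _)
        ev-cleared (suc d) f = R.begin
          ev (suc d ℕ.* 3) (C (f 0) * E³ ^ suc d + t * t * cleared d (tl f))
            R.≈⟨ ev-+ (suc d ℕ.* 3) (C (f 0) * E³ ^ suc d) (t * t * cleared d (tl f)) ⟩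
          ev (0 ℕ.+ suc d ℕ.* 3) (C (f 0) * E³ ^ suc d) R.+ ev (suc (2 ℕ.+ d ℕ.* 3)) (t * t * cleared d (tl f))
            R.≈⟨ R.+-cong (R.trans (ev-* 0 (suc d ℕ.* 3) {C (f 0)} {E³ ^ suc d} (Deg≤-C (f 0)) (Deg≤-^ {E³} (suc d) E³-deg)) (R.*-congˡ (R.trans (ev-^ R.1# 3 (suc d) {E³} E³-deg) (R.^-congˡ (suc d) ev-E³))))
                 (R.trans (ev-pad 1 (2 ℕ.+ d ℕ.* 3) {t * t * cleared d (tl f)} (Deg≤-* {t * t} {cleared d (tl f)} 2 (d ℕ.* 3) tt-deg (cleared-deg d (tl f))))
                   (R.trans (ev-* 2 (d ℕ.* 3) {t * t} {cleared d (tl f)} tt-deg (cleared-deg d (tl f))) (R.*-cong ev-tt (ev-cleared d (tl f))))) ⟩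
          f 0 R.* (c₀ R.* c₀ R.^ d) R.+ R.1# R.* (c₀ R.^ d R.* Z.ev d (tl f))
            R.≈⟨ R.+-congˡ (R.*-congʳ (R.sym z₀-eq)) ⟩
          f 0 R.* (c₀ R.* c₀ R.^ d) R.+ c₀ R.* z₀ R.* (c₀ R.^ d R.* Z.ev d (tl f))
            R.≈⟨ R.solve 5 (λ f c x z e → f :* (c :* x) :+ c :* z :* (x :* e) := c :* x :* (f :+ z :* e)) (f 0) c₀ (c₀ R.^ d) z₀ (Z.ev d (tl f)) ⟩
          c₀ R.* c₀ R.^ d R.* Z.ev (suc d) f R.∎

      -- As e = r + 3 K, the product of W and v(ζ) is a polynomial of degree at most e. Its
      -- coefficients up to e = p - 1 are those of D, and at t = 1 one has E = -3 and ζ = -1/27.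
      domb-sum : ∀ {D} → Operator.apply L D ≈ 0# → D 0 R.≈ v 0 → ev e D R.≈ -3# R.^ e R.* Z.ev K v
      domb-sum {D} LD D0 = R.begin
        ev e D
          R.≈⟨ ev-agree e (λ k k≤e → domb LD D0 k (≡.subst (suc k ℕ.≤_) e+1≡p (s≤s k≤e))) ⟩
        ev e (W * sub K v)
          R.≈⟨ ev-cong e shape ⟩
        ev e (E ^ r * cleared K v)
          R.≡⟨ ≡.cong (λ k → ev k (E ^ r * cleared K v)) (≡.trans e≡ (≡.cong (ℕ._+ K ℕ.* 3) (≡.sym (ℕₚ.*-identityʳ r)))) ⟩
        ev (r ℕ.* 1 ℕ.+ K ℕ.* 3) (E ^ r * cleared K v)
          R.≈⟨ ev-* (r ℕ.* 1) (K ℕ.* 3) {E ^ r} {cleared K v} (Deg≤-^ {E} r E-deg) (cleared-deg K v) ⟩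
        ev (r ℕ.* 1) (E ^ r) R.* ev (K ℕ.* 3) (cleared K v)
          R.≈⟨ R.*-cong (R.trans (ev-^ R.1# 1 r {E} E-deg) (R.^-congˡ r ev-E)) (ev-cleared K v) ⟩
        -3# R.^ r R.* (c₀ R.^ K R.* Z.ev K v)
          R.≈⟨ R.trans (R.sym (R.*-assoc _ _ _)) (R.*-congʳ (R.*-congˡ (R.trans (R.^-congˡ K (R.solve 1 (λ a → a :* a :* a := a :^ 3) -3#)) (R.trans (R.^-assocʳ -3# 3 K) (R.reflexive (≡.cong (-3# R.^_) (ℕₚ.*-comm 3 K))))))) ⟩
        -3# R.^ r R.* -3# R.^ (K ℕ.* 3) R.* Z.ev K v
          R.≈⟨ R.*-congʳ (R.trans (R.sym (R.^-homo-* -3# r (K ℕ.* 3))) (R.reflexive (≡.cong (-3# R.^_) (≡.sym e≡)))) ⟩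
        -3# R.^ e R.* Z.ev K v R.∎
        where
        E-power : ∀ k → E ^ (k ℕ.* 3) ≈ E³ ^ k
        E-power k = trans (reflexive (≡.cong (E ^_) (ℕₚ.*-comm k 3))) (trans (sym (^-assocʳ E 3 k)) (^-congˡ k (solve 1 (λ a → a :^ 3 := a :* a :* a) E)))
        shape : W * sub K v ≈ E ^ r * cleared K v
        shape = begin
          E ^ e * sub K v ≡⟨ ≡.cong (λ k → E ^ k * sub K v) e≡ ⟩
          E ^ (r ℕ.+ K ℕ.* 3) * sub K v ≈⟨ *-congʳ (trans (^-homo-* E r (K ℕ.* 3)) (*-congˡ {E ^ r} (E-power K))) ⟩
          E ^ r * E³ ^ K * sub K v ≈⟨ *-assoc (E ^ r) (E³ ^ K) _ ⟩
          E ^ r * (E³ ^ K * sub K v) ≈⟨ *-congˡ {E ^ r} (cleared-eq K v) ⟩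
          E ^ r * cleared K v ∎

-- Binomial coefficients

module Binomials where
 open import Data.Nat using (_∸_)
 open import Data.Nat.Combinatorics using (_C_; nCk≡nC[n∸k]; nCk+nC[k+1]≡[n+1]C[k+1]; k>n⇒nCk≡0; nCn≡1)

 nC0≡1 : ∀ n → n C 0 ≡ 1
 nC0≡1 n = ≡.trans (nCk≡nC[n∸k] {0} {n} z≤n) (nCn≡1 n)

 absorption : ∀ n k → suc k ℕ.* (suc n C suc k) ≡ suc n ℕ.* (n C k)
 absorption zero zero = ≡.refl
 absorption zero (suc k) = ≡.trans (≡.cong (suc (suc k) ℕ.*_) (k>n⇒nCk≡0 {1} {suc (suc k)} (s≤s (s≤s z≤n))))
   (≡.trans (ℕₚ.*-zeroʳ (suc (suc k))) (≡.sym (≡.cong (1 ℕ.*_) (k>n⇒nCk≡0 {0} {suc k} (s≤s z≤n)))))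
 absorption (suc n) zero = ≡.trans (ℕₚ.*-identityˡ _) (≡.trans (≡.sym (nCk+nC[k+1]≡[n+1]C[k+1] (suc n) 0))
   (≡.trans (≡.cong₂ ℕ._+_ (nC0≡1 (suc n)) (≡.trans (≡.sym (ℕₚ.*-identityˡ _)) (≡.trans (absorption n 0) (≡.cong (suc n ℕ.*_) (nC0≡1 n)))))
     (≡.trans (≡.cong suc (ℕₚ.*-identityʳ (suc n))) (≡.trans (≡.sym (ℕₚ.*-identityʳ (suc (suc n)))) (≡.cong (suc (suc n) ℕ.*_) (≡.sym (nC0≡1 (suc n))))))))
 absorption (suc n) (suc k) = proof
   where
   a = n C k
   b = n C suc k
   c = suc n C suc k
   d = suc n C suc (suc k)
   open ≡.≡-Reasoning
   proof : suc (suc k) ℕ.* (suc (suc n) C suc (suc k)) ≡ suc (suc n) ℕ.* c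
   proof = begin
     suc (suc k) ℕ.* (suc (suc n) C suc (suc k))
       ≡⟨ ≡.cong (suc (suc k) ℕ.*_) (≡.sym (nCk+nC[k+1]≡[n+1]C[k+1] (suc n) (suc k))) ⟩
     suc (suc k) ℕ.* (c ℕ.+ d)
       ≡⟨ N.solve 3 (λ k c d → (N.con 2 N.:+ k) N.:* (c N.:+ d) N.:= (N.con 1 N.:+ k) N.:* c N.:+ (c N.:+ (N.con 2 N.:+ k) N.:* d)) ≡.refl k c d ⟩
     suc k ℕ.* c ℕ.+ (c ℕ.+ suc (suc k) ℕ.* d)
       ≡⟨ ≡.cong₂ (λ u v → u ℕ.+ (c ℕ.+ v)) (absorption n k) (absorption n (suc k)) ⟩
     suc n ℕ.* a ℕ.+ (c ℕ.+ suc n ℕ.* b)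
       ≡⟨ N.solve 4 (λ n a b c → (N.con 1 N.:+ n) N.:* a N.:+ (c N.:+ (N.con 1 N.:+ n) N.:* b) N.:= c N.:+ (N.con 1 N.:+ n) N.:* (a N.:+ b)) ≡.refl n a b c ⟩
     c ℕ.+ suc n ℕ.* (a ℕ.+ b)
       ≡⟨ ≡.cong (λ u → c ℕ.+ suc n ℕ.* u) (nCk+nC[k+1]≡[n+1]C[k+1] n k) ⟩
     suc (suc n) ℕ.* c ∎

 ratio : ∀ n k → suc k ℕ.* (n C suc k) ℕ.+ suc k ℕ.* (n C k) ≡ suc n ℕ.* (n C k)
 ratio n k = ≡.trans (≡.trans (≡.sym (ℕₚ.*-distribˡ-+ (suc k) (n C suc k) (n C k)))
   (≡.cong (suc k ℕ.*_) (≡.trans (ℕₚ.+-comm (n C suc k) (n C k)) (nCk+nC[k+1]≡[n+1]C[k+1] n k)))) (absorption n k)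

 central : ℕ → ℕ
 central k = (2 ℕ.* k) C k

 central-rec : ∀ k → suc k ℕ.* central (suc k) ≡ 2 ℕ.* (2 ℕ.* k ℕ.+ 1) ℕ.* central k
 central-rec k = ℕₚ.*-cancelˡ-≡ _ _ (suc k) (begin
   suc k ℕ.* (suc k ℕ.* central (suc k))
     ≡⟨ ≡.cong (λ j → suc k ℕ.* (suc k ℕ.* (j C suc k))) 2[1+k] ⟩
   suc k ℕ.* (suc k ℕ.* (suc N C suc k))
     ≡⟨ ≡.cong (suc k ℕ.*_) (absorption N k) ⟩
   suc k ℕ.* (suc N ℕ.* (N C k))
     ≡⟨ ≡.cong (λ c → suc k ℕ.* (suc N ℕ.* c)) (≡.trans (nCk≡nC[n∸k] {k} {N} (ℕₚ.m≤n⇒m≤1+n (ℕₚ.m≤m+n k (k ℕ.+ 0)))) (≡.cong (N C_) N∸k)) ⟩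
   suc k ℕ.* (suc N ℕ.* (N C suc k))
     ≡⟨ N.solve 3 (λ k N c → k N.:* (N N.:* c) N.:= N N.:* (k N.:* c)) ≡.refl (suc k) (suc N) (N C suc k) ⟩
   suc N ℕ.* (suc k ℕ.* (N C suc k))
     ≡⟨ ≡.cong (suc N ℕ.*_) (absorption (2 ℕ.* k) k) ⟩
   suc N ℕ.* (N ℕ.* central k)
     ≡⟨ N.solve 2 (λ k c → (N.con 2 N.:+ N.con 2 N.:* k) N.:* ((N.con 1 N.:+ N.con 2 N.:* k) N.:* c)
          N.:= (N.con 1 N.:+ k) N.:* (N.con 2 N.:* (N.con 2 N.:* k N.:+ N.con 1) N.:* c)) ≡.refl k (central k) ⟩
   suc k ℕ.* (2 ℕ.* (2 ℕ.* k ℕ.+ 1) ℕ.* central k) ∎)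
   where
   open ≡.≡-Reasoning
   N = suc (2 ℕ.* k)
   2[1+k] : 2 ℕ.* suc k ≡ suc N
   2[1+k] = ≡.cong suc (ℕₚ.+-suc k (k ℕ.+ 0))
   N∸k : N ∸ k ≡ suc k
   N∸k = ≡.trans (≡.cong (_∸ k) (≡.trans (≡.cong (λ j → suc (k ℕ.+ j)) (ℕₚ.+-identityʳ k)) (≡.sym (ℕₚ.+-suc k k)))) (ℕₚ.m+n∸m≡n k (suc k))

-- The recurrence of the Domb numbers

module DombRec where
 open import Defs
 open import Data.Integer as ℤ using (ℤ; +_)
 open import Data.Nat using (_∸_)
 open import Data.Nat.Combinatorics using (_C_; nCk≡nC[n∸k]; nCk+nC[k+1]≡[n+1]C[k+1]; k>n⇒nCk≡0; nCn≡1)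
 open Binomials
 open RingKit ℤₚ.+-*-commutativeRing

 Sequence : Set
 Sequence = ℕ → ℤ

 Σ≤ : ℕ → Sequence → ℤ
 Σ≤ zero f = f 0
 Σ≤ (suc n) f = Σ≤ n f + f (suc n)

 Σ≤-cong : ∀ n {f g : Sequence} → (∀ k → k ℕ.≤ n → f k ≡ g k) → Σ≤ n f ≡ Σ≤ n g
 Σ≤-cong zero h = h 0 z≤n
 Σ≤-cong (suc n) h = ≡.cong₂ _+_ (Σ≤-cong n (λ k k≤n → h k (ℕₚ.m≤n⇒m≤1+n k≤n))) (h (suc n) ℕₚ.≤-refl)

 Σ≤-+ : ∀ n f g → Σ≤ n (λ k → f k + g k) ≡ Σ≤ n f + Σ≤ n g
 Σ≤-+ zero f g = ≡.refl
 Σ≤-+ (suc n) f g = ≡.trans (≡.cong (_+ (f (suc n) + g (suc n))) (Σ≤-+ n f g))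
   (solve 4 (λ a b c d → (a :+ b) :+ (c :+ d) := (a :+ c) :+ (b :+ d)) (Σ≤ n f) (Σ≤ n g) (f (suc n)) (g (suc n)))

 Σ≤-* : ∀ n c f → Σ≤ n (λ k → c * f k) ≡ c * Σ≤ n f
 Σ≤-* zero c f = ≡.refl
 Σ≤-* (suc n) c f = ≡.trans (≡.cong (_+ c * f (suc n)) (Σ≤-* n c f)) (≡.sym (distribˡ c (Σ≤ n f) (f (suc n))))

 Σ≤-head : ∀ n f → Σ≤ (suc n) f ≡ f 0 + Σ≤ n (λ k → f (suc k))
 Σ≤-head zero f = ≡.refl
 Σ≤-head (suc n) f = ≡.trans (≡.cong (_+ f (suc (suc n))) (Σ≤-head n f)) (+-assoc (f 0) _ _)

 Σ≤-reverse : ∀ n f → Σ≤ n f ≡ Σ≤ n (λ k → f (n ∸ k))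
 Σ≤-reverse zero f = ≡.refl
 Σ≤-reverse (suc n) f = ≡.trans (≡.cong (_+ f (suc n)) (Σ≤-reverse n f)) (≡.trans (+-comm (Σ≤ n (λ k → f (n ∸ k))) (f (suc n))) (≡.sym (Σ≤-head n (λ k → f (suc n ∸ k)))))

 -- The product corresponding to that of the generating functions Σ f k tᵏ / (k!)².
 infixl 7 _⋆_
 _⋆_ : Sequence → Sequence → Sequence
 (f ⋆ g) n = Σ≤ n (λ k → + (n C k) * + (n C k) * (f k * g (n ∸ k)))

 ⋆-comm : ∀ f g n → (f ⋆ g) n ≡ (g ⋆ f) n
 ⋆-comm f g n = ≡.trans (Σ≤-reverse n _) (Σ≤-cong n (λ k k≤n → ≡.cong₂ _*_
   (≡.cong₂ _*_ (≡.cong +_ (≡.sym (nCk≡nC[n∸k] k≤n))) (≡.cong +_ (≡.sym (nCk≡nC[n∸k] k≤n))))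
   (≡.trans (≡.cong (f (n ∸ k) *_) (≡.cong g (ℕₚ.m∸[m∸n]≡n k≤n))) (*-comm (f (n ∸ k)) (g k)))))

 ⋆-congʳ : ∀ f {g h} → (∀ k → g k ≡ h k) → ∀ n → (f ⋆ g) n ≡ (f ⋆ h) n
 ⋆-congʳ f e n = Σ≤-cong n (λ k _ → ≡.cong (λ x → + (n C k) * + (n C k) * (f k * x)) (e (n ∸ k)))

 ⋆-linearʳ : ∀ f c d g h n → (f ⋆ (λ k → c * g k + d * h k)) n ≡ c * (f ⋆ g) n + d * (f ⋆ h) n
 ⋆-linearʳ f c d g h n = ≡.trans (Σ≤-cong n (λ k _ → solve 6 (λ b x c y d z → b :* (x :* (c :* y :+ d :* z)) := c :* (b :* (x :* y)) :+ d :* (b :* (x :* z))) (+ (n C k) * + (n C k)) (f k) c (g (n ∸ k)) d (h (n ∸ k))))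
   (≡.trans (Σ≤-+ n _ _) (≡.cong₂ _+_ (Σ≤-* n c _) (Σ≤-* n d _)))

 -- T is multiplication by t: passing from 1 / (n!)² to 1 / ((n + 1)!)² accounts for the factor (n +
 -- 1)².
 θ T : Sequence → Sequence
 θ f n = + n * f n
 T f zero = + 0
 T f (suc n) = + suc n * + suc n * f n

 ⋆-leibniz : ∀ f g n → + n * (f ⋆ g) n ≡ (θ f ⋆ g) n + (f ⋆ θ g) n
 ⋆-leibniz f g n = ≡.trans (≡.sym (Σ≤-* n (+ n) _)) (≡.trans (Σ≤-cong n (λ k k≤n → ≡.trans
     (≡.cong (_* (+ (n C k) * + (n C k) * (f k * g (n ∸ k)))) (≡.trans (≡.cong +_ (≡.sym (ℕₚ.m+[n∸m]≡n k≤n))) (ℤₚ.pos-+ k (n ∸ k))))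
     (solve 5 (λ b k j x y → (k :+ j) :* (b :* (x :* y)) := b :* (k :* x :* y) :+ b :* (x :* (j :* y))) (+ (n C k) * + (n C k)) (+ k) (+ (n ∸ k)) (f k) (g (n ∸ k)))))
   (Σ≤-+ n _ _))

 T-⋆ : ∀ f g n → (T f ⋆ g) n ≡ T (f ⋆ g) n
 T-⋆ f g zero = *-assoc (+ 1) (+ 1) (+ 0 * g 0)
 T-⋆ f g (suc n) = ≡.trans (Σ≤-head n _) (≡.trans (≡.cong (_+ rest) (≡.trans (≡.cong (b₀ *_) (ℤₚ.*-zeroˡ (g (suc n)))) (ℤₚ.*-zeroʳ b₀)))
   (≡.trans (ℤₚ.+-identityˡ rest) (≡.trans (Σ≤-cong n (λ k _ → term k)) (Σ≤-* n (+ suc n * + suc n) _))))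
   where
   b₀ = + (suc n C 0) * + (suc n C 0)
   rest = Σ≤ n (λ k → + (suc n C suc k) * + (suc n C suc k) * (T f (suc k) * g (n ∸ k)))
   term : ∀ k → + (suc n C suc k) * + (suc n C suc k) * (T f (suc k) * g (n ∸ k)) ≡ + suc n * + suc n * (+ (n C k) * + (n C k) * (f k * g (n ∸ k)))
   term k = ≡.trans (solve 4 (λ b s x y → b :* b :* (s :* s :* x :* y) := (s :* b) :* (s :* b) :* (x :* y)) (+ (suc n C suc k)) (+ suc k) (f k) (g (n ∸ k)))
     (≡.trans (≡.cong (λ z → z * z * (f k * g (n ∸ k))) (≡.trans (≡.sym (ℤₚ.pos-* (suc k) (suc n C suc k))) (≡.trans (≡.cong +_ (absorption n k)) (ℤₚ.pos-* (suc n) (n C k)))))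
       (solve 4 (λ b s x y → (s :* b) :* (s :* b) :* (x :* y) := s :* s :* (b :* b :* (x :* y))) (+ (n C k)) (+ suc n) (f k) (g (n ∸ k))))

 -- With F the sum of all tᵏ / (k!)², a Bessel function, J is the sequence of F², so the Domb
 -- numbers J ⋆ J are that of F⁴.
 J J₁ J₂ : Sequence
 J k = + central k
 J₁ = θ J
 J₂ = θ J₁

 -- The symmetric square of Bessel's equation θ² F = t F.
 J-ode : ∀ n → θ J₂ n ≡ T (λ k → + 4 * J₁ k + + 2 * J k) n
 J-ode zero = ≡.refl
 J-ode (suc k) = ≡.trans (solve 2 (λ s j → s :* (s :* (s :* j)) := s :* s :* (s :* j)) (+ suc k) (J (suc k)))
   (≡.cong (+ suc k * + suc k *_) (≡.trans (≡.sym (ℤₚ.pos-* (suc k) (central (suc k)))) (≡.trans (≡.cong +_ (central-rec k))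
     (≡.trans (≡.cong +_ (N.solve 2 (λ k c → N.con 2 N.:* (N.con 2 N.:* k N.:+ N.con 1) N.:* c N.:= N.con 4 N.:* (k N.:* c) N.:+ N.con 2 N.:* c) ≡.refl k (central k)))
       (≡.trans (ℤₚ.pos-+ (4 ℕ.* (k ℕ.* central k)) (2 ℕ.* central k)) (≡.cong₂ _+_ (≡.trans (ℤₚ.pos-* 4 (k ℕ.* central k)) (≡.cong (+ 4 *_) (ℤₚ.pos-* k (central k)))) (ℤₚ.pos-* 2 (central k))))))))

 a b c d e q : Sequence
 a = J ⋆ J
 b = J ⋆ J₁
 c = J ⋆ J₂
 d = J₁ ⋆ J₂
 e = J₂ ⋆ J₂
 q = J₁ ⋆ J₁

 private
   times-θJ₂ : ∀ f n → (f ⋆ θ J₂) n ≡ T (λ k → + 4 * (f ⋆ J₁) k + + 2 * (f ⋆ J) k) n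
   times-θJ₂ f n = ≡.trans (⋆-congʳ f J-ode n) (≡.trans (⋆-comm f (T lin) n) (≡.trans (T-⋆ lin f n) (T-cong n)))
     where
     lin : Sequence
     lin k = + 4 * J₁ k + + 2 * J k
     T-cong : ∀ n → T (lin ⋆ f) n ≡ T (λ k → + 4 * (f ⋆ J₁) k + + 2 * (f ⋆ J) k) n
     T-cong zero = ≡.refl
     T-cong (suc k) = ≡.cong (+ suc k * + suc k *_) (≡.trans (⋆-comm lin f k) (⋆-linearʳ f (+ 4) (+ 2) J₁ J k))

   θa : ∀ n → + n * a n ≡ + 2 * b n
   θa n = ≡.trans (⋆-leibniz J J n) (≡.trans (≡.cong (_+ b n) (⋆-comm J₁ J n)) (solve 1 (λ b → b :+ b := κ 2 :* b) (b n)))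

   θq : ∀ n → + n * q n ≡ + 2 * d n
   θq n = ≡.trans (⋆-leibniz J₁ J₁ n) (≡.trans (≡.cong (_+ d n) (⋆-comm J₂ J₁ n)) (solve 1 (λ b → b :+ b := κ 2 :* b) (d n)))

   θb : ∀ n → + n * b n ≡ q n + c n
   θb = ⋆-leibniz J J₁

   θc : ∀ n → + n * c n ≡ d n + T (λ k → + 4 * b k + + 2 * a k) n
   θc n = ≡.trans (⋆-leibniz J J₂ n) (≡.cong (λ z → d n + z) (times-θJ₂ J n))

   -- the first integral of the symmetric square operator annihilating J
   q-eq : ∀ k → q (suc k) ≡ + 2 * c (suc k) - + 4 * (+ suc k * + suc k * a k)
   q-eq k = ℤₚ.*-cancelˡ-≡ (+ suc k) (q (suc k)) _ (cancel+
     (solve 6 (λ k q c d b a → let s = :1 :+ k in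
         s :* q :+ (κ 2 :* d :+ κ 2 :* (s :* c) :+ κ 4 :* (s :* s) :* (κ 2 :* b))
         := s :* (κ 2 :* c :- κ 4 :* (s :* s :* a)) :+ (s :* q :+ κ 2 :* (d :+ s :* s :* (κ 4 :* b :+ κ 2 :* a)) :+ κ 4 :* (s :* s) :* (k :* a)))
         (+ k) (q (suc k)) (c (suc k)) (d (suc k)) (b k) (a k))
     (≡.cong₂ _+_ (≡.cong₂ _+_ (≡.sym (θq (suc k))) (≡.cong (+ 2 *_) (θc (suc k)))) (≡.cong (+ 4 * (+ suc k * + suc k) *_) (≡.sym (θa k)))))

   θb′ : ∀ k → + suc k * b (suc k) ≡ + 3 * c (suc k) - + 4 * (+ suc k * + suc k * a k)
   θb′ k = ≡.trans (θb (suc k)) (≡.trans (≡.cong (_+ c (suc k)) (q-eq k))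
     (solve 2 (λ c x → (κ 2 :* c :- x) :+ c := κ 3 :* c :- x) (c (suc k)) (+ 4 * (+ suc k * + suc k * a k))))

   θd : ∀ k → + suc (suc k) * d (suc (suc k)) ≡ e (suc (suc k)) + + suc (suc k) * + suc (suc k) * (+ 8 * c (suc k) + + 2 * b (suc k) - + 16 * (+ suc k * + suc k * a k))
   θd k = ≡.trans (⋆-leibniz J₁ J₂ (suc (suc k))) (≡.cong (λ z → e (suc (suc k)) + z) (≡.trans (times-θJ₂ J₁ (suc (suc k)))
     (≡.cong (+ suc (suc k) * + suc (suc k) *_) (≡.trans (≡.cong₂ (λ x y → + 4 * x + + 2 * y) (q-eq k) (⋆-comm J₁ J (suc k)))
       (solve 3 (λ c b x → κ 4 :* (κ 2 :* c :- κ 4 :* x) :+ κ 2 :* b := κ 8 :* c :+ κ 2 :* b :- κ 16 :* x) (c (suc k)) (b (suc k)) (+ suc k * + suc k * a k))))))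

   θe : ∀ k → + suc k * e (suc k) ≡ + suc k * + suc k * (+ 8 * d k + + 4 * c k)
   θe k = ≡.trans (⋆-leibniz J₂ J₂ (suc k)) (≡.trans (≡.cong (_+ (J₂ ⋆ θ J₂) (suc k)) (⋆-comm (θ J₂) J₂ (suc k)))
     (≡.trans (≡.cong (λ x → x + x) (≡.trans (times-θJ₂ J₂ (suc k)) (≡.cong (+ suc k * + suc k *_) (≡.cong₂ (λ x y → + 4 * x + + 2 * y) (⋆-comm J₂ J₁ k) (⋆-comm J₂ J k)))))
       (solve 3 (λ s d c → s :* s :* (κ 4 :* d :+ κ 2 :* c) :+ s :* s :* (κ 4 :* d :+ κ 2 :* c) := s :* s :* (κ 8 :* d :+ κ 4 :* c)) (+ suc k) (d k) (c k))))

   -- Five uses of the Leibniz rule, through b, c, d and e, carry n⁵ a(n) down to products at index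
   -- n - 1; the cofactors w₁ to w₄ then express these through a at n - 1 and n - 2. The surplus
   -- factor n² is cancelled.
   recurrence-a : ∀ k → let n = + suc (suc k) ; m = + suc k in
     n * n * n * a (suc (suc k)) + + 64 * (m * m * m) * a k ≡ (+ 20 * (m * m * m) + + 30 * (m * m) + + 18 * m + + 4) * a (suc k)
   recurrence-a k = ℤₚ.*-cancelˡ-≡ (+ suc (suc k)) _ _ (ℤₚ.*-cancelˡ-≡ (+ suc (suc k)) _ _ (cancel+
     (solve 12 (λ k a₂ b₂ c₂ d₂ e₂ a₁ b₁ c₁ d₁ a₀ b₀ →
       let m = :1 :+ k ; n = :1 :+ m
           S = m :* m
           w₁ = n :* n :* κ 48
           w₂ = n :* n :* (κ 16 :* m :+ κ 8 :+ κ 16 :* n)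
           w₃ = n :* n :* (κ 8 :* m :* m :+ κ 4 :* m :+ κ 8 :* n :* m :+ κ 6 :* n :+ κ 12 :* n :* n)
           w₄ = n :* n :* κ 96 :* S
       in n :* (n :* (n :* n :* n :* a₂ :+ κ 64 :* (m :* m :* m) :* a₀))
          :+ (n :* n :* n :* n :* (κ 2 :* b₂) :+ κ 2 :* n :* n :* n :* (κ 3 :* c₂ :- κ 4 :* (n :* n :* a₁)) :+ κ 6 :* n :* n :* (d₂ :+ n :* n :* (κ 4 :* b₁ :+ κ 2 :* a₁))
             :+ κ 6 :* n :* (e₂ :+ n :* n :* (κ 8 :* c₁ :+ κ 2 :* b₁ :- κ 16 :* (S :* a₀))) :+ κ 6 :* (n :* n :* (κ 8 :* d₁ :+ κ 4 :* c₁))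
             :+ (w₁ :* (m :* c₁) :+ w₂ :* (m :* b₁) :+ w₃ :* (m :* a₁) :+ w₄ :* (κ 2 :* b₀)))
       := n :* (n :* ((κ 20 :* (m :* m :* m) :+ κ 30 :* (m :* m) :+ κ 18 :* m :+ κ 4) :* a₁))
          :+ (n :* n :* n :* n :* (n :* a₂) :+ κ 2 :* n :* n :* n :* (n :* b₂) :+ κ 6 :* n :* n :* (n :* c₂) :+ κ 6 :* n :* (n :* d₂) :+ κ 6 :* (n :* e₂)
             :+ (w₁ :* (d₁ :+ S :* (κ 4 :* b₀ :+ κ 2 :* a₀)) :+ w₂ :* (κ 3 :* c₁ :- κ 4 :* (S :* a₀)) :+ w₃ :* (κ 2 :* b₁) :+ w₄ :* (k :* a₀))))
       (+ k) (a (suc (suc k))) (b (suc (suc k))) (c (suc (suc k))) (d (suc (suc k))) (e (suc (suc k))) (a (suc k)) (b (suc k)) (c (suc k)) (d (suc k)) (a k) (b k))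
     (≡.cong₂ _+_ (≡.cong₂ _+_ (≡.cong₂ _+_ (≡.cong₂ _+_ (≡.cong₂ _+_ (≡.cong (n * n * n * n *_) (≡.sym (θa (suc (suc k)))))
         (≡.cong (+ 2 * n * n * n *_) (≡.sym (θb′ (suc k))))) (≡.cong (+ 6 * n * n *_) (≡.sym (θc (suc (suc k)))))) (≡.cong (+ 6 * n *_) (≡.sym (θd k)))) (≡.cong (+ 6 *_) (≡.sym (θe (suc k)))))
       (≡.cong₂ _+_ (≡.cong₂ _+_ (≡.cong₂ _+_ (≡.cong (n * n * + 48 *_) (θc (suc k))) (≡.cong (n * n * (+ 16 * m + + 8 + + 16 * n) *_) (θb′ k)))
         (≡.cong (n * n * (+ 8 * m * m + + 4 * m + + 8 * n * m + + 6 * n + + 12 * n * n) *_) (θa (suc k)))) (≡.cong (n * n * + 96 * (m * m) *_) (≡.sym (θa k)))))))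
     where
     n = + suc (suc k)
     m = + suc k

   sumTo-Σ≤ : ∀ n f → + sumTo n f ≡ Σ≤ n (λ k → + f k)
   sumTo-Σ≤ zero f = ≡.refl
   sumTo-Σ≤ (suc n) f = ≡.trans (ℤₚ.pos-+ (sumTo n f) (f (suc n))) (≡.cong (_+ + f (suc n)) (sumTo-Σ≤ n f))

   A≡a : ∀ n → + A n ≡ a n
   A≡a n = ≡.trans (sumTo-Σ≤ n _) (Σ≤-cong n (λ k _ → term k))
     where
     term : ∀ k → + (((2 ℕ.* k) C k) ℕ.* ((2 ℕ.* n ∸ 2 ℕ.* k) C (n ∸ k)) ℕ.* ((n C k) ℕ.* (n C k))) ≡ + (n C k) * + (n C k) * (J k * J (n ∸ k))
     term k = ≡.trans (ℤₚ.pos-* (central k ℕ.* ((2 ℕ.* n ∸ 2 ℕ.* k) C (n ∸ k))) ((n C k) ℕ.* (n C k)))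
       (≡.trans (≡.cong₂ _*_ (≡.trans (ℤₚ.pos-* (central k) _) (≡.cong (λ j → J k * + (j C (n ∸ k))) (≡.sym (ℕₚ.*-distribˡ-∸ 2 n k)))) (ℤₚ.pos-* (n C k) (n C k)))
         (*-comm (J k * J (n ∸ k)) _))

 domb-recurrence : ∀ k → suc (suc k) ℕ.* suc (suc k) ℕ.* suc (suc k) ℕ.* A (suc (suc k)) ℕ.+ 64 ℕ.* (suc k ℕ.* suc k ℕ.* suc k) ℕ.* A k
   ≡ (20 ℕ.* (suc k ℕ.* suc k ℕ.* suc k) ℕ.+ 30 ℕ.* (suc k ℕ.* suc k) ℕ.+ 18 ℕ.* suc k ℕ.+ 4) ℕ.* A (suc k)
 domb-recurrence k = ℤₚ.+-injective (≡.trans (≡.trans (ℤₚ.pos-+ (n ℕ.* n ℕ.* n ℕ.* A (suc (suc k))) (64 ℕ.* (m ℕ.* m ℕ.* m) ℕ.* A k))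
     (≡.cong₂ _+_ (≡.trans (ℤₚ.pos-* (n ℕ.* n ℕ.* n) (A (suc (suc k)))) (≡.cong₂ _*_ (cube n) (A≡a (suc (suc k)))))
       (≡.trans (ℤₚ.pos-* (64 ℕ.* (m ℕ.* m ℕ.* m)) (A k)) (≡.cong₂ _*_ (≡.trans (ℤₚ.pos-* 64 (m ℕ.* m ℕ.* m)) (≡.cong (+ 64 *_) (cube m))) (A≡a k)))))
   (≡.trans (recurrence-a k) (≡.sym (≡.trans (ℤₚ.pos-* (20 ℕ.* (m ℕ.* m ℕ.* m) ℕ.+ 30 ℕ.* (m ℕ.* m) ℕ.+ 18 ℕ.* m ℕ.+ 4) (A (suc k)))
     (≡.cong₂ _*_ (≡.trans (ℤₚ.pos-+ (20 ℕ.* (m ℕ.* m ℕ.* m) ℕ.+ 30 ℕ.* (m ℕ.* m) ℕ.+ 18 ℕ.* m) 4) (≡.cong (_+ + 4)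
       (≡.trans (ℤₚ.pos-+ (20 ℕ.* (m ℕ.* m ℕ.* m) ℕ.+ 30 ℕ.* (m ℕ.* m)) (18 ℕ.* m)) (≡.cong₂ _+_
         (≡.trans (ℤₚ.pos-+ (20 ℕ.* (m ℕ.* m ℕ.* m)) (30 ℕ.* (m ℕ.* m))) (≡.cong₂ _+_ (≡.trans (ℤₚ.pos-* 20 (m ℕ.* m ℕ.* m)) (≡.cong (+ 20 *_) (cube m)))
           (≡.trans (ℤₚ.pos-* 30 (m ℕ.* m)) (≡.cong (+ 30 *_) (ℤₚ.pos-* m m))))) (ℤₚ.pos-* 18 m))))) (A≡a (suc k)))))))
   where
   n = suc (suc k)
   m = suc k
   cube : ∀ j → + (j ℕ.* j ℕ.* j) ≡ + j * + j * + j
   cube j = ≡.trans (ℤₚ.pos-* (j ℕ.* j) j) (≡.cong (_* + j) (ℤₚ.pos-* j j))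

-- The sum of the Domb numbers as the square of a Hasse invariant

module DombSum (R : CommutativeRing 0ℓ 0ℓ) where
 open import Data.Nat using (_∸_)
 open import Data.Nat.Divisibility using (_∣_)
 open import Defs
 open Binomials
 open DombRec using (domb-recurrence)
 open import Algebra.Definitions.RawMonoid using (sum)
 import Data.Empty
 open import Data.Fin as Fin using (Fin; toℕ)
 import Data.Fin.Properties as Finₚ
 open import Data.Nat.Combinatorics using (nCk≡nC[n∸k]; nCk+nC[k+1]≡[n+1]C[k+1]; k>n⇒nCk≡0; nCn≡1)
 open import Data.Nat.DivMod using (_/_; _%_; m≡m%n+[m/n]*n; m%n<n)
 open import Data.Nat.Combinatorics using () renaming (_C_ to infixl 6 _choose_)

 open Series R renaming (C to const)
 private module S = RingKit seriesRing
 open RingKit R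
 open import Algebra.Properties.CommutativeSemiring.Binomial S.commutativeSemiring using (theorem; binomialTerm)

 module On (n : ℕ) (3<p : 3 ℕ.< suc (n ℕ.+ n))
   (char : RingKit.HasChar R (suc (n ℕ.+ n)))
   (unit : RingKit.UnitsPrimeTo R (suc (n ℕ.+ n))) where

  private
    1<p : 1 ℕ.< suc (n ℕ.+ n)
    1<p = ℕₚ.<-trans (s≤s (s≤s z≤n)) 3<p

  open CharP.On R (suc (n ℕ.+ n)) 1<p char unit
  private module O = ODE.On R (suc (n ℕ.+ n)) 1<p char unit

  p : ℕ
  p = suc (n ℕ.+ n)

  nat-* : ∀ i j → nat (i ℕ.* j) ≈ nat i * nat j
  nat-* = ×1-homo-*

  nat-+ : ∀ i j → nat (i ℕ.+ j) ≈ nat i + nat j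
  nat-+ = ×-homo-+ 1#

  nat-≡ : ∀ {i j} → i ≡ j → nat i ≈ nat j
  nat-≡ e = reflexive (≡.cong nat e)

  module _ (w : Carrier) where

    linear-power : ∀ N j → ((t S.+ const w) S.^ N) j ≈ nat (N choose j) * w ^ (N ∸ j)
    linear-power zero zero = solve 0 (:1 := (:1 :+ :0) :* :1)
    linear-power zero (suc j) = sym (trans (*-congʳ (nat-≡ (k>n⇒nCk≡0 {0} {suc j} (s≤s z≤n)))) (zeroˡ _))
    linear-power (suc N) zero = begin
      (0# + w) * f 0 ≈⟨ *-cong (+-identityˡ w) (linear-power N 0) ⟩
      w * (nat (N choose 0) * w ^ N) ≈⟨ solve 3 (λ w a b → w :* (a :* b) := a :* (w :* b)) w (nat (N choose 0)) (w ^ N) ⟩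
      nat (N choose 0) * (w * w ^ N) ≈⟨ *-congʳ (nat-≡ (≡.trans (nC0≡1 N) (≡.sym (nC0≡1 (suc N))))) ⟩
      nat (suc N choose 0) * w ^ suc N ∎
      where f = (t S.+ const w) S.^ N
    linear-power (suc N) (suc j) = begin
      ((t S.+ const w) S.* f) (suc j)
        ≈⟨ S.trans (S.distribʳ f t (const w)) (λ _ → refl) (suc j) ⟩
      (t S.* f) (suc j) + (const w S.* f) (suc j)
        ≈⟨ +-cong (trans (t-⊛-suc f j) (linear-power N j)) (trans (C-⊛ w f (suc j)) (*-congˡ (linear-power N (suc j)))) ⟩
      nat (N choose j) * w ^ (N ∸ j) + w * (nat (N choose suc j) * w ^ (N ∸ suc j))
        ≈⟨ +-congˡ step ⟩
      nat (N choose j) * w ^ (N ∸ j) + nat (N choose suc j) * w ^ (N ∸ j)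
        ≈⟨ sym (distribʳ _ _ _) ⟩
      (nat (N choose j) + nat (N choose suc j)) * w ^ (N ∸ j)
        ≈⟨ *-congʳ (trans (sym (nat-+ (N choose j) (N choose suc j))) (nat-≡ (nCk+nC[k+1]≡[n+1]C[k+1] N j))) ⟩
      nat (suc N choose suc j) * w ^ (N ∸ j) ∎
      where
      f = (t S.+ const w) S.^ N
      step : w * (nat (N choose suc j) * w ^ (N ∸ suc j)) ≈ nat (N choose suc j) * w ^ (N ∸ j)
      step with suc j ℕ.≤? N
      ... | yes j<N = trans (solve 3 (λ w a b → w :* (a :* b) := a :* (w :* b)) w (nat (N choose suc j)) (w ^ (N ∸ suc j)))
        (*-congˡ (reflexive (≡.cong (w ^_) (≡.sym (ℕₚ.+-∸-assoc 1 j<N)))))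
      ... | no j≮N = trans (*-congˡ (trans (*-congʳ zero-C) (zeroˡ _))) (trans (zeroʳ w) (sym (trans (*-congʳ zero-C) (zeroˡ _))))
        where
        zero-C : nat (N choose suc j) ≈ 0#
        zero-C = nat-≡ (k>n⇒nCk≡0 {N} {suc j} (ℕₚ.≰⇒> j≮N))

  -- The coefficient of w^k in the t^(2n)-coefficient of (4 t³ + (t + w)²)^n. Modulo p = 2 n + 1 it
  -- agrees with (3k)! / (k!)³ for k < p.
  uℕ : ℕ → ℕ
  uℕ k = 4 ℕ.^ k ℕ.* (n choose k) ℕ.* ((2 ℕ.* (n ∸ k)) choose k)

  u v : Series
  u k = nat (uℕ k)
  v k = nat (central k) * u k

  private
    0<n : 0 ℕ.< n
    0<n = positive n 3<p
      where
      positive : ∀ n → 3 ℕ.< suc (n ℕ.+ n) → 0 ℕ.< n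
      positive zero (s≤s ())
      positive (suc n) _ = s≤s z≤n

    nat-2n : nat 2 * nat n ≈ - 1#
    nat-2n = diff≈0⇒≈ (trans (solve 1 (λ m → κ 2 :* m :- (:- :1) := :1 :+ (m :+ m)) (nat n)) (trans (+-congˡ (sym (nat-+ n n))) char))

    u-beyond : ∀ k → n ℕ.≤ k → u k ≈ 0#
    u-beyond k n≤k = trans (nat-* (4 ℕ.^ k ℕ.* (n choose k)) _) (trans (*-congˡ (nat-≡ (zero-C k n≤k))) (zeroʳ _))
      where
      zero-C : ∀ k → n ℕ.≤ k → (2 ℕ.* (n ∸ k)) choose k ≡ 0
      zero-C k n≤k rewrite ℕₚ.m≤n⇒m∸n≡0 n≤k = k>n⇒nCk≡0 {0} {k} (ℕₚ.<-≤-trans 0<n n≤k)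

    ratio-nat : ∀ N k → nat (suc k) * nat (N choose suc k) ≈ (nat N - nat k) * nat (N choose k)
    ratio-nat N k = diff≈0⇒≈ (begin
      nat (suc k) * nat (N choose suc k) - (nat N - nat k) * nat (N choose k)
        ≈⟨ solve 4 (λ k N a b → (:1 :+ k) :* b :- (N :- k) :* a := ((:1 :+ k) :* b :+ (:1 :+ k) :* a) :- (:1 :+ N) :* a) (nat k) (nat N) (nat (N choose k)) (nat (N choose suc k)) ⟩
      (nat (suc k) * nat (N choose suc k) + nat (suc k) * nat (N choose k)) - nat (suc N) * nat (N choose k)
        ≈⟨ ≈⇒diff≈0 (trans (+-cong (sym (nat-* (suc k) (N choose suc k))) (sym (nat-* (suc k) (N choose k)))) (trans (sym (nat-+ (suc k ℕ.* (N choose suc k)) (suc k ℕ.* (N choose k))))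
             (trans (nat-≡ (ratio N k)) (nat-* (suc N) (N choose k))))) ⟩
      0# ∎)

    lower-nat : ∀ N k → nat (suc N) * nat (N choose k) ≈ (nat (suc N) - nat k) * nat (suc N choose k)
    lower-nat N k = trans (trans (sym (nat-* (suc N) (N choose k))) (trans (nat-≡ (≡.sym (absorption N k))) (nat-* (suc k) (suc N choose suc k)))) (ratio-nat (suc N) k)

    -- For k ≥ n both sides vanish. Otherwise the quotients of the binomials are rational in k and
    -- n, and 2 n = -1 turns them into the hypergeometric ratio 3 (3k + 1) (3k + 2) / (k + 1)². The
    -- factors multiplied in for this purpose are prime to p.
    u-rec : ∀ k → nat (suc k) * (nat (suc k) * u (suc k)) ≈ nat 27 * (nat k * (nat k * u k)) + nat 27 * (nat k * u k) + nat 6 * u k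
    u-rec k with n ℕ.≤? k
    ... | yes n≤k = trans (*-congˡ (trans (*-congˡ (u-beyond (suc k) (ℕₚ.m≤n⇒m≤1+n n≤k))) (zeroʳ _))) (trans (zeroʳ _) (sym
      (trans (+-cong (+-cong (*-congˡ (*-congˡ (*-congˡ (u-beyond k n≤k)))) (*-congˡ (*-congˡ (u-beyond k n≤k)))) (*-congˡ (u-beyond k n≤k)))
        (solve 1 (λ k → κ 27 :* (k :* (k :* :0)) :+ κ 27 :* (k :* :0) :+ κ 6 :* :0 := :0) (nat k)))))
    ... | no n≰k = go (n ∸ suc k) (≡.sym (ℕₚ.m+[n∸m]≡n (ℕₚ.≰⇒> n≰k)))
      where
      go : ∀ i → n ≡ suc k ℕ.+ i → nat (suc k) * (nat (suc k) * u (suc k)) ≈ nat 27 * (nat k * (nat k * u k)) + nat 27 * (nat k * u k) + nat 6 * u k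
      go i n≡ = cancel-nat k+1∤ (cancel-nat 2i+2∤ (cancel-nat 2∤ (begin
        nat 2 * (nat (suc (suc (2 ℕ.* i))) * (nat (suc k) * (nat (suc k) * (nat (suc k) * u (suc k)))))
          ≈⟨ *-congˡ (*-congˡ (*-congˡ (*-congˡ (*-congˡ u′)))) ⟩
        nat 2 * (nat (suc (suc (2 ℕ.* i))) * (nat (suc k) * (nat (suc k) * (nat (suc k) * (nat 4 * F * N₁ * B′)))))
          ≈⟨ cancel+ (solve 11 (λ k j F N₀ N₁ B B₁ B₂ B′ m z →
               let I = :1 :+ (:1 :+ j) ; I₁ = :1 :+ j ; s = :1 :+ k
                   c₀ = κ 2 :* I :* s :* (κ 4 :* F)
                   M = c₀ :* (m :- k) :* N₀
               in κ 2 :* (I :* (s :* (s :* (s :* (κ 4 :* F :* N₁ :* B′)))))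
                  :+ (c₀ :* (s :* B′) :* ((m :- k) :* N₀) :+ M :* ((j :- k) :* B₂) :+ κ 0 :* z)
                  := M :* ((j :- k) :* B₂) :+ (c₀ :* (s :* B′) :* (s :* N₁) :+ M :* (s :* B′) :+ κ 0 :* z))
               (nat k) (nat (2 ℕ.* i)) F N₀ N₁ B B₁ B₂ B′ (nat n) 0#)
             (+-congʳ (+-cong (*-congˡ (sym rA)) (*-congˡ (sym rB)))) ⟩
        nat 2 * I * s * (nat 4 * F) * (nat n - nat k) * N₀ * ((nat (2 ℕ.* i) - nat k) * B₂)
          ≈⟨ end ⟩
        nat 2 * (nat (suc (suc (2 ℕ.* i))) * (nat (suc k) * (nat 27 * (nat k * (nat k * u k)) + nat 27 * (nat k * u k) + nat 6 * u k))) ∎)))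
        where
        F = nat (4 ℕ.^ k)
        N₀ = nat (n choose k)
        N₁ = nat (n choose suc k)
        s = nat (suc k)
        I = nat (suc (suc (2 ℕ.* i)))
        B = nat (suc (suc (2 ℕ.* i)) choose k)
        B₁ = nat (suc (2 ℕ.* i) choose k)
        B₂ = nat ((2 ℕ.* i) choose k)
        B′ = nat ((2 ℕ.* i) choose suc k)
        i<n : i ℕ.< n
        i<n = ≡.subst (i ℕ.<_) (≡.sym n≡) (s≤s (ℕₚ.m≤n+m i k))
        n<p : n ℕ.< p
        n<p = s≤s (ℕₚ.m≤m+n n n)
        k+1∤ : ¬ p ∣ suc k
        k+1∤ = ∤-small (s≤s z≤n) (ℕₚ.≤-<-trans (≡.subst (suc k ℕ.≤_) (≡.sym n≡) (ℕₚ.m≤m+n (suc k) i)) n<p)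
        2∤ : ¬ p ∣ 2
        2∤ = ∤-small (s≤s z≤n) (ℕₚ.<-trans (s≤s (s≤s (s≤s z≤n))) 3<p)
        2i+2∤ : ¬ p ∣ suc (suc (2 ℕ.* i))
        2i+2∤ = ∤-small (s≤s z≤n) (s≤s (≡.subst (ℕ._≤ n ℕ.+ n) (N.solve 1 (λ i → (N.con 1 N.:+ i) N.:+ (N.con 1 N.:+ i) N.:= N.con 2 N.:+ N.con 2 N.:* i) ≡.refl i) (ℕₚ.+-mono-≤ i<n i<n)))
        rA : s * N₁ ≈ (nat n - nat k) * N₀
        rA = ratio-nat n k
        rB : s * B′ ≈ (nat (2 ℕ.* i) - nat k) * B₂
        rB = ratio-nat (2 ℕ.* i) k
        l₁ : nat (suc (2 ℕ.* i)) * B₂ ≈ (nat (suc (2 ℕ.* i)) - nat k) * B₁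
        l₁ = lower-nat (2 ℕ.* i) k
        l₂ : I * B₁ ≈ (I - nat k) * B
        l₂ = lower-nat (suc (2 ℕ.* i)) k
        u′ : u (suc k) ≈ nat 4 * F * N₁ * B′
        u′ = trans (nat-* (4 ℕ.^ suc k ℕ.* (n choose suc k)) _) (*-cong (trans (nat-* (4 ℕ.^ suc k) (n choose suc k)) (*-congʳ (nat-* 4 (4 ℕ.^ k))))
          (nat-≡ (≡.cong (λ j → (2 ℕ.* j) choose suc k) (≡.trans (≡.cong (_∸ suc k) n≡) (ℕₚ.m+n∸m≡n (suc k) i)))))
        u-eq : u k ≈ F * N₀ * B
        u-eq = trans (nat-* (4 ℕ.^ k ℕ.* (n choose k)) _) (*-cong (nat-* (4 ℕ.^ k) (n choose k))
          (nat-≡ (≡.cong (_choose k) (≡.trans (≡.cong (2 ℕ.*_) (≡.trans (≡.cong (_∸ k) (≡.trans n≡ (≡.sym (ℕₚ.+-suc k i)))) (ℕₚ.m+n∸m≡n k (suc i)))) (≡.cong suc (ℕₚ.+-suc i (i ℕ.+ 0)))))))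
        -- 2 n = - 1 turns every linear factor into one in k
        j-eq : nat (2 ℕ.* i) ≈ - nat 3 - nat 2 * nat k
        j-eq = diff≈0⇒≈ (trans (trans (+-congʳ (nat-* 2 i)) (solve 2 (λ i k → κ 2 :* i :- (:- κ 3 :- κ 2 :* k) := κ 2 :* (:1 :+ k :+ i) :- (:- :1)) (nat i) (nat k)))
          (≈⇒diff≈0 (trans (*-congˡ (trans (sym (nat-+ (suc k) i)) (nat-≡ (≡.sym n≡)))) nat-2n)))
        end : nat 2 * I * s * (nat 4 * F) * (nat n - nat k) * N₀ * ((nat (2 ℕ.* i) - nat k) * B₂)
          ≈ nat 2 * (nat (suc (suc (2 ℕ.* i))) * (nat (suc k) * (nat 27 * (nat k * (nat k * u k)) + nat 27 * (nat k * u k) + nat 6 * u k)))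
        end = begin
          nat 2 * I * s * (nat 4 * F) * (nat n - nat k) * N₀ * ((nat (2 ℕ.* i) - nat k) * B₂)
            ≈⟨ *-congˡ (*-congʳ (+-congʳ j-eq)) ⟩
          nat 2 * I * s * (nat 4 * F) * (nat n - nat k) * N₀ * ((- nat 3 - nat 2 * nat k - nat k) * B₂)
            ≈⟨ solve 6 (λ I k F n N₀ B → κ 2 :* I :* (:1 :+ k) :* (κ 4 :* F) :* (n :- k) :* N₀ :* ((:- κ 3 :- κ 2 :* k :- k) :* B)
                 := I :* (:1 :+ k) :* F :* N₀ :* κ 6 :* ((κ 2 :* n :- κ 2 :* k) :* ((:1 :+ (:- κ 3 :- κ 2 :* k)) :* B))) I (nat k) F (nat n) N₀ B₂ ⟩
          I * s * F * N₀ * nat 6 * ((nat 2 * nat n - nat 2 * nat k) * ((1# + (- nat 3 - nat 2 * nat k)) * B₂))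
            ≈⟨ *-congˡ (*-cong (+-congʳ nat-2n) (trans (*-congʳ (+-congˡ (sym j-eq))) (trans l₁ (*-congʳ (+-congʳ (+-congˡ j-eq)))))) ⟩
          I * s * F * N₀ * nat 6 * ((- 1# - nat 2 * nat k) * (((1# + (- nat 3 - nat 2 * nat k)) - nat k) * B₁))
            ≈⟨ solve 5 (λ c k B z w → c :* ((:- :1 :- κ 2 :* k) :* (((:1 :+ (:- κ 3 :- κ 2 :* k)) :- k) :* B)) := c :* (:- (κ 3 :* k :+ κ 2)) :* ((:1 :+ (:1 :+ (:- κ 3 :- κ 2 :* k))) :* B)) (I * s * F * N₀ * nat 6) (nat k) B₁ 0# 0# ⟩
          I * s * F * N₀ * nat 6 * - (nat 3 * nat k + nat 2) * ((1# + (1# + (- nat 3 - nat 2 * nat k))) * B₁)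
            ≈⟨ *-congˡ (trans (*-congʳ (+-congˡ (+-congˡ (sym j-eq)))) (trans l₂ (*-congʳ (+-congʳ (+-congˡ (+-congˡ j-eq)))))) ⟩
          I * s * F * N₀ * nat 6 * - (nat 3 * nat k + nat 2) * (((1# + (1# + (- nat 3 - nat 2 * nat k))) - nat k) * B)
            ≈⟨ solve 5 (λ I k F N₀ B → let z = F :* N₀ :* B in I :* (:1 :+ k) :* F :* N₀ :* κ 6 :* (:- (κ 3 :* k :+ κ 2)) :* (((:1 :+ (:1 :+ (:- κ 3 :- κ 2 :* k))) :- k) :* B)
                 := κ 2 :* (I :* ((:1 :+ k) :* (κ 27 :* (k :* (k :* z)) :+ κ 27 :* (k :* z) :+ κ 6 :* z)))) I (nat k) F N₀ B ⟩
          nat 2 * (I * (s * (nat 27 * (nat k * (nat k * (F * N₀ * B))) + nat 27 * (nat k * (F * N₀ * B)) + nat 6 * (F * N₀ * B))))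
            ≈⟨ *-congˡ (*-congˡ (*-congˡ (+-cong (+-cong (*-congˡ (*-congˡ (*-congˡ (sym u-eq)))) (*-congˡ (*-congˡ (sym u-eq)))) (*-congˡ (sym u-eq))))) ⟩
          nat 2 * (I * (s * (nat 27 * (nat k * (nat k * u k)) + nat 27 * (nat k * u k) + nat 6 * u k))) ∎

  u-ode : θ (θ u) ≋ t S.* (S.nat 27 S.* θ (θ u) S.+ S.nat 27 S.* θ u S.+ S.nat 6 S.* u)
  u-ode zero = solve 2 (λ u z → :0 :* (:0 :* u) := :0 :* z) (u 0) _
  u-ode (suc k) = trans (u-rec k) (sym (trans (t-⊛-suc (S.nat 27 S.* θ (θ u) S.+ S.nat 27 S.* θ u S.+ S.nat 6 S.* u) k)
    (+-cong (+-cong (nat-⊛ 27 (θ (θ u)) k) (nat-⊛ 27 (θ u) k)) (nat-⊛ 6 u k))))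
    where
    nat-⊛ : ∀ j f k → (S.nat j S.* f) k ≈ nat j * f k
    nat-⊛ j f k = trans (S.*-congʳ {f} (S.sym (C-nat j)) k) (C-⊛ (nat j) f k)

  private
    nat-⊛ : ∀ j f k → (S.nat j S.* f) k ≈ nat j * f k
    nat-⊛ j f k = trans (S.*-congʳ {f} (S.sym (C-nat j)) k) (C-⊛ (nat j) f k)

    central-nat : ∀ k → nat (suc k) * nat (central (suc k)) ≈ nat 2 * (nat 2 * nat k + 1#) * nat (central k)
    central-nat k = trans (sym (nat-* (suc k) (central (suc k)))) (trans (nat-≡ (central-rec k)) (trans (nat-* (2 ℕ.* (2 ℕ.* k ℕ.+ 1)) (central k))
      (*-congʳ (trans (nat-* 2 (2 ℕ.* k ℕ.+ 1)) (*-congˡ (trans (nat-+ (2 ℕ.* k) 1) (+-cong (nat-* 2 k) (+-identityʳ 1#))))))))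

  v-ode : θ (θ (θ v)) ≋ t S.* (S.nat 108 S.* θ (θ (θ v)) S.+ S.nat 162 S.* θ (θ v) S.+ S.nat 78 S.* θ v S.+ S.nat 12 S.* v)
  v-ode zero = solve 2 (λ u z → :0 :* (:0 :* (:0 :* u)) := :0 :* z) (v 0) _
  v-ode (suc k) = trans (trans (solve 3 (λ s c u → s :* (s :* (s :* (c :* u))) := (s :* c) :* (s :* (s :* u))) (nat (suc k)) (nat (central (suc k))) (u (suc k)))
      (trans (*-cong (central-nat k) (u-rec k)) (solve 3 (λ k c u → κ 2 :* (κ 2 :* k :+ :1) :* c :* (κ 27 :* (k :* (k :* u)) :+ κ 27 :* (k :* u) :+ κ 6 :* u)
        := κ 108 :* (k :* (k :* (k :* (c :* u)))) :+ κ 162 :* (k :* (k :* (c :* u))) :+ κ 78 :* (k :* (c :* u)) :+ κ 12 :* (c :* u)) (nat k) (nat (central k)) (u k))))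
    (sym (trans (t-⊛-suc (S.nat 108 S.* θ (θ (θ v)) S.+ S.nat 162 S.* θ (θ v) S.+ S.nat 78 S.* θ v S.+ S.nat 12 S.* v) k)
      (+-cong (+-cong (+-cong (nat-⊛ 108 (θ (θ (θ v))) k) (nat-⊛ 162 (θ (θ v)) k)) (nat-⊛ 78 (θ v) k)) (nat-⊛ 12 v k))))

  K r : ℕ
  K = (n ℕ.+ n) / 3
  r = (n ℕ.+ n) % 3

  2n≡ : n ℕ.+ n ≡ r ℕ.+ K ℕ.* 3
  2n≡ = m≡m%n+[m/n]*n (n ℕ.+ n) 3

  u-deg : Deg≤ u K
  u-deg k K<k = trans (nat-* (4 ℕ.^ k ℕ.* (n choose k)) _) (trans (*-congˡ (nat-≡ (k>n⇒nCk≡0 {2 ℕ.* (n ∸ k)} {k} small))) (zeroʳ _))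
    where
    2n<3k : n ℕ.+ n ℕ.< k ℕ.+ (k ℕ.+ k)
    2n<3k = ≡.subst (ℕ._< k ℕ.+ (k ℕ.+ k)) (≡.sym 2n≡) (ℕₚ.<-≤-trans (ℕₚ.+-monoˡ-< (K ℕ.* 3) (m%n<n (n ℕ.+ n) 3))
      (≡.subst (3 ℕ.+ K ℕ.* 3 ℕ.≤_) (N.solve 1 (λ k → k N.:* N.con 3 N.:= k N.:+ (k N.:+ k)) ≡.refl k) (ℕₚ.*-monoˡ-≤ 3 K<k)))
    small : 2 ℕ.* (n ∸ k) ℕ.< k
    small = ≡.subst (ℕ._< k) (≡.sym (≡.trans (ℕₚ.*-distribˡ-∸ 2 n k) (≡.cong₂ _∸_ (double n) (double k)))) (sub-< (n ℕ.+ n) (k ℕ.+ k) k (ℕₚ.≤-<-trans z≤n K<k) 2n<3k)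
      where
      double : ∀ j → 2 ℕ.* j ≡ j ℕ.+ j
      double j = ≡.cong (j ℕ.+_) (ℕₚ.+-identityʳ j)
      sub-< : ∀ a b c → 0 ℕ.< c → a ℕ.< c ℕ.+ b → a ∸ b ℕ.< c
      sub-< a b c 0<c lt with b ℕ.≤? a
      ... | yes b≤a = ℕₚ.+-cancelʳ-< b _ _ (≡.subst (ℕ._< c ℕ.+ b) (≡.sym (ℕₚ.m∸n+n≡m b≤a)) lt)
      ... | no b≰a = ≡.subst (ℕ._< c) (≡.sym (ℕₚ.m≤n⇒m∸n≡0 (ℕₚ.<⇒≤ (ℕₚ.≰⇒> b≰a)))) 0<c

  v-deg : Deg≤ v K
  v-deg k K<k = trans (*-congˡ (u-deg k K<k)) (zeroʳ _)

  module _ (w : Carrier) where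
    open Hasse.On.Curve.Cubic R n 1<p char unit 1# w using (cubic; cubic-hasse)
    open Evaluation w

    private
      a b : Series
      a = S.nat 4 S.* (t S.* t S.* t)
      b = (t S.+ const w) S.* (t S.+ const w)

      Σ : ∀ {m} → (Fin m → Carrier) → Carrier
      Σ = sum +-rawMonoid

      Σ-cong : ∀ {m} {f g : Fin m → Carrier} → (∀ i → f i ≈ g i) → Σ f ≈ Σ g
      Σ-cong {zero} h = refl
      Σ-cong {suc m} h = +-cong (h Fin.zero) (Σ-cong (λ i → h (Fin.suc i)))

      coefficient-Σ : ∀ {m} (f : Fin m → Series) j → sum S.+-rawMonoid f j ≈ Σ (λ i → f i j)
      coefficient-Σ {zero} f j = refl
      coefficient-Σ {suc m} f j = +-congˡ (coefficient-Σ (λ i → f (Fin.suc i)) j)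

      Σ-ev : ∀ d c f → Σ {suc d} (λ i → f (toℕ i) * (c * w ^ toℕ i)) ≈ c * ev d f
      Σ-ev zero c f = solve 2 (λ c x → x :* (c :* :1) :+ :0 := c :* x) c (f 0)
      Σ-ev (suc d) c f = trans (+-congˡ (trans (Σ-cong {suc d} (λ i → *-congˡ {f (suc (toℕ i))} (sym (*-assoc c w (w ^ toℕ i))))) (Σ-ev d (c * w) (tl f))))
        (solve 4 (λ c w x e → x :* (c :* :1) :+ c :* w :* e := c :* (x :+ w :* e)) c w (f 0) (ev d (tl f)))

      scalar : ∀ j f i → (j S.· f) i ≈ nat j * f i
      scalar zero f i = sym (zeroˡ (f i))
      scalar (suc j) f i = trans (+-congˡ (scalar j f i)) (solve 2 (λ j x → x :+ j :* x := (:1 :+ j) :* x) (nat j) (f i))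

      a^ : ∀ k → a S.^ k S.≈ const (nat (4 ℕ.^ k)) S.* t S.^ (k ℕ.* 3)
      a^ zero = S.trans (S.sym (S.*-identityʳ S.1#)) (S.*-congʳ {S.1#} (S.trans (S.sym C-1) (C-cong (sym (+-identityʳ 1#)))))
      a^ (suc k) = S.trans (S.*-congˡ {a} (a^ k)) (S.trans
        (S.solve 4 (λ f t x y → (f :* (t :* t :* t)) :* (x :* y) := f :* x :* (t :* (t :* (t :* y)))) (S.nat 4) t (const (nat (4 ℕ.^ k))) (t S.^ (k ℕ.* 3)))
        (S.*-congʳ {t S.^ (suc k ℕ.* 3)} (S.trans (S.*-congʳ {const (nat (4 ℕ.^ k))} (S.sym (C-nat 4))) (S.trans (S.sym (C-* (nat 4) (nat (4 ℕ.^ k)))) (C-cong (sym (nat-* 4 (4 ℕ.^ k))))))))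

      b^ : ∀ j → b S.^ j S.≈ (t S.+ const w) S.^ (2 ℕ.* j)
      b^ j = S.trans (S.sym (Hasse.On.square^ R n 1<p char unit (t S.+ const w) j)) (S.reflexive (≡.cong (λ i → (t S.+ const w) S.^ (j ℕ.+ i)) (≡.sym (ℕₚ.+-identityʳ j))))

      below-t^ : ∀ i f j → j ℕ.< i → (t S.^ i S.* f) j ≈ 0#
      below-t^ (suc i) f zero _ = trans (S.*-assoc t (t S.^ i) f 0) (t-⊛-zero (t S.^ i S.* f))
      below-t^ (suc i) f (suc j) (s≤s lt) = trans (S.*-assoc t (t S.^ i) f (suc j)) (trans (t-⊛-suc (t S.^ i S.* f) j) (below-t^ i f j lt))

      -- If 3 k > 2 n both sides are 0, because then 2 (n - k) < k; otherwise the symmetry of the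
      -- binomials makes the exponent of w the lower index.
      coefficient : ∀ k → k ℕ.≤ n → (t S.^ (k ℕ.* 3) S.* b S.^ (n ∸ k)) (n ℕ.+ n) ≈ nat ((2 ℕ.* (n ∸ k)) choose k) * w ^ k
      coefficient k k≤n with k ℕ.* 3 ℕ.≤? n ℕ.+ n
      ... | no lt = trans (below-t^ (k ℕ.* 3) (b S.^ (n ∸ k)) (n ℕ.+ n) (ℕₚ.≰⇒> lt)) (sym (trans (*-congʳ (nat-≡ (k>n⇒nCk≡0 {2 ℕ.* (n ∸ k)} {k} small))) (zeroˡ _)))
        where
        small : 2 ℕ.* (n ∸ k) ℕ.< k
        small = ℕₚ.+-cancelʳ-< (k ℕ.+ k) _ _ (≡.subst₂ ℕ._<_ (≡.trans (≡.cong₂ ℕ._+_ (≡.sym (ℕₚ.m∸n+n≡m k≤n)) (≡.sym (ℕₚ.m∸n+n≡m k≤n)))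
            (N.solve 2 (λ i k → (i N.:+ k) N.:+ (i N.:+ k) N.:= N.con 2 N.:* i N.:+ (k N.:+ k)) ≡.refl (n ∸ k) k))
          (N.solve 1 (λ k → k N.:* N.con 3 N.:= k N.:+ (k N.:+ k)) ≡.refl k) (ℕₚ.≰⇒> lt))
      ... | yes le = trans (trans (reflexive (≡.cong (t S.^ (k ℕ.* 3) S.* b S.^ (n ∸ k)) (≡.sym (ℕₚ.m+[n∸m]≡n le)))) (t^-⊛ (k ℕ.* 3) (b S.^ (n ∸ k)) j))
          (trans (b^ (n ∸ k) j) (trans (linear-power w (2 ℕ.* (n ∸ k)) j) (*-cong (nat-≡ (≡.trans (nCk≡nC[n∸k] {j} {N} j≤N) (≡.cong (N choose_) N∸j))) (reflexive (≡.cong (w ^_) N∸j)))))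
        where
        j = n ℕ.+ n ∸ k ℕ.* 3
        N = 2 ℕ.* (n ∸ k)
        N≡ : N ≡ k ℕ.+ j
        N≡ = ℕₚ.+-cancelʳ-≡ (k ℕ.+ k) N (k ℕ.+ j) (≡.trans
          (≡.trans (N.solve 2 (λ i k → N.con 2 N.:* i N.:+ (k N.:+ k) N.:= (i N.:+ k) N.:+ (i N.:+ k)) ≡.refl (n ∸ k) k) (≡.cong₂ ℕ._+_ (ℕₚ.m∸n+n≡m k≤n) (ℕₚ.m∸n+n≡m k≤n)))
          (≡.trans (≡.sym (ℕₚ.m+[n∸m]≡n le)) (N.solve 2 (λ k j → k N.:* N.con 3 N.:+ j N.:= k N.:+ j N.:+ (k N.:+ k)) ≡.refl k j)))
        j≤N : j ℕ.≤ N
        j≤N = ≡.subst (j ℕ.≤_) (≡.sym N≡) (ℕₚ.m≤n+m j k)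
        N∸j : N ∸ j ≡ k
        N∸j = ≡.trans (≡.cong (_∸ j) N≡) (ℕₚ.m+n∸n≡m k j)

      term : ∀ (i : Fin (suc n)) → binomialTerm a b n i (n ℕ.+ n) ≈ u (toℕ i) * (1# * w ^ toℕ i)
      term i = begin
        ((n choose k) S.· (a S.^ k S.* b S.^ (n ∸ k))) (n ℕ.+ n)
          ≈⟨ scalar (n choose k) (a S.^ k S.* b S.^ (n ∸ k)) (n ℕ.+ n) ⟩
        nat (n choose k) * (a S.^ k S.* b S.^ (n ∸ k)) (n ℕ.+ n)
          ≈⟨ *-congˡ (trans (S.trans (S.*-congʳ {b S.^ (n ∸ k)} (a^ k)) (S.*-assoc (const (nat (4 ℕ.^ k))) (t S.^ (k ℕ.* 3)) (b S.^ (n ∸ k))) (n ℕ.+ n))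
               (trans (C-⊛ (nat (4 ℕ.^ k)) (t S.^ (k ℕ.* 3) S.* b S.^ (n ∸ k)) (n ℕ.+ n)) (*-congˡ (coefficient k (ℕₚ.≤-pred (Finₚ.toℕ<n i)))))) ⟩
        nat (n choose k) * (nat (4 ℕ.^ k) * (nat ((2 ℕ.* (n ∸ k)) choose k) * w ^ k))
          ≈⟨ solve 4 (λ x y z w → x :* (y :* (z :* w)) := y :* x :* z :* (:1 :* w)) (nat (n choose k)) (nat (4 ℕ.^ k)) (nat ((2 ℕ.* (n ∸ k)) choose k)) (w ^ k) ⟩
        nat (4 ℕ.^ k) * nat (n choose k) * nat ((2 ℕ.* (n ∸ k)) choose k) * (1# * w ^ k)
          ≈⟨ *-congʳ (sym (trans (nat-* (4 ℕ.^ k ℕ.* (n choose k)) _) (*-congʳ (nat-* (4 ℕ.^ k) (n choose k))))) ⟩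
        u k * (1# * w ^ k) ∎
        where k = toℕ i

      K≤n : K ℕ.≤ n
      K≤n with K ℕ.≤? n
      ... | yes le = le
      ... | no nle = Data.Empty.⊥-elim (ℕₚ.<⇒≱ (ℕₚ.<-≤-trans (ℕₚ.+-mono-< (ℕₚ.≰⇒> nle) (ℕₚ.≰⇒> nle))
          (≡.subst (K ℕ.+ K ℕ.≤_) (N.solve 1 (λ k → (k N.:+ k) N.:+ k N.:= k N.:* N.con 3) ≡.refl K) (ℕₚ.m≤m+n (K ℕ.+ K) K)))
        (≡.subst (K ℕ.* 3 ℕ.≤_) (≡.sym 2n≡) (ℕₚ.m≤n+m (K ℕ.* 3) r)))

    cubic-hasse-series : cubic-hasse ≈ ev K u
    cubic-hasse-series = begin
      cubic-hasse
        ≈⟨ theorem n a b (n ℕ.+ n) ⟩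
      sum S.+-rawMonoid (binomialTerm a b n) (n ℕ.+ n)
        ≈⟨ coefficient-Σ (binomialTerm a b n) (n ℕ.+ n) ⟩
      Σ (λ i → binomialTerm a b n i (n ℕ.+ n))
        ≈⟨ Σ-cong {suc n} term ⟩
      Σ {suc n} (λ i → u (toℕ i) * (1# * w ^ toℕ i))
        ≈⟨ trans (Σ-ev n 1# u) (*-identityˡ _) ⟩
      ev n u
        ≈⟨ trans (reflexive (≡.cong (λ j → ev j u) (≡.sym (ℕₚ.m∸n+n≡m K≤n)))) (ev-pad (n ∸ K) K {u} u-deg) ⟩
      ev K u ∎

  𝔸 : Series
  𝔸 k = nat (A k)

  module _ (w : Carrier) (w-eq : - nat 27 * (w * (1# - nat 27 * w)) ≈ 1#) where
    open Hasse.On.Curve.Cubic R n 1<p char unit 1# w using (cubic-hasse)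
    private
      module E₁ = Evaluation 1#
      module E = Evaluation w

      2K<p : K ℕ.+ K ℕ.< p
      2K<p = s≤s (≡.subst (K ℕ.+ K ℕ.≤_) (≡.sym 2n≡) (ℕₚ.≤-trans (≡.subst (K ℕ.+ K ℕ.≤_) (N.solve 1 (λ k → (k N.:+ k) N.:+ k N.:= k N.:* N.con 3) ≡.refl K) (ℕₚ.m≤m+n (K ℕ.+ K) K)) (ℕₚ.m≤n+m (K ℕ.* 3) r)))

      uℕ0 : uℕ 0 ≡ 1
      uℕ0 = ≡.cong₂ (λ x y → 1 ℕ.* x ℕ.* y) (nC0≡1 n) (nC0≡1 (2 ℕ.* n))

      u0 : u 0 ≈ 1#
      u0 = trans (nat-≡ uℕ0) (+-identityʳ 1#)

      v0 : v 0 ≈ 1#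
      v0 = trans (*-cong (+-identityʳ 1#) u0) (*-identityˡ 1#)

      module Cl = O.Clausen u v K v-deg u-ode v-ode (trans (*-cong u0 u0) (trans (*-identityˡ 1#) (sym v0)))
      module Do = O.Domb (n ℕ.+ n) K r ≡.refl 2n≡ v v-deg v-ode

      -3# : Carrier
      -3# = - nat 3

      three-unit : nat 3 ^ (n ℕ.+ n) ≈ 1#
      three-unit = cancel-nat (∤-small (s≤s z≤n) 3<p) (trans (fermat 3) (sym (*-identityʳ _)))

      -3-unit : -3# ^ (n ℕ.+ n) ≈ 1#
      -3-unit = trans (trans (^-homo-* -3# n n) (sym (^-distrib-* -3# -3# n))) (trans (^-congˡ n (solve 0 ((:- κ 3) :* (:- κ 3) := κ 3 :* κ 3)))
        (trans (trans (^-distrib-* (nat 3) (nat 3) n) (sym (^-homo-* (nat 3) n n))) three-unit))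

      sum-ev : ∀ d (f : ℕ → ℕ) → nat (sumBelow (suc d) f) ≈ E₁.ev d (λ k → nat (f k))
      sum-ev zero f = refl
      sum-ev (suc d) f = trans (nat-≡ (head (suc d) f)) (trans (nat-+ (f 0) (sumBelow (suc d) (λ k → f (suc k)))) (+-congˡ (trans (sum-ev d (λ k → f (suc k))) (sym (*-identityˡ _)))))
        where
        head : ∀ d f → sumBelow (suc d) f ≡ f 0 ℕ.+ sumBelow d (λ k → f (suc k))
        head zero f = ℕₚ.+-comm 0 (f 0)
        head (suc d) f = ≡.trans (≡.cong (ℕ._+ f (suc d)) (head d f)) (ℕₚ.+-assoc (f 0) _ _)

      𝔸-ode : O.Operator.apply Do.L 𝔸 S.≈ S.0#
      𝔸-ode = S.trans (S.solve 5 (λ t a b c y →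
          (:1 :- κ 20 :* t :+ κ 64 :* (t :* t)) :* c :+ (κ 192 :* (t :* t) :- κ 30 :* t) :* b :+ (κ 192 :* (t :* t) :- κ 18 :* t) :* a :+ (κ 64 :* (t :* t) :- κ 4 :* t) :* y
          := (c :+ t :* (t :* (κ 64 :* c :+ κ 192 :* b :+ κ 192 :* a :+ κ 64 :* y))) :- t :* (κ 20 :* c :+ κ 30 :* b :+ κ 18 :* a :+ κ 4 :* y)) t a₁ a₂ a₃ 𝔸)
        (λ k → ≈⇒diff≈0 (balance k))
        where
        a₁ = θ 𝔸
        a₂ = θ a₁
        a₃ = θ a₂
        F G : Series
        F = S.nat 64 S.* a₃ S.+ S.nat 192 S.* a₂ S.+ S.nat 192 S.* a₁ S.+ S.nat 64 S.* 𝔸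
        G = S.nat 20 S.* a₃ S.+ S.nat 30 S.* a₂ S.+ S.nat 18 S.* a₁ S.+ S.nat 4 S.* 𝔸
        expand : ∀ i j l m k → (S.nat i S.* a₃ S.+ S.nat j S.* a₂ S.+ S.nat l S.* a₁ S.+ S.nat m S.* 𝔸) k
          ≈ (nat i * (nat k * nat k * nat k) + nat j * (nat k * nat k) + nat l * nat k + nat m) * 𝔸 k
        expand i j l m k = trans (+-cong (+-cong (+-cong (nat-⊛ i a₃ k) (nat-⊛ j a₂ k)) (nat-⊛ l a₁ k)) (nat-⊛ m 𝔸 k))
          (solve 6 (λ i j l m k x → i :* (k :* (k :* (k :* x))) :+ j :* (k :* (k :* x)) :+ l :* (k :* x) :+ m :* x := (i :* (k :* k :* k) :+ j :* (k :* k) :+ l :* k :+ m) :* x) (nat i) (nat j) (nat l) (nat m) (nat k) (𝔸 k))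
        balance : ∀ k → (a₃ S.+ t S.* (t S.* F)) k ≈ (t S.* G) k
        balance zero = solve 3 (λ x f g → :0 :* (:0 :* (:0 :* x)) :+ :0 :* f := :0 :* g) (𝔸 0) _ _
        -- The recurrence begins with A 2; this coefficient records A 1 = 4 A 0.
        balance (suc zero) = trans (+-congˡ (trans (t-⊛-suc (t S.* F) 0) (t-⊛-zero F))) (trans (trans (+-identityʳ _)
          (solve 0 ((:1 :+ :0) :* ((:1 :+ :0) :* ((:1 :+ :0) :* κ 4)) := (κ 20 :* (:0 :* :0 :* :0) :+ κ 30 :* (:0 :* :0) :+ κ 18 :* :0 :+ κ 4) :* κ 1)))
          (sym (trans (t-⊛-suc G 0) (expand 20 30 18 4 0))))
        balance (suc (suc k)) = begin
          a₃ (suc (suc k)) + (t S.* (t S.* F)) (suc (suc k))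
            ≈⟨ +-congˡ (trans (t-⊛-suc (t S.* F) (suc k)) (trans (t-⊛-suc F k) (expand 64 192 192 64 k))) ⟩
          a₃ (suc (suc k)) + (nat 64 * (nat k * nat k * nat k) + nat 192 * (nat k * nat k) + nat 192 * nat k + nat 64) * 𝔸 k
            ≈⟨ solve 4 (λ k s x y → s :* (s :* (s :* x)) :+ (κ 64 :* (k :* k :* k) :+ κ 192 :* (k :* k) :+ κ 192 :* k :+ κ 64) :* y
                 := s :* s :* s :* x :+ κ 64 :* ((:1 :+ k) :* (:1 :+ k) :* (:1 :+ k)) :* y) (nat k) (nat (suc (suc k))) (𝔸 (suc (suc k))) (𝔸 k) ⟩
          nat s * nat s * nat s * 𝔸 s + nat 64 * (nat m * nat m * nat m) * 𝔸 k
            ≈⟨ sym (trans (nat-+ (s ℕ.* s ℕ.* s ℕ.* A s) (64 ℕ.* (m ℕ.* m ℕ.* m) ℕ.* A k)) (+-cong (trans (nat-* (s ℕ.* s ℕ.* s) (A s)) (*-congʳ (cube s)))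
                 (trans (nat-* (64 ℕ.* (m ℕ.* m ℕ.* m)) (A k)) (*-congʳ (trans (nat-* 64 (m ℕ.* m ℕ.* m)) (*-congˡ (cube m))))))) ⟩
          nat (s ℕ.* s ℕ.* s ℕ.* A s ℕ.+ 64 ℕ.* (m ℕ.* m ℕ.* m) ℕ.* A k)
            ≈⟨ nat-≡ (domb-recurrence k) ⟩
          nat ((20 ℕ.* (m ℕ.* m ℕ.* m) ℕ.+ 30 ℕ.* (m ℕ.* m) ℕ.+ 18 ℕ.* m ℕ.+ 4) ℕ.* A m)
            ≈⟨ trans (nat-* (20 ℕ.* (m ℕ.* m ℕ.* m) ℕ.+ 30 ℕ.* (m ℕ.* m) ℕ.+ 18 ℕ.* m ℕ.+ 4) (A m)) (*-congʳ (trans (nat-+ (20 ℕ.* (m ℕ.* m ℕ.* m) ℕ.+ 30 ℕ.* (m ℕ.* m) ℕ.+ 18 ℕ.* m) 4) (+-congʳ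
                 (trans (nat-+ (20 ℕ.* (m ℕ.* m ℕ.* m) ℕ.+ 30 ℕ.* (m ℕ.* m)) (18 ℕ.* m)) (+-cong (trans (nat-+ (20 ℕ.* (m ℕ.* m ℕ.* m)) (30 ℕ.* (m ℕ.* m)))
                   (+-cong (trans (nat-* 20 (m ℕ.* m ℕ.* m)) (*-congˡ (cube m))) (trans (nat-* 30 (m ℕ.* m)) (*-congˡ (nat-* m m))))) (nat-* 18 m)))))) ⟩
          (nat 20 * (nat m * nat m * nat m) + nat 30 * (nat m * nat m) + nat 18 * nat m + nat 4) * 𝔸 m
            ≈⟨ sym (trans (t-⊛-suc G m) (expand 20 30 18 4 m)) ⟩
          (t S.* G) (suc (suc k)) ∎
          where
          s = suc (suc k)
          m = suc k
          cube : ∀ j → nat (j ℕ.* j ℕ.* j) ≈ nat j * nat j * nat j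
          cube j = trans (nat-* (j ℕ.* j) j) (*-congʳ (nat-* j j))

    -- The hypothesis on w says w (1 - 27 w) = -1/27, the value at t = 1 of the argument in the Domb
    -- formula, so that formula and Clausen's meet. The remaining factor (-3)^(p-1) is 1.
    domb-sum-square : nat (sumBelow p A) ≈ cubic-hasse * cubic-hasse
    domb-sum-square = begin
      nat (sumBelow p A) ≈⟨ sum-ev (n ℕ.+ n) A ⟩
      E₁.ev (n ℕ.+ n) 𝔸 ≈⟨ Do.domb-sum z₀ z₀-eq 𝔸-ode (trans (+-identityʳ 1#) (sym v0)) ⟩
      -3# ^ (n ℕ.+ n) * Z.ev K v ≈⟨ trans (*-congʳ -3-unit) (*-identityˡ _) ⟩
      Z.ev K v ≈⟨ sym (Cl.clausen-value w u-deg 2K<p) ⟩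
      E.ev K u * E.ev K u ≈⟨ *-cong (sym (cubic-hasse-series w)) (sym (cubic-hasse-series w)) ⟩
      cubic-hasse * cubic-hasse ∎
      where
      z₀ = w * (1# - nat 27 * w)
      module Z = Evaluation z₀
      z₀-eq : -3# * -3# * -3# * z₀ ≈ 1#
      z₀-eq = trans (*-congʳ (solve 0 ((:- κ 3) :* (:- κ 3) :* (:- κ 3) := :- κ 27))) w-eq

-- Reduction of points from ℤ / p² to ℤ / p

module Thickening (A K : CommutativeRing 0ℓ 0ℓ) where
 private
   module A = RingKit A
   module K = RingKit K

 -- the situation of ℤ / p² → ℤ / p
 record IsThickening (p : ℕ) (φ : A.Carrier → K.Carrier) : Set where
   field
     hom : IsRingHomomorphism A.rawRing K.rawRing φ
     surjective : ∀ x → ∃ λ y → φ y K.≈ x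
     kernel : ∀ {x} → φ x K.≈ K.0# → ∃ λ y → x A.≈ A.nat p A.* y
     torsion : ∀ {x} → A.nat p A.* x A.≈ A.0# → φ x K.≈ K.0#
     p²≈0 : A.nat p A.* A.nat p A.≈ A.0#

module Reduction (A K : CommutativeRing 0ℓ 0ℓ) where
 private
   module A = RingKit A
   module K = RingKit K
   module AS = Series A
   module AR = RingKit AS.seriesRing
 open Series K
 open RingKit seriesRing

 module On
   (φ : CommutativeRing.Carrier A → CommutativeRing.Carrier K)
   (hom : IsRingHomomorphism (CommutativeRing.rawRing A) (CommutativeRing.rawRing K) φ)
   (½ : CommutativeRing.Carrier A)
   (½*2 : RingKit.IsHalf A ½)
   (q : CommutativeRing.Carrier A) where
  open IsRingHomomorphism hom

  φ-nat : ∀ k → φ (A.nat k) K.≈ K.nat k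
  φ-nat zero = 0#-homo
  φ-nat (suc k) = K.trans (+-homo A.1# (A.nat k)) (K.+-cong 1#-homo (φ-nat k))

  Φ : AS.Series → Series
  Φ f n = φ (f n)

  Φ-cong : ∀ {f g} → f AR.≈ g → Φ f ≈ Φ g
  Φ-cong h n = ⟦⟧-cong (h n)

  Φ-+ : ∀ f g → Φ (f AR.+ g) ≈ Φ f + Φ g
  Φ-+ f g n = +-homo (f n) (g n)

  Φ-neg : ∀ f → Φ (AR.- f) ≈ - Φ f
  Φ-neg f n = -‿homo (f n)

  Φ-* : ∀ f g → Φ (f AR.* g) ≈ Φ f * Φ g
  Φ-* f g zero = *-homo (f 0) (g 0)
  Φ-* f g (suc n) = K.trans (+-homo _ _) (K.+-cong (*-homo (f 0) (g (suc n))) (Φ-* (AS.tl f) g n))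

  Φ-1 : Φ AR.1# ≈ 1#
  Φ-1 zero = 1#-homo
  Φ-1 (suc n) = 0#-homo

  Φ-t : Φ AS.t ≈ t
  Φ-t zero = 0#-homo
  Φ-t (suc n) = Φ-1 n

  Φ-C : ∀ c → Φ (AS.C c) ≈ C (φ c)
  Φ-C c zero = K.refl
  Φ-C c (suc n) = 0#-homo

  Φ-θ : ∀ f → Φ (AS.θ f) ≈ θ (Φ f)
  Φ-θ f n = K.trans (*-homo _ _) (K.*-congʳ (φ-nat n))

  ½*2′ : φ ½ K.* K.nat 2 K.≈ K.1#
  ½*2′ = K.trans (K.*-congˡ (K.sym (φ-nat 2))) (K.trans (K.sym (*-homo ½ (A.nat 2))) (K.trans (⟦⟧-cong ½*2) 1#-homo))

  module PA = Points.On A ½ ½*2 q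
  module PK = Points.On K (φ ½) ½*2′ (φ q)
  private
    module RA = PA.Point
    module RK = PK.Point

  private
    Φ-quartic : ∀ f → Φ (PA.quartic f) ≈ PK.quartic (Φ f)
    Φ-quartic f = trans (Φ-+ _ _) (+-cong (trans (Φ-+ _ _) (+-cong Φ-1 (trans (Φ-* (AS.C q) f) (*-congʳ (Φ-C q))))) (Φ-* f f))

    quartic-cong : ∀ {f g} → f ≈ g → PK.quartic f ≈ PK.quartic g
    quartic-cong h = +-cong (+-congˡ {1#} (*-congˡ {C (φ q)} h)) (*-cong h h)

  -- f + g has constant term 2, hence is a unit, and it kills f - g.
  sqrt-unique : ∀ {f g} → f 0 K.≈ K.1# → g 0 K.≈ K.1# → f * f ≈ g * g → f ≈ g
  sqrt-unique {f} {g} f0 g0 h = diff≈0⇒≈ (PK.cancel-unit (inv-inverse s s0) (begin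
    s * (f - g) ≈⟨ solve 3 (λ h f g → (h :* (f :+ g)) :* (f :- g) := h :* (f :* f :- g :* g)) (C (φ ½)) f g ⟩
    C (φ ½) * (f * f - g * g) ≈⟨ *-congˡ {C (φ ½)} (≈⇒diff≈0 h) ⟩
    C (φ ½) * 0# ≈⟨ solve 2 (λ h s → h :* :0 := s :* :0) (C (φ ½)) s ⟩
    s * 0# ∎))
    where
    s : Series
    s = C (φ ½) * (f + g)
    s0 : s 0 K.≈ K.1#
    s0 = K.trans (K.*-congˡ (K.+-cong f0 g0)) (K.trans (K.*-congˡ (K.solve 0 (:1 :+ :1 := κ 2))) ½*2′)

  Φ-y₀ : Φ PA.y₀ ≈ PK.y₀
  Φ-y₀ = sqrt-unique 1#-homo K.refl (begin
    Φ PA.y₀ * Φ PA.y₀ ≈⟨ sym (Φ-* PA.y₀ PA.y₀) ⟩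
    Φ (PA.y₀ AR.* PA.y₀) ≈⟨ Φ-cong PA.y₀-square ⟩
    Φ (PA.quartic (AS.t AR.* AS.t)) ≈⟨ Φ-quartic _ ⟩
    PK.quartic (Φ (AS.t AR.* AS.t)) ≈⟨ quartic-cong (trans (Φ-* AS.t AS.t) (*-cong Φ-t Φ-t)) ⟩
    PK.quartic (t * t) ≈⟨ sym PK.y₀-square ⟩
    PK.y₀ * PK.y₀ ∎)

  reduce : PA.Point → PK.Point
  reduce P = record
    { x = Φ (RA.x P) ; y = Φ (RA.y P) ; m = φ (RA.m P)
    ; x-zero = K.trans (⟦⟧-cong (RA.x-zero P)) 0#-homo
    ; y-zero = K.trans (⟦⟧-cong (RA.y-zero P)) 1#-homo
    ; curve = trans (sym (Φ-* (RA.y P) (RA.y P))) (trans (Φ-cong (RA.curve P)) (trans (Φ-quartic _) (quartic-cong (Φ-* (RA.x P) (RA.x P)))))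
    ; diff = begin
        PK.y₀ * θ (Φ (RA.x P)) ≈⟨ *-cong (sym Φ-y₀) (sym (Φ-θ (RA.x P))) ⟩
        Φ PA.y₀ * Φ (AS.θ (RA.x P)) ≈⟨ trans (sym (Φ-* PA.y₀ (AS.θ (RA.x P)))) (Φ-cong (RA.diff P)) ⟩
        Φ (AS.t AR.* (AS.C (RA.m P) AR.* RA.y P))
          ≈⟨ trans (Φ-* AS.t _) (*-cong Φ-t (trans (Φ-* (AS.C (RA.m P)) (RA.y P)) (*-congʳ (Φ-C (RA.m P))))) ⟩
        t * (C (φ (RA.m P)) * Φ (RA.y P)) ∎
    }

  x-⊞-cong : ∀ {P P′ Q Q′} → RK.x P ≈ RK.x P′ → RK.y P ≈ RK.y P′ → RK.x Q ≈ RK.x Q′ → RK.y Q ≈ RK.y Q′ →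
    RK.x (P PK.⊞ Q) ≈ RK.x (P′ PK.⊞ Q′)
  x-⊞-cong {P} {P′} {Q} {Q′} ex ey fx fy = *-cong (+-cong (*-cong ex fy) (*-cong fx ey))
    (PK.cancel-unit (PK.Sum.Δi P Q) (trans (PK.Sum.Δi P Q) (sym (trans (*-congʳ Δ-eq) (PK.Sum.Δi P′ Q′)))))
    where
    Δ-eq : PK.Sum.Δ P Q ≈ PK.Sum.Δ P′ Q′
    Δ-eq = +-congˡ {1#} (-‿cong (*-cong (*-cong ex fx) (*-cong ex fx)))

  -- Only x-coordinates are compared, since the height of a sum depends on nothing else.
  reduce-⊞ : ∀ P Q → Φ (RA.x (P PA.⊞ Q)) ≈ RK.x (reduce P PK.⊞ reduce Q)
  reduce-⊞ P Q = trans (Φ-* (PA.Sum.N P Q) (PA.Sum.i P Q)) (*-cong N-eq i-eq)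
    where
    x₁ = RA.x P
    x₂ = RA.x Q
    P′ = reduce P
    Q′ = reduce Q
    N-eq : Φ (PA.Sum.N P Q) ≈ PK.Sum.N P′ Q′
    N-eq = trans (Φ-+ _ _) (+-cong (Φ-* x₁ (RA.y Q)) (Φ-* x₂ (RA.y P)))
    Δ-eq : Φ (PA.Sum.Δ P Q) ≈ PK.Sum.Δ P′ Q′
    Δ-eq = trans (Φ-+ _ _) (+-cong Φ-1 (trans (Φ-neg _) (-‿cong (trans (Φ-* (x₁ AR.* x₂) (x₁ AR.* x₂)) (*-cong (Φ-* x₁ x₂) (Φ-* x₁ x₂))))))
    i-eq : Φ (PA.Sum.i P Q) ≈ PK.Sum.i P′ Q′
    i-eq = PK.cancel-unit (PK.Sum.Δi P′ Q′) (trans (trans (*-congʳ (sym Δ-eq)) (trans (sym (Φ-* (PA.Sum.Δ P Q) (PA.Sum.i P Q))) (trans (Φ-cong (PA.Sum.Δi P Q)) Φ-1))) (sym (PK.Sum.Δi P′ Q′)))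

  reduce-⊟ : ∀ P Q → Φ (RA.x (P PA.⊟ Q)) ≈ RK.x (reduce P PK.⊟ reduce Q)
  reduce-⊟ P Q = trans (reduce-⊞ P (PA.neg Q)) (x-⊞-cong {reduce P} {reduce P} {reduce (PA.neg Q)} {PK.neg (reduce Q)} refl refl (Φ-neg (RA.x Q)) refl)

-- Series in t^p

module Flat (R : CommutativeRing 0ℓ 0ℓ) where
 open import Data.Nat.Divisibility using (_∣_)
 open import Data.Nat.Divisibility using (∣m+n∣m⇒∣n; ∣-refl)
 open Series R
 open RingKit seriesRing
 private
   module R = RingKit R

 module On (p : ℕ) (1<p : 1 ℕ.< p)
   (char : RingKit.HasChar R p)
   (unit : RingKit.UnitsPrimeTo R p)
   (fermat : ∀ a → CommutativeRing._≈_ R (RingKit._^_ R a p) a) where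
  private
    module CP = CharP.On R p 1<p char unit

    series-units : UnitsPrimeTo p
    series-units n p∤n = let (b , e) = unit n p∤n in C b , trans (*-congʳ (sym (C-nat n))) (trans (sym (C-* _ b)) (trans (C-cong e) C-1))

    module CS = CharP.On seriesRing p 1<p CP.Snat-p series-units

  infix 9 _♭
  -- The operator U_p known from modular forms; on series in t^p it undoes the substitution of t^p
  -- for t.
  _♭ : Series → Series
  (f ♭) j = f (j ℕ.* p)

  ♭-cong : ∀ {f g} → f ≈ g → f ♭ ≈ g ♭
  ♭-cong h j = h (j ℕ.* p)

  Sparse : Series → Set
  Sparse f = ∀ n → ¬ p ∣ n → f n R.≈ R.0#

  private
    drop : Series → Series
    drop f n = f (p ℕ.+ n)

    low : ∀ f k n → n ℕ.< k → (t ^ k * f) n R.≈ R.0#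
    low f (suc k) zero _ = R.trans (*-assoc t (t ^ k) f 0) (t-⊛-zero (t ^ k * f))
    low f (suc k) (suc n) (s≤s lt) = R.trans (*-assoc t (t ^ k) f (suc n)) (R.trans (t-⊛-suc (t ^ k * f) n) (low f k n lt))

    high : ∀ {a} n → 0 ℕ.< n → C a n R.≈ R.0#
    high (suc n) _ = R.refl

    split : ∀ {f} → Sparse f → f ≈ C (f 0) + t ^ p * drop f
    split {f} sp n with n ℕ.<? p
    split {f} sp zero | yes 0<p = R.sym (R.trans (R.+-congˡ (low (drop f) p 0 0<p)) (R.+-identityʳ _))
    split {f} sp (suc n) | yes n<p = R.trans (sp (suc n) (CP.∤-small (s≤s z≤n) n<p)) (R.sym (R.trans (R.+-congˡ (low (drop f) p (suc n) n<p)) (R.+-identityʳ _)))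
    split {f} sp n | no n≮p = ≡.subst (λ n → f n R.≈ C (f 0) n R.+ (t ^ p * drop f) n) (ℕₚ.m+[n∸m]≡n (ℕₚ.≮⇒≥ n≮p))
      (R.sym (R.trans (R.+-cong (high (p ℕ.+ (n ℕ.∸ p)) (ℕₚ.<-≤-trans (ℕₚ.<-trans (s≤s z≤n) 1<p) (ℕₚ.m≤m+n p _))) (t^-⊛ p (drop f) (n ℕ.∸ p))) (R.+-identityˡ _)))

    drop-sparse : ∀ {f} → Sparse f → Sparse (drop f)
    drop-sparse sp n p∤n = sp (p ℕ.+ n) (λ d → p∤n (∣m+n∣m⇒∣n d ∣-refl))

  -- When f is a series in t^p, the coefficients of a product at multiples of p involve g only at
  -- multiples of p. The induction splits f into its constant term and t^p times a series of the
  -- same kind.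
  ♭-* : ∀ {f} g → Sparse f → (f * g) ♭ ≈ f ♭ * g ♭
  ♭-* g sp zero = R.refl
  ♭-* {f} g sp (suc j) = R.begin
    (f * g) (p ℕ.+ j ℕ.* p)
      R.≈⟨ trans (*-congʳ (split sp)) (trans (distribʳ g (C (f 0)) (t ^ p * drop f)) (+-congˡ {C (f 0) * g} (*-assoc (t ^ p) (drop f) g))) (p ℕ.+ j ℕ.* p) ⟩
    (C (f 0) * g) (p ℕ.+ j ℕ.* p) R.+ (t ^ p * (drop f * g)) (p ℕ.+ j ℕ.* p)
      R.≈⟨ R.+-cong (C-⊛ (f 0) g _) (R.trans (t^-⊛ p (drop f * g) (j ℕ.* p)) (♭-* {drop f} g (drop-sparse sp) j)) ⟩
    f 0 R.* g (p ℕ.+ j ℕ.* p) R.+ (drop f ♭ * g ♭) j R.∎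

  -- f^p(t) = f(t^p) when the coefficients are fixed by the Frobenius
  power-♭ : ∀ f → (f ^ p) ♭ ≈ f
  power-♭ f zero = R.trans (CP.^-zero f p) (fermat (f 0))
  power-♭ f (suc j) = R.begin
    (f ^ p) (p ℕ.+ j ℕ.* p)
      R.≈⟨ trans (^-congˡ p (horner f)) (trans (CS.frobenius (C (f 0)) (t * tl f)) (+-cong (sym (C-^ (f 0) p)) (^-distrib-* t (tl f) p))) (p ℕ.+ j ℕ.* p) ⟩
    C (f 0 R.^ p) (p ℕ.+ j ℕ.* p) R.+ (t ^ p * tl f ^ p) (p ℕ.+ j ℕ.* p)
      R.≈⟨ R.+-cong (high _ (ℕₚ.<-≤-trans (ℕₚ.<-trans (s≤s z≤n) 1<p) (ℕₚ.m≤m+n p _))) (R.trans (t^-⊛ p (tl f ^ p) (j ℕ.* p)) (power-♭ (tl f) j)) ⟩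
    R.0# R.+ tl f j R.≈⟨ R.+-identityˡ _ ⟩
    f (suc j) R.∎

  p-power-sparse : ∀ f → Sparse (f ^ p)
  p-power-sparse f = CP.θ-kernel (CP.θ-p-power f)

-- Points of height 2 have multiplier ± 1

module SmallPoint (K : CommutativeRing 0ℓ 0ℓ) where
 private module K = RingKit K
 open Series K
 open RingKit seriesRing

 module On
   (_≟0 : RingKit.ZeroTest K)
   (inverse : RingKit.Inverses K)
   (1≉0 : RingKit.NonTrivial K)
   (½ : CommutativeRing.Carrier K)
   (½*2 : RingKit.IsHalf K ½)
   (A : CommutativeRing.Carrier K) where
  open Points.On K ½ ½*2 A
  open Point
  open Heights.On K _≟0 inverse 1≉0

  private
    cancel₂ : ∀ {a b} → K.nat 2 K.* a K.≈ K.nat 2 K.* b → a K.≈ b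
    cancel₂ {a} {b} h = K.trans (K.sym (half a)) (K.trans (K.*-congˡ h) (half b))
      where
      half : ∀ a → ½ K.* (K.nat 2 K.* a) K.≈ a
      half a = K.trans (K.sym (K.*-assoc ½ (K.nat 2) a)) (K.trans (K.*-congʳ ½*2) (K.*-identityˡ a))

    -- the convolution of Series at the level of solver expressions
    conv : ∀ {n} → (ℕ → Expr n) → (ℕ → Expr n) → ℕ → Expr n
    conv f g zero = f 0 :* g 0
    conv f g (suc n) = f 0 :* g (suc n) :+ conv (λ k → f (suc k)) g n

    poly₅ : ∀ {a} {A : Set a} → A → A → A → A → A → A → ℕ → A
    poly₅ z a b c d e 0 = a
    poly₅ z a b c d e 1 = b
    poly₅ z a b c d e 2 = c
    poly₅ z a b c d e 3 = d
    poly₅ z a b c d e 4 = e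
    poly₅ z a b c d e (suc (suc (suc (suc (suc _))))) = z

    nat₄ : Series
    nat₄ = poly₅ K.0# (K.nat 4) K.0# K.0# K.0# K.0#

  -- Only b = 0 is compatible with A ≠ 0, A² ≠ 3 and 2 A² ≠ 9.
  module _ (A≉0 : ¬ A K.≈ K.0#) (A²≉3 : ¬ A K.* A K.- K.nat 3 K.≈ K.0#) (2A²≉9 : ¬ K.nat 2 K.* (A K.* A) K.- K.nat 9 K.≈ K.0#) where

    private
      resolve : ∀ b l → A K.≈ K.nat 3 K.* b K.+ A K.* l → K.1# K.≈ K.nat 3 K.* (b K.* b) K.+ K.nat 2 K.* (b K.* (A K.* l)) K.+ l K.* l →
        b K.* (b K.* b K.+ A K.* l K.* b K.+ l K.* l) K.≈ K.0# → l K.≈ K.1#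
      resolve b l e₁ e₂ e₃ with b ≟0
      ... | yes z = K.diff≈0⇒≈ (integral {A} (K.trans (K.solve 3 (λ A l b → A :* (l :- :1) := κ 3 :* b :+ A :* l :- A :- κ 3 :* b) A l b)
              (K.trans (K.+-cong (K.≈⇒diff≈0 (K.sym e₁)) (K.-‿cong (K.trans (K.*-congˡ z) (K.zeroʳ _)))) (K.-‿inverseʳ K.0#))) A≉0)
      -- For b ≠ 0 the equations become b² = A b - 1 and l² = A b - 2; together with A l = A - 3 b
      -- and A² ≠ 3 they force A b = 3, so b² = 2 and 2 A² = 9.
      ... | no b≉0 = ⊥-elim (2A²≉9 (K.trans (K.sym (K.+-congʳ A²b²)) (K.≈⇒diff≈0 (K.trans (K.solve 2 (λ A b → A :* A :* (b :* b) := A :* b :* (A :* b)) A b)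
          (K.trans (K.*-cong Ab Ab) (K.solve 0 (κ 3 :* κ 3 := κ 9)))))))
        where
        e₃′ = integral e₃ b≉0
        Al : A K.* l K.≈ A K.- K.nat 3 K.* b
        Al = K.trans (K.solve 2 (λ u v → u := v :+ u :- v) (A K.* l) (K.nat 3 K.* b)) (K.+-congʳ (K.sym e₁))
        bb : b K.* b K.≈ A K.* b K.- K.1#
        bb = K.trans (K.cancel+ (K.solve 3 (λ b s L → b :* b :+ ((κ 3 :* (b :* b) :+ κ 2 :* (b :* s) :+ L) :+ :0) := (s :+ κ 3 :* b) :* b :- :1 :+ (:1 :+ (b :* b :+ s :* b :+ L))) b (A K.* l) (l K.* l))
          (K.+-cong (K.sym e₂) (K.sym e₃′)))
          (K.+-congʳ (K.*-congʳ (K.trans (K.+-comm _ _) (K.sym e₁))))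
        ll : l K.* l K.≈ A K.* b K.- K.nat 2
        ll = K.begin
          l K.* l K.≈⟨ K.solve 3 (λ b s L → L := (b :* b :+ s :* b :+ L) :- b :* b :- s :* b) b (A K.* l) (l K.* l) ⟩
          (b K.* b K.+ A K.* l K.* b K.+ l K.* l) K.- b K.* b K.- A K.* l K.* b K.≈⟨ K.+-cong (K.+-congʳ e₃′) (K.-‿cong (K.*-congʳ Al)) ⟩
          K.0# K.- b K.* b K.- (A K.- K.nat 3 K.* b) K.* b K.≈⟨ K.solve 2 (λ A b → :0 :- b :* b :- (A :- κ 3 :* b) :* b := κ 2 :* (b :* b) :- A :* b) A b ⟩
          K.nat 2 K.* (b K.* b) K.- A K.* b K.≈⟨ K.+-congʳ (K.*-congˡ bb) ⟩
          K.nat 2 K.* (A K.* b K.- K.1#) K.- A K.* b K.≈⟨ K.solve 1 (λ u → κ 2 :* (u :- :1) :- u := u :- κ 2) (A K.* b) ⟩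
          A K.* b K.- K.nat 2 K.∎
        prod : (A K.* A K.- K.nat 3) K.* (A K.* b K.- K.nat 3) K.≈ K.0#
        prod = K.begin
          (A K.* A K.- K.nat 3) K.* (A K.* b K.- K.nat 3)
            K.≈⟨ K.solve 2 (λ A b → (A :* A :- κ 3) :* (A :* b :- κ 3) := A :* A :* (A :* b :- κ 2) :- (A :* A :- κ 6 :* (A :* b) :+ κ 9 :* (A :* b :- :1))) A b ⟩
          A K.* A K.* (A K.* b K.- K.nat 2) K.- (A K.* A K.- K.nat 6 K.* (A K.* b) K.+ K.nat 9 K.* (A K.* b K.- K.1#))
            K.≈⟨ K.+-cong (K.*-congˡ (K.sym ll)) (K.-‿cong (K.+-congˡ (K.*-congˡ (K.sym bb)))) ⟩
          A K.* A K.* (l K.* l) K.- (A K.* A K.- K.nat 6 K.* (A K.* b) K.+ K.nat 9 K.* (b K.* b))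
            K.≈⟨ K.solve 3 (λ A l b → A :* A :* (l :* l) :- (A :* A :- κ 6 :* (A :* b) :+ κ 9 :* (b :* b)) := A :* l :* (A :* l) :- (A :- κ 3 :* b) :* (A :- κ 3 :* b)) A l b ⟩
          A K.* l K.* (A K.* l) K.- (A K.- K.nat 3 K.* b) K.* (A K.- K.nat 3 K.* b)
            K.≈⟨ K.≈⇒diff≈0 (K.*-cong Al Al) ⟩
          K.0# K.∎
        Ab : A K.* b K.≈ K.nat 3
        Ab = K.diff≈0⇒≈ (integral prod A²≉3)
        A²b² : A K.* A K.* (b K.* b) K.≈ K.nat 2 K.* (A K.* A)
        A²b² = K.trans (K.*-congˡ (K.trans bb (K.+-congʳ Ab))) (K.solve 1 (λ k → k :* (κ 3 :- :1) := κ 2 :* k) (A K.* A))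

      -- the coefficients of 1 + A t² + t⁴, of D = 1 + d t + b t² and of E = 2 D - θ D
      Q₀ : Series
      Q₀ = poly₅ K.0# K.1# K.0# A K.0# K.1#

      module _ (d b l : K.Carrier) where
        D₀ E₀ : Series
        D₀ = poly₅ K.0# K.1# d b K.0# K.0#
        E₀ = poly₅ K.0# (K.nat 2) d K.0# K.0# K.0#

        shift₂ shift₄ : Series
        shift₂ = poly₅ K.0# K.0# K.0# (A K.* l) K.0# K.0#
        shift₄ = poly₅ K.0# K.0# K.0# K.0# K.0# (l K.* l)

        module _ (eq : E₀ * E₀ * Q₀ ≈ nat₄ * (D₀ * (D₀ * D₀ + shift₂ * D₀ + shift₄))) where
          private
            infixl 7 _⊛ᴱ_
            infixl 6 _⊕ᴱ_
            Sᴱ : ℕ → Set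
            Sᴱ n = ℕ → Expr n
            _⊛ᴱ_ _⊕ᴱ_ : ∀ {n} → Sᴱ n → Sᴱ n → Sᴱ n
            _⊛ᴱ_ = conv
            (f ⊕ᴱ g) k = f k :+ g k
            lᴱ rᴱ : (d b l A : Expr 4) → Sᴱ 4
            lᴱ d b l A = let E = poly₅ :0 (κ 2) d :0 :0 :0 in E ⊛ᴱ E ⊛ᴱ poly₅ :0 :1 :0 A :0 :1
            rᴱ d b l A = let D = poly₅ :0 :1 d b :0 :0 in
              poly₅ :0 (κ 4) :0 :0 :0 :0 ⊛ᴱ (D ⊛ᴱ (D ⊛ᴱ D ⊕ᴱ poly₅ :0 :0 :0 (A :* l) :0 :0 ⊛ᴱ D ⊕ᴱ poly₅ :0 :0 :0 :0 :0 (l :* l)))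

          -- The coefficients of t on the two sides are 4 d and 12 d.
          d≈0 : d K.≈ K.0#
          d≈0 = cancel₂ (cancel₂ (cancel₂ (K.cancel+ {c = K.nat 4 K.* d} (K.begin
            K.nat 2 K.* (K.nat 2 K.* (K.nat 2 K.* d)) K.+ K.nat 4 K.* d
              K.≈⟨ K.solve 4 (λ d b l A → κ 2 :* (κ 2 :* (κ 2 :* d)) :+ κ 4 :* d := rᴱ d b l A 1) d b l A ⟩
            (nat₄ * (D₀ * (D₀ * D₀ + shift₂ * D₀ + shift₄))) 1
              K.≈⟨ K.sym (eq 1) ⟩
            (E₀ * E₀ * Q₀) 1
              K.≈⟨ K.solve 4 (λ d b l A → lᴱ d b l A 1 := κ 2 :* (κ 2 :* (κ 2 :* :0)) :+ κ 4 :* d) d b l A ⟩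
            K.nat 2 K.* (K.nat 2 K.* (K.nat 2 K.* K.0#)) K.+ K.nat 4 K.* d K.∎) K.refl)))

          private
            d-dies : ∀ {x y e} → K.nat 4 K.* x K.+ d K.* e K.≈ K.nat 4 K.* y → x K.≈ y
            d-dies {x} {y} {e} h = cancel₂ (cancel₂ (K.begin
              K.nat 2 K.* (K.nat 2 K.* x) K.≈⟨ K.solve 2 (λ x e → κ 2 :* (κ 2 :* x) := κ 4 :* x :+ :0 :* e) x e ⟩
              K.nat 4 K.* x K.+ K.0# K.* e K.≈⟨ K.+-congˡ (K.*-congʳ (K.sym d≈0)) ⟩
              K.nat 4 K.* x K.+ d K.* e K.≈⟨ h ⟩
              K.nat 4 K.* y K.≈⟨ K.solve 1 (λ y → κ 4 :* y := κ 2 :* (κ 2 :* y)) y ⟩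
              K.nat 2 K.* (K.nat 2 K.* y) K.∎))

          c₂ : A K.≈ K.nat 3 K.* b K.+ A K.* l
          c₂ = d-dies (K.trans (K.solve 4 (λ d b l A → κ 4 :* A :+ d :* (d :- κ 12 :* d) := lᴱ d b l A 2 :- κ 12 :* (d :* d)) d b l A)
            (K.trans (K.+-congʳ (eq 2)) (K.solve 4 (λ d b l A → rᴱ d b l A 2 :- κ 12 :* (d :* d) := κ 4 :* (κ 3 :* b :+ A :* l)) d b l A)))

          c₄ : K.1# K.≈ K.nat 3 K.* (b K.* b) K.+ K.nat 2 K.* (b K.* (A K.* l)) K.+ l K.* l
          c₄ = d-dies (K.trans (K.solve 4 (λ d b l A → κ 4 :* :1 :+ d :* (d :* A :- κ 4 :* (d :* (κ 3 :* b :+ A :* l))) := lᴱ d b l A 4 :- κ 4 :* (d :* d :* (κ 3 :* b :+ A :* l))) d b l A)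
            (K.trans (K.+-congʳ (eq 4)) (K.solve 4 (λ d b l A → rᴱ d b l A 4 :- κ 4 :* (d :* d :* (κ 3 :* b :+ A :* l)) := κ 4 :* (κ 3 :* (b :* b) :+ κ 2 :* (b :* (A :* l)) :+ l :* l)) d b l A)))

          c₆ : b K.* (b K.* b K.+ A K.* l K.* b K.+ l K.* l) K.≈ K.0#
          c₆ = K.sym (d-dies (K.trans (K.solve 4 (λ d b l A → κ 4 :* :0 :+ d :* d := lᴱ d b l A 6) d b l A)
            (K.trans (eq 6) (K.solve 4 (λ d b l A → rᴱ d b l A 6 := κ 4 :* (b :* (b :* b :+ A :* l :* b :+ l :* l))) d b l A))))

          coefficients : l K.≈ K.1#
          coefficients = resolve b l c₂ c₄ c₆

    private
      t-cancel : ∀ {f g} → t * f ≈ t * g → f ≈ g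
      t-cancel {f} {g} h n = K.trans (K.sym (t-⊛-suc f n)) (K.trans (h (suc n)) (t-⊛-suc g n))

    module _ (P : Point) (D : Series) (k : K.Carrier) (D-zero : D 0 K.≈ K.1#) (D-deg : Deg≤ D 2) (k≉0 : ¬ k K.≈ K.0#)
      (quotient : D * (x P * x P) ≈ C k * (t * t)) where

      private
        X x′ E c : Series
        X = x P * x P
        x′ = θ (x P)
        E = nat 2 * D - θ D
        c = C (m P)
        λ′ : K.Carrier
        λ′ = m P K.* m P

        x1 : x P 1 K.≈ m P
        x1 = K.trans (K.solve 3 (λ x w z → x := :1 :* ((:1 :+ :0) :* x) :+ w :* (:0 :* z)) (x P 1) (y₀ 1) (x P 0))
          (K.trans (diff P 1) (K.trans (t-⊛-suc (C (m P) * y P) 0) (K.trans (C-⊛ (m P) (y P) 0) (K.trans (K.*-congˡ (y-zero P)) (K.*-identityʳ (m P))))))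

        k≈ : k K.≈ λ′
        k≈ = K.begin
          k K.≈⟨ K.sym (K.trans (C-⊛ k (t * t) 2) (K.trans (K.*-congˡ (t-⊛-suc t 1)) (K.*-identityʳ k))) ⟩
          (C k * (t * t)) 2 K.≈⟨ K.sym (quotient 2) ⟩
          (D * X) 2 K.≈⟨ K.+-cong (K.*-congʳ D-zero) (K.+-cong (K.*-congˡ (K.+-cong (K.*-congʳ (x-zero P)) (K.*-congˡ (x-zero P)))) (K.*-congˡ (K.*-congʳ (x-zero P)))) ⟩
          K.1# K.* (x P 0 K.* x P 2 K.+ (x P 1 K.* x P 1 K.+ x P 2 K.* x P 0)) K.+ (D 1 K.* (K.0# K.* x P 1 K.+ x P 1 K.* K.0#) K.+ D 2 K.* (K.0# K.* x P 0))
            K.≈⟨ K.+-congʳ (K.*-congˡ (K.+-cong (K.*-congʳ (x-zero P)) (K.+-congˡ (K.*-congˡ (x-zero P))))) ⟩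
          K.1# K.* (K.0# K.* x P 2 K.+ (x P 1 K.* x P 1 K.+ x P 2 K.* K.0#)) K.+ (D 1 K.* (K.0# K.* x P 1 K.+ x P 1 K.* K.0#) K.+ D 2 K.* (K.0# K.* x P 0))
            K.≈⟨ K.solve 5 (λ x0 x1 x2 d1 d2 → :1 :* (:0 :* x2 :+ (x1 :* x1 :+ x2 :* :0)) :+ (d1 :* (:0 :* x1 :+ x1 :* :0) :+ d2 :* (:0 :* x0)) := x1 :* x1) (x P 0) (x P 1) (x P 2) (D 1) (D 2) ⟩
          x P 1 K.* x P 1 K.≈⟨ K.*-cong x1 x1 ⟩
          λ′ K.∎

        quotient′ : D * X ≈ c * c * (t * t)
        quotient′ = trans quotient (*-congʳ (trans (C-cong k≈) (C-* (m P) (m P))))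

        θ-tt : θ (c * c * (t * t)) ≈ nat 2 * (c * c * (t * t))
        θ-tt = trans (θ-cong (*-congʳ (sym (C-* (m P) (m P))))) (trans (θ-* (C λ′) (t * t)) (trans (+-cong (*-congʳ (θ-C λ′)) (*-congˡ {C λ′} (trans (θ-* t t) (+-cong (*-congʳ θ-t) (*-congˡ {t} θ-t)))))
          (trans (solve 2 (λ l T → :0 :* T :+ l :* (T :+ T) := κ 2 :* (l :* T)) (C λ′) (t * t)) (*-congˡ {nat 2} (*-congʳ (C-* (m P) (m P)))))))

        DDθX : D * D * (nat 2 * (x P * x′)) ≈ c * c * (t * t) * E
        DDθX = begin
          D * D * (nat 2 * (x P * x′))
            ≈⟨ solve 4 (λ D D′ x x′ → let X = x :* x in D :* D :* (κ 2 :* (x :* x′)) := D :* (D′ :* X :+ D :* (x′ :* x :+ x :* x′)) :- D′ :* (D :* X)) D (θ D) (x P) x′ ⟩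
          D * (θ D * X + D * (x′ * x P + x P * x′)) - θ D * (D * X)
            ≈⟨ +-cong (*-congˡ {D} (trans (sym (trans (θ-* D X) (+-congˡ {θ D * X} (*-congˡ {D} (θ-* (x P) (x P)))))) (trans (θ-cong quotient′) θ-tt))) (-‿cong (*-congˡ {θ D} quotient′)) ⟩
          D * (nat 2 * (c * c * (t * t))) - θ D * (c * c * (t * t))
            ≈⟨ solve 4 (λ D D′ c T → D :* (κ 2 :* (c :* c :* T)) :- D′ :* (c :* c :* T) := c :* c :* T :* (κ 2 :* D :- D′)) D (θ D) c (t * t) ⟩
          c * c * (t * t) * E ∎

        -- Square D² θ(x²) = m² t² E and insert the differential equation and the curve: y
        -- disappears, and a polynomial identity in D alone is left.
        cleared : c * c * (c * c) * (t * (t * (t * (t * (E * E * quartic (t * t)))))) ≈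
          c * c * (c * c) * (t * (t * (t * (t * (nat 4 * (D * (D * D + C A * (c * c * (t * t)) * D + c * c * (t * t) * (c * c * (t * t)))))))))
        cleared = begin
          c * c * (c * c) * (t * (t * (t * (t * (E * E * quartic (t * t))))))
            ≈⟨ solve 4 (λ c t E Q → c :* c :* (c :* c) :* (t :* (t :* (t :* (t :* (E :* E :* Q))))) := Q :* ((c :* c :* (t :* t) :* E) :* (c :* c :* (t :* t) :* E))) c t E (quartic (t * t)) ⟩
          quartic (t * t) * ((c * c * (t * t) * E) * (c * c * (t * t) * E))
            ≈⟨ *-cong (sym y₀-square) (*-cong (sym DDθX) (sym DDθX)) ⟩
          y₀ * y₀ * (D * D * (nat 2 * (x P * x′)) * (D * D * (nat 2 * (x P * x′))))
            ≈⟨ solve 4 (λ q D x x′ → q :* q :* (D :* D :* (κ 2 :* (x :* x′)) :* (D :* D :* (κ 2 :* (x :* x′)))) := κ 4 :* (D :* D :* D :* (D :* (x :* x)) :* ((q :* x′) :* (q :* x′)))) y₀ D (x P) x′ ⟩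
          nat 4 * (D * D * D * (D * X) * ((y₀ * x′) * (y₀ * x′)))
            ≈⟨ *-congˡ {nat 4} (*-cong (*-congˡ {D * D * D} quotient′) (*-cong (diff P) (diff P))) ⟩
          nat 4 * (D * D * D * (c * c * (t * t)) * ((t * (c * y P)) * (t * (c * y P))))
            ≈⟨ solve 4 (λ D c t y → κ 4 :* (D :* D :* D :* (c :* c :* (t :* t)) :* ((t :* (c :* y)) :* (t :* (c :* y)))) := c :* c :* (c :* c) :* (t :* (t :* (t :* (t :* (κ 4 :* (D :* (D :* D :* (y :* y))))))))) D c t (y P) ⟩
          c * c * (c * c) * (t * (t * (t * (t * (nat 4 * (D * (D * D * (y P * y P))))))))
            ≈⟨ inner (trans (*-congˡ {D * D} (curve P)) (trans (solve 3 (λ D a X → D :* D :* (:1 :+ a :* X :+ X :* X) := D :* D :+ a :* (D :* X) :* D :+ D :* X :* (D :* X)) D (C A) X)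
                 (+-cong (+-congˡ {D * D} (*-congʳ (*-congˡ {C A} quotient′))) (*-cong quotient′ quotient′)))) ⟩
          c * c * (c * c) * (t * (t * (t * (t * (nat 4 * (D * (D * D + C A * (c * c * (t * t)) * D + c * c * (t * t) * (c * c * (t * t))))))))) ∎
          where
          inner : ∀ {f g} → f ≈ g → c * c * (c * c) * (t * (t * (t * (t * (nat 4 * (D * f)))))) ≈ c * c * (c * c) * (t * (t * (t * (t * (nat 4 * (D * g))))))
          inner h = *-congˡ {c * c * (c * c)} (*-congˡ {t} (*-congˡ {t} (*-congˡ {t} (*-congˡ {t} (*-congˡ {nat 4} (*-congˡ {D} h))))))

        identity : E * E * quartic (t * t) ≈ nat 4 * (D * (D * D + C A * (c * c * (t * t)) * D + c * c * (t * t) * (c * c * (t * t))))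
        identity = t-cancel (t-cancel (t-cancel (t-cancel (cancel-series {c * c * (c * c)} nz cleared))))
          where
          λ≉0 : ¬ λ′ K.≈ K.0#
          λ≉0 z = k≉0 (K.trans k≈ z)
          nz : ¬ (c * c * (c * c)) 0 K.≈ K.0#
          nz = *-nonzero λ≉0 λ≉0

        d = D 1
        b = D 2

        D≈ : D ≈ D₀ d b λ′
        D≈ 0 = D-zero
        D≈ 1 = K.refl
        D≈ 2 = K.refl
        D≈ 3 = D-deg 3 ℕₚ.≤-refl
        D≈ 4 = D-deg 4 (ℕₚ.n≤1+n 3)
        D≈ (suc (suc (suc (suc (suc n))))) = D-deg _ (s≤s (s≤s (s≤s z≤n)))

        E≈ : E ≈ E₀ d b λ′
        E≈ = trans (+-cong (*-cong (sym (C-nat 2)) D≈) (-‿cong (θ-cong D≈))) λ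
          { 0 → K.trans (K.+-congʳ (C-⊛ (K.nat 2) (D₀ d b λ′) 0)) (K.solve 0 (κ 2 :* :1 :- :0 :* :1 := κ 2))
          ; 1 → K.trans (K.+-congʳ (C-⊛ (K.nat 2) (D₀ d b λ′) 1)) (K.solve 1 (λ d → κ 2 :* d :- κ 1 :* d := d) d)
          ; 2 → K.trans (K.+-congʳ (C-⊛ (K.nat 2) (D₀ d b λ′) 2)) (K.solve 1 (λ d → κ 2 :* d :- κ 2 :* d := :0) b)
          ; 3 → K.trans (K.+-congʳ (C-⊛ (K.nat 2) (D₀ d b λ′) 3)) (z (K.nat 3))
          ; 4 → K.trans (K.+-congʳ (C-⊛ (K.nat 2) (D₀ d b λ′) 4)) (z (K.nat 4))
          ; (suc (suc (suc (suc (suc n))))) → K.trans (K.+-congʳ (C-⊛ (K.nat 2) (D₀ d b λ′) (suc (suc (suc (suc (suc n))))))) (z _) }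
          where
          z : ∀ a → K.nat 2 K.* K.0# K.- a K.* K.0# K.≈ K.0#
          z a = K.solve 1 (λ a → κ 2 :* :0 :- a :* :0 := :0) a

        ttt : t * t * (t * t) ≈ poly₅ K.0# K.0# K.0# K.0# K.0# K.1#
        ttt n = K.trans (*-assoc t t (t * t) n) (go n)
          where
          go : ∀ n → (t * (t * (t * t))) n K.≈ poly₅ K.0# K.0# K.0# K.0# K.0# K.1# n
          go 0 = t-⊛-zero (t * (t * t))
          go 1 = K.trans (t-⊛-suc (t * (t * t)) 0) (t-⊛-zero (t * t))
          go 2 = K.trans (t-⊛-suc (t * (t * t)) 1) (K.trans (t-⊛-suc (t * t) 0) (t-⊛-zero t))
          go 3 = K.trans (t-⊛-suc (t * (t * t)) 2) (K.trans (t-⊛-suc (t * t) 1) (t-⊛-suc t 0))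
          go 4 = K.trans (t-⊛-suc (t * (t * t)) 3) (K.trans (t-⊛-suc (t * t) 2) (t-⊛-suc t 1))
          go (suc (suc (suc (suc (suc n))))) = K.trans (t-⊛-suc (t * (t * t)) (suc (suc (suc (suc n))))) (K.trans (t-⊛-suc (t * t) (suc (suc (suc n)))) (t-⊛-suc t (suc (suc n))))

        tt≈ : t * t ≈ poly₅ K.0# K.0# K.0# K.1# K.0# K.0#
        tt≈ 0 = t-⊛-zero t
        tt≈ 1 = t-⊛-suc t 0
        tt≈ 2 = t-⊛-suc t 1
        tt≈ 3 = t-⊛-suc t 2
        tt≈ 4 = t-⊛-suc t 3
        tt≈ (suc (suc (suc (suc (suc n))))) = t-⊛-suc t (suc (suc (suc (suc n))))

        scale₂ : ∀ k → C k * (t * t) ≈ poly₅ K.0# K.0# K.0# k K.0# K.0#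
        scale₂ k = trans (*-congˡ {C k} tt≈) (trans (C-⊛ k _) λ
          { 0 → K.zeroʳ k ; 1 → K.zeroʳ k ; 2 → K.*-identityʳ k ; 3 → K.zeroʳ k ; 4 → K.zeroʳ k ; (suc (suc (suc (suc (suc n))))) → K.zeroʳ k })

        scale₄ : ∀ k → C k * (t * t * (t * t)) ≈ poly₅ K.0# K.0# K.0# K.0# K.0# k
        scale₄ k = trans (*-congˡ {C k} ttt) (trans (C-⊛ k _) λ
          { 0 → K.zeroʳ k ; 1 → K.zeroʳ k ; 2 → K.zeroʳ k ; 3 → K.zeroʳ k ; 4 → K.*-identityʳ k ; (suc (suc (suc (suc (suc n))))) → K.zeroʳ k })

        Q≈ : quartic (t * t) ≈ Q₀
        Q≈ = trans (+-cong (+-congˡ {1#} (scale₂ A)) ttt) λ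
          { 0 → K.solve 0 (:1 :+ :0 :+ :0 := :1)
          ; 1 → K.solve 0 (:0 :+ :0 :+ :0 := :0)
          ; 2 → K.solve 1 (λ A → :0 :+ A :+ :0 := A) A
          ; 3 → K.solve 0 (:0 :+ :0 :+ :0 := :0)
          ; 4 → K.solve 0 (:0 :+ :0 :+ :1 := :1)
          ; (suc (suc (suc (suc (suc n))))) → K.solve 0 (:0 :+ :0 :+ :0 := :0) }

        shift₂≈ : C A * (c * c * (t * t)) ≈ shift₂ d b λ′
        shift₂≈ = trans (solve 3 (λ a c T → a :* (c :* c :* T) := (a :* (c :* c)) :* T) (C A) c (t * t))
          (trans (*-congʳ (trans (*-congˡ {C A} (sym (C-* (m P) (m P)))) (sym (C-* A λ′)))) (scale₂ (A K.* λ′)))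

        shift₄≈ : c * c * (t * t) * (c * c * (t * t)) ≈ shift₄ d b λ′
        shift₄≈ = trans (solve 2 (λ c T → c :* c :* T :* (c :* c :* T) := (c :* c :* (c :* c)) :* (T :* T)) c (t * t))
          (trans (*-congʳ (trans (*-cong (sym (C-* (m P) (m P))) (sym (C-* (m P) (m P)))) (sym (C-* λ′ λ′)))) (scale₄ (λ′ K.* λ′)))

        nat₄≈ : nat 4 ≈ nat₄
        nat₄≈ = trans (sym (C-nat 4)) λ
          { 0 → K.refl ; 1 → K.refl ; 2 → K.refl ; 3 → K.refl ; 4 → K.refl ; (suc (suc (suc (suc (suc n))))) → K.refl }

      -- Once d = 0, x² is a Möbius function of t² that fixes 0 and permutes the other branch points
      -- of Y² = X (1 + A X + X²). The exclusions on A say that the j-invariant is neither 0 nor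
      -- 1728, so this function is the identity.
      multiplier-square : m P K.* m P K.≈ K.1#
      multiplier-square = coefficients d b λ′ (begin
        E₀ d b λ′ * E₀ d b λ′ * Q₀ ≈⟨ *-cong (*-cong (sym E≈) (sym E≈)) (sym Q≈) ⟩
        E * E * quartic (t * t) ≈⟨ identity ⟩
        nat 4 * (D * (D * D + C A * (c * c * (t * t)) * D + c * c * (t * t) * (c * c * (t * t))))
          ≈⟨ *-cong nat₄≈ (*-cong D≈ (+-cong (+-cong (*-cong D≈ D≈) (*-cong shift₂≈ D≈)) shift₄≈)) ⟩
        nat₄ * (D₀ d b λ′ * (D₀ d b λ′ * D₀ d b λ′ + shift₂ d b λ′ * D₀ d b λ′ + shift₄ d b λ′)) ∎)

-- Arithmetic of the height form on N α + j

module HeightLattice where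
 open import Data.Integer as ℤ using (ℤ; +_; -[1+_]; _⊖_)
 open import Data.Nat.Divisibility using (_∣_; ∣⇒≤; ∣m+n∣m⇒∣n; ∣m∣n⇒∣m+n; ∣-refl)
 open import Data.Nat.Primality using (euclidsLemma)
 private
   module I = RingKit ℤₚ.+-*-commutativeRing
   infixl 6 _+_ _-_
   infixl 7 _*_
   _+_ _-_ _*_ : ℤ → ℤ → ℤ
   _+_ = ℤ._+_
   _-_ = ℤ._-_
   _*_ = ℤ._*_

 -- the height of R + j P when the heights of R and P are a and 2
 parabola : ℕ → ℤ → ℕ → ℤ
 parabola a ε j = + 2 * (+ j * + j) + ε * + j + + a

 slope : ℕ → ℕ → ℤ
 slope a b = + b - + 2 - + a

 -- The parallelogram law with a point of height 2 makes the second difference equal to 4.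
 parabola-next : ∀ a ε j d e f → + d ≡ parabola a ε j → + e ≡ parabola a ε (suc j) →
   f ℕ.+ d ≡ (e ℕ.+ e) ℕ.+ 4 → + f ≡ parabola a ε (suc (suc j))
 parabola-next a ε j d e f hd he h = I.cancel+ {c = + d} {d = parabola a ε j} (I.begin
   + f + + d I.≈⟨ ≡.cong +_ h ⟩
   + e + + e + + 4 I.≈⟨ ≡.cong (λ z → z + z + + 4) he ⟩
   parabola a ε (suc j) + parabola a ε (suc j) + + 4
     I.≈⟨ I.solve 3 (λ a ε j → let P = λ j → κ 2 :* (j :* j) :+ ε :* j :+ a in
       P (:1 :+ j) :+ P (:1 :+ j) :+ κ 4 := P (:1 :+ (:1 :+ j)) :+ P j) (+ a) ε (+ j) ⟩
   parabola a ε (suc (suc j)) + parabola a ε j I.∎) hd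

 parabola-zero : ∀ a ε → + a ≡ parabola a ε 0
 parabola-zero a ε = I.solve 2 (λ a ε → a := κ 2 :* (:0 :* :0) :+ ε :* :0 :+ a) (+ a) ε

 parabola-one : ∀ a b → + b ≡ parabola a (slope a b) 1
 parabola-one a b = I.solve 2 (λ a b → b := κ 2 :* (:1 :* :1) :+ (b :- κ 2 :- a) :* :1 :+ a) (+ a) (+ b)

 squares-step : ∀ k → (8 ℕ.* (suc (suc k) ℕ.* suc (suc k)) ℕ.+ 8 ℕ.* (suc (suc k) ℕ.* suc (suc k))) ℕ.+ 16
   ≡ 8 ℕ.* (suc (suc (suc k)) ℕ.* suc (suc (suc k))) ℕ.+ 8 ℕ.* (suc k ℕ.* suc k)
 squares-step k = N.solve 1 (λ k → (N.con 8 N.:* ((N.con 2 N.:+ k) N.:* (N.con 2 N.:+ k)) N.:+ N.con 8 N.:* ((N.con 2 N.:+ k) N.:* (N.con 2 N.:+ k))) N.:+ N.con 16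
   N.:= N.con 8 N.:* ((N.con 3 N.:+ k) N.:* (N.con 3 N.:+ k)) N.:+ N.con 8 N.:* ((N.con 1 N.:+ k) N.:* (N.con 1 N.:+ k))) ≡.refl k

 module _ (N M p : ℕ) (prime : Prime p) (0<N : 0 ℕ.< N) (3≤M : 3 ℕ.≤ M) (M<p : M ℕ.< p) (10N<p : 10 ℕ.* N ℕ.< p)
   (norm : M ℕ.* M ℕ.+ 4 ℕ.* (N ℕ.* N) ≡ p ℕ.+ M ℕ.* N)
   (d₊ d₋ hu hd : ℕ) (sum : d₊ ℕ.+ d₋ ≡ (8 ℕ.* (N ℕ.* N) ℕ.+ 8 ℕ.* (N ℕ.* N)) ℕ.+ 4)
   (up : + hu ≡ parabola (8 ℕ.* (N ℕ.* N)) (slope (8 ℕ.* (N ℕ.* N)) d₊) (N ℕ.+ N))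
   (down : + hd ≡ parabola (8 ℕ.* (N ℕ.* N)) (slope (8 ℕ.* (N ℕ.* N)) d₋) M)
   (p∣hd : p ∣ hd) where

   private
     a = 8 ℕ.* (N ℕ.* N)
     n = + N
     m = + M
     -- The deviation of the cross term from 2 N, its value for twice the norm form of ℤ[α].
     η : ℤ
     η = slope a d₊ - (n + n)

     a≡ : + a ≡ + 8 * (n * n)
     a≡ = ≡.trans (ℤₚ.pos-* 8 (N ℕ.* N)) (≡.cong (+ 8 *_) (ℤₚ.pos-* N N))

     norm′ : m * m + + 4 * (n * n) ≡ + p + m * n
     norm′ = ≡.trans (≡.cong₂ _+_ (≡.sym (ℤₚ.pos-* M M)) (≡.trans (≡.cong (+ 4 *_) (≡.sym (ℤₚ.pos-* N N))) (≡.sym (ℤₚ.pos-* 4 (N ℕ.* N)))))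
       (≡.trans (≡.cong +_ norm) (≡.cong (λ z → + p + z) (ℤₚ.pos-* M N)))

     slopes : slope a d₋ ≡ ℤ.- slope a d₊
     slopes = I.diff≈0⇒≈ (≡.trans (I.solve 3 (λ a b c → (c :- κ 2 :- a) :- (:- (b :- κ 2 :- a)) := (b :+ c) :- (a :+ a :+ κ 4)) (+ a) (+ d₊) (+ d₋))
       (I.≈⇒diff≈0 (≡.cong +_ sum)))

     down′ : + hd + η * m ≡ + p + + p
     down′ = ≡.trans (≡.cong (λ z → z + η * m) (≡.trans down (≡.cong₂ (λ s a′ → + 2 * (m * m) + s * m + a′) slopes a≡)))
       (≡.trans (I.solve 3 (λ s m n → κ 2 :* (m :* m) :+ (:- s) :* m :+ κ 8 :* (n :* n) :+ (s :- (n :+ n)) :* m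
           := (m :* m :+ κ 4 :* (n :* n)) :+ (m :* m :+ κ 4 :* (n :* n)) :- (m :* n :+ m :* n)) (slope a d₊) m n)
         (≡.trans (≡.cong (λ z → z + z - (m * n + m * n)) norm′)
           (I.solve 2 (λ p k → p :+ k :+ (p :+ k) :- (k :+ k) := p :+ p) (+ p) (m * n))))

     up′ : + hu ≡ + 2 * n * (+ 10 * n + η)
     up′ = ≡.trans up (≡.trans (≡.cong (λ a′ → + 2 * ((n + n) * (n + n)) + slope a d₊ * (n + n) + a′) a≡)
       (I.solve 2 (λ s n → κ 2 :* ((n :+ n) :* (n :+ n)) :+ s :* (n :+ n) :+ κ 8 :* (n :* n) := κ 2 :* n :* (κ 10 :* n :+ (s :- (n :+ n)))) (slope a d₊) n))

     p∣factor : ∀ k → p ∣ k ℕ.* M → p ∣ k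
     p∣factor k d with euclidsLemma k M prime d
     ... | inj₁ h = h
     ... | inj₂ h = ⊥-elim (ℕₚ.<⇒≱ M<p (∣⇒≤ {{ℕ.>-nonZero (ℕₚ.<-≤-trans (s≤s z≤n) 3≤M)}} h))

     p∣2p : p ∣ p ℕ.+ p
     p∣2p = ∣m∣n⇒∣m+n ∣-refl ∣-refl

     0<p : 0 ℕ.< p
     0<p = ℕₚ.≤-<-trans z≤n M<p

     positive : ∀ k → hd ℕ.+ k ℕ.* M ≡ p ℕ.+ p → hd ≡ p ℕ.+ p
     positive zero h = ≡.trans (≡.sym (ℕₚ.+-identityʳ hd)) h
     positive (suc k) h = ⊥-elim (ℕₚ.<⇒≱ (ℕₚ.m<m+n (p ℕ.+ p) 0<p)
       (ℕₚ.≤-trans (ℕₚ.≤-reflexive (N.solve 1 (λ p → p N.:+ p N.:+ p N.:= p N.:* N.con 3) ≡.refl p))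
         (ℕₚ.≤-trans (ℕₚ.*-mono-≤ (∣⇒≤ p∣k) 3≤M) (ℕₚ.≤-trans (ℕₚ.m≤n+m (suc k ℕ.* M) hd) (ℕₚ.≤-reflexive h)))))
       where
       p∣k : p ∣ suc k
       p∣k = p∣factor (suc k) (∣m+n∣m⇒∣n (≡.subst (p ∣_) (≡.sym h) p∣2p) p∣hd)

     negative : ∀ k → hd ≡ (p ℕ.+ p) ℕ.+ suc k ℕ.* M → hu ℕ.+ 2 ℕ.* N ℕ.* suc k ≡ 2 ℕ.* N ℕ.* (10 ℕ.* N) → hd ≡ p ℕ.+ p
     negative k h h′ = ⊥-elim (ℕₚ.<⇒≱ (ℕₚ.*-monoʳ-< (2 ℕ.* N) {{ℕ.>-nonZero (ℕₚ.≤-trans 0<N (ℕₚ.m≤m+n N _))}} (ℕₚ.<-≤-trans 10N<p (∣⇒≤ p∣k)))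
       (ℕₚ.≤-trans (ℕₚ.m≤n+m _ hu) (ℕₚ.≤-reflexive h′)))
       where
       p∣k : p ∣ suc k
       p∣k = p∣factor (suc k) (∣m+n∣m⇒∣n (≡.subst (p ∣_) h p∣hd) p∣2p)

     cases : ∀ z → η ≡ z → hd ≡ p ℕ.+ p
     cases (+ k) e = positive k (ℤₚ.+-injective (≡.trans (≡.cong (λ z → + hd + z) (ℤₚ.pos-* k M)) (≡.trans (≡.cong (λ z → + hd + z * m) (≡.sym e)) down′)))
     cases -[1+ k ] e = negative k
       (ℤₚ.+-injective (≡.trans (I.solve 2 (λ h z → h := h :+ z :- z) (+ hd) (η * m)) (≡.trans (≡.cong (_- η * m) down′)
         (≡.cong (λ z → + p + + p + z) (≡.trans (≡.cong (λ z → ℤ.- (z * m)) e) (≡.trans (ℤₚ.neg-distribˡ-* -[1+ k ] m) (≡.sym (ℤₚ.pos-* (suc k) M))))))))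
       (ℤₚ.+-injective (≡.trans (≡.cong₂ _+_ up′ (≡.trans (ℤₚ.pos-* (2 ℕ.* N) (suc k)) (≡.cong (_* + suc k) (ℤₚ.pos-* 2 N))))
         (≡.trans (≡.cong (λ z → + 2 * n * (+ 10 * n + z) + + 2 * n * + suc k) e)
           (≡.trans (I.solve 2 (λ n k → κ 2 :* n :* (κ 10 :* n :+ (:- k)) :+ κ 2 :* n :* k := κ 2 :* n :* (κ 10 :* n)) n (+ suc k))
             (≡.sym (≡.trans (ℤₚ.pos-* (2 ℕ.* N) (10 ℕ.* N)) (≡.cong₂ _*_ (ℤₚ.pos-* 2 N) (ℤₚ.pos-* 10 N))))))))

   -- hd = 2 p - η M, so p divides η. If η ≥ p, this is negative because M ≥ 3; if η ≤ -p, the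
   -- height 2 N (10 N + η) at j = 2 N is negative because 10 N < p. Hence η = 0.
   bottom-height : hd ≡ p ℕ.+ p
   bottom-height = cases η ≡.refl

-- The point of height 2 p and the value of the Hasse invariant

-- A stands for ℤ / p² and K for ℤ / p, with p = 2 n + 1; φ is the reduction.
module Lattice (A K : CommutativeRing 0ℓ 0ℓ) where
 open import Data.Nat.Divisibility using (_∣_)
 open import Data.Integer as ℤ using (ℤ; +_)
 open import Data.Nat.Divisibility using (_∣?_; divides)
 private
   module A = RingKit A
   module AS = Series A
   module AR = RingKit AS.seriesRing
   module K = RingKit K
 open Series K
 open RingKit seriesRing

 module On
   (φ : CommutativeRing.Carrier A → CommutativeRing.Carrier K)
   (_≟0 : RingKit.ZeroTest K)
   (inverse : RingKit.Inverses K)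
   (1≉0 : RingKit.NonTrivial K)
   (n : ℕ) (thickening : Thickening.IsThickening A K (suc (n ℕ.+ n)) φ) (prime : Prime (suc (n ℕ.+ n))) (1<p : 1 ℕ.< suc (n ℕ.+ n))
   (char : RingKit.HasChar K (suc (n ℕ.+ n)))
   (unit : RingKit.UnitsPrimeTo K (suc (n ℕ.+ n)))
   (fermat : ∀ a → CommutativeRing._≈_ K (RingKit._^_ K a (suc (n ℕ.+ n))) a)
   (½ : CommutativeRing.Carrier A)
   (½*2 : RingKit.IsHalf A ½)
   (q α μ : CommutativeRing.Carrier A) where
  open HeightLattice
  private
    p = suc (n ℕ.+ n)
  open Thickening.IsThickening thickening using (hom; kernel; torsion)
  open IsRingHomomorphism hom
  open Reduction.On A K φ hom ½ ½*2 q
  open Heights.On K _≟0 inverse 1≉0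
  open Flat.On K p 1<p char unit fermat
  private
    module CP = CharP.On K p 1<p char unit
    module AP = AlphaPoint.On A ½ ½*2 q α μ
    module HC = Hasse.On.Curve K n 1<p char unit (φ q)
  open PA using (Point; _⊞_; _⊟_; neg; generic)
  open Point
  private module RK = PK.Point

  nat-nonzero : ∀ {k} → 0 ℕ.< k → k ℕ.< p → ¬ K.nat k K.≈ K.0#
  nat-nonzero {k} 0<k k<p z = let (b , e) = unit k (CP.∤-small 0<k k<p) in
    1≉0 (K.trans (K.sym e) (K.trans (K.*-congʳ z) (K.zeroˡ b)))

  -- A point with multiplier 0 is a function of t^p.
  module _ (P : PK.Point) (m0 : RK.m P K.≈ K.0#) where
    private
      vanish : ∀ {f g} → PK.y₀ * θ f ≈ t * (C (RK.m P) * g) → θ f ≈ 0#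
      vanish {f} {g} h = PK.cancel-unit (inv-inverse PK.y₀ K.refl) (trans h (trans (*-congˡ {t} (trans (*-congʳ (trans (C-cong m0) C-0)) (zeroˡ g)))
        (trans (zeroʳ t) (sym (zeroʳ PK.y₀)))))

    θx≈0 : θ (RK.x P) ≈ 0#
    θx≈0 = vanish (RK.diff P)

    θy≈0 : θ (RK.y P) ≈ 0#
    θy≈0 = vanish (PK.diff-y P)

  -- Numerator and denominator are supported on multiples of p, and one of them is nonzero at index
  -- d.
  p∣height : ∀ {f d} → Height f d → θ f ≈ 0# → p ∣ d
  p∣height {f} {d} H θf with p ∣? d
  ... | yes h = h
  ... | no p∤d = ⊥-elim (Height.top H (CP.θ-kernel (θnum≈0 H θf) d p∤d , CP.θ-kernel (θden≈0 H θf) d p∤d))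

  X̄ : Point → Series
  X̄ P = Φ (x P) * Φ (x P)

  x̄-sq : ∀ {f g : Series} → f ≈ g → f * f ≈ g * g
  x̄-sq h = *-cong h h

  private
    height-zero : ∀ {f} → f ≈ 0# → Height f 0
    height-zero {f} z = record
      { num = 0# ; den = 1# ; num-deg = λ _ _ → K.refl ; den-deg = Deg≤-𝟏 ; den-zero = 1≉0
      ; quotient = trans (*-identityˡ f) z ; top = λ q → 1≉0 (proj₂ q)
      ; coprime = P.0# , P.1# , trans (+-cong (zeroˡ 0#) (*-identityˡ 1#)) (+-identityˡ 1#) }

    tt-deg : Deg≤ (t * t) 2
    tt-deg = Deg≤-* {t} {t} 1 1 Deg≤-t Deg≤-t

    height-generic : Height (X̄ generic) 2
    height-generic = record
      { num = t * t ; den = 1# ; num-deg = tt-deg ; den-deg = Deg≤-mono {1#} z≤n Deg≤-𝟏 ; den-zero = 1≉0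
      ; quotient = trans (*-identityˡ _) (*-cong Φ-t Φ-t)
      ; top = λ q → 1≉0 (K.trans (K.sym (K.trans (t-⊛-suc t 1) K.refl)) (proj₁ q))
      ; coprime = P.0# , P.1# , trans (+-cong (zeroˡ (t * t)) (*-identityˡ 1#)) (+-identityˡ 1#) }

    sparse-θ : ∀ {f} → θ f ≈ 0# → Sparse f
    sparse-θ h = CP.θ-kernel h

  -- If the height of a point with multiplier p υ is 2 p, then υ times the Hasse invariant is ± 1.
  module Bottom (P : Point) (υ : A.Carrier) (m-eq : m P A.≈ A.nat p A.* υ) (H : Height (X̄ P) (p ℕ.+ p))
    (q≉0 : ¬ φ q K.≈ K.0#) (q²≉3 : ¬ φ q K.* φ q K.- K.nat 3 K.≈ K.0#) (2q²≉9 : ¬ K.nat 2 K.* (φ q K.* φ q) K.- K.nat 9 K.≈ K.0#) where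

    private
      module H = Height H
      P̄ = reduce P
      m̄≈0 : φ (m P) K.≈ K.0#
      m̄≈0 = K.trans (⟦⟧-cong m-eq) (K.trans (*-homo (A.nat p) υ) (K.trans (K.*-congʳ (K.trans (φ-nat p) char)) (K.zeroˡ _)))

      x̄ ȳ ξ η : Series
      x̄ = RK.x P̄
      ȳ = RK.y P̄
      ξ = x̄ ♭
      η = ȳ ♭

      x̄-sparse : Sparse x̄
      x̄-sparse = sparse-θ (θx≈0 P̄ m̄≈0)
      ȳ-sparse : Sparse ȳ
      ȳ-sparse = sparse-θ (θy≈0 P̄ m̄≈0)

      XX-sparse : Sparse (x̄ * x̄)
      XX-sparse = sparse-θ (trans (θ-* x̄ x̄) (trans (+-cong (trans (*-congʳ (θx≈0 P̄ m̄≈0)) (zeroˡ x̄)) (trans (*-congˡ {x̄} (θx≈0 P̄ m̄≈0)) (zeroʳ x̄))) (+-identityˡ 0#)))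

      C-♭ : ∀ a → C a ♭ ≈ C a
      C-♭ a zero = K.refl
      C-♭ a (suc j) = K.refl

      C-sparse : ∀ a → Sparse (C a)
      C-sparse a zero p∤0 = ⊥-elim (p∤0 (divides 0 ≡.refl))
      C-sparse a (suc n) _ = K.refl

      1-♭ : 1# ♭ ≈ 1#
      1-♭ zero = K.refl
      1-♭ (suc j) = K.refl

      -- θ x divided by p. Division by p is not possible in ℤ / p², but the multiplier p υ allows
      -- the quotient to be written down.
      G : AS.Series
      G = AS.t AR.* (AS.C υ AR.* y P) AR.* AS.inv PA.y₀

      y₀i : PA.y₀ AR.* AS.inv PA.y₀ AR.≈ AR.1#
      y₀i = AS.inv-inverse PA.y₀ A.refl

      θx-G : AS.θ (x P) AR.≈ AS.C (A.nat p) AR.* G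
      θx-G = PA.cancel-unit y₀i (AR.begin
        PA.y₀ AR.* AS.θ (x P) AR.≈⟨ diff P ⟩
        AS.t AR.* (AS.C (m P) AR.* y P) AR.≈⟨ AR.*-congˡ {AS.t} (AR.*-congʳ (AR.trans (AS.C-cong m-eq) (AS.C-* (A.nat p) υ))) ⟩
        AS.t AR.* (AS.C (A.nat p) AR.* AS.C υ AR.* y P) AR.≈⟨ AR.solve 4 (λ t k u y → t :* (k :* u :* y) := k :* (t :* (u :* y)) :* :1) AS.t (AS.C (A.nat p)) (AS.C υ) (y P) ⟩
        AS.C (A.nat p) AR.* (AS.t AR.* (AS.C υ AR.* y P)) AR.* AR.1#
          AR.≈⟨ AR.*-congˡ {AS.C (A.nat p) AR.* (AS.t AR.* (AS.C υ AR.* y P))} (AR.sym y₀i) ⟩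
        AS.C (A.nat p) AR.* (AS.t AR.* (AS.C υ AR.* y P)) AR.* (PA.y₀ AR.* AS.inv PA.y₀)
          AR.≈⟨ AR.solve 4 (λ k w y i → k :* w :* (y :* i) := y :* (k :* (w :* i))) (AS.C (A.nat p)) (AS.t AR.* (AS.C υ AR.* y P)) PA.y₀ (AS.inv PA.y₀) ⟩
        PA.y₀ AR.* (AS.C (A.nat p) AR.* G) AR.∎)

      -- At index j p the Euler derivation itself contributes a factor p, so j p x(jp) = p G(jp),
      -- and `torsion` cancels p after reduction.
      θξ : θ ξ ≈ Φ G ♭
      θξ j = K.diff≈0⇒≈ (K.trans (K.+-cong (K.sym (K.trans (*-homo _ _) (K.*-congʳ (φ-nat j)))) (K.sym (-‿homo _))) (K.trans (K.sym (+-homo _ _)) (torsion (A.begin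
        A.nat p A.* (A.nat j A.* x P (j ℕ.* p) A.- G (j ℕ.* p))
          A.≈⟨ A.solve 4 (λ p j x g → p :* (j :* x :- g) := (j :* p) :* x :- p :* g) (A.nat p) (A.nat j) (x P (j ℕ.* p)) (G (j ℕ.* p)) ⟩
        A.nat j A.* A.nat p A.* x P (j ℕ.* p) A.- A.nat p A.* G (j ℕ.* p)
          A.≈⟨ A.+-cong (A.*-congʳ (A.sym (A.×1-homo-* j p))) (A.-‿cong (A.sym (AS.C-⊛ (A.nat p) G (j ℕ.* p)))) ⟩
        AS.θ (x P) (j ℕ.* p) A.- (AS.C (A.nat p) AR.* G) (j ℕ.* p)
          A.≈⟨ A.≈⇒diff≈0 (θx-G (j ℕ.* p)) ⟩
        A.0# A.∎))))

      y₀-ΦG : PK.y₀ * Φ G ≈ t * (C (φ υ) * ȳ)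
      y₀-ΦG = begin
        PK.y₀ * Φ G ≈⟨ trans (*-congʳ (sym Φ-y₀)) (sym (Φ-* PA.y₀ G)) ⟩
        Φ (PA.y₀ AR.* G) ≈⟨ Φ-cong (AR.trans (AR.solve 3 (λ w y i → y :* (w :* i) := w :* (y :* i)) (AS.t AR.* (AS.C υ AR.* y P)) PA.y₀ (AS.inv PA.y₀))
                                    (AR.trans (AR.*-congˡ {AS.t AR.* (AS.C υ AR.* y P)} y₀i) (AR.*-identityʳ _))) ⟩
        Φ (AS.t AR.* (AS.C υ AR.* y P)) ≈⟨ trans (Φ-* AS.t _) (*-cong Φ-t (trans (Φ-* (AS.C υ) (y P)) (*-congʳ (Φ-C υ)))) ⟩
        t * (C (φ υ) * ȳ) ∎

      -- t Q^n has degree 4 n + 1 < 2 p, so among the multiples of p only index p survives, where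
      -- the coefficient is the Hasse invariant.
      tQ♭ : (t * HC.Q ^ n) ♭ ≈ C HC.hasse * t
      tQ♭ 0 = K.trans (t-⊛-zero (HC.Q ^ n)) (K.sym (K.zeroʳ HC.hasse))
      tQ♭ 1 = K.trans (t-⊛-suc (HC.Q ^ n) (n ℕ.+ n ℕ.+ 0)) (K.trans (K.reflexive (≡.cong (HC.Q ^ n) (ℕₚ.+-identityʳ (n ℕ.+ n))))
        (K.sym (K.trans (C-⊛ HC.hasse t 1) (K.*-identityʳ HC.hasse))))
      tQ♭ (suc (suc j)) = K.trans (t-⊛-suc (HC.Q ^ n) _) (K.trans (Deg≤-^ {HC.Q} n HC.Q-deg _ (ℕₚ.<-≤-trans
          (≡.subst (n ℕ.* 4 ℕ.<_) (N.solve 1 (λ n → N.con 1 N.:+ n N.:* N.con 4 N.:= n N.:+ n N.:+ (N.con 1 N.:+ (n N.:+ n))) ≡.refl n) ℕₚ.≤-refl)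
          (ℕₚ.+-monoʳ-≤ (n ℕ.+ n) (ℕₚ.m≤m+n (suc (n ℕ.+ n)) (j ℕ.* p)))))
        (K.sym (K.trans (C-⊛ HC.hasse t (suc (suc j))) (K.zeroʳ _))))

      c = HC.hasse

      -- The factor y₀ is first written as the ♭ of y₀^p. Under ♭ one y₀ is used up by the
      -- differential equation of P, and the even power y₀^(p-1) = Q^n supplies the Hasse invariant.
      diff♭ : PK.y₀ * θ ξ ≈ t * (C (φ υ K.* c) * η)
      diff♭ = begin
        PK.y₀ * θ ξ ≈⟨ *-cong (sym (power-♭ PK.y₀)) θξ ⟩
        (PK.y₀ ^ p) ♭ * Φ G ♭ ≈⟨ sym (♭-* (Φ G) (p-power-sparse PK.y₀)) ⟩
        (PK.y₀ * PK.y₀ ^ (n ℕ.+ n) * Φ G) ♭ ≈⟨ ♭-cong (begin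
          PK.y₀ * PK.y₀ ^ (n ℕ.+ n) * Φ G ≈⟨ solve 3 (λ y w g → y :* w :* g := w :* (y :* g)) PK.y₀ (PK.y₀ ^ (n ℕ.+ n)) (Φ G) ⟩
          PK.y₀ ^ (n ℕ.+ n) * (PK.y₀ * Φ G) ≈⟨ *-cong (trans (trans (^-homo-* PK.y₀ n n) (sym (^-distrib-* PK.y₀ PK.y₀ n))) (^-congˡ n PK.y₀-square)) y₀-ΦG ⟩
          HC.Q ^ n * (t * (C (φ υ) * ȳ)) ≈⟨ solve 4 (λ Q t c y → Q :* (t :* (c :* y)) := y :* (c :* (t :* Q))) (HC.Q ^ n) t (C (φ υ)) ȳ ⟩
          ȳ * (C (φ υ) * (t * HC.Q ^ n)) ∎) ⟩
        (ȳ * (C (φ υ) * (t * HC.Q ^ n))) ♭ ≈⟨ trans (♭-* _ ȳ-sparse) (*-congˡ {η} (trans (♭-* _ (C-sparse (φ υ))) (*-cong (C-♭ (φ υ)) tQ♭))) ⟩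
        η * (C (φ υ) * (C c * t)) ≈⟨ solve 4 (λ y u c t → y :* (u :* (c :* t)) := t :* (u :* c :* y)) η (C (φ υ)) (C c) t ⟩
        t * (C (φ υ) * C c * η) ≈⟨ *-congˡ {t} (*-congʳ (sym (C-* (φ υ) c))) ⟩
        t * (C (φ υ K.* c) * η) ∎

      flat : PK.Point
      flat = record
        { x = ξ ; y = η ; m = φ υ K.* c
        ; x-zero = RK.x-zero P̄ ; y-zero = RK.y-zero P̄
        ; curve = begin
            η * η ≈⟨ sym (♭-* ȳ ȳ-sparse) ⟩
            (ȳ * ȳ) ♭ ≈⟨ ♭-cong (RK.curve P̄) ⟩
            1# ♭ + (C (φ q) * (x̄ * x̄)) ♭ + (x̄ * x̄ * (x̄ * x̄)) ♭
              ≈⟨ +-cong (+-cong 1-♭ (trans (♭-* (x̄ * x̄) (C-sparse (φ q))) (*-cong (C-♭ (φ q)) (♭-* x̄ x̄-sparse)))) (trans (♭-* (x̄ * x̄) XX-sparse) (*-cong (♭-* x̄ x̄-sparse) (♭-* x̄ x̄-sparse))) ⟩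
            PK.quartic (ξ * ξ) ∎
        ; diff = diff♭ }

      XX-θ : θ (X̄ P) ≈ 0#
      XX-θ = trans (θ-* x̄ x̄) (trans (+-cong (trans (*-congʳ (θx≈0 P̄ m̄≈0)) (zeroˡ x̄)) (trans (*-congˡ {x̄} (θx≈0 P̄ m̄≈0)) (zeroʳ x̄))) (+-identityˡ 0#))

      num-sparse : Sparse H.num
      num-sparse = sparse-θ (θnum≈0 H XX-θ)
      den-sparse : Sparse H.den
      den-sparse = sparse-θ (θden≈0 H XX-θ)

      d₀ : ∃ λ b → H.den 0 K.* b K.≈ K.1#
      d₀ = inverse (H.den 0) H.den-zero
      b = proj₁ d₀

      D : Series
      D = C b * H.den ♭

      quotient♭ : H.den ♭ * (ξ * ξ) ≈ H.num ♭
      quotient♭ = trans (*-congˡ {H.den ♭} (sym (♭-* x̄ x̄-sparse))) (trans (sym (♭-* (X̄ P) den-sparse)) (♭-cong H.quotient))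

      beyond : ∀ j → p ℕ.+ p ℕ.< suc (suc (suc j)) ℕ.* p
      beyond j = ℕₚ.≤-trans (ℕₚ.m<m+n (p ℕ.+ p) (s≤s z≤n)) (ℕₚ.≤-trans (ℕₚ.≤-reflexive (ℕₚ.+-assoc p p p)) (ℕₚ.+-monoʳ-≤ p (ℕₚ.+-monoʳ-≤ p (ℕₚ.m≤m+n p (j ℕ.* p)))))

      -- Height 2 p leaves the indices 0, 1 and 2 after ♭, and the first two coefficients vanish
      -- because x does at t = 0.
      num♭ : H.num ♭ ≈ C (H.num (2 ℕ.* p)) * (t * t)
      num♭ 0 = K.trans (K.sym (quotient♭ 0)) (K.trans (K.trans (K.*-congˡ (K.trans (K.*-congʳ (RK.x-zero P̄)) (K.zeroˡ _))) (K.zeroʳ _))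
        (K.sym (K.trans (K.*-congˡ (t-⊛-zero t)) (K.zeroʳ _))))
      num♭ 1 = K.trans (K.sym (quotient♭ 1)) (K.trans (K.+-cong (K.*-congˡ (K.+-cong (K.*-congʳ (RK.x-zero P̄)) (K.*-congˡ (RK.x-zero P̄)))) (K.*-congˡ (K.*-congʳ (RK.x-zero P̄))))
        (K.trans (K.solve 4 (λ d0 d1 x0 x1 → d0 :* (:0 :* x1 :+ x1 :* :0) :+ d1 :* (:0 :* x0) := :0) ((H.den ♭) 0) ((H.den ♭) 1) (ξ 0) (ξ 1))
          (K.sym (K.trans (C-⊛ (H.num (2 ℕ.* p)) (t * t) 1) (K.trans (K.*-congˡ (t-⊛-suc t 0)) (K.zeroʳ _))))))
      num♭ 2 = K.sym (K.trans (C-⊛ (H.num (2 ℕ.* p)) (t * t) 2) (K.trans (K.*-congˡ (t-⊛-suc t 1)) (K.*-identityʳ _)))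
      num♭ (suc (suc (suc j))) = K.trans (H.num-deg _ (beyond j)) (K.sym (K.trans (C-⊛ (H.num (2 ℕ.* p)) (t * t) (suc (suc (suc j)))) (K.trans (K.*-congˡ (t-⊛-suc t (suc (suc j)))) (K.zeroʳ _))))

      k = b K.* H.num (2 ℕ.* p)

      b≉0 : ¬ b K.≈ K.0#
      b≉0 z = 1≉0 (K.trans (K.sym (proj₂ d₀)) (K.trans (K.*-congˡ z) (K.zeroʳ _)))

      num≉0 : ¬ H.num (2 ℕ.* p) K.≈ K.0#
      num≉0 z = ℕₚ.<⇒≢ (s≤s z≤n) (height-unique refl (height-zero X≈0) H)
        where
        num≈0 : H.num ≈ 0#
        num≈0 i with p ∣? i
        ... | yes (divides j ≡.refl) = K.trans (num♭ j) (K.trans (*-congʳ (trans (C-cong z) C-0) j) (zeroˡ (t * t) j))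
        ... | no p∤i = num-sparse i p∤i
        X≈0 : X̄ P ≈ 0#
        X≈0 = cancel-series {H.den} H.den-zero (trans H.quotient (trans num≈0 (sym (zeroʳ H.den))))

      D-deg : Deg≤ D 2
      D-deg (suc (suc (suc j))) _ = K.trans (C-⊛ b (H.den ♭) (suc (suc (suc j)))) (K.trans (K.*-congˡ (H.den-deg _ (beyond j))) (K.zeroʳ b))
      D-deg 1 (s≤s ())
      D-deg 2 (s≤s (s≤s ()))

      D-quotient : D * (ξ * ξ) ≈ C k * (t * t)
      D-quotient = trans (*-assoc (C b) (H.den ♭) (ξ * ξ)) (trans (*-congˡ {C b} (trans quotient♭ num♭))
        (trans (sym (*-assoc (C b) _ (t * t))) (*-congʳ (sym (C-* b _)))))

    hasse-multiplier : φ υ K.* c K.* (φ υ K.* c) K.≈ K.1#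
    hasse-multiplier = SmallPoint.On.multiplier-square K _≟0 inverse 1≉0 (φ ½) ½*2′ (φ q) q≉0 q²≉3 2q²≉9 flat D k (K.trans (C-⊛ b (H.den ♭) 0) (K.trans (K.*-comm b _) (proj₂ d₀))) D-deg (*-nonzero b≉0 num≉0) D-quotient

  module _
    (rel₁ : q A.- A.nat 6 A.- A.nat 6 A.* μ A.≈ q A.* (α A.* α))
    (rel₂ : μ A.* μ A.≈ A.nat 8 A.- A.nat 4 A.* q)
    (rel₃ : A.nat 4 A.* μ A.* (A.nat 2 A.* μ A.- q A.+ A.nat 6) A.≈ α A.* α A.* (α A.* α))
    (w : K.Carrier) (w-inv : K.nat 4 K.* (K.nat 4 K.- φ q K.* φ q) K.* w K.≈ K.1#)
    (μ≉0 : ¬ φ μ K.≈ K.0#) (α≉0 : ¬ φ α K.≈ K.0#)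
    where

    αP : Point
    αP = AP.αPoint rel₁ rel₂ rel₃

    private
      step : ∀ (P Q : Point) → ¬ φ (m P) K.≈ K.0# → ¬ φ (m Q) K.≈ K.0# → ∀ {d₁ d₂} → Height (X̄ P) d₁ → Height (X̄ Q) d₂ →
        ∃₂ λ d₊ d₋ → Height (X̄ (P ⊞ Q)) d₊ × Height (X̄ (P ⊟ Q)) d₋ × d₊ ℕ.+ d₋ ≡ (d₁ ℕ.+ d₁) ℕ.+ (d₂ ℕ.+ d₂)
      step P Q mP mQ H₁ H₂ = let (d₊ , d₋ , H₊ , H₋ , e) = PointHeights.On.point-parallelogram K _≟0 inverse 1≉0 (φ ½) ½*2′ (φ q) w w-inv (reduce P) (reduce Q) mP mQ H₁ H₂ in
        d₊ , d₋ , height-cong (x̄-sq (sym (reduce-⊞ P Q))) H₊ , height-cong (x̄-sq (sym (reduce-⊟ P Q))) H₋ , e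

      next-⊞ : ∀ (P Q : Point) → ¬ φ (m (P ⊞ Q)) K.≈ K.0# → ¬ φ (m Q) K.≈ K.0# → ∀ {d e s} → Height (X̄ P) d → Height (X̄ (P ⊞ Q)) e → Height (X̄ Q) s →
        ∃ λ f → Height (X̄ ((P ⊞ Q) ⊞ Q)) f × f ℕ.+ d ≡ (e ℕ.+ e) ℕ.+ (s ℕ.+ s)
      next-⊞ P Q mPQ mQ HP HPQ HQ = let (d₊ , d₋ , H₊ , H₋ , e) = step (P ⊞ Q) Q mPQ mQ HPQ HQ in
        d₊ , H₊ , ≡.trans (≡.cong (d₊ ℕ.+_) (height-unique (x̄-sq (sym (Φ-cong (PA.⊞-⊟-cancel P Q)))) HP H₋)) e

      next-⊟ : ∀ (P Q : Point) → ¬ φ (m (P ⊟ Q)) K.≈ K.0# → ¬ φ (m Q) K.≈ K.0# → ∀ {d e s} → Height (X̄ P) d → Height (X̄ (P ⊟ Q)) e → Height (X̄ Q) s →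
        ∃ λ f → Height (X̄ ((P ⊟ Q) ⊟ Q)) f × f ℕ.+ d ≡ (e ℕ.+ e) ℕ.+ (s ℕ.+ s)
      next-⊟ P Q mPQ mQ HP HPQ HQ = let (d₊ , d₋ , H₊ , H₋ , e) = step (P ⊟ Q) Q mPQ mQ HPQ HQ in
        d₋ , H₋ , ≡.trans (≡.cong (d₋ ℕ.+_) (height-unique (x̄-sq (Φ-cong (AR.sym (AR.trans (AR.sym (PA.⊟-⊞-neg (P ⊟ Q) Q)) (PA.⊞-⊟-cancel P (neg Q)))))) HP H₊)) (≡.trans (ℕₚ.+-comm d₋ d₊) e)

      μ⁻¹ α⁻¹ : K.Carrier
      μ⁻¹ = proj₁ (inverse (φ μ) μ≉0)
      α⁻¹ = proj₁ (inverse (φ α) α≉0)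

      Tₚ sₚ qₚ numₚ : Poly
      Tₚ = tₚ P.* tₚ
      sₚ = P.1# P.+ Tₚ
      qₚ = sₚ P.* sₚ P.+ Cₚ (φ μ) P.* Tₚ
      numₚ = Cₚ (φ α) P.* Cₚ (φ α) P.* (Tₚ P.* (sₚ P.* sₚ))

      unitₚ : ∀ {a b} → a K.* b K.≈ K.1# → Cₚ a P.* Cₚ b P.≈ P.1#
      unitₚ e = trans (sym (C-* _ _)) (trans (C-cong e) C-1)

      cop-T-s : Coprimeₚ Tₚ sₚ
      cop-T-s = P.- P.1# , P.1# , P.solve 1 (λ T → (:- :1) :* T :+ :1 :* (:1 :+ T) := :1) Tₚ

      cop-T-q : Coprimeₚ Tₚ qₚ
      cop-T-q = coprime-respʳ {Tₚ} {Cₚ (φ μ) P.* Tₚ P.+ sₚ P.* sₚ} {qₚ} (P.+-comm (Cₚ (φ μ) P.* Tₚ) (sₚ P.* sₚ))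
        (coprime-+ {Tₚ} {sₚ P.* sₚ} (Cₚ (φ μ)) (coprime-* {Tₚ} {sₚ} {sₚ} cop-T-s cop-T-s))

      cop-s-q : Coprimeₚ sₚ qₚ
      cop-s-q = coprime-+ {sₚ} {Cₚ (φ μ) P.* Tₚ} sₚ (coprime-* {sₚ} {Cₚ (φ μ)} {Tₚ}
        (coprime-unit {sₚ} {Cₚ (φ μ)} {Cₚ μ⁻¹} (unitₚ (proj₂ (inverse (φ μ) μ≉0)))) (coprime-sym {Tₚ} {sₚ} cop-T-s))

      -- s = 1 modulo T and T = -1 modulo s, so q = s² + μ T is 1 modulo T and -μ modulo s, a unit
      -- in both cases.
      cop-q-num : Coprimeₚ qₚ numₚ
      cop-q-num = coprime-* {qₚ} {Cₚ (φ α) P.* Cₚ (φ α)} {Tₚ P.* (sₚ P.* sₚ)} (coprime-* {qₚ} {Cₚ (φ α)} {Cₚ (φ α)} unit-α unit-α)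
        (coprime-* {qₚ} {Tₚ} {sₚ P.* sₚ} (coprime-sym {Tₚ} {qₚ} cop-T-q) (coprime-* {qₚ} {sₚ} {sₚ} cop-q-s cop-q-s))
        where
        unit-α : Coprimeₚ qₚ (Cₚ (φ α))
        unit-α = coprime-unit {qₚ} {Cₚ (φ α)} {Cₚ α⁻¹} (unitₚ (proj₂ (inverse (φ α) α≉0)))
        cop-q-s : Coprimeₚ qₚ sₚ
        cop-q-s = coprime-sym {sₚ} {qₚ} cop-s-q

      s-deg : Deg≤ (ser sₚ) 2
      s-deg = Deg≤-+ {1#} (Deg≤-mono {1#} z≤n Deg≤-𝟏) tt-deg

      q-deg : Deg≤ (ser qₚ) 4
      q-deg = Deg≤-+ {ser sₚ * ser sₚ} (Deg≤-* {ser sₚ} {ser sₚ} 2 2 s-deg s-deg)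
        (Deg≤-mono {C (φ μ) * (t * t)} (s≤s (s≤s z≤n)) (Deg≤-* {C (φ μ)} {t * t} 0 2 (Deg≤-C (φ μ)) tt-deg))

      num-deg : Deg≤ (ser numₚ) 8
      num-deg = Deg≤-mono {ser numₚ} (ℕₚ.m≤m+n 6 2) (Deg≤-* {C (φ α) * C (φ α)} {t * t * (ser sₚ * ser sₚ)} 0 6 (Deg≤-* {C (φ α)} {C (φ α)} 0 0 (Deg≤-C (φ α)) (Deg≤-C (φ α)))
        (Deg≤-* {t * t} {ser sₚ * ser sₚ} 2 4 tt-deg (Deg≤-* {ser sₚ} {ser sₚ} 2 2 s-deg s-deg)))

      q4 : ser qₚ 4 K.≈ K.1#
      q4 = K.trans (K.+-cong (K.trans (top-* {ser sₚ} {ser sₚ} 2 2 s-deg s-deg) (K.trans (K.*-cong s2 s2) (K.*-identityˡ K.1#)))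
        (Deg≤-* {C (φ μ)} {t * t} 0 2 (Deg≤-C (φ μ)) tt-deg 4 (ℕₚ.n≤1+n 3))) (K.+-identityʳ K.1#)
        where
        s2 : ser sₚ 2 K.≈ K.1#
        s2 = K.trans (K.+-identityˡ _) (t-⊛-suc t 1)

      Φ-T : Φ AP.T ≈ t * t
      Φ-T = trans (Φ-* AS.t AS.t) (*-cong Φ-t Φ-t)

      Φ-s : Φ (AR.1# AR.+ AP.T) ≈ ser sₚ
      Φ-s = trans (Φ-+ AR.1# AP.T) (+-cong Φ-1 Φ-T)

      Φ-q : Φ AP.q ≈ ser qₚ
      Φ-q = trans (Φ-+ ((AR.1# AR.+ AP.T) AR.* (AR.1# AR.+ AP.T)) (AS.C μ AR.* AP.T)) (+-cong (trans (Φ-* _ _) (*-cong Φ-s Φ-s)) (trans (Φ-* _ _) (*-cong (Φ-C μ) Φ-T)))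

      αP-quotient : ser qₚ * ser qₚ * X̄ αP ≈ ser numₚ
      αP-quotient = begin
        ser qₚ * ser qₚ * X̄ αP ≈⟨ *-cong (*-cong (sym Φ-q) (sym Φ-q)) (sym (Φ-* (x αP) (x αP))) ⟩
        Φ AP.q * Φ AP.q * Φ (x αP AR.* x αP) ≈⟨ trans (*-congʳ (sym (Φ-* AP.q AP.q))) (sym (Φ-* _ _)) ⟩
        Φ (AP.q AR.* AP.q AR.* (x αP AR.* x αP)) ≈⟨ Φ-cong (AP.αPoint-quotient rel₁ rel₂ rel₃) ⟩
        Φ (AS.C α AR.* AS.C α AR.* (AP.T AR.* ((AR.1# AR.+ AP.T) AR.* (AR.1# AR.+ AP.T))))
          ≈⟨ trans (Φ-* _ _) (*-cong (trans (Φ-* _ _) (*-cong (Φ-C α) (Φ-C α))) (trans (Φ-* _ _) (*-cong Φ-T (trans (Φ-* _ _) (*-cong Φ-s Φ-s))))) ⟩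
        ser numₚ ∎

      -- x has degree 4, the norm of α, and heights are those of x².
      height-α : Height (X̄ αP) 8
      height-α = record
        { num = ser numₚ ; den = ser qₚ * ser qₚ ; num-deg = num-deg ; den-deg = Deg≤-* {ser qₚ} {ser qₚ} 4 4 q-deg q-deg
        ; den-zero = λ z → 1≉0 (K.trans (K.sym (K.trans (K.*-cong q0 q0) (K.*-identityˡ K.1#))) z)
        ; quotient = αP-quotient
        ; top = λ z → 1≉0 (K.trans (K.sym (K.trans (top-* {ser qₚ} {ser qₚ} 4 4 q-deg q-deg) (K.trans (K.*-cong q4 q4) (K.*-identityˡ K.1#)))) (proj₂ z))
        ; coprime = coprime-sym {qₚ P.* qₚ} {numₚ} (coprime-*ˡ {qₚ} {qₚ} {numₚ} cop-q-num cop-q-num) }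
        where
        q0 : ser qₚ 0 K.≈ K.1#
        q0 = K.solve 1 (λ m → (:1 :+ :0 :* :0) :* (:1 :+ :0 :* :0) :+ m :* (:0 :* :0) := :1) (φ μ)

    mul : ℕ → Point
    mul zero = αP
    mul (suc k) = mul k ⊞ αP

    mul-m : ∀ k → m (mul k) A.≈ A.nat (suc k) A.* α
    mul-m zero = A.solve 1 (λ a → a := κ 1 :* a) α
    mul-m (suc k) = A.trans (A.+-congʳ (mul-m k)) (A.solve 2 (λ k a → k :* a :+ a := (:1 :+ k) :* a) (A.nat (suc k)) α)

    private
      mul-m≉0 : ∀ k → suc k ℕ.< p → ¬ φ (m (mul k)) K.≈ K.0#
      mul-m≉0 k k<p z = *-nonzero (nat-nonzero (s≤s z≤n) k<p) α≉0 (K.trans (K.sym (K.trans (⟦⟧-cong (mul-m k)) (K.trans (*-homo _ _) (K.*-congʳ (φ-nat (suc k)))))) z)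

      sq8 : ℕ → ℕ
      sq8 k = 8 ℕ.* (suc k ℕ.* suc k)

      -- The difference α P - α P has x-coordinate 0 and height 0; this starts the recursion for the
      -- multiples of α P.
      twice-α : ∃ λ d → Height (X̄ (αP ⊞ αP)) d × d ≡ 32
      twice-α = let (d₊ , d₋ , H₊ , H₋ , e) = step αP αP α≉0 α≉0 height-α height-α in
        d₊ , H₊ , ≡.trans (≡.sym (≡.trans (≡.cong (d₊ ℕ.+_) (height-unique refl H₋ (height-zero zero-x))) (ℕₚ.+-identityʳ d₊))) e
        where
        zero-x : X̄ (αP ⊟ αP) ≈ 0#
        zero-x = trans (x̄-sq (trans (Φ-cong (AR.solve 3 (λ x y i → (x :* y :+ (:- x) :* y) :* i := :0) (x αP) (y αP) (PA.Sum.i αP (neg αP)))) (λ n → 0#-homo))) (zeroˡ 0#)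

      mul-height : ∀ k → suc k ℕ.< p → Height (X̄ (mul k)) (sq8 k) × Height (X̄ (mul (suc k))) (sq8 (suc k))
      mul-height zero _ = let (d , H , e) = twice-α in height-α , ≡.subst (Height (X̄ (αP ⊞ αP))) e H
      mul-height (suc k) lt =
        let (H , H′) = mul-height k (ℕₚ.<-trans ℕₚ.≤-refl lt)
            (f , H″ , e) = next-⊞ (mul k) αP (mul-m≉0 (suc k) lt) α≉0 H H′ height-α
        in H′ , ≡.subst (Height (X̄ (mul (suc (suc k))))) (ℕₚ.+-cancelʳ-≡ (sq8 k) f (sq8 (suc (suc k))) (≡.trans e
          (squares-step k))) H″

      HeightAt : (ℕ → Point) → ℕ → ℤ → ℕ → Set _
      HeightAt U a ε j = ∃ λ d → Height (X̄ (U j)) d × + d ≡ parabola a ε j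

      -- Two consecutive heights are carried along, because each use of the parallelogram law needs
      -- both to reach the next one.
      row : (U : ℕ → Point) (J : ℕ) →
        (∀ j → suc j ℕ.< J → ∀ {d e} → Height (X̄ (U j)) d → Height (X̄ (U (suc j))) e → ∃ λ f → Height (X̄ (U (suc (suc j)))) f × f ℕ.+ d ≡ (e ℕ.+ e) ℕ.+ 4) →
        ∀ {a b} → Height (X̄ (U 0)) a → Height (X̄ (U 1)) b → ∀ j → j ℕ.< J → HeightAt U a (slope a b) j × HeightAt U a (slope a b) (suc j)
      row U J next {a} {b} H₀ H₁ zero _ = (a , H₀ , parabola-zero a (slope a b)) , (b , H₁ , parabola-one a b)
      row U J next {a} {b} H₀ H₁ (suc j) lt = extend (row U J next H₀ H₁ j (ℕₚ.<-trans ℕₚ.≤-refl lt))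
        where
        extend : HeightAt U a (slope a b) j × HeightAt U a (slope a b) (suc j) → HeightAt U a (slope a b) (suc j) × HeightAt U a (slope a b) (suc (suc j))
        extend ((d , Hd , hd) , (e , He , he)) = let (f , Hf , eq) = next j lt Hd He in (e , He , he) , (f , Hf , parabola-next a (slope a b) j d e f hd he eq)

      row-end : (U : ℕ → Point) (J : ℕ) →
        (∀ j → suc j ℕ.< J → ∀ {d e} → Height (X̄ (U j)) d → Height (X̄ (U (suc j))) e → ∃ λ f → Height (X̄ (U (suc (suc j)))) f × f ℕ.+ d ≡ (e ℕ.+ e) ℕ.+ 4) →
        ∀ {a b} → Height (X̄ (U 0)) a → Height (X̄ (U 1)) b → 0 ℕ.< J → HeightAt U a (slope a b) J
      row-end U (suc j) next H₀ H₁ _ = proj₂ (row U (suc j) next H₀ H₁ j ℕₚ.≤-refl)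

    module _ (N′ M : ℕ) where
      private N = suc N′

      up down : ℕ → Point
      up zero = mul N′
      up (suc j) = up j ⊞ generic
      down zero = mul N′
      down (suc j) = down j ⊟ generic

      down-m : ∀ j → m (down j) A.≈ A.nat N A.* α A.- A.nat j
      down-m zero = A.trans (mul-m N′) (A.solve 1 (λ a → a := a :- κ 0) _)
      down-m (suc j) = A.trans (A.+-congʳ (down-m j)) (A.solve 2 (λ a j → (a :- j) :- :1 := a :- (:1 :+ j)) _ (A.nat j))

      up-m : ∀ j → m (up j) A.≈ A.nat N A.* α A.+ A.nat j
      up-m zero = A.trans (mul-m N′) (A.solve 1 (λ a → a := a :+ κ 0) _)
      up-m (suc j) = A.trans (A.+-congʳ (up-m j)) (A.solve 2 (λ a j → (a :+ j) :+ :1 := a :+ (:1 :+ j)) _ (A.nat j))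

      -- That p divides one value of the quadratic form and another value is nonnegative pins it down.
      module _ (α-norm : α A.* α A.≈ α A.- A.nat 4) (3≤M : 3 ℕ.≤ M) (10N<p : 10 ℕ.* N ℕ.< p) (M+2N<p : M ℕ.+ (N ℕ.+ N) ℕ.< p)
        (norm : M ℕ.* M ℕ.+ 4 ℕ.* (N ℕ.* N) ≡ p ℕ.+ M ℕ.* N)
        (Nα≈M : K.nat N K.* φ α K.≈ K.nat M)
        (q≉0 : ¬ φ q K.≈ K.0#) (q²≉3 : ¬ φ q K.* φ q K.- K.nat 3 K.≈ K.0#) (2q²≉9 : ¬ K.nat 2 K.* (φ q K.* φ q) K.- K.nat 9 K.≈ K.0#) where

        private
          φ-Nα : φ (A.nat N A.* α) K.≈ K.nat M
          φ-Nα = K.trans (*-homo _ _) (K.trans (K.*-congʳ (φ-nat N)) Nα≈M)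

          -- α reduces to M / N, so the multiplier of `up j` reduces to M + j, which M + 2 N < p
          -- keeps below p.
          up-m≉0 : ∀ j → j ℕ.< N ℕ.+ N → ¬ φ (m (up j)) K.≈ K.0#
          up-m≉0 j lt z = nat-nonzero (ℕₚ.<-≤-trans (ℕₚ.<-≤-trans (s≤s z≤n) 3≤M) (ℕₚ.m≤m+n M j)) (ℕₚ.<-trans (ℕₚ.+-monoʳ-< M lt) M+2N<p)
            (K.trans (K.×-homo-+ K.1# M j) (K.trans (K.sym (K.trans (⟦⟧-cong (up-m j)) (K.trans (+-homo _ _) (K.+-cong φ-Nα (φ-nat j))))) z))

          M<p : M ℕ.< p
          M<p = ℕₚ.≤-<-trans (ℕₚ.m≤m+n M (N ℕ.+ N)) M+2N<p

          φ-down : ∀ j → φ (m (down j)) K.≈ K.nat M K.- K.nat j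
          φ-down j = K.trans (⟦⟧-cong (down-m j)) (K.trans (+-homo _ _) (K.+-cong φ-Nα (K.trans (-‿homo _) (K.-‿cong (φ-nat j)))))

          down-m≉0 : ∀ j → j ℕ.< M → ¬ φ (m (down j)) K.≈ K.0#
          down-m≉0 j lt z = nat-nonzero (ℕₚ.m<n⇒0<n∸m lt) (ℕₚ.≤-<-trans (ℕₚ.m∸n≤m M j) M<p)
            (K.trans (K.trans (K.solve 2 (λ d j → d := (d :+ j) :- j) (K.nat (M ℕ.∸ j)) (K.nat j))
              (K.+-congʳ (K.trans (K.sym (K.×-homo-+ K.1# (M ℕ.∸ j) j)) (K.reflexive (≡.cong K.nat (ℕₚ.m∸n+n≡m (ℕₚ.<⇒≤ lt)))))))
              (K.trans (K.sym (φ-down j)) z))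

          one≉0 : ¬ φ A.1# K.≈ K.0#
          one≉0 z = 1≉0 (K.trans (K.sym 1#-homo) z)

          N<p : N ℕ.< p
          N<p = ℕₚ.≤-<-trans (ℕₚ.m≤m+n N _) 10N<p

          m̄≈0 : φ (m (down M)) K.≈ K.0#
          m̄≈0 = K.trans (φ-down M) (K.-‿inverseʳ _)

          Xθ : θ (X̄ (down M)) ≈ 0#
          Xθ = trans (θ-* f f) (trans (+-cong (trans (*-congʳ z) (zeroˡ f)) (trans (*-congˡ {f} z) (zeroʳ f))) (+-identityˡ 0#))
            where
            f : Series
            f = Φ (x (down M))
            z : θ f ≈ 0#
            z = θx≈0 (reduce (down M)) m̄≈0

          conclude : ∀ d₊ d₋ → d₊ ℕ.+ d₋ ≡ (sq8 N′ ℕ.+ sq8 N′) ℕ.+ 4 → HeightAt up (sq8 N′) (slope (sq8 N′) d₊) (N ℕ.+ N) →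
            HeightAt down (sq8 N′) (slope (sq8 N′) d₋) M → Height (X̄ (down M)) (p ℕ.+ p)
          conclude d₊ d₋ s (hu , _ , eu) (hd , H , ed) = ≡.subst (Height (X̄ (down M)))
            (bottom-height N M p prime (s≤s z≤n) 3≤M M<p 10N<p norm d₊ d₋ hu hd s eu ed (p∣height H Xθ)) H

          H₀ : Height (X̄ (mul N′)) (sq8 N′)
          H₀ = proj₁ (mul-height N′ N<p)

          rows : (∃₂ λ d₊ d₋ → Height (X̄ (up 1)) d₊ × Height (X̄ (down 1)) d₋ × d₊ ℕ.+ d₋ ≡ (sq8 N′ ℕ.+ sq8 N′) ℕ.+ 4) → Height (X̄ (down M)) (p ℕ.+ p)
          rows (d₊ , d₋ , H₊ , H₋ , s) = conclude d₊ d₋ s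
            (row-end up (N ℕ.+ N) (λ j lt Hd He → next-⊞ (up j) generic (up-m≉0 (suc j) lt) one≉0 Hd He height-generic) H₀ H₊ (s≤s z≤n))
            (row-end down M (λ j lt Hd He → next-⊟ (down j) generic (down-m≉0 (suc j) lt) one≉0 Hd He height-generic) H₀ H₋ (ℕₚ.<-≤-trans (s≤s z≤n) 3≤M))

          height-2p : Height (X̄ (down M)) (p ℕ.+ p)
          height-2p = rows (step (mul N′) generic (mul-m≉0 N′ N<p) one≉0 H₀ height-generic)

          u : A.Carrier
          u = proj₁ (kernel m̄≈0)
          u-eq : m (down M) A.≈ A.nat p A.* u
          u-eq = proj₂ (kernel m̄≈0)

          v : A.Carrier
          v = A.nat N A.* (A.1# A.- α) A.- A.nat M

          nat-norm : A.nat M A.* A.nat M A.+ A.nat 4 A.* (A.nat N A.* A.nat N) A.≈ A.nat p A.+ A.nat M A.* A.nat N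
          nat-norm = A.begin
            A.nat M A.* A.nat M A.+ A.nat 4 A.* (A.nat N A.* A.nat N) A.≈⟨ A.+-cong (A.sym (A.×1-homo-* M M)) (A.trans (A.*-congˡ (A.sym (A.×1-homo-* N N))) (A.sym (A.×1-homo-* 4 (N ℕ.* N)))) ⟩
            A.nat (M ℕ.* M) A.+ A.nat (4 ℕ.* (N ℕ.* N)) A.≈⟨ A.sym (A.×-homo-+ A.1# (M ℕ.* M) (4 ℕ.* (N ℕ.* N))) ⟩
            A.nat (M ℕ.* M ℕ.+ 4 ℕ.* (N ℕ.* N)) A.≈⟨ A.reflexive (≡.cong A.nat norm) ⟩
            A.nat (p ℕ.+ M ℕ.* N) A.≈⟨ A.×-homo-+ A.1# p (M ℕ.* N) ⟩
            A.nat p A.+ A.nat (M ℕ.* N) A.≈⟨ A.+-congˡ (A.×1-homo-* M N) ⟩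
            A.nat p A.+ A.nat M A.* A.nat N A.∎

          -- v is the conjugate of N α - M, and the product of the two is the norm p.
          uv : A.nat p A.* (u A.* v) A.≈ A.nat p
          uv = A.begin
            A.nat p A.* (u A.* v) A.≈⟨ A.sym (A.*-assoc _ u v) ⟩
            A.nat p A.* u A.* v A.≈⟨ A.*-congʳ (A.trans (A.sym u-eq) (down-m M)) ⟩
            (A.nat N A.* α A.- A.nat M) A.* v
              A.≈⟨ A.solve 3 (λ N M a → (N :* a :- M) :* (N :* (:1 :- a) :- M) := N :* N :* (a :- a :* a) :+ M :* M :- M :* N) (A.nat N) (A.nat M) α ⟩
            A.nat N A.* A.nat N A.* (α A.- α A.* α) A.+ A.nat M A.* A.nat M A.- A.nat M A.* A.nat N
              A.≈⟨ A.+-congʳ (A.+-congʳ (A.*-congˡ (A.+-congˡ (A.-‿cong α-norm)))) ⟩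
            A.nat N A.* A.nat N A.* (α A.- (α A.- A.nat 4)) A.+ A.nat M A.* A.nat M A.- A.nat M A.* A.nat N
              A.≈⟨ A.solve 3 (λ N M a → N :* N :* (a :- (a :- κ 4)) :+ M :* M :- M :* N := (M :* M :+ κ 4 :* (N :* N)) :- M :* N) (A.nat N) (A.nat M) α ⟩
            (A.nat M A.* A.nat M A.+ A.nat 4 A.* (A.nat N A.* A.nat N)) A.- A.nat M A.* A.nat N
              A.≈⟨ A.+-congʳ nat-norm ⟩
            A.nat p A.+ A.nat M A.* A.nat N A.- A.nat M A.* A.nat N
              A.≈⟨ A.solve 2 (λ p k → p :+ k :- k := p) (A.nat p) (A.nat M A.* A.nat N) ⟩
            A.nat p A.∎

          ūv̄ : φ u K.* φ v K.≈ K.1#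
          ūv̄ = K.diff≈0⇒≈ (K.trans (K.sym (K.trans (+-homo _ _) (K.+-cong (*-homo u v) (K.trans (-‿homo _) (K.-‿cong 1#-homo)))))
            (torsion (A.trans (A.solve 2 (λ p z → p :* (z :- :1) := p :* z :- p) (A.nat p) (u A.* v)) (A.≈⇒diff≈0 uv))))

          v̄ : φ v K.≈ K.nat N K.- K.nat M K.- K.nat M
          v̄ = K.trans (⟦⟧-cong (A.solve 3 (λ N M a → N :* (:1 :- a) :- M := (N :- N :* a) :- M) (A.nat N) (A.nat M) α))
            (K.trans (+-homo _ _) (K.+-cong (K.trans (+-homo _ _) (K.+-cong (φ-nat N) (K.trans (-‿homo _) (K.-‿cong φ-Nα)))) (K.trans (-‿homo _) (K.-‿cong (φ-nat M)))))

          h = HC.hasse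

        -- By `Bottom` the square of u h is 1, and u is inverse to v modulo p, so h² = v²; since N α
        -- reduces to M, v reduces to N - 2 M.
        hasse-square : h K.* h K.≈ (K.nat N K.- K.nat M K.- K.nat M) K.* (K.nat N K.- K.nat M K.- K.nat M)
        hasse-square = K.begin
          h K.* h K.≈⟨ K.solve 1 (λ h → h :* h := h :* h :* (:1 :* :1)) h ⟩
          h K.* h K.* (K.1# K.* K.1#) K.≈⟨ K.*-congˡ (K.*-cong (K.sym ūv̄) (K.sym ūv̄)) ⟩
          h K.* h K.* (φ u K.* φ v K.* (φ u K.* φ v))
            K.≈⟨ K.solve 3 (λ h u v → h :* h :* (u :* v :* (u :* v)) := (u :* h :* (u :* h)) :* (v :* v)) h (φ u) (φ v) ⟩
          (φ u K.* h K.* (φ u K.* h)) K.* (φ v K.* φ v)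
            K.≈⟨ K.trans (K.*-congʳ (Bottom.hasse-multiplier (down M) u u-eq height-2p q≉0 q²≉3 2q²≉9)) (K.*-identityˡ _) ⟩
          φ v K.* φ v K.≈⟨ K.*-cong v̄ v̄ ⟩
          (K.nat N K.- K.nat M K.- K.nat M) K.* (K.nat N K.- K.nat M K.- K.nat M) K.∎

-- The rings ℤ / m

module Zmod (m : ℕ) where
 open import Data.Integer as ℤ using (ℤ; +_; -[1+_])
 private module I = RingKit ℤₚ.+-*-commutativeRing

 infix 4 _≈_
 -- The carrier is ℤ for every modulus, so the reduction from ℤ / p² to ℤ / p is the identity
 -- function.
 record _≈_ (a b : ℤ) : Set where
   constructor mod
   field
     quotient : ℤ
     equation : a ℤ.- b ≡ + m ℤ.* quotient

 ≡⇒≈ : ∀ {a b} → a ≡ b → a ≈ b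
 ≡⇒≈ {a} ≡.refl = mod ℤ.0ℤ (≡.trans (ℤₚ.+-inverseʳ a) (≡.sym (ℤₚ.*-zeroʳ (+ m))))

 zmod : CommutativeRing 0ℓ 0ℓ
 zmod = record
   { Carrier = ℤ ; _≈_ = _≈_ ; _+_ = ℤ._+_ ; _*_ = ℤ._*_ ; -_ = ℤ.-_ ; 0# = ℤ.0ℤ ; 1# = ℤ.1ℤ
   ; isCommutativeRing = record
     { isRing = record
       { +-isAbelianGroup = record
         { isGroup = record
           { isMonoid = record
             { isSemigroup = record
               { isMagma = record
                 { isEquivalence = record
                   { refl = ≡⇒≈ ≡.refl
                   ; sym = λ { {a} {b} (mod c e) → mod (ℤ.- c) (≡.trans (I.solve 2 (λ a b → b :- a := :- (a :- b)) a b) (≡.trans (≡.cong ℤ.-_ e) (ℤₚ.neg-distribʳ-* (+ m) c))) }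
                   ; trans = λ { {a} {b} {d} (mod c e) (mod c′ e′) → mod (c ℤ.+ c′) (≡.trans (I.solve 3 (λ a b d → a :- d := (a :- b) :+ (b :- d)) a b d)
                       (≡.trans (≡.cong₂ ℤ._+_ e e′) (≡.sym (ℤₚ.*-distribˡ-+ (+ m) c c′)))) } }
                 ; ∙-cong = λ { {a} {b} {u} {v} (mod c e) (mod c′ e′) → mod (c ℤ.+ c′) (≡.trans (I.solve 4 (λ a b u v → (a :+ u) :- (b :+ v) := (a :- b) :+ (u :- v)) a b u v)
                       (≡.trans (≡.cong₂ ℤ._+_ e e′) (≡.sym (ℤₚ.*-distribˡ-+ (+ m) c c′)))) } }
               ; assoc = λ a b c → ≡⇒≈ (ℤₚ.+-assoc a b c) }
             ; identity = (λ a → ≡⇒≈ (ℤₚ.+-identityˡ a)) , (λ a → ≡⇒≈ (ℤₚ.+-identityʳ a)) }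
           ; inverse = (λ a → ≡⇒≈ (ℤₚ.+-inverseˡ a)) , (λ a → ≡⇒≈ (ℤₚ.+-inverseʳ a))
           ; ⁻¹-cong = λ { {a} {b} (mod c e) → mod (ℤ.- c) (≡.trans (I.solve 2 (λ a b → (:- a) :- (:- b) := :- (a :- b)) a b) (≡.trans (≡.cong ℤ.-_ e) (ℤₚ.neg-distribʳ-* (+ m) c))) } }
         ; comm = λ a b → ≡⇒≈ (ℤₚ.+-comm a b) }
       ; *-cong = λ { {a} {b} {u} {v} (mod c e) (mod c′ e′) → mod (c ℤ.* u ℤ.+ b ℤ.* c′) (≡.trans (I.solve 4 (λ a b u v → a :* u :- b :* v := (a :- b) :* u :+ b :* (u :- v)) a b u v)
           (≡.trans (≡.cong₂ (λ x y → x ℤ.* u ℤ.+ b ℤ.* y) e e′) (I.solve 5 (λ m c u b c′ → m :* c :* u :+ b :* (m :* c′) := m :* (c :* u :+ b :* c′)) (+ m) c u b c′))) }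
       ; *-assoc = λ a b c → ≡⇒≈ (ℤₚ.*-assoc a b c)
       ; *-identity = (λ a → ≡⇒≈ (ℤₚ.*-identityˡ a)) , (λ a → ≡⇒≈ (ℤₚ.*-identityʳ a))
       ; distrib = (λ a b c → ≡⇒≈ (ℤₚ.*-distribˡ-+ a b c)) , (λ a b c → ≡⇒≈ (ℤₚ.*-distribʳ-+ a b c)) }
     ; *-comm = λ a b → ≡⇒≈ (ℤₚ.*-comm a b) } }

 open RingKit zmod using (nat)

 nat≡ : ∀ k → nat k ≡ + k
 nat≡ zero = ≡.refl
 nat≡ (suc k) = ≡.cong (λ z → ℤ.1ℤ ℤ.+ z) (nat≡ k)

 modulus≈0 : nat m ≈ ℤ.0ℤ
 modulus≈0 = mod ℤ.1ℤ (≡.trans (ℤₚ.+-identityʳ _) (≡.trans (nat≡ m) (≡.sym (ℤₚ.*-identityʳ (+ m)))))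

-- The prime field

module PrimeField (p : ℕ) (prime : Prime p) where
 open import Data.Nat.Primality using (prime⇒nonTrivial)
 open import Data.Integer as ℤ using (ℤ; +_; -[1+_])
 open import Data.Integer.Divisibility as ℤ∣ using ()
 import Data.Integer.Divisibility.Signed as ℤ∣ₛ
 open import Data.Integer.DivMod using (_%ℕ_; _/ℕ_; a≡a%ℕn+[a/ℕn]*n)
 open import Data.Nat.Divisibility using (_∣_; _∣?_; ∣⇒≤; m%n≡0⇒n∣m)
 open import Data.Nat.DivMod using (m%n<n)
 open import Data.Nat.Coprimality using (prime⇒coprime; coprime-Bézout; Coprime) renaming (sym to coprime-sym)
 open import Data.Nat.GCD using (module Bézout)
 open import Relation.Nullary.Decidable using (map′)
 open Zmod p using (_≈_; mod; ≡⇒≈; zmod; nat≡; modulus≈0) public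
 private
   module I = RingKit ℤₚ.+-*-commutativeRing
   module K = RingKit zmod

 instance
   p-nonZero : ℕ.NonZero p
   p-nonZero = ℕ.nonTrivial⇒nonZero p {{prime⇒nonTrivial prime}}

 1<p : 1 ℕ.< p
 1<p = ℕ.nonTrivial⇒n>1 p {{prime⇒nonTrivial prime}}

 ∣⇒≈0 : ∀ {a} → + p ℤ∣.∣ a → a ≈ ℤ.0ℤ
 ∣⇒≈0 {a} h with ℤ∣ₛ.∣ᵤ⇒∣ h
 ... | ℤ∣ₛ.divides c e = mod c (≡.trans (ℤₚ.+-identityʳ a) (≡.trans e (ℤₚ.*-comm c (+ p))))

 ≈0⇒∣ : ∀ {a} → a ≈ ℤ.0ℤ → + p ℤ∣.∣ a
 ≈0⇒∣ {a} (mod c e) = ℤ∣ₛ.∣⇒∣ᵤ (ℤ∣ₛ.divides c (≡.trans (≡.sym (ℤₚ.+-identityʳ a)) (≡.trans e (ℤₚ.*-comm (+ p) c))))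

 _≟0 : ∀ a → Dec (a ≈ ℤ.0ℤ)
 a ≟0 = map′ ∣⇒≈0 ≈0⇒∣ (p ∣? ℤ.∣ a ∣)

 nat≈0⇒∣ : ∀ {k} → K.nat k ≈ ℤ.0ℤ → p ∣ k
 nat≈0⇒∣ {k} h = ≈0⇒∣ (K.trans (≡⇒≈ (≡.sym (nat≡ k))) h)

 1≉0 : ¬ ℤ.1ℤ ≈ ℤ.0ℤ
 1≉0 h = ℕₚ.<⇒≱ 1<p (∣⇒≤ (≈0⇒∣ h))

 residue : ∀ a → a ≈ K.nat (a %ℕ p)
 residue a = mod (a /ℕ p) (≡.trans (≡.cong (λ z → z ℤ.- K.nat (a %ℕ p)) (a≡a%ℕn+[a/ℕn]*n a p)) (≡.trans (≡.cong (λ z → + (a %ℕ p) ℤ.+ (a /ℕ p) ℤ.* + p ℤ.- z) (nat≡ (a %ℕ p)))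
   (I.solve 3 (λ r d p → r :+ d :* p :- r := p :* d) (+ (a %ℕ p)) (a /ℕ p) (+ p))))

 private
   module Bézout-inverse (R : CommutativeRing 0ℓ 0ℓ) (char : RingKit.HasChar R p) where
     open RingKit R renaming (_≈_ to _≋_)

     nat-* : ∀ y → nat (y ℕ.* p) ≋ 0#
     nat-* y = trans (×1-homo-* y p) (trans (*-congˡ char) (zeroʳ (nat y)))

     bézout-plus : ∀ x y k → 1 ℕ.+ y ℕ.* p ≡ x ℕ.* k → nat k * nat x ≋ 1#
     bézout-plus x y k e = begin
       nat k * nat x ≈⟨ *-comm (nat k) (nat x) ⟩
       nat x * nat k ≈⟨ sym (×1-homo-* x k) ⟩
       nat (x ℕ.* k) ≡⟨ ≡.cong nat (≡.sym e) ⟩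
       1# + nat (y ℕ.* p) ≈⟨ trans (+-congˡ (nat-* y)) (+-identityʳ 1#) ⟩
       1# ∎

     bézout-minus : ∀ x y k → 1 ℕ.+ x ℕ.* k ≡ y ℕ.* p → nat k * - nat x ≋ 1#
     bézout-minus x y k e = begin
       nat k * - nat x ≈⟨ solve 2 (λ x k → k :* (:- x) := :1 :- (:1 :+ x :* k)) (nat x) (nat k) ⟩
       1# - (1# + nat x * nat k) ≈⟨ +-congˡ (-‿cong (+-congˡ (sym (×1-homo-* x k)))) ⟩
       1# - nat (1 ℕ.+ x ℕ.* k) ≡⟨ ≡.cong (λ k → 1# - nat k) e ⟩
       1# - nat (y ℕ.* p) ≈⟨ +-congˡ (trans (-‿cong (nat-* y)) -0#≈0#) ⟩
       1# + 0# ≈⟨ +-identityʳ 1# ⟩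
       1# ∎

   open Bézout-inverse zmod modulus≈0

 unit : ∀ k → ¬ p ∣ k → ∃ λ b → K.nat k K.* b ≈ K.1#
 unit k p∤k with k ℕ.% p in eq
 ... | zero = ⊥-elim (p∤k (m%n≡0⇒n∣m k p eq))
 ... | suc j = go (coprime-Bézout (coprime-sym (prime⇒coprime {n = suc j} prime (≡.subst (ℕ._< p) eq (m%n<n k p)))))
   where
   k≈ : K.nat k ≈ K.nat (suc j)
   k≈ = K.trans (≡⇒≈ (nat≡ k)) (K.trans (residue (+ k)) (K.reflexive (≡.cong K.nat eq)))
   go : Bézout.Identity 1 (suc j) p → ∃ λ b → K.nat k K.* b ≈ K.1#
   go (Bézout.+- x y e) = K.nat x , K.trans (K.*-congʳ {K.nat x} k≈) (bézout-plus x y (suc j) e)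
   go (Bézout.-+ x y e) = K.- K.nat x , K.trans (K.*-congʳ {K.- K.nat x} k≈) (bézout-minus x y (suc j) e)

 inverse : ∀ a → ¬ a ≈ ℤ.0ℤ → ∃ λ b → a K.* b ≈ K.1#
 inverse a a≉0 = let (b , e) = unit (a %ℕ p) (λ p∣r → a≉0 (K.trans (residue a) (K.trans (≡⇒≈ (nat≡ _)) (∣⇒≈0 p∣r)))) in
   b , K.trans (K.*-congʳ {b} (residue a)) e

 fermat : ∀ a → a K.^ p ≈ a
 fermat a = K.trans (K.^-congˡ p (residue a)) (K.trans (CharP.On.fermat zmod p 1<p modulus≈0 unit (a %ℕ p)) (K.sym (residue a)))

-- Free quadratic extensions

-- the free quadratic extension R[x] / (x² - b x - c)
module Quad (R : CommutativeRing 0ℓ 0ℓ) (b c : CommutativeRing.Carrier R) where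
 open RingKit R

 infix 4 _≃_
 record _≃_ (x y : Carrier × Carrier) : Set where
   constructor _,_
   field
     fst : proj₁ x ≈ proj₁ y
     snd : proj₂ x ≈ proj₂ y
 open _≃_ public

 private
   _⊗_ : Carrier × Carrier → Carrier × Carrier → Carrier × Carrier
   (x , x′) ⊗ (y , y′) = x * y + c * (x′ * y′) , x * y′ + x′ * y + b * (x′ * y′)

 quadRing : CommutativeRing 0ℓ 0ℓ
 quadRing = record
   { Carrier = Carrier × Carrier ; _≈_ = _≃_
   ; _+_ = λ { (x , x′) (y , y′) → x + y , x′ + y′ } ; _*_ = _⊗_ ; -_ = λ { (x , x′) → - x , - x′ } ; 0# = 0# , 0# ; 1# = 1# , 0#
   ; isCommutativeRing = record
     { isRing = record
       { +-isAbelianGroup = record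
         { isGroup = record
           { isMonoid = record
             { isSemigroup = record
               { isMagma = record
                 { isEquivalence = record { refl = refl , refl ; sym = λ { (e , f) → sym e , sym f } ; trans = λ { (e , f) (g , h) → trans e g , trans f h } }
                 ; ∙-cong = λ { (e , f) (g , h) → +-cong e g , +-cong f h } }
               ; assoc = λ _ _ _ → +-assoc _ _ _ , +-assoc _ _ _ }
             ; identity = (λ _ → +-identityˡ _ , +-identityˡ _) , (λ _ → +-identityʳ _ , +-identityʳ _) }
           ; inverse = (λ _ → -‿inverseˡ _ , -‿inverseˡ _) , (λ _ → -‿inverseʳ _ , -‿inverseʳ _)
           ; ⁻¹-cong = λ { (e , f) → -‿cong e , -‿cong f } }
         ; comm = λ _ _ → +-comm _ _ , +-comm _ _ }
       ; *-cong = λ { (e , f) (g , h) → +-cong (*-cong e g) (*-congˡ (*-cong f h)) , +-cong (+-cong (*-cong e h) (*-cong f g)) (*-congˡ (*-cong f h)) }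
       ; *-assoc = λ { (x , x′) (y , y′) (z , z′) →
           solve 8 (λ x x′ y y′ z z′ b c → (x :* y :+ c :* (x′ :* y′)) :* z :+ c :* ((x :* y′ :+ x′ :* y :+ b :* (x′ :* y′)) :* z′)
             := x :* (y :* z :+ c :* (y′ :* z′)) :+ c :* (x′ :* (y :* z′ :+ y′ :* z :+ b :* (y′ :* z′)))) x x′ y y′ z z′ b c
         , solve 8 (λ x x′ y y′ z z′ b c → (x :* y :+ c :* (x′ :* y′)) :* z′ :+ (x :* y′ :+ x′ :* y :+ b :* (x′ :* y′)) :* z :+ b :* ((x :* y′ :+ x′ :* y :+ b :* (x′ :* y′)) :* z′)
             := x :* (y :* z′ :+ y′ :* z :+ b :* (y′ :* z′)) :+ x′ :* (y :* z :+ c :* (y′ :* z′)) :+ b :* (x′ :* (y :* z′ :+ y′ :* z :+ b :* (y′ :* z′)))) x x′ y y′ z z′ b c }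
       ; *-identity =
           (λ { (x , x′) → solve 3 (λ x x′ c → :1 :* x :+ c :* (:0 :* x′) := x) x x′ c , solve 3 (λ x x′ b → :1 :* x′ :+ :0 :* x :+ b :* (:0 :* x′) := x′) x x′ b })
         , (λ { (x , x′) → solve 3 (λ x x′ c → x :* :1 :+ c :* (x′ :* :0) := x) x x′ c , solve 3 (λ x x′ b → x :* :0 :+ x′ :* :1 :+ b :* (x′ :* :0) := x′) x x′ b })
       ; distrib =
           (λ { (x , x′) (y , y′) (z , z′) →
               solve 7 (λ x x′ y y′ z z′ c → x :* (y :+ z) :+ c :* (x′ :* (y′ :+ z′)) := (x :* y :+ c :* (x′ :* y′)) :+ (x :* z :+ c :* (x′ :* z′))) x x′ y y′ z z′ c
             , solve 7 (λ x x′ y y′ z z′ b → x :* (y′ :+ z′) :+ x′ :* (y :+ z) :+ b :* (x′ :* (y′ :+ z′)) := (x :* y′ :+ x′ :* y :+ b :* (x′ :* y′)) :+ (x :* z′ :+ x′ :* z :+ b :* (x′ :* z′))) x x′ y y′ z z′ b })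
         , (λ { (x , x′) (y , y′) (z , z′) →
               solve 7 (λ x x′ y y′ z z′ c → (y :+ z) :* x :+ c :* ((y′ :+ z′) :* x′) := (y :* x :+ c :* (y′ :* x′)) :+ (z :* x :+ c :* (z′ :* x′))) x x′ y y′ z z′ c
             , solve 7 (λ x x′ y y′ z z′ b → (y :+ z) :* x′ :+ (y′ :+ z′) :* x :+ b :* ((y′ :+ z′) :* x′) := (y :* x′ :+ y′ :* x :+ b :* (y′ :* x′)) :+ (z :* x′ :+ z′ :* x :+ b :* (z′ :* x′))) x x′ y y′ z z′ b }) }
     ; *-comm = λ { (x , x′) (y , y′) → +-cong (*-comm x y) (*-congˡ (*-comm x′ y′))
         , solve 5 (λ x x′ y y′ b → x :* y′ :+ x′ :* y :+ b :* (x′ :* y′) := y :* x′ :+ y′ :* x :+ b :* (y′ :* x′)) x x′ y y′ b } } }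

 private module Q = RingKit quadRing

 ι : Carrier → Q.Carrier
 ι a = a , 0#

 gen : Q.Carrier
 gen = 0# , 1#

 gen² : gen Q.* gen Q.≈ ι b Q.* gen Q.+ ι c
 gen² = solve 2 (λ b c → :0 :* :0 :+ c :* (:1 :* :1) := (b :* :0 :+ c :* (:0 :* :1)) :+ c) b c
      , solve 1 (λ b → :0 :* :1 :+ :1 :* :0 :+ b :* (:1 :* :1) := (b :* :1 :+ :0 :* :0 :+ b :* (:0 :* :1)) :+ :0) b

 ι-cong : ∀ {x y} → x ≈ y → ι x Q.≈ ι y
 ι-cong e = e , refl

 ι-+ : ∀ x y → ι (x + y) Q.≈ ι x Q.+ ι y
 ι-+ x y = refl , sym (+-identityˡ 0#)

 ι-* : ∀ x y → ι (x * y) Q.≈ ι x Q.* ι y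
 ι-* x y = solve 3 (λ x y c → x :* y := x :* y :+ c :* (:0 :* :0)) x y c , solve 3 (λ x y b → :0 := x :* :0 :+ :0 :* y :+ b :* (:0 :* :0)) x y b

 ι-neg : ∀ x → ι (- x) Q.≈ Q.- ι x
 ι-neg x = refl , sym -0#≈0#

 ι-nat : ∀ k → ι (nat k) Q.≈ Q.nat k
 ι-nat zero = refl , refl
 ι-nat (suc k) = Q.trans (ι-+ 1# (nat k)) (Q.+-congˡ (ι-nat k))

 ι-injective : ∀ {x y} → ι x Q.≈ ι y → x ≈ y
 ι-injective (e , _) = e

 ι-unit : ∀ {x y} → x * y ≈ 1# → ι x Q.* ι y Q.≈ Q.1#
 ι-unit e = Q.trans (Q.sym (ι-* _ _)) (ι-cong e)

 ι-1 : ι 1# Q.≈ Q.1#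
 ι-1 = refl , refl

 ι-eisenstein : ∀ {x} → x * x ≈ - 1# - x → ι x Q.* ι x Q.≈ Q.- Q.1# Q.- ι x
 ι-eisenstein {x} e = Q.trans (Q.sym (ι-* x x)) (Q.trans (ι-cong e) (Q.trans (ι-+ (- 1#) (- x)) (Q.+-cong (ι-neg 1#) (ι-neg x))))

 ι-golden : ∀ {x} → x * x ≈ 1# - x → ι x Q.* ι x Q.≈ Q.1# Q.- ι x
 ι-golden {x} e = Q.trans (Q.sym (ι-* x x)) (Q.trans (ι-cong e) (Q.trans (ι-+ 1# (- x)) (Q.+-congˡ {Q.1#} (ι-neg x))))

 ι-nat-zero : ∀ {k} → nat k ≈ 0# → Q.nat k Q.≈ Q.0#
 ι-nat-zero {k} e = Q.trans (Q.sym (ι-nat k)) (ι-cong e)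

 -- The extension is free and therefore contains R. A congruence between integers may thus be proved
 -- after adjoining roots, whether or not R already has them.
 nat-zero⁻¹ : ∀ {k} → Q.nat k Q.≈ Q.0# → nat k ≈ 0#
 nat-zero⁻¹ {k} e = ι-injective (Q.trans (ι-nat k) e)

 ι-nat-unit : ∀ {k} → ∃ (λ b → nat k * b ≈ 1#) → ∃ λ b → Q.nat k Q.* b Q.≈ Q.1#
 ι-nat-unit {k} (b , e) = ι b , Q.trans (Q.*-congʳ {ι b} (Q.sym (ι-nat k))) (ι-unit e)

-- Finite differences of polynomial functions

module Differences (R : CommutativeRing 0ℓ 0ℓ) where
 open RingKit R

 module On (p : ℕ) (1<p : 1 ℕ.< p)
   (char : RingKit.HasChar R p)
   (unit : RingKit.UnitsPrimeTo R p) where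
  open CharP.On R p 1<p char unit using (nat-zero; ∤-small)

  Δ : (ℕ → Carrier) → ℕ → Carrier
  Δ F j = F (suc j) - F j

  -- F is a polynomial function with leading term a j^d
  data Polynomial : ℕ → Carrier → (ℕ → Carrier) → Set where
    constant : ∀ {a F} → (∀ j → F j ≈ a) → Polynomial 0 a F
    difference : ∀ {d a b F} → b ≈ nat (suc d) * a → Polynomial d b (Δ F) → Polynomial (suc d) a F

  poly-cong : ∀ {d a b F G} → a ≈ b → (∀ j → F j ≈ G j) → Polynomial d a F → Polynomial d b G
  poly-cong e h (constant c) = constant (λ j → trans (sym (h j)) (trans (c j) e))
  poly-cong e h (difference f D) = difference (trans f (*-congˡ e)) (poly-cong refl (λ j → +-cong (h (suc j)) (-‿cong (h j))) D)

  poly-+ : ∀ {d a b F G} → Polynomial d a F → Polynomial d b G → Polynomial d (a + b) (λ j → F j + G j)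
  poly-+ (constant c) (constant c′) = constant (λ j → +-cong (c j) (c′ j))
  poly-+ (difference f D) (difference g E) = difference (trans (+-cong f g) (sym (distribˡ _ _ _)))
    (poly-cong refl (λ j → solve 4 (λ a b c d → (a :- b) :+ (c :- d) := (a :+ c) :- (b :+ d)) _ _ _ _) (poly-+ D E))

  poly-shift : ∀ {d a F} → Polynomial d a F → Polynomial d a (λ j → F (suc j))
  poly-shift (constant c) = constant (λ j → c (suc j))
  poly-shift (difference f D) = difference f (poly-shift D)

  poly-j* : ∀ {d a F} → Polynomial d a F → Polynomial (suc d) a (λ j → nat j * F j)
  poly-j* {a = a} {F} (constant c) = difference refl (constant (λ j → trans (+-cong (*-congˡ (c (suc j))) (-‿cong (*-congˡ (c j))))
    (solve 2 (λ j a → (:1 :+ j) :* a :- j :* a := κ 1 :* a) (nat j) a)))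
  poly-j* {suc d} {a} {F} D@(difference {b = b} f E) = difference refl (poly-cong
    (trans (+-congʳ f) (solve 2 (λ d a → d :* a :+ a := (:1 :+ d) :* a) (nat (suc d)) a))
    (λ j → solve 3 (λ j u v → j :* (v :- u) :+ v := (:1 :+ j) :* v :- j :* u) (nat j) (F j) (F (suc j)))
    (poly-+ (poly-j* E) (poly-shift D)))

  poly-power : ∀ k → Polynomial k 1# (λ j → nat j ^ k)
  poly-power zero = constant (λ _ → refl)
  poly-power (suc k) = poly-j* (poly-power k)

  -- Taking d differences leaves d! times the leading coefficient, computed from d + 1 consecutive
  -- values, and d! is a unit for d < p.
  leading-zero : ∀ {d a F} i → d ℕ.< p → Polynomial d a F → (∀ j → i ℕ.≤ j → j ℕ.≤ i ℕ.+ d → F j ≈ 0#) → a ≈ 0#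
  leading-zero i d<p (constant c) z = trans (sym (c i)) (z i ℕₚ.≤-refl (ℕₚ.m≤m+n i 0))
  leading-zero {suc d} i d<p (difference f D) z = nat-zero (∤-small (s≤s z≤n) d<p) (trans (sym f) (leading-zero i (ℕₚ.<-trans ℕₚ.≤-refl d<p) D
    (λ j i≤j j≤ → trans (+-cong (z (suc j) (ℕₚ.m≤n⇒m≤1+n i≤j) (≡.subst (suc j ℕ.≤_) (≡.sym (ℕₚ.+-suc i d)) (s≤s j≤)))
      (-‿cong (z j i≤j (ℕₚ.≤-trans j≤ (ℕₚ.+-monoʳ-≤ i (ℕₚ.n≤1+n d)))))) (-‿inverseʳ 0#))))

  -- Otherwise the polynomial j^(k+1) - 1 would vanish at the consecutive points 1, ..., k + 2. This
  -- will provide non-cubes, hence a primitive cube root of unity.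
  powers-not-all-one : ∀ k → suc (suc k) ℕ.< p → ¬ 1# ≈ 0# → ¬ (∀ j → 1 ℕ.≤ j → j ℕ.< p → nat j ^ suc k ≈ 1#)
  powers-not-all-one k lt 1≉0 h = 1≉0 (leading-zero 1 (ℕₚ.<-trans ℕₚ.≤-refl lt) (shifted (poly-power (suc k)))
    (λ j 1≤j j≤ → ≈⇒diff≈0 (h j 1≤j (ℕₚ.≤-<-trans j≤ lt))))
    where
    shifted : ∀ {d a F} → Polynomial (suc d) a F → Polynomial (suc d) a (λ j → F j - 1#)
    shifted (difference f D) = difference f (poly-cong refl (λ j → solve 2 (λ u v → v :- u := (v :- :1) :- (u :- :1)) _ _) D)

-- The constants of the curve with complex multiplication

module Constants (R : CommutativeRing 0ℓ 0ℓ) where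
 open import Data.Bool using (true)
 open import Data.Fin using (zero; suc)
 open import Data.List using (List; []; _∷_)
 open import Data.Vec using ([]; _∷_)
 open import Data.Unit using (tt)
 open RingKit R

 -- r = √5, θ = √-3 and k = 1 / 432.  The curve y² = 1 + A x² + x⁴ is the translate by the 2-torsion
 -- point x = e of y² = 4 x³ + (x + w)²; it has complex multiplication by ℤ[α], α = (1 + √-15) / 2.
 module Elements (k r θ : Carrier) where

   α μ A e ν w : Carrier
   α = k * (nat 216 * (1# + r * θ))
   μ = k * (nat 108 * - (nat 9 + nat 5 * r + θ + r * θ))
   A = k * (nat 27 * - (nat 15 + nat 21 * r + nat 17 * θ + nat 7 * r * θ))
   e = k * (nat 6 * (nat 2 * r + nat 2 * θ - r * θ - nat 3))
   ν = k * (nat 6 * (nat 4 * θ - r * θ - nat 3))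
   w = k * (nat 8 * (1# - r))

   -- proportional to the product of the other conjugates
   A* [A²-3]* [2A²-9]* [2+A]* μ* ν* : Carrier
   A* = nat 15 - nat 12 * r + nat 4 * θ + r * θ
   [A²-3]* = nat 125 - nat 56 * r + nat 40 * θ - nat 21 * r * θ
   [2A²-9]* = nat 44 * r + nat 60 * θ - nat 29 * r * θ - nat 99
   [2+A]* = nat 17 - nat 21 * r + nat 17 * θ + nat 7 * r * θ
   μ* = nat 3 - nat 2 * r - nat 2 * θ + r * θ
   ν* = - (nat 27 + nat 9 * r + nat 21 * θ + nat 3 * r * θ)

   module _ (k-inv : nat 432 * k ≈ 1#) (r² : r * r ≈ nat 5) (θ² : θ * θ ≈ - nat 3) where

     private
       x y z αᴱ μᴱ Aᴱ eᴱ νᴱ wᴱ : Expr 3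
       x = var zero
       y = var (suc zero)
       z = var (suc (suc zero))
       αᴱ = x :* (κ 216 :* (:1 :+ y :* z))
       μᴱ = x :* (κ 108 :* (:- (κ 9 :+ κ 5 :* y :+ z :+ y :* z)))
       Aᴱ = x :* (κ 27 :* (:- (κ 15 :+ κ 21 :* y :+ κ 17 :* z :+ κ 7 :* y :* z)))
       eᴱ = x :* (κ 6 :* (κ 2 :* y :+ κ 2 :* z :- y :* z :- κ 3))
       νᴱ = x :* (κ 6 :* (κ 4 :* z :- y :* z :- κ 3))
       wᴱ = x :* (κ 8 :* (:1 :- y))

       with-cofactors : Expr 3 → Expr 3 → Expr 3 → List (Expr 3 × Expr 3 × Expr 3)
       with-cofactors a b c = (a , κ 432 :* x , :1) ∷ (b , y :* y , κ 5) ∷ (c , z :* z , :- κ 3) ∷ []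

       -- Every identity below is a membership in the ideal of the three relations for k, r and θ;
       -- `a`, `b` and `c` are the cofactors.
       by : (e : Expr 3 × Expr 3) (a b c : Expr 3) → check (combination (with-cofactors a b c) e) ≡ true →
         ⟦ proj₁ e ⟧ (k ∷ r ∷ θ ∷ []) ≈ ⟦ proj₂ e ⟧ (k ∷ r ∷ θ ∷ [])
       by e a b c h = prove-mod e (with-cofactors a b c) h (k ∷ r ∷ θ ∷ []) (k-inv , r² , θ² , tt)

     α-norm : α * α ≈ α - nat 4
     α-norm = by (αᴱ :* αᴱ := αᴱ :- κ 4)
       (:- (κ 4) :+ κ 216 :* x :* (:- (κ 7) :+ z :* y))
       (κ 46656 :* x :^ 2 :* z :^ 2)
       (κ 233280 :* x :^ 2)
       ≡.refl

     rel₁ : A - nat 6 - nat 6 * μ ≈ A * (α * α)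
     rel₁ = by (Aᴱ :- κ 6 :- κ 6 :* μᴱ := Aᴱ :* (αᴱ :* αᴱ))
       (κ 6 :+ κ 27 :* x :* (:- (κ 105) :- κ 7 :* z :+ y :* (:- (κ 99) :- κ 17 :* z)) :+ κ 11664 :* x :^ 2 :* (:- (κ 105) :- κ 7 :* z :+ y :* (:- (κ 99) :- κ 17 :* z)))
       (κ 1259712 :* x :^ 3 :* (κ 42 :* z :+ κ 29 :* z :^ 2 :+ κ 17 :* z :^ 3 :+ y :* (κ 21 :* z :^ 2 :+ κ 7 :* z :^ 3)))
       (κ 1259712 :* x :^ 3 :* (κ 145 :+ κ 85 :* z :+ y :* (κ 139 :+ κ 35 :* z)))
       ≡.refl

     rel₂ : μ * μ ≈ nat 8 - nat 4 * A
     rel₂ = by (μᴱ :* μᴱ := κ 8 :- κ 4 :* Aᴱ)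
       (κ 8 :+ κ 108 :* x :* (κ 47 :+ κ 17 :* z :+ y :* (κ 21 :+ κ 7 :* z)))
       (κ 11664 :* x :^ 2 :* (κ 25 :+ κ 10 :* z :+ z :^ 2))
       (κ 23328 :* x :^ 2 :* (κ 3 :+ y))
       ≡.refl

     rel₃ : nat 4 * μ * (nat 2 * μ - A + nat 6) ≈ α * α * (α * α)
     rel₃ = by (κ 4 :* μᴱ :* (κ 2 :* μᴱ :- Aᴱ :+ κ 6) := αᴱ :* αᴱ :* (αᴱ :* αᴱ))
       (κ 2592 :* x :* (κ 9 :+ z :+ y :* (κ 5 :+ z)) :+ κ 93312 :* x :^ 2 :* (:- (κ 17) :+ κ 7 :* z :* y) :+ κ 40310784 :* x :^ 3 :* (:- (κ 17) :+ κ 7 :* z :* y))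
       (κ 11664 :* x :^ 2 :* (κ 95 :+ κ 24 :* z :+ z :^ 2) :+ κ 2176782336 :* x :^ 4 :* (:- (κ 6 :* z :^ 2) :- κ 5 :* z :^ 4 :- κ 4 :* z :^ 3 :* y :- z :^ 4 :* y :^ 2))
       (κ 46656 :* x :^ 2 :* (:- (κ 1) :- κ 2 :* y) :+ κ 10883911680 :* x :^ 4 :* (κ 9 :- κ 5 :* z :^ 2 :- κ 4 :* z :* y))
       ≡.refl

     -- 27 w = (1 - √5) / 2 is a root of z² = z + 1.
     w-eq : - (nat 27 * (w * (1# - nat 27 * w))) ≈ 1#
     w-eq = by (:- (κ 27 :* (wᴱ :* (:1 :- κ 27 :* wᴱ))) := :1)
       (κ 1 :+ κ 216 :* x :* (κ 3 :- y))
       (κ 46656 :* x :^ 2)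
       (:0)
       ≡.refl

     -- With `e-lin` and `e-quad` this is the identity cubic(ν T + e) = 4 ν³ T (1 + A T + T²),
     -- coefficient by coefficient.
     e-root : nat 4 * (e * e * e) + (e + w) * (e + w) ≈ 0#
     e-root = by (κ 4 :* (eᴱ :* eᴱ :* eᴱ) :+ (eᴱ :+ wᴱ) :* (eᴱ :+ wᴱ) := :0)
       (κ 8 :* x :^ 2 :* (κ 99 :+ κ 60 :* z :+ y :* (:- (κ 44) :- κ 27 :* z)))
       (κ 4 :* x :^ 2 :* (κ 4 :- κ 12 :* z :+ κ 9 :* z :^ 2) :+ κ 864 :* x :^ 3 :* (:- (κ 36) :+ κ 60 :* z :- κ 33 :* z :^ 2 :+ κ 6 :* z :^ 3 :+ y :* (κ 8 :- κ 12 :* z :+ κ 6 :* z :^ 2 :- z :^ 3)))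
       (κ 36 :* x :^ 2 :* (κ 9 :- κ 4 :* y) :+ κ 864 :* x :^ 3 :* (:- (κ 201) :+ κ 38 :* z :+ y :* (κ 90 :- κ 17 :* z)))
       ≡.refl

     e-lin : nat 12 * (e * e) + nat 2 * (e + w) ≈ nat 4 * (ν * ν)
     e-lin = by (κ 12 :* (eᴱ :* eᴱ) :+ κ 2 :* (eᴱ :+ wᴱ) := κ 4 :* (νᴱ :* νᴱ))
       (κ 4 :* x :* (κ 5 :- κ 6 :* z :+ y :* (:- (κ 2) :+ κ 3 :* z)))
       (κ 288 :* x :^ 2 :* (κ 6 :- κ 6 :* z :+ z :^ 2))
       (κ 288 :* x :^ 2 :* (κ 3 :- κ 2 :* y))
       ≡.refl

     e-quad : nat 12 * e + 1# ≈ nat 4 * (ν * A)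
     e-quad = by (κ 12 :* eᴱ :+ :1 := κ 4 :* (νᴱ :* Aᴱ))
       (:- (κ 1) :+ κ 72 :* x :* (:- (κ 3) :- κ 2 :* z :+ y :* (:- (κ 2) :+ z)))
       (κ 4536 :* x :^ 2 :* (:- (κ 3 :* z) :- z :^ 2))
       (κ 7128 :* x :^ 2 :* (κ 3 :+ y))
       ≡.refl

     -- In this and the following norms the right-hand sides 84, 330, 462, 256, 8 and 4 have no
     -- prime factor above 11, so the factors on the left become units for p > 11.
     A-norm : A * A* ≈ nat 84
     A-norm = by (Aᴱ :* (κ 15 :- κ 12 :* y :+ κ 4 :* z :+ y :* z) := κ 84)
       (κ 84)
       (κ 189 :* x :* (κ 36 :+ κ 9 :* z :- z :^ 2))
       (κ 27 :* x :* (:- (κ 103) :- κ 45 :* y))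
       ≡.refl

     A²-3-norm : (A * A - nat 3) * [A²-3]* ≈ nat 330
     A²-3-norm = by ((Aᴱ :* Aᴱ :- κ 3) :* (κ 125 :- κ 56 :* y :+ κ 40 :* z :- κ 21 :* y :* z) := κ 330)
       (κ 705 :+ κ 120 :* z :+ y :* (:- (κ 168) :- κ 63 :* z) :+ κ 1296 :* x :* (κ 235 :+ κ 40 :* z :+ y :* (:- (κ 56) :- κ 21 :* z)))
       (κ 35721 :* x :^ 2 :* (κ 405 :- κ 216 :* z :- κ 303 :* z :^ 2 :- κ 62 :* z :^ 3 :+ y :* (:- (κ 504) :- κ 525 :* z :- κ 182 :* z :^ 2 :- κ 21 :* z :^ 3)))
       (κ 16038 :* x :^ 2 :* (:- (κ 805) :- κ 165 :* z :+ y :* (:- (κ 217) :- κ 77 :* z)))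
       ≡.refl

     2A²-9-norm : (nat 2 * (A * A) - nat 9) * [2A²-9]* ≈ nat 462
     2A²-9-norm = by ((κ 2 :* (Aᴱ :* Aᴱ) :- κ 9) :* (κ 44 :* y :+ κ 60 :* z :- κ 29 :* y :* z :- κ 99) := κ 462)
       (:- (κ 429) :+ κ 540 :* z :+ y :* (κ 396 :- κ 261 :* z) :+ κ 1296 :* x :* (:- (κ 143) :+ κ 180 :* z :+ y :* (κ 132 :- κ 87 :* z)))
       (κ 10206 :* x :^ 2 :* (:- (κ 2277) :+ κ 2820 :* z :- κ 505 :* z :^ 2 :- κ 566 :* z :^ 3 :+ y :* (κ 2772 :+ κ 21 :* z :- κ 910 :* z :^ 2 :- κ 203 :* z :^ 3)))
       (κ 2916 :* x :^ 2 :* (:- (κ 7843) :- κ 1235 :* z :+ y :* (:- (κ 1023) :- κ 603 :* z)))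
       ≡.refl

     2-A-square : nat 4 * (nat 2 - A) ≈ μ * μ
     2-A-square = by (κ 4 :* (κ 2 :- Aᴱ) := μᴱ :* μᴱ)
       (:- (κ 8) :+ κ 108 :* x :* (:- (κ 47) :- κ 17 :* z :+ y :* (:- (κ 21) :- κ 7 :* z)))
       (κ 11664 :* x :^ 2 :* (:- (κ 25) :- κ 10 :* z :- z :^ 2))
       (κ 23328 :* x :^ 2 :* (:- (κ 3) :- y))
       ≡.refl

     2+A-norm : (nat 2 + A) * [2+A]* ≈ nat 256
     2+A-norm = by ((κ 2 :+ Aᴱ) :* (κ 17 :- κ 21 :* y :+ κ 17 :* z :+ κ 7 :* y :* z) := κ 256)
       (κ 222 :- κ 34 :* z :+ y :* (κ 42 :- κ 14 :* z))
       (κ 1323 :* x :* (κ 9 :- z :^ 2))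
       (κ 54 :* x :* (:- (κ 267) :- κ 119 :* y))
       ≡.refl

     μ-norm : μ * μ* ≈ nat 8
     μ-norm = by (μᴱ :* (κ 3 :- κ 2 :* y :- κ 2 :* z :+ y :* z) := κ 8)
       (κ 8)
       (κ 108 :* x :* (κ 10 :- κ 3 :* z :- z :^ 2))
       (κ 108 :* x :* (:- (κ 3) :+ y))
       ≡.refl

     ν-norm : ν * ν* ≈ nat 4
     ν-norm = by (νᴱ :* (:- (κ 27 :+ κ 9 :* y :+ κ 21 :* z :+ κ 3 :* y :* z)) := κ 4)
       (κ 4)
       (κ 18 :* x :* (κ 3 :* z :+ z :^ 2))
       (κ 18 :* x :* (:- (κ 23) :+ κ 3 :* y))
       ≡.refl

     2α-1 : nat 2 * α - 1# ≈ r * θ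
     2α-1 = by (κ 2 :* αᴱ :- :1 := y :* z)
       (κ 1 :+ z :* y)
       (:0)
       (:0)
       ≡.refl

     rθ-square : r * θ * (r * θ) ≈ - nat 15
     rθ-square = by (y :* z :* (y :* z) := :- κ 15)
       (:0)
       (z :^ 2)
       (κ 5)
       ≡.refl

-- The Domb sum and the Hasse invariant over a ring with √5 and √-3

module CMCurve (R : CommutativeRing 0ℓ 0ℓ) where
 open import Defs using (sumBelow) renaming (A to a)
 open RingKit R

 module On (n : ℕ) (3<p : 3 ℕ.< suc (n ℕ.+ n))
   (char : RingKit.HasChar R (suc (n ℕ.+ n)))
   (unit : RingKit.UnitsPrimeTo R (suc (n ℕ.+ n)))
   (k r θ : CommutativeRing.Carrier R)
   (k-inv : CommutativeRing._≈_ R (CommutativeRing._*_ R (RingKit.nat R 432) k) (CommutativeRing.1# R))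
   (r² : CommutativeRing._≈_ R (CommutativeRing._*_ R r r) (RingKit.nat R 5))
   (θ² : CommutativeRing._≈_ R (CommutativeRing._*_ R θ θ) (CommutativeRing.-_ R (RingKit.nat R 3))) where
  module E = Constants.Elements R k r θ
  open E using (α; μ; A; e; ν; w; ν*) public

  1<p : 1 ℕ.< suc (n ℕ.+ n)
  1<p = ℕₚ.<-trans (s≤s (s≤s z≤n)) 3<p

  open Hasse.On.Curve R n 1<p char unit A using (hasse; hasse-point) public
  open Hasse.On.Curve.Cubic R n 1<p char unit A w using (cubic-hasse; hasse-shift) public

  hasse-α : hasse * α ^ suc (n ℕ.+ n) ≈ α * hasse
  hasse-α = hasse-point (AlphaPoint.On.αPoint R (Hasse.On.½ R n 1<p char unit) (Hasse.On.½*2 R n 1<p char unit) A α μ (E.rel₁ k-inv r² θ²) (E.rel₂ k-inv r² θ²) (E.rel₃ k-inv r² θ²))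

  shift : cubic-hasse * ν ^ (n ℕ.+ n) * ν ≈ (nat 4 * (ν * ν * ν)) ^ n * ν * hasse
  shift = hasse-shift e ν (E.e-root k-inv r² θ²) (E.e-lin k-inv r² θ²) (E.e-quad k-inv r² θ²)

  sum≈ : nat (sumBelow (suc (n ℕ.+ n)) a) ≈ cubic-hasse * cubic-hasse
  sum≈ = DombSum.On.domb-sum-square R n 3<p char unit w (trans (sym (-‿distribˡ-* (nat 27) _)) (E.w-eq k-inv r² θ²))

-- The inert case

-- The Frobenius fixes √5 but not √-3, so it conjugates α, and the Hasse invariant must vanish.
module Inert (R : CommutativeRing 0ℓ 0ℓ) where
 open import Data.Nat.Divisibility using (_∣_)
 open import Defs using (sumBelow) renaming (A to a)
 open RingKit R

 module On (n : ℕ) (3<p : 3 ℕ.< suc (n ℕ.+ n))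
   (char : RingKit.HasChar R (suc (n ℕ.+ n)))
   (unit : RingKit.UnitsPrimeTo R (suc (n ℕ.+ n)))
   (∤-432 : ¬ suc (n ℕ.+ n) ∣ 432) (∤-15 : ¬ suc (n ℕ.+ n) ∣ 15) (∤-4 : ¬ suc (n ℕ.+ n) ∣ 4) (∤-2 : ¬ suc (n ℕ.+ n) ∣ 2)
   (ω g ζ : CommutativeRing.Carrier R) where

  private
    p = suc (n ℕ.+ n)
    1<p : 1 ℕ.< suc (n ℕ.+ n)
    1<p = ℕₚ.<-trans (s≤s (s≤s z≤n)) 3<p
  open CharP.On R (suc (n ℕ.+ n)) 1<p char unit using (frobenius; fermat; one-^; nat-zero; cancel-nat)

  module _ (ω² : ω * ω ≈ - 1# - ω) (g² : g * g ≈ 1# - g) (ζ² : ζ * ζ ≈ g * ζ - 1#)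
    (mod-3 : ∃ λ q → p ≡ 2 ℕ.+ q ℕ.* 3) (mod-5 : ∃ (λ q → p ≡ 1 ℕ.+ q ℕ.* 5) ⊎ ∃ (λ q → p ≡ 4 ℕ.+ q ℕ.* 5)) where

    private
      r θ k : Carrier
      r = nat 2 * g + 1#
      θ = nat 2 * ω + 1#
      k = proj₁ (unit 432 ∤-432)

      r² : r * r ≈ nat 5
      r² = trans (solve 1 (λ g → (κ 2 :* g :+ :1) :* (κ 2 :* g :+ :1) := κ 4 :* (g :* g) :+ κ 4 :* g :+ :1) g)
        (trans (+-congʳ (+-congʳ (*-congˡ g²))) (solve 1 (λ g → κ 4 :* (:1 :- g) :+ κ 4 :* g :+ :1 := κ 5) g))

      θ² : θ * θ ≈ - nat 3
      θ² = trans (solve 1 (λ g → (κ 2 :* g :+ :1) :* (κ 2 :* g :+ :1) := κ 4 :* (g :* g) :+ κ 4 :* g :+ :1) ω)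
        (trans (+-congʳ (+-congʳ (*-congˡ ω²))) (solve 1 (λ g → κ 4 :* (:- :1 :- g) :+ κ 4 :* g :+ :1 := :- κ 3) ω))

      module C = CMCurve.On R n 3<p char unit k r θ (proj₂ (unit 432 ∤-432)) r² θ²

      periodic : ∀ {x} c a q → x ^ c ≈ 1# → x ^ (a ℕ.+ q ℕ.* c) ≈ x ^ a
      periodic {x} c a q h = begin
        x ^ (a ℕ.+ q ℕ.* c) ≈⟨ ^-homo-* x a (q ℕ.* c) ⟩
        x ^ a * x ^ (q ℕ.* c) ≡⟨ ≡.cong (λ j → x ^ a * x ^ j) (ℕₚ.*-comm q c) ⟩
        x ^ a * x ^ (c ℕ.* q) ≈⟨ *-congˡ (trans (sym (^-assocʳ x c q)) (trans (^-congˡ q h) (one-^ q))) ⟩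
        x ^ a * 1# ≈⟨ *-identityʳ _ ⟩
        x ^ a ∎

      ω³ : ω ^ 3 ≈ 1#
      ω³ = trans (solve 1 (λ w → w :^ 3 := w :* (w :* w)) ω) (trans (*-congˡ ω²)
        (trans (solve 1 (λ w → w :* (:- :1 :- w) := :- w :- w :* w) ω) (trans (+-congˡ (-‿cong ω²)) (solve 1 (λ w → :- w :- (:- :1 :- w) := :1) ω))))

      -- p is 2 modulo 3, so ω^p = ω², the conjugate of ω.
      ω^p : ω ^ p ≈ - 1# - ω
      ω^p = trans (reflexive (≡.cong (ω ^_) (proj₂ mod-3))) (trans (periodic 3 2 (proj₁ mod-3) ω³) (trans (*-congˡ (*-identityʳ ω)) ω²))

      double^p : ∀ x → (nat 2 * x + 1#) ^ p ≈ nat 2 * x ^ p + 1#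
      double^p x = trans (frobenius (nat 2 * x) 1#) (+-cong (trans (^-distrib-* (nat 2) x p) (*-congʳ (fermat 2))) (one-^ p))

      θ^p : θ ^ p ≈ - θ
      θ^p = trans (double^p ω) (trans (+-congʳ (*-congˡ ω^p)) (solve 1 (λ w → κ 2 :* (:- :1 :- w) :+ :1 := :- (κ 2 :* w :+ :1)) ω))

      ζ⁴ : ζ ^ 4 ≈ g - ζ
      ζ⁴ = begin
        ζ ^ 4 ≈⟨ solve 1 (λ z → z :^ 4 := (z :* z) :* (z :* z)) ζ ⟩
        (ζ * ζ) * (ζ * ζ) ≈⟨ *-cong ζ² ζ² ⟩
        (g * ζ - 1#) * (g * ζ - 1#) ≈⟨ solve 2 (λ g z → (g :* z :- :1) :* (g :* z :- :1) := (g :* g) :* (z :* z) :- κ 2 :* (g :* z) :+ :1) g ζ ⟩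
        (g * g) * (ζ * ζ) - nat 2 * (g * ζ) + 1# ≈⟨ +-congʳ (+-congʳ (*-cong g² ζ²)) ⟩
        (1# - g) * (g * ζ - 1#) - nat 2 * (g * ζ) + 1# ≈⟨ solve 2 (λ g z → (:1 :- g) :* (g :* z :- :1) :- κ 2 :* (g :* z) :+ :1 := g :- g :* z :- (g :* g) :* z) g ζ ⟩
        g - g * ζ - (g * g) * ζ ≈⟨ +-congˡ (-‿cong (*-congʳ g²)) ⟩
        g - g * ζ - (1# - g) * ζ ≈⟨ solve 2 (λ g z → g :- g :* z :- (:1 :- g) :* z := g :- z) g ζ ⟩
        g - ζ ∎

      ζ⁵ : ζ ^ 5 ≈ 1#
      ζ⁵ = trans (*-congˡ ζ⁴) (trans (solve 2 (λ g z → z :* (g :- z) := g :* z :- z :* z) g ζ) (trans (+-congˡ (-‿cong ζ²)) (solve 2 (λ g z → g :* z :- (g :* z :- :1) := :1) g ζ)))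

      g≈ : g ≈ ζ + ζ ^ 4
      g≈ = sym (trans (+-congˡ ζ⁴) (solve 2 (λ g z → z :+ (g :- z) := g) g ζ))

      -- g = ζ + ζ⁴ with ζ⁵ = 1, and a prime that is 1 or 4 modulo 5 fixes or exchanges ζ and ζ⁴.
      -- Roots of unity thus replace quadratic reciprocity.
      g^p : g ^ p ≈ g
      g^p = trans (^-congˡ p g≈) (trans (frobenius ζ (ζ ^ 4)) (trans (swap mod-5) (sym g≈)))
        where
        ζ^4p : (ζ ^ 4) ^ p ≈ (ζ ^ p) ^ 4
        ζ^4p = trans (^-assocʳ ζ 4 p) (trans (reflexive (≡.cong (ζ ^_) (ℕₚ.*-comm 4 p))) (sym (^-assocʳ ζ p 4)))
        swap : ∃ (λ q → p ≡ 1 ℕ.+ q ℕ.* 5) ⊎ ∃ (λ q → p ≡ 4 ℕ.+ q ℕ.* 5) → ζ ^ p + (ζ ^ 4) ^ p ≈ ζ + ζ ^ 4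
        swap (inj₁ (q , e)) = +-cong ζp (trans ζ^4p (^-congˡ 4 ζp))
          where
          ζp : ζ ^ p ≈ ζ
          ζp = trans (reflexive (≡.cong (ζ ^_) e)) (trans (periodic 5 1 q ζ⁵) (*-identityʳ ζ))
        swap (inj₂ (q , e)) = trans (+-cong ζp (trans ζ^4p (trans (^-congˡ 4 ζp) (trans (^-assocʳ ζ 4 4) (trans (periodic 5 1 3 ζ⁵) (*-identityʳ ζ)))))) (+-comm _ _)
          where
          ζp : ζ ^ p ≈ ζ ^ 4
          ζp = trans (reflexive (≡.cong (ζ ^_) e)) (periodic 5 4 q ζ⁵)

      r^p : r ^ p ≈ r
      r^p = trans (double^p g) (+-congʳ (*-congˡ g^p))

      2α : nat 2 * C.α ≈ 1# + r * θ
      2α = trans (solve 1 (λ x → x := :1 :+ (x :- :1)) (nat 2 * C.α)) (+-congˡ (C.E.2α-1 (proj₂ (unit 432 ∤-432)) r² θ²))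

      α^p : C.α ^ p ≈ 1# - C.α
      α^p = cancel-nat ∤-2 (begin
        nat 2 * C.α ^ p ≈⟨ *-congʳ (sym (fermat 2)) ⟩
        nat 2 ^ p * C.α ^ p ≈⟨ sym (^-distrib-* (nat 2) C.α p) ⟩
        (nat 2 * C.α) ^ p ≈⟨ ^-congˡ p 2α ⟩
        (1# + r * θ) ^ p ≈⟨ frobenius 1# (r * θ) ⟩
        1# ^ p + (r * θ) ^ p ≈⟨ +-cong (one-^ p) (trans (^-distrib-* r θ p) (*-cong r^p θ^p)) ⟩
        1# + r * - θ ≈⟨ solve 2 (λ r t → :1 :+ r :* (:- t) := κ 2 :- (:1 :+ r :* t)) r θ ⟩
        nat 2 - (1# + r * θ) ≈⟨ +-congˡ (-‿cong (sym 2α)) ⟩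
        nat 2 - nat 2 * C.α ≈⟨ solve 1 (λ x → κ 2 :- κ 2 :* x := κ 2 :* (:1 :- x)) C.α ⟩
        nat 2 * (1# - C.α) ∎)

      -- From h α^p = α h and α^p = 1 - α follows (2 α - 1) h = 0, and (2 α - 1)² = -15 is a unit.
      hasse≈0 : C.hasse ≈ 0#
      hasse≈0 = nat-zero ∤-15 (begin
        nat 15 * C.hasse ≈⟨ solve 1 (λ h → κ 15 :* h := (:- (:- κ 15)) :* h) C.hasse ⟩
        - - nat 15 * C.hasse ≈⟨ *-congʳ (-‿cong (sym (C.E.rθ-square (proj₂ (unit 432 ∤-432)) r² θ²))) ⟩
        - (r * θ * (r * θ)) * C.hasse ≈⟨ solve 2 (λ x h → :- (x :* x) :* h := :- (x :* (((:1 :+ x) :- :1) :* h))) (r * θ) C.hasse ⟩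
        - (r * θ * (((1# + r * θ) - 1#) * C.hasse)) ≈⟨ -‿cong (*-congˡ (*-congʳ (+-congʳ (sym 2α)))) ⟩
        - (r * θ * ((nat 2 * C.α - 1#) * C.hasse))
          ≈⟨ -‿cong (*-congˡ (trans (solve 2 (λ x h → (κ 2 :* x :- :1) :* h := x :* h :- h :* (:1 :- x)) C.α C.hasse)
               (≈⇒diff≈0 (trans (sym C.hasse-α) (*-congˡ α^p))))) ⟩
        - (r * θ * 0#) ≈⟨ solve 1 (λ x → :- (x :* :0) := :0) (r * θ) ⟩
        0# ∎)

      ν-unit : ∃ λ v → C.ν * v ≈ 1#
      ν-unit = let (i , e) = unit 4 ∤-4 in C.ν* * i , trans (sym (*-assoc _ _ i)) (trans (*-congʳ (C.E.ν-norm (proj₂ (unit 432 ∤-432)) r² θ²)) e)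

    sum≈0 : nat (sumBelow p a) ≈ 0#
    sum≈0 = trans C.sum≈ (trans (*-congʳ cubic≈0) (zeroˡ _))
      where
      v = proj₁ ν-unit
      ν^v^ : C.ν ^ p * v ^ p ≈ 1#
      ν^v^ = trans (sym (^-distrib-* C.ν v p)) (trans (^-congˡ p (proj₂ ν-unit)) (one-^ p))
      cubic≈0 : C.cubic-hasse ≈ 0#
      cubic≈0 = begin
        C.cubic-hasse ≈⟨ sym (trans (*-congˡ ν^v^) (*-identityʳ _)) ⟩
        C.cubic-hasse * (C.ν ^ p * v ^ p) ≈⟨ solve 4 (λ h u w v → h :* ((u :* w) :* v) := (h :* w :* u) :* v) C.cubic-hasse C.ν (C.ν ^ (n ℕ.+ n)) (v ^ p) ⟩
        (C.cubic-hasse * C.ν ^ (n ℕ.+ n) * C.ν) * v ^ p ≈⟨ *-congʳ (trans C.shift (trans (*-congˡ hasse≈0) (zeroʳ _))) ⟩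
        0# * v ^ p ≈⟨ zeroˡ _ ⟩
        0# ∎

-- Adjoining a cube root of unity, √5 and a fifth root of unity

module InertTower (F : CommutativeRing 0ℓ 0ℓ) where
 open import Data.Nat.Divisibility using (_∣_)
 open import Defs using (sumBelow) renaming (A to a)
 private
   module F = RingKit F
   module Q₁ = Quad F (F.- F.1#) (F.- F.1#)
   module R₁ = RingKit Q₁.quadRing
   module Q₂ = Quad Q₁.quadRing (R₁.- R₁.1#) R₁.1#
   module R₂ = RingKit Q₂.quadRing
   module Q₃ = Quad Q₂.quadRing Q₂.gen (R₂.- R₂.1#)
   module R₃ = RingKit Q₃.quadRing

 module On (n : ℕ) (3<p : 3 ℕ.< suc (n ℕ.+ n))
   (char : RingKit.HasChar F (suc (n ℕ.+ n)))
   (unit : RingKit.UnitsPrimeTo F (suc (n ℕ.+ n)))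
   (∤-432 : ¬ suc (n ℕ.+ n) ∣ 432) (∤-15 : ¬ suc (n ℕ.+ n) ∣ 15) (∤-4 : ¬ suc (n ℕ.+ n) ∣ 4) (∤-2 : ¬ suc (n ℕ.+ n) ∣ 2)
   (mod-3 : ∃ λ q → suc (n ℕ.+ n) ≡ 2 ℕ.+ q ℕ.* 3)
   (mod-5 : ∃ (λ q → suc (n ℕ.+ n) ≡ 1 ℕ.+ q ℕ.* 5) ⊎ ∃ (λ q → suc (n ℕ.+ n) ≡ 4 ℕ.+ q ℕ.* 5)) where

  private
    ω² : Q₁.gen R₁.* Q₁.gen R₁.≈ R₁.- R₁.1# R₁.- Q₁.gen
    ω² = R₁.trans Q₁.gen² (R₁.trans (R₁.+-cong (R₁.trans (R₁.*-congʳ {Q₁.gen} (Q₁.ι-neg F.1#)) (R₁.*-congʳ {Q₁.gen} (R₁.-‿cong Q₁.ι-1))) (R₁.trans (Q₁.ι-neg F.1#) (R₁.-‿cong Q₁.ι-1)))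
      (R₁.solve 1 (λ x → (:- :1) :* x :+ (:- :1) := :- :1 :- x) Q₁.gen))

    g² : Q₂.gen R₂.* Q₂.gen R₂.≈ R₂.1# R₂.- Q₂.gen
    g² = R₂.trans Q₂.gen² (R₂.trans (R₂.+-cong (R₂.*-congʳ {Q₂.gen} (R₂.trans (Q₂.ι-neg R₁.1#) (R₂.-‿cong Q₂.ι-1))) Q₂.ι-1)
      (R₂.solve 1 (λ x → (:- :1) :* x :+ :1 := :1 :- x) Q₂.gen))

    ζ² : Q₃.gen R₃.* Q₃.gen R₃.≈ Q₃.ι Q₂.gen R₃.* Q₃.gen R₃.- R₃.1#
    ζ² = R₃.trans Q₃.gen² (R₃.+-congˡ {Q₃.ι Q₂.gen R₃.* Q₃.gen} (R₃.trans (Q₃.ι-neg R₂.1#) (R₃.-‿cong Q₃.ι-1)))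

    p = suc (n ℕ.+ n)

  sum≈0 : F.nat (sumBelow p a) F.≈ F.0#
  sum≈0 = Q₁.nat-zero⁻¹ {sumBelow p a} (Q₂.nat-zero⁻¹ {sumBelow p a} (Q₃.nat-zero⁻¹ {sumBelow p a}
    (Inert.On.sum≈0 Q₃.quadRing n 3<p (Q₃.ι-nat-zero {p} (Q₂.ι-nat-zero {p} (Q₁.ι-nat-zero {p} char)))
      (λ k p∤k → Q₃.ι-nat-unit {k} (Q₂.ι-nat-unit {k} (Q₁.ι-nat-unit {k} (unit k p∤k))))
      ∤-432 ∤-15 ∤-4 ∤-2 (Q₃.ι (Q₂.ι Q₁.gen)) (Q₃.ι Q₂.gen) Q₃.gen
      (Q₃.ι-eisenstein {Q₂.ι Q₁.gen} (Q₂.ι-eisenstein {Q₁.gen} ω²)) (Q₃.ι-golden {Q₂.gen} g²) ζ² mod-3 mod-5)))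

-- Numbers with small prime factors

module SmallFactors (p : ℕ) (prime : Prime p) where
 open import Data.Nat.Primality using (euclidsLemma)
 open import Data.List using (List; []; _∷_)
 open import Data.Nat.ListAction using (product)
 open import Data.List.Relation.Unary.All using (All; []; _∷_)
 open import Data.Nat.Divisibility using (_∣_; ∣⇒≤)
 open import Data.Sum using ([_,_]′)
 open import Function using (_∘_)

 ∤-product : ∀ {b} → 1 ℕ.< p → b ℕ.< p → ∀ ds → All (λ d → 0 ℕ.< d × d ℕ.≤ b) ds → ¬ p ∣ product ds
 ∤-product 1<p b<p [] [] h = ℕₚ.<⇒≱ 1<p (∣⇒≤ h)
 ∤-product 1<p b<p (d ∷ ds) ((0<d , d≤b) ∷ hs) h = [ (λ p∣d → ℕₚ.<⇒≱ (ℕₚ.≤-<-trans d≤b b<p) (∣⇒≤ {{ℕ.>-nonZero 0<d}} p∣d)) , ∤-product 1<p b<p ds hs ]′ (euclidsLemma d (product ds) prime h)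

-- Lifting units and square roots to ℤ / p²

module Hensel (A K : CommutativeRing 0ℓ 0ℓ) where
 module On
   (φ : CommutativeRing.Carrier A → CommutativeRing.Carrier K)
   (p : ℕ) (thickening : Thickening.IsThickening A K p φ)
   (char : RingKit.HasChar K p) where
  open Thickening.IsThickening thickening
  open IsRingHomomorphism hom

  private
    module A = RingKit A
    module K = RingKit K
    π : A.Carrier
    π = A.nat p

    π-kills : ∀ {x} → φ x K.≈ K.0# → π A.* x A.≈ A.0#
    π-kills {x} z = let (y , e) = kernel z in
      A.trans (A.*-congˡ e) (A.trans (A.sym (A.*-assoc π π y)) (A.trans (A.*-congʳ p²≈0) (A.zeroˡ y)))

  φ-diff : ∀ x y → φ (x A.- y) K.≈ φ x K.- φ y
  φ-diff x y = K.trans (+-homo x (A.- y)) (K.+-congˡ (-‿homo y))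

  congruent : ∀ {x y} → φ x K.≈ φ y → ∃ λ d → x A.≈ y A.+ π A.* d
  congruent {x} {y} e = let (d , f) = kernel (K.trans (φ-diff x y) (K.≈⇒diff≈0 e)) in
    d , A.trans (A.solve 2 (λ x y → x := y :+ (x :- y)) x y) (A.+-congˡ f)

  -- An inverse modulo p is off by a factor 1 + p d, whose own inverse is 1 - p d because p² = 0.
  lift-unit : ∀ x {v} → φ x K.* v K.≈ K.1# → ∃ λ y → x A.* y A.≈ A.1#
  lift-unit x {v} e =
    let (y , ye) = surjective v
        (d , f) = congruent {x A.* y} {A.1#} (K.trans (*-homo x y) (K.trans (K.*-congˡ ye) (K.trans e (K.sym 1#-homo))))
    in y A.* (A.1# A.- π A.* d) , (A.begin
      x A.* (y A.* (A.1# A.- π A.* d)) A.≈⟨ A.sym (A.*-assoc x y _) ⟩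
      x A.* y A.* (A.1# A.- π A.* d) A.≈⟨ A.*-congʳ f ⟩
      (A.1# A.+ π A.* d) A.* (A.1# A.- π A.* d) A.≈⟨ A.solve 2 (λ π d → (:1 :+ π :* d) :* (:1 :- π :* d) := :1 :- (π :* π) :* (d :* d)) π d ⟩
      A.1# A.- (π A.* π) A.* (d A.* d) A.≈⟨ A.+-congˡ (A.-‿cong (A.*-congʳ p²≈0)) ⟩
      A.1# A.- A.0# A.* (d A.* d) A.≈⟨ A.solve 1 (λ d → :1 :- :0 :* d := :1) (d A.* d) ⟩
      A.1# A.∎)

  -- One Newton step: if y² = c + p d, the correction p u with 2 y u = -d modulo p is exact because
  -- p² = 0.
  lift-sqrt : ∀ c s {v} → s K.* s K.≈ φ c → K.nat 2 K.* s K.* v K.≈ K.1# → ∃ λ x → x A.* x A.≈ c × φ x K.≈ s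
  lift-sqrt c s {v} ss sv =
    let (y , ye) = surjective s
        (d , f) = congruent {y A.* y} {c} (K.trans (*-homo y y) (K.trans (K.*-cong ye ye) ss))
        (u , ue) = surjective (K.- (φ d K.* v))
        φ2 : φ (A.nat 2) K.≈ K.nat 2
        φ2 = K.trans (+-homo _ _) (K.+-cong 1#-homo (K.trans (+-homo _ _) (K.+-cong 1#-homo 0#-homo)))
        z : φ (d A.+ A.nat 2 A.* y A.* u) K.≈ K.0#
        z = K.trans (K.trans (+-homo _ _) (K.+-congˡ (K.trans (*-homo _ u) (K.*-cong (K.trans (*-homo _ y) (K.*-cong φ2 ye)) ue))))
          (K.trans (K.solve 3 (λ d s v → d :+ κ 2 :* s :* (:- (d :* v)) := d :* (:1 :- κ 2 :* s :* v)) (φ d) s v)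
            (K.trans (K.*-congˡ (K.≈⇒diff≈0 (K.sym sv))) (K.zeroʳ (φ d))))
    in y A.+ π A.* u , (A.begin
        (y A.+ π A.* u) A.* (y A.+ π A.* u) A.≈⟨ A.solve 3 (λ y π u → (y :+ π :* u) :* (y :+ π :* u) := y :* y :+ π :* (κ 2 :* y :* u) :+ (π :* π) :* (u :* u)) y π u ⟩
        y A.* y A.+ π A.* (A.nat 2 A.* y A.* u) A.+ (π A.* π) A.* (u A.* u)
          A.≈⟨ A.+-cong (A.+-congʳ f) (A.*-congʳ p²≈0) ⟩
        c A.+ π A.* d A.+ π A.* (A.nat 2 A.* y A.* u) A.+ A.0# A.* (u A.* u)
          A.≈⟨ A.solve 5 (λ c π d w u → c :+ π :* d :+ π :* w :+ :0 :* u := c :+ π :* (d :+ w)) c π d (A.nat 2 A.* y A.* u) (u A.* u) ⟩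
        c A.+ π A.* (d A.+ A.nat 2 A.* y A.* u) A.≈⟨ A.trans (A.+-congˡ (π-kills z)) (A.+-identityʳ c) ⟩
        c A.∎)
      , K.trans (+-homo y _) (K.trans (K.+-cong ye (K.trans (*-homo π u) (K.trans (K.*-congʳ π̄≈0) (K.zeroˡ (φ u))))) (K.+-identityʳ s))
    where
    φ-nat : ∀ k → φ (A.nat k) K.≈ K.nat k
    φ-nat zero = 0#-homo
    φ-nat (suc k) = K.trans (+-homo A.1# (A.nat k)) (K.+-cong 1#-homo (φ-nat k))
    π̄≈0 : φ π K.≈ K.0#
    π̄≈0 = K.trans (φ-nat p) char

-- The split case

module Split (A K : CommutativeRing 0ℓ 0ℓ) where
 open import Data.Nat.Divisibility using (_∣_)
 open import Defs using (sumBelow) renaming (A to a)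
 open import Data.List using (List; []; _∷_)
 open import Data.List.Relation.Unary.All using (All; []; _∷_; all?)
 open import Data.Nat.ListAction using (product)
 open import Relation.Nullary.Decidable using (True; toWitness; _×-dec_; ¬?; decidable-stable)
 open RingKit K
 private
   module A = RingKit A

 module On
   (φ : CommutativeRing.Carrier A → CommutativeRing.Carrier K)
   (_≟0 : RingKit.ZeroTest K)
   (inverse : RingKit.Inverses K)
   (1≉0 : RingKit.NonTrivial K)
   (n : ℕ) (thickening : Thickening.IsThickening A K (suc (n ℕ.+ n)) φ) (prime : Prime (suc (n ℕ.+ n))) (11<p : 11 ℕ.< suc (n ℕ.+ n))
   (char : RingKit.HasChar K (suc (n ℕ.+ n)))
   (unit : RingKit.UnitsPrimeTo K (suc (n ℕ.+ n)))
   (fermat : ∀ a → CommutativeRing._≈_ K (RingKit._^_ K a (suc (n ℕ.+ n))) a) where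
  open Thickening.IsThickening thickening using (hom)
  open IsRingHomomorphism hom
  private
    p = suc (n ℕ.+ n)
    1<p : 1 ℕ.< suc (n ℕ.+ n)
    1<p = ℕₚ.<-trans (s≤s (s≤s z≤n)) 11<p
    3<p : 3 ℕ.< suc (n ℕ.+ n)
    3<p = ℕₚ.<-trans (s≤s (s≤s (s≤s (s≤s z≤n)))) 11<p
  open Hensel.On A K φ p thickening char
  open CharP.On K p 1<p char unit using (one-^; ∤-small; cancel-nat)

  private
    φ-nat : ∀ k → φ (A.nat k) ≈ nat k
    φ-nat zero = 0#-homo
    φ-nat (suc k) = trans (+-homo A.1# (A.nat k)) (+-cong 1#-homo (φ-nat k))

    integral : ∀ {a b} → a * b ≈ 0# → ¬ a ≈ 0# → b ≈ 0#
    integral {a} {b} h a≉0 = let (a′ , e) = inverse a a≉0 in trans (sym (*-identityˡ b)) (trans (*-congʳ (sym e))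
      (trans (solve 3 (λ a a′ b → a :* a′ :* b := a′ :* (a :* b)) a a′ b) (trans (*-congˡ h) (zeroʳ a′))))

    smooth : ∀ ds → {True (all? (λ d → (1 ℕ.≤? d) ×-dec (d ℕ.≤? 11)) ds)} → ¬ p ∣ product ds
    smooth ds {t} = SmallFactors.∤-product p prime 1<p 11<p ds (toWitness t)

    nat≉0 : ∀ {c} → ¬ p ∣ c → ¬ nat c ≈ 0#
    nat≉0 {c} p∤c z = let (b , e) = unit c p∤c in 1≉0 (trans (sym e) (trans (*-congʳ z) (zeroˡ b)))

    factor≉0 : ∀ {x y c} → x A.* y A.≈ A.nat c → ¬ p ∣ c → ¬ φ x ≈ 0#
    factor≉0 {x} {y} {c} e p∤c z = nat≉0 p∤c (trans (sym (φ-nat c)) (trans (⟦⟧-cong (A.sym e)) (trans (*-homo x y) (trans (*-congʳ z) (zeroˡ _)))))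

    fermat′ : ∀ x → ¬ x ≈ 0# → x ^ (n ℕ.+ n) ≈ 1#
    fermat′ x x≉0 = diff≈0⇒≈ (integral (trans (solve 2 (λ x y → x :* (y :- :1) := x :* y :- x) x (x ^ (n ℕ.+ n))) (≈⇒diff≈0 (fermat x))) x≉0)

    -- A value of j^((p-1)/3) other than 1 is a primitive cube root of unity, by Fermat. The search
    -- below p succeeds, as a polynomial of this degree cannot take the value 1 throughout.
    cube-root : (q : ℕ) → p ≡ 1 ℕ.+ q ℕ.* 3 → ∃ λ ω → ω * ω + ω + 1# ≈ 0#
    cube-root zero e = ⊥-elim (ℕₚ.<⇒≢ 1<p (≡.sym e))
    cube-root (suc k) e with ℕₚ.anyUpTo? (λ j → (1 ℕ.≤? j) ×-dec ¬? ((nat j ^ suc k - 1#) ≟0)) p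
    ... | no none = ⊥-elim (Differences.On.powers-not-all-one K p 1<p char unit k (≡.subst (suc (suc k) ℕ.<_) (≡.sym e)
            (s≤s (s≤s (s≤s (ℕₚ.≤-trans (ℕₚ.m≤m*n k 3) (ℕₚ.m≤n+m _ 1)))))) 1≉0
            (λ j 1≤j j<p → diff≈0⇒≈ (decidable-stable ((nat j ^ suc k - 1#) ≟0) (λ z → none (j , j<p , 1≤j , z)))))
    ... | yes (j , j<p , 1≤j , ω≉1) = ω , integral (trans (solve 1 (λ w → (w :- :1) :* (w :* w :+ w :+ :1) := w :^ 3 :- :1) ω) (≈⇒diff≈0 ω³)) ω≉1
      where
      ω = nat j ^ suc k
      ω³ : ω ^ 3 ≈ 1#
      ω³ = trans (^-assocʳ (nat j) (suc k) 3) (trans (reflexive (≡.cong (nat j ^_) (≡.sym (ℕₚ.suc-injective e)))) (fermat′ (nat j) (nat≉0 (∤-small 1≤j j<p))))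

  module _ (q : ℕ) (mod-3 : p ≡ 1 ℕ.+ q ℕ.* 3) (N′ M : ℕ)
    (3≤M : 3 ℕ.≤ M) (10N<p : 10 ℕ.* suc N′ ℕ.< p) (M+2N<p : M ℕ.+ (suc N′ ℕ.+ suc N′) ℕ.< p)
    (norm : M ℕ.* M ℕ.+ 4 ℕ.* (suc N′ ℕ.* suc N′) ≡ p ℕ.+ M ℕ.* suc N′) where

    private
      N = suc N′
      0<N : 0 ℕ.< N
      0<N = s≤s z≤n

      ω θ₀ i₃ N⁻¹ α₀ s₀ r₀ : Carrier
      ω = proj₁ (cube-root q mod-3)
      θ₀ = nat 2 * ω + 1#
      i₃ = proj₁ (unit 3 (smooth (3 ∷ [])))
      i₃-inv : nat 3 * i₃ ≈ 1#
      i₃-inv = proj₂ (unit 3 (smooth (3 ∷ [])))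
      N-unit : ∃ λ b → nat N * b ≈ 1#
      N-unit = unit N (∤-small 0<N (ℕₚ.≤-<-trans (ℕₚ.m≤m+n N _) 10N<p))
      N⁻¹ = proj₁ N-unit
      -- The root of α² - α + 4 modulo p for which N α - M vanishes.
      α₀ = nat M * N⁻¹
      s₀ = nat 2 * α₀ - 1#
      -- √5 is taken to be √-15 / √-3, so that r₀ θ₀ = s₀ and the α built from the lifts reduces to
      -- α₀ and not to its conjugate.
      r₀ = - (s₀ * θ₀ * i₃)

      θ₀² : θ₀ * θ₀ ≈ - nat 3
      θ₀² = trans (solve 1 (λ w → (κ 2 :* w :+ :1) :* (κ 2 :* w :+ :1) := κ 4 :* (w :* w :+ w :+ :1) :- κ 3) ω)
        (trans (+-congʳ (trans (*-congˡ (proj₂ (cube-root q mod-3))) (zeroʳ _))) (+-identityˡ _))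

      norm-K : nat M * nat M + nat 4 * (nat N * nat N) ≈ nat M * nat N
      norm-K = begin
        nat M * nat M + nat 4 * (nat N * nat N) ≈⟨ +-cong (sym (×1-homo-* M M)) (trans (*-congˡ (sym (×1-homo-* N N))) (sym (×1-homo-* 4 (N ℕ.* N)))) ⟩
        nat (M ℕ.* M) + nat (4 ℕ.* (N ℕ.* N)) ≈⟨ sym (×-homo-+ 1# (M ℕ.* M) (4 ℕ.* (N ℕ.* N))) ⟩
        nat (M ℕ.* M ℕ.+ 4 ℕ.* (N ℕ.* N)) ≈⟨ reflexive (≡.cong nat norm) ⟩
        nat (p ℕ.+ M ℕ.* N) ≈⟨ ×-homo-+ 1# p (M ℕ.* N) ⟩
        nat p + nat (M ℕ.* N) ≈⟨ trans (+-congʳ char) (+-identityˡ _) ⟩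
        nat (M ℕ.* N) ≈⟨ ×1-homo-* M N ⟩
        nat M * nat N ∎

      Nα₀ : nat N * α₀ ≈ nat M
      Nα₀ = trans (solve 3 (λ N M i → N :* (M :* i) := M :* (N :* i)) (nat N) (nat M) N⁻¹) (trans (*-congˡ (proj₂ N-unit)) (*-identityʳ _))

      -- Divide M² + 4 N² = M N, valid modulo p, by N².
      α₀² : α₀ * α₀ - α₀ + nat 4 ≈ 0#
      α₀² = integral (integral (begin
        nat N * (nat N * (α₀ * α₀ - α₀ + nat 4))
          ≈⟨ solve 2 (λ N a → N :* (N :* (a :* a :- a :+ κ 4)) := (N :* a) :* (N :* a) :+ κ 4 :* (N :* N) :- (N :* a) :* N) (nat N) α₀ ⟩
        (nat N * α₀) * (nat N * α₀) + nat 4 * (nat N * nat N) - (nat N * α₀) * nat N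
          ≈⟨ +-cong (+-congʳ (*-cong Nα₀ Nα₀)) (-‿cong (*-congʳ Nα₀)) ⟩
        nat M * nat M + nat 4 * (nat N * nat N) - nat M * nat N ≈⟨ ≈⇒diff≈0 norm-K ⟩
        0# ∎) N≉0) N≉0
        where
        N≉0 : ¬ nat N ≈ 0#
        N≉0 = nat≉0 (∤-small 0<N (ℕₚ.≤-<-trans (ℕₚ.m≤m+n N _) 10N<p))

      s₀² : s₀ * s₀ ≈ - nat 15
      s₀² = trans (solve 1 (λ a → (κ 2 :* a :- :1) :* (κ 2 :* a :- :1) := κ 4 :* (a :* a :- a :+ κ 4) :- κ 15) α₀)
        (trans (+-congʳ (trans (*-congˡ α₀²) (zeroʳ _))) (+-identityˡ _))

      r₀² : r₀ * r₀ ≈ nat 5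
      r₀² = begin
        r₀ * r₀ ≈⟨ solve 3 (λ s t i → (:- (s :* t :* i)) :* (:- (s :* t :* i)) := (s :* s) :* (t :* t) :* (i :* i)) s₀ θ₀ i₃ ⟩
        (s₀ * s₀) * (θ₀ * θ₀) * (i₃ * i₃) ≈⟨ *-congʳ (*-cong s₀² θ₀²) ⟩
        - nat 15 * - nat 3 * (i₃ * i₃) ≈⟨ solve 1 (λ i → (:- κ 15) :* (:- κ 3) :* (i :* i) := κ 5 :* ((κ 3 :* i) :* (κ 3 :* i))) i₃ ⟩
        nat 5 * ((nat 3 * i₃) * (nat 3 * i₃)) ≈⟨ *-congˡ (trans (*-cong i₃-inv i₃-inv) (*-identityˡ 1#)) ⟩
        nat 5 * 1# ≈⟨ *-identityʳ _ ⟩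
        nat 5 ∎

      r₀θ₀ : r₀ * θ₀ ≈ s₀
      r₀θ₀ = begin
        r₀ * θ₀ ≈⟨ solve 3 (λ s t i → (:- (s :* t :* i)) :* t := :- (s :* (t :* t) :* i)) s₀ θ₀ i₃ ⟩
        - (s₀ * (θ₀ * θ₀) * i₃) ≈⟨ -‿cong (*-congʳ (*-congˡ θ₀²)) ⟩
        - (s₀ * - nat 3 * i₃) ≈⟨ solve 2 (λ s i → :- (s :* (:- κ 3) :* i) := s :* (κ 3 :* i)) s₀ i₃ ⟩
        s₀ * (nat 3 * i₃) ≈⟨ trans (*-congˡ i₃-inv) (*-identityʳ s₀) ⟩
        s₀ ∎

      two-root : ∀ {s c} → s * s ≈ c → ¬ c ≈ 0# → ∃ λ v → nat 2 * s * v ≈ 1#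
      two-root {s} {c} ss c≉0 = inverse (nat 2 * s) (λ z → c≉0 (trans (sym ss) (trans (*-congˡ (integral z (nat≉0 (smooth (2 ∷ []))))) (zeroʳ s))))

      neg≉0 : ∀ {x} → ¬ x ≈ 0# → ¬ - x ≈ 0#
      neg≉0 {x} h z = h (trans (sym (-‿involutive x)) (trans (-‿cong z) -0#≈0#))

      θ-lift : ∃ λ x → x A.* x A.≈ A.- A.nat 3 × φ x ≈ θ₀
      θ-lift = lift-sqrt (A.- A.nat 3) θ₀ (trans θ₀² (sym (trans (-‿homo _) (-‿cong (φ-nat 3)))))
        (proj₂ (two-root θ₀² (neg≉0 (nat≉0 (smooth (3 ∷ []))))))

      r-lift : ∃ λ x → x A.* x A.≈ A.nat 5 × φ x ≈ r₀
      r-lift = lift-sqrt (A.nat 5) r₀ (trans r₀² (sym (φ-nat 5))) (proj₂ (two-root r₀² (nat≉0 (smooth (5 ∷ [])))))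

      432-unit : ∃ λ y → A.nat 432 A.* y A.≈ A.1#
      432-unit = lift-unit (A.nat 432) (trans (*-congʳ (φ-nat 432)) (proj₂ (unit 432 (smooth (8 ∷ 6 ∷ 9 ∷ [])))))

      r θ k : A.Carrier
      r = proj₁ r-lift
      θ = proj₁ θ-lift
      k = proj₁ 432-unit
      k-inv : A.nat 432 A.* k A.≈ A.1#
      k-inv = proj₂ 432-unit
      r² : r A.* r A.≈ A.nat 5
      r² = proj₁ (proj₂ r-lift)
      θ² : θ A.* θ A.≈ A.- A.nat 3
      θ² = proj₁ (proj₂ θ-lift)
      module E = Constants.Elements A k r θ

      φ-eq : ∀ {x y x′ y′} → φ x ≈ x′ → φ y ≈ y′ → x A.≈ y → x′ ≈ y′
      φ-eq fx fy e = trans (sym fx) (trans (⟦⟧-cong e) fy)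

      φ-*nat : ∀ c x → φ (A.nat c A.* x) ≈ nat c * φ x
      φ-*nat c x = trans (*-homo _ x) (*-congʳ (φ-nat c))

      module C = CMCurve.On K n 3<p char unit (φ k) (φ r) (φ θ)
        (φ-eq (φ-*nat 432 k) 1#-homo k-inv) (φ-eq (*-homo r r) (φ-nat 5) r²) (φ-eq (*-homo θ θ) (trans (-‿homo _) (-‿cong (φ-nat 3))) θ²)

      φ-A : φ E.A ≈ C.A
      φ-A = trans (*-homo k _) (*-congˡ (trans (φ-*nat 27 _) (*-congˡ (trans (-‿homo _) (-‿cong
        (trans (+-homo _ _) (+-cong (trans (+-homo _ _) (+-cong (trans (+-homo _ _) (+-cong (φ-nat 15) (φ-*nat 21 r))) (φ-*nat 17 θ)))
          (trans (*-homo (A.nat 7 A.* r) θ) (*-congʳ (φ-*nat 7 r))))))))))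

      φ-α : φ E.α ≈ α₀
      φ-α = cancel-nat (smooth (2 ∷ [])) (begin
        nat 2 * φ E.α ≈⟨ solve 1 (λ x → x := (x :- :1) :+ :1) (nat 2 * φ E.α) ⟩
        (nat 2 * φ E.α - 1#) + 1#
          ≈⟨ +-congʳ (φ-eq (trans (φ-diff _ A.1#) (+-cong (φ-*nat 2 E.α) (-‿cong 1#-homo))) (trans (*-homo r θ) (*-cong (proj₂ (proj₂ r-lift)) (proj₂ (proj₂ θ-lift)))) (E.2α-1 k-inv r² θ²)) ⟩
        r₀ * θ₀ + 1# ≈⟨ +-congʳ r₀θ₀ ⟩
        s₀ + 1# ≈⟨ solve 1 (λ a → (κ 2 :* a :- :1) :+ :1 := κ 2 :* a) α₀ ⟩
        nat 2 * α₀ ∎)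

      ½ : A.Carrier
      ½ = A.nat 216 A.* k

      ½*2 : ½ A.* A.nat 2 A.≈ A.1#
      ½*2 = A.trans (A.solve 1 (λ k → κ 216 :* k :* κ 2 := κ 432 :* k) k) k-inv

      A≉0 : ¬ φ E.A ≈ 0#
      A≉0 = factor≉0 (E.A-norm k-inv r² θ²) (smooth (7 ∷ 3 ∷ 4 ∷ []))

      A²≉3 : ¬ φ E.A * φ E.A - nat 3 ≈ 0#
      A²≉3 z = factor≉0 (E.A²-3-norm k-inv r² θ²) (smooth (3 ∷ 10 ∷ 11 ∷ []))
        (trans (φ-diff _ _) (trans (+-cong (*-homo _ _) (-‿cong (φ-nat 3))) z))

      2A²≉9 : ¬ nat 2 * (φ E.A * φ E.A) - nat 9 ≈ 0#
      2A²≉9 z = factor≉0 (E.2A²-9-norm k-inv r² θ²) (smooth (6 ∷ 7 ∷ 11 ∷ []))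
        (trans (φ-diff _ _) (trans (+-cong (trans (φ-*nat 2 _) (*-congˡ (*-homo _ _))) (-‿cong (φ-nat 9))) z))

      μ≉0 : ¬ φ E.μ ≈ 0#
      μ≉0 = factor≉0 (E.μ-norm k-inv r² θ²) (smooth (8 ∷ []))

      4-A²-unit : ∃ λ v → nat 4 * (nat 4 - φ E.A * φ E.A) * v ≈ 1#
      4-A²-unit = inverse _ (λ z → factor≉0 (E.2+A-norm k-inv r² θ²) (smooth (8 ∷ 8 ∷ 4 ∷ []))
        (trans (+-homo _ E.A) (trans (+-congʳ (φ-nat 2)) (integral (integral (trans (sym (*-assoc _ _ _)) (trans (*-congʳ (sym 2-A))
          (trans (solve 1 (λ a → κ 4 :* (κ 2 :- a) :* (κ 2 :+ a) := κ 4 :* (κ 4 :- a :* a)) (φ E.A)) z))) μ≉0) μ≉0))))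
        where
        2-A : nat 4 * (nat 2 - φ E.A) ≈ φ E.μ * φ E.μ
        2-A = φ-eq (trans (φ-*nat 4 _) (*-congˡ (trans (φ-diff _ E.A) (+-congʳ (φ-nat 2))))) (*-homo E.μ E.μ) (E.2-A-square k-inv r² θ²)

      α≉0 : ¬ φ E.α ≈ 0#
      α≉0 z = nat≉0 (smooth (4 ∷ [])) (trans (sym (solve 0 (:0 :* :0 :- :0 :+ κ 4 := κ 4)))
        (trans (+-congʳ (+-cong (*-cong (sym α₀≈0) (sym α₀≈0)) (-‿cong (sym α₀≈0)))) α₀²))
        where
        α₀≈0 : α₀ ≈ 0#
        α₀≈0 = trans (sym φ-α) z

      hₗ : Carrier
      hₗ = Hasse.On.Curve.hasse K n 1<p char unit (φ E.A)

      hasse-square : hₗ * hₗ ≈ (nat N - nat M - nat M) * (nat N - nat M - nat M)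
      hasse-square = Lattice.On.hasse-square A K φ _≟0 inverse 1≉0 n thickening prime 1<p char unit fermat ½ ½*2 E.A E.α E.μ (E.rel₁ k-inv r² θ²) (E.rel₂ k-inv r² θ²) (E.rel₃ k-inv r² θ²) (proj₁ 4-A²-unit) (proj₂ 4-A²-unit) μ≉0 α≉0
        N′ M (E.α-norm k-inv r² θ²) 3≤M 10N<p M+2N<p norm (trans (*-congˡ φ-α) Nα₀) A≉0 A²≉3 2A²≉9

      hasse-cong : hₗ ≈ C.hasse
      hasse-cong = KS.^-congˡ n (KS.+-congʳ (KS.+-congˡ {KS.1#} (KS.*-congʳ (Series.C-cong K φ-A)))) (n ℕ.+ n)
        where module KS = RingKit (Series.seriesRing K)

      ν≉0 : ¬ C.ν ≈ 0#
      ν≉0 z = nat≉0 (smooth (4 ∷ [])) (trans (sym (C.E.ν-norm (φ-eq (φ-*nat 432 k) 1#-homo k-inv) (φ-eq (*-homo r r) (φ-nat 5) r²) (φ-eq (*-homo θ θ) (trans (-‿homo _) (-‿cong (φ-nat 3))) θ²)))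
        (trans (*-congʳ z) (zeroˡ _)))

      u : Carrier
      u = nat 4 * (C.ν * C.ν * C.ν)

      u≉0 : ¬ u ≈ 0#
      u≉0 z = ν≉0 (integral (integral (trans (sym (*-assoc _ _ _)) (integral z (nat≉0 (smooth (4 ∷ []))))) ν≉0) ν≉0)

      -- Since ν^(p-1) = 1, the relation between the two Hasse invariants loses its powers of ν. The
      -- factor u^n that stays has square u^(p-1) = 1 and disappears on squaring.
      cubic≈ : C.cubic-hasse ≈ u ^ n * C.hasse
      cubic≈ = diff≈0⇒≈ (integral (begin
        C.ν * (C.cubic-hasse - u ^ n * C.hasse)
          ≈⟨ solve 4 (λ v c w h → v :* (c :- w :* h) := c :* :1 :* v :- w :* v :* h) C.ν C.cubic-hasse (u ^ n) C.hasse ⟩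
        C.cubic-hasse * 1# * C.ν - u ^ n * C.ν * C.hasse
          ≈⟨ +-congʳ (*-congʳ (*-congˡ (sym (fermat′ C.ν ν≉0)))) ⟩
        C.cubic-hasse * C.ν ^ (n ℕ.+ n) * C.ν - u ^ n * C.ν * C.hasse
          ≈⟨ ≈⇒diff≈0 C.shift ⟩
        0# ∎) ν≉0)

    sum≈ : nat (sumBelow p a) ≈ (nat N - nat M - nat M) * (nat N - nat M - nat M)
    sum≈ = begin
      nat (sumBelow p a) ≈⟨ C.sum≈ ⟩
      C.cubic-hasse * C.cubic-hasse ≈⟨ *-cong cubic≈ cubic≈ ⟩
      u ^ n * C.hasse * (u ^ n * C.hasse) ≈⟨ solve 2 (λ w h → w :* h :* (w :* h) := (w :* w) :* (h :* h)) (u ^ n) C.hasse ⟩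
      (u ^ n * u ^ n) * (C.hasse * C.hasse)
        ≈⟨ *-congʳ (trans (sym (^-homo-* u n n)) (fermat′ u u≉0)) ⟩
      1# * (C.hasse * C.hasse) ≈⟨ trans (*-identityˡ _) (*-cong (sym hasse-cong) (sym hasse-cong)) ⟩
      hₗ * hₗ ≈⟨ hasse-square ⟩
      (nat N - nat M - nat M) * (nat N - nat M - nat M) ∎

-- The theorem over the integers

open import Defs
open import Data.Nat using (ℕ; _%_)
open import Data.Nat.Primality using (Prime)
open import Data.Integer using (ℤ; +_; _+_; _*_; _-_)
open import Data.Integer.Divisibility using (_∣_)
open import Data.Sum using (_⊎_)
open import Data.Product using (_×_)
open import Relation.Binary.PropositionalEquality using (_≡_)

open import Data.Integer as ℤ using (-[1+_])
open import Data.List using ([]; _∷_)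
open import Data.List.Relation.Unary.All using ([]; _∷_; all?)
open import Data.Nat using (_/_)
open import Data.Nat.DivMod using (m≡m%n+[m/n]*n; m*n%n≡0; m%n<n)
open import Data.Nat.ListAction using (product)
open import Data.Nat.Primality using (prime?; prime⇒irreducible)
open import Data.Sum using ([_,_]′)
open import Relation.Nullary.Decidable using (True; toWitness; from-yes; _×-dec_; ¬?)
open import Relation.Binary.PropositionalEquality using (refl)

private module I = RingKit ℤₚ.+-*-commutativeRing

module SquareModulus (p : ℕ) (prime : Prime p) where
  private
    module F = PrimeField p prime
    module K = RingKit F.zmod
    module Z = Zmod (p ℕ.* p)
    module A = RingKit Z.zmod

    +p≢0 : ℤ.NonZero (+ p)
    +p≢0 = ℕ.>-nonZero (ℕₚ.<-trans (s≤s z≤n) F.1<p)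

  weaken : ∀ {a b} → a Z.≈ b → a F.≈ b
  weaken (Zmod.mod c e) = F.mod (+ p * c) (≡.trans e (≡.trans (≡.cong (_* c) (ℤₚ.pos-* p p)) (ℤₚ.*-assoc (+ p) (+ p) c)))

  reduction : IsRingHomomorphism A.rawRing K.rawRing (λ a → a)
  reduction = record
    { isSemiringHomomorphism = record
      { isNearSemiringHomomorphism = record
        { +-isMonoidHomomorphism = record
          { isMagmaHomomorphism = record { isRelHomomorphism = record { cong = weaken } ; homo = λ a b → F.≡⇒≈ refl }
          ; ε-homo = F.≡⇒≈ refl }
        ; *-homo = λ a b → F.≡⇒≈ refl }
      ; 1#-homo = F.≡⇒≈ refl }
    ; -‿homo = λ a → F.≡⇒≈ refl }

  kernel : ∀ {a} → a F.≈ ℤ.0ℤ → ∃ λ b → a Z.≈ A.nat p * b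
  kernel {a} (F.mod c e) = c , Z.≡⇒≈ (≡.trans (≡.sym (ℤₚ.+-identityʳ a)) (≡.trans e (≡.cong (_* c) (≡.sym (Z.nat≡ p)))))

  -- If p a is a multiple of p² in ℤ, one factor p can be cancelled.
  torsion : ∀ {a} → A.nat p * a Z.≈ ℤ.0ℤ → a F.≈ ℤ.0ℤ
  torsion {a} (Z.mod c e) = F.mod c (≡.trans (ℤₚ.+-identityʳ a) (ℤₚ.*-cancelˡ-≡ (+ p) a (+ p * c) {{+p≢0}}
    (≡.trans (≡.cong (_* a) (≡.sym (Z.nat≡ p))) (≡.trans (≡.sym (ℤₚ.+-identityʳ _)) (≡.trans e (≡.trans (≡.cong (_* c) (ℤₚ.pos-* p p)) (ℤₚ.*-assoc (+ p) (+ p) c)))))))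

  p²≈0 : A.nat p * A.nat p Z.≈ ℤ.0ℤ
  p²≈0 = Z.mod ℤ.1ℤ (≡.trans (ℤₚ.+-identityʳ _) (≡.trans (≡.cong₂ _*_ (Z.nat≡ p) (Z.nat≡ p)) (≡.trans (≡.sym (ℤₚ.pos-* p p)) (≡.sym (ℤₚ.*-identityʳ _)))))

  thickening : Thickening.IsThickening Z.zmod F.zmod p (λ a → a)
  thickening = record { hom = reduction ; surjective = λ a → a , F.≡⇒≈ refl ; kernel = kernel ; torsion = torsion ; p²≈0 = p²≈0 }

split-case : ∀ n → Prime (suc (n ℕ.+ n)) → 11 ℕ.< suc (n ℕ.+ n) → ∀ q → suc (n ℕ.+ n) ≡ 1 ℕ.+ q ℕ.* 3 → ∀ N′ M → 3 ℕ.≤ M →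
  10 ℕ.* suc N′ ℕ.< suc (n ℕ.+ n) → M ℕ.+ (suc N′ ℕ.+ suc N′) ℕ.< suc (n ℕ.+ n) →
  M ℕ.* M ℕ.+ 4 ℕ.* (suc N′ ℕ.* suc N′) ≡ suc (n ℕ.+ n) ℕ.+ M ℕ.* suc N′ →
  + suc (n ℕ.+ n) ∣ (+ sumBelow (suc (n ℕ.+ n)) A - (+ suc N′ - + M - + M) * (+ suc N′ - + M - + M))
split-case n pr 11<p q mod-3 N′ M 3≤M 10N<p M+2N<p norm = F.≈0⇒∣ (K.≈⇒diff≈0 (K.trans (F.≡⇒≈ (≡.sym (F.nat≡ _)))
  (K.trans (Split.On.sum≈ Z.zmod F.zmod (λ a → a) F._≟0 F.inverse F.1≉0 n thickening pr 11<p F.modulus≈0 F.unit F.fermat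
    q mod-3 N′ M 3≤M 10N<p M+2N<p norm) (F.≡⇒≈ (≡.cong₂ (λ N M → (N - M - M) * (N - M - M)) (F.nat≡ (suc N′)) (F.nat≡ M))))))
  where
  p = suc (n ℕ.+ n)
  module F = PrimeField p pr
  module K = RingKit F.zmod
  module Z = Zmod (p ℕ.* p)
  open SquareModulus p pr

inert-case : ∀ n → Prime (suc (n ℕ.+ n)) → 10 ℕ.< suc (n ℕ.+ n) → ∃ (λ q → suc (n ℕ.+ n) ≡ 2 ℕ.+ q ℕ.* 3) →
  ∃ (λ q → suc (n ℕ.+ n) ≡ 1 ℕ.+ q ℕ.* 5) ⊎ ∃ (λ q → suc (n ℕ.+ n) ≡ 4 ℕ.+ q ℕ.* 5) → suc (n ℕ.+ n) ℕ∣.∣ sumBelow (suc (n ℕ.+ n)) A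
inert-case n pr 10<p mod-3 mod-5 = F.nat≈0⇒∣ (InertTower.On.sum≈0 F.zmod n (ℕₚ.<-trans (s≤s (s≤s (s≤s (s≤s z≤n)))) 10<p) F.modulus≈0 F.unit
  (smooth (8 ∷ 6 ∷ 9 ∷ [])) (smooth (3 ∷ 5 ∷ [])) (smooth (4 ∷ [])) (smooth (2 ∷ [])) mod-3 mod-5)
  where
  module F = PrimeField (suc (n ℕ.+ n)) pr
  smooth : ∀ ds → {True (all? (λ d → (1 ℕ.≤? d) ×-dec (d ℕ.≤? 10)) ds)} → ¬ suc (n ℕ.+ n) ℕ∣.∣ product ds
  smooth ds {t} = SmallFactors.∤-product (suc (n ℕ.+ n)) pr F.1<p 10<p ds (toWitness t)

odd-prime : ∀ p → Prime p → 2 ℕ.< p → ∃ λ n → p ≡ suc (n ℕ.+ n)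
odd-prime p pr 2<p = p / 2 , go (p % 2) refl (m%n<n p 2)
  where
  double : (p / 2) ℕ.* 2 ≡ p / 2 ℕ.+ p / 2
  double = ≡.trans (ℕₚ.*-comm (p / 2) 2) (≡.cong (p / 2 ℕ.+_) (ℕₚ.+-identityʳ _))
  go : ∀ r → r ≡ p % 2 → p % 2 ℕ.< 2 → p ≡ suc (p / 2 ℕ.+ p / 2)
  go 0 e _ = ⊥-elim ([ (λ ()) , (λ 2≡p → ℕₚ.<⇒≢ 2<p 2≡p) ]′ (prime⇒irreducible pr (ℕ∣.m%n≡0⇒n∣m p 2 (≡.sym e))))
  go 1 e _ = ≡.trans (m≡m%n+[m/n]*n p 2) (≡.cong₂ ℕ._+_ (≡.sym e) double)
  go (suc (suc r)) e lt = ⊥-elim (ℕₚ.<⇒≱ (≡.subst (ℕ._< 2) (≡.sym e) lt) (s≤s (s≤s z≤n)))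

square-abs : ∀ x → x * x ≡ + (ℤ.∣ x ∣ ℕ.* ℤ.∣ x ∣)
square-abs (+ n) = ≡.sym (ℤₚ.pos-* n n)
square-abs -[1+ n ] = refl

-- For 19 = 2² + 15 one has N = 2, and 10 N < p fails. It is the only prime x² + 15 y² that misses
-- the size conditions, so its congruence is computed outright.
nineteen : 19 ℕ∣.∣ ℤ.∣ + sumBelow 19 A - + 16 ∣
nineteen = from-yes (19 ℕ∣.∣? ℤ.∣ + sumBelow 19 A - + 16 ∣)

residue-class : ∀ p m r .{{_ : ℕ.NonZero m}} → p % m ≡ r → p ≡ r ℕ.+ p / m ℕ.* m
residue-class p m r e = ≡.trans (m≡m%n+[m/n]*n p m) (≡.cong (ℕ._+ p / m ℕ.* m) e)

not-prime : ∀ {p} → Prime p → ∀ k → {True (¬? (prime? k))} → ¬ p ≡ k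
not-prime pr k {t} refl = toWitness t pr

module Representation (p : ℕ) (pr : Prime p) (q : ℕ) (mod-3 : p ≡ 1 ℕ.+ q ℕ.* 3) (11<p : 11 ℕ.< p) where

  Value : ℕ → ℕ → Set
  Value X Y = + p ∣ (+ sumBelow p A - + 4 * + (X ℕ.* X))

  apply : ∀ X Y′ → let N′ = Y′ ℕ.+ suc Y′ ; M = X ℕ.+ suc Y′ in p ≡ X ℕ.* X ℕ.+ 15 ℕ.* (suc Y′ ℕ.* suc Y′) →
    3 ℕ.≤ M → 10 ℕ.* suc N′ ℕ.< p → M ℕ.+ (suc N′ ℕ.+ suc N′) ℕ.< p → Value X (suc Y′)
  apply X Y′ e 3≤M 10N<p M+2N<p = ≡.subst (λ z → + p ∣ (+ sumBelow p A - z)) value (run (odd-prime p pr (ℕₚ.<-trans (s≤s (s≤s (s≤s z≤n))) 11<p)))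
    where
    Y = suc Y′
    N′ = Y′ ℕ.+ suc Y′
    M = X ℕ.+ suc Y′
    norm : M ℕ.* M ℕ.+ 4 ℕ.* (suc N′ ℕ.* suc N′) ≡ p ℕ.+ M ℕ.* suc N′
    norm = ≡.trans (N.solve 2 (λ x y → (x N.:+ y) N.:* (x N.:+ y) N.:+ N.con 4 N.:* ((y N.:+ y) N.:* (y N.:+ y)) N.:= (x N.:* x N.:+ N.con 15 N.:* (y N.:* y)) N.:+ (x N.:+ y) N.:* (y N.:+ y)) refl X Y)
      (≡.cong (ℕ._+ M ℕ.* suc N′) (≡.sym e))
    value : (+ suc N′ - + M - + M) * (+ suc N′ - + M - + M) ≡ + 4 * + (X ℕ.* X)
    value = ≡.trans (I.solve 2 (λ x y → (y :+ y :- (x :+ y) :- (x :+ y)) :* (y :+ y :- (x :+ y) :- (x :+ y)) := κ 4 :* (x :* x)) (+ X) (+ Y))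
      (≡.cong (λ z → + 4 * z) (≡.sym (ℤₚ.pos-* X X)))
    run : (∃ λ n → p ≡ suc (n ℕ.+ n)) → + p ∣ (+ sumBelow p A - (+ suc N′ - + M - + M) * (+ suc N′ - + M - + M))
    run (n , refl) = split-case n pr 11<p q mod-3 N′ M 3≤M 10N<p M+2N<p norm

  slack : ∀ {a} b {c} → c ≡ suc a ℕ.+ b → a ℕ.< c
  slack {a} b e = ℕₚ.≤-trans (ℕₚ.m≤m+n (suc a) b) (ℕₚ.≤-reflexive (≡.sym e))

  -- The cases not passed to `apply` are X = 0, Y = 0, (1, 1) and (2, 1). The first three would make
  -- p a multiple of 15, a square or 16; the last is p = 19.
  value : ∀ X Y → ¬ p % 15 ≡ 0 → p ≡ X ℕ.* X ℕ.+ 15 ℕ.* (Y ℕ.* Y) → Value X Y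
  value zero Y p%15≢0 e = ⊥-elim (p%15≢0 (≡.trans (≡.cong (_% 15) (≡.trans e (ℕₚ.*-comm 15 (Y ℕ.* Y)))) (m*n%n≡0 (Y ℕ.* Y) 15)))
  value (suc X) zero _ e = ⊥-elim (square (prime⇒irreducible pr (ℕ∣.divides (suc X) e′)))
    where
    e′ : p ≡ suc X ℕ.* suc X
    e′ = ≡.trans e (ℕₚ.+-identityʳ _)
    square : suc X ≡ 1 ⊎ suc X ≡ p → _
    square (inj₁ refl) = not-prime pr 1 e′
    square (inj₂ refl) = ℕₚ.<⇒≢ (ℕₚ.m<m*n p p (ℕₚ.<-trans (s≤s (s≤s z≤n)) 11<p)) e′
  value 1 1 _ e = ⊥-elim (not-prime pr 16 e)
  value 2 1 _ refl = nineteen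
  value (suc (suc (suc X))) 1 _ e = apply (3 ℕ.+ X) 0 e (s≤s (s≤s (s≤s z≤n)))
    (slack (3 ℕ.+ 6 ℕ.* X ℕ.+ X ℕ.* X) (≡.trans e (N.solve 1 (λ x → (N.con 3 N.:+ x) N.:* (N.con 3 N.:+ x) N.:+ N.con 15 N.:= N.con 21 N.:+ (N.con 3 N.:+ N.con 6 N.:* x N.:+ x N.:* x)) refl X)))
    (slack (15 ℕ.+ 5 ℕ.* X ℕ.+ X ℕ.* X) (≡.trans e (N.solve 1 (λ x → (N.con 3 N.:+ x) N.:* (N.con 3 N.:+ x) N.:+ N.con 15 N.:= (N.con 1 N.:+ ((N.con 3 N.:+ x N.:+ N.con 1) N.:+ N.con 4)) N.:+ (N.con 15 N.:+ N.con 5 N.:* x N.:+ x N.:* x)) refl X)))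
  value (suc X) (suc (suc Y)) _ e = apply (suc X) (suc Y) e (s≤s (ℕₚ.≤-trans (s≤s (s≤s z≤n)) (ℕₚ.m≤n+m (suc (suc Y)) X)))
    (slack (20 ℕ.+ 2 ℕ.* X ℕ.+ X ℕ.* X ℕ.+ 40 ℕ.* Y ℕ.+ 15 ℕ.* (Y ℕ.* Y)) (≡.trans e (N.solve 2 (λ x y →
      (N.con 1 N.:+ x) N.:* (N.con 1 N.:+ x) N.:+ N.con 15 N.:* ((N.con 2 N.:+ y) N.:* (N.con 2 N.:+ y))
      N.:= (N.con 1 N.:+ N.con 10 N.:* ((N.con 2 N.:+ y) N.:+ (N.con 2 N.:+ y))) N.:+ (N.con 20 N.:+ N.con 2 N.:* x N.:+ x N.:* x N.:+ N.con 40 N.:* y N.:+ N.con 15 N.:* (y N.:* y))) refl X Y)))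
    (slack (49 ℕ.+ X ℕ.+ X ℕ.* X ℕ.+ 55 ℕ.* Y ℕ.+ 15 ℕ.* (Y ℕ.* Y)) (≡.trans e (N.solve 2 (λ x y →
      (N.con 1 N.:+ x) N.:* (N.con 1 N.:+ x) N.:+ N.con 15 N.:* ((N.con 2 N.:+ y) N.:* (N.con 2 N.:+ y))
      N.:= (N.con 1 N.:+ ((N.con 1 N.:+ x N.:+ (N.con 2 N.:+ y)) N.:+ (((N.con 2 N.:+ y) N.:+ (N.con 2 N.:+ y)) N.:+ ((N.con 2 N.:+ y) N.:+ (N.con 2 N.:+ y))))) N.:+ (N.con 49 N.:+ x N.:+ x N.:* x N.:+ N.con 55 N.:* y N.:+ N.con 15 N.:* (y N.:* y))) refl X Y)))

  represented : ∀ x y → ¬ p % 15 ≡ 0 → + p ≡ x * x + + 15 * (y * y) → + p ∣ (+ sumBelow p A - + 4 * (x * x))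
  represented x y p%15≢0 e = ≡.subst (λ z → + p ∣ (+ sumBelow p A - + 4 * z)) (≡.sym (square-abs x)) (value ℤ.∣ x ∣ ℤ.∣ y ∣ p%15≢0
    (ℤₚ.+-injective (≡.trans e (≡.cong₂ _+_ (square-abs x) (≡.trans (≡.cong (λ z → + 15 * z) (square-abs y)) (≡.sym (ℤₚ.pos-* 15 (ℤ.∣ y ∣ ℕ.* ℤ.∣ y ∣))))))))

theorem3p2 : (p : ℕ) → Prime p → (p % 5 ≡ 1 ⊎ p % 5 ≡ 4) →
    (((p % 15 ≡ 1 ⊎ p % 15 ≡ 4) → (x y : ℤ) → + p ≡ x * x + + 15 * (y * y) →
        (+ p) ∣ (+ sumBelow p A - + 4 * (x * x)))
    × ((p % 15 ≡ 11 ⊎ p % 15 ≡ 14) → (+ p) ∣ (+ sumBelow p A)))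
theorem3p2 p pr _ = splits , inert
  where
  d = p / 15

  -- Once p differs from its residue r it is at least r + 15, which exceeds 11.
  large : ∀ r d → p ≡ r ℕ.+ d ℕ.* 15 → ¬ p ≡ r → 11 ℕ.< p
  large r zero e p≢r = ⊥-elim (p≢r (≡.trans e (ℕₚ.+-identityʳ r)))
  large r (suc d) e _ = ≡.subst (11 ℕ.<_) (≡.sym e) (ℕₚ.≤-trans (ℕₚ.m≤m+n 12 (3 ℕ.+ d ℕ.* 15)) (ℕₚ.m≤n+m _ r))

  splits : (p % 15 ≡ 1 ⊎ p % 15 ≡ 4) → (x y : ℤ) → + p ≡ x * x + + 15 * (y * y) → (+ p) ∣ (+ sumBelow p A - + 4 * (x * x))
  splits (inj₁ h) x y = Representation.represented p pr (5 ℕ.* d) (≡.trans e (N.solve 1 (λ d → N.con 1 N.:+ d N.:* N.con 15 N.:= N.con 1 N.:+ N.con 5 N.:* d N.:* N.con 3) refl d))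
    (large 1 d e (not-prime pr 1)) x y (λ z → ℕₚ.0≢1+n (≡.trans (≡.sym z) h))
    where e = residue-class p 15 1 h
  splits (inj₂ h) x y = Representation.represented p pr (1 ℕ.+ 5 ℕ.* d) (≡.trans e (N.solve 1 (λ d → N.con 4 N.:+ d N.:* N.con 15 N.:= N.con 1 N.:+ (N.con 1 N.:+ N.con 5 N.:* d) N.:* N.con 3) refl d))
    (large 4 d e (not-prime pr 4)) x y (λ z → ℕₚ.0≢1+n (≡.trans (≡.sym z) h))
    where e = residue-class p 15 4 h

  inert-odd : 10 ℕ.< p → ∃ (λ q → p ≡ 2 ℕ.+ q ℕ.* 3) → ∃ (λ q → p ≡ 1 ℕ.+ q ℕ.* 5) ⊎ ∃ (λ q → p ≡ 4 ℕ.+ q ℕ.* 5) → (+ p) ∣ (+ sumBelow p A)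
  inert-odd 10<p mod-3 mod-5 = run (odd-prime p pr (ℕₚ.<-trans (s≤s (s≤s (s≤s z≤n))) 10<p)) 10<p mod-3 mod-5
    where
    run : ∃ (λ n → p ≡ suc (n ℕ.+ n)) → 10 ℕ.< p → ∃ (λ q → p ≡ 2 ℕ.+ q ℕ.* 3) →
      ∃ (λ q → p ≡ 1 ℕ.+ q ℕ.* 5) ⊎ ∃ (λ q → p ≡ 4 ℕ.+ q ℕ.* 5) → (+ p) ∣ (+ sumBelow p A)
    run (n , refl) = inert-case n pr

  inert : (p % 15 ≡ 11 ⊎ p % 15 ≡ 14) → (+ p) ∣ (+ sumBelow p A)
  inert (inj₁ h) = inert-odd (≡.subst (10 ℕ.<_) (≡.sym e) (ℕₚ.m≤m+n 11 _))
    (3 ℕ.+ 5 ℕ.* d , ≡.trans e (N.solve 1 (λ d → N.con 11 N.:+ d N.:* N.con 15 N.:= N.con 2 N.:+ (N.con 3 N.:+ N.con 5 N.:* d) N.:* N.con 3) refl d))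
    (inj₁ (2 ℕ.+ 3 ℕ.* d , ≡.trans e (N.solve 1 (λ d → N.con 11 N.:+ d N.:* N.con 15 N.:= N.con 1 N.:+ (N.con 2 N.:+ N.con 3 N.:* d) N.:* N.con 5) refl d)))
    where e = residue-class p 15 11 h
  inert (inj₂ h) = inert-odd (≡.subst (10 ℕ.<_) (≡.sym e) (ℕₚ.m≤m+n 11 _))
    (4 ℕ.+ 5 ℕ.* d , ≡.trans e (N.solve 1 (λ d → N.con 14 N.:+ d N.:* N.con 15 N.:= N.con 2 N.:+ (N.con 4 N.:+ N.con 5 N.:* d) N.:* N.con 3) refl d))
    (inj₂ (2 ℕ.+ 3 ℕ.* d , ≡.trans e (N.solve 1 (λ d → N.con 14 N.:+ d N.:* N.con 15 N.:= N.con 4 N.:+ (N.con 2 N.:+ N.con 3 N.:* d) N.:* N.con 5) refl d)))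
    where e = residue-class p 15 14 h
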